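{- For every $k\in\mathbb{N}=\{1,2,3,\dots\}$, \[ \Phi_8(k)=F_8(k):=\max_{1\le j\le k}\frac{j}{j+\lceil 2\sqrt{j}\,\rceil+1},\qquad \Phi_4(k)\le F_4(k):=\max_{1\le j\le k}\frac{j}{j+\frac{\lceil 2\sqrt{2j-1}\,\rceil}{2}} . \] Moreover, $\Phi_4(k)=F_4(k)$ for every $k\in\mathcal{S}$, and $\Phi_4(k)<F_4(k)$ for every $k\in\mathcal{U}$, where \[ \mathcal{S}:=\mathbb{N}\cap\bigcup_{n=1}^{\infty}\Big(\Big[s_0(n)-\tfrac n2,\ s_0(n)+\tfrac{n-1}{2}\Big]\cup\Big[s_2(n)-\tfrac n2,\ s_2(n)+\tfrac n2\Big]\Big)=\{1,2,4,5,7,8,9,12,13,14,17,18,19,23,24,25,26,30,\dots\}, \] \[ \mathcal{U}:=\mathbb{N}_{\ge 2}\cap\bigcup_{n=1}^{\infty}\Big(\Big[s_1(n),\ s_1(n)+\tfrac{n-1}{2}\Big]\cup\Big[s_3(n),\ s_3(n)+\tfrac n2\Big]\Big)=\{3,6,10,11,15,16,21,22,28,29,\dots\}, \] with $s_0(n)=(n-1)^2+n^2$, $s_1(n)=n(2n-1)$, $s_2(n)=2n^2$, $s_3(n)=n(2n+1)$.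
   Context: An infinite binary image is a map $I:\mathbb{Z}^2\to\{\text{black},\text{white}\}$; its elements are pixels. For $x,y\in\mathbb{Z}^2$ let $d_4(x,y)=|x_1-y_1|+|x_2-y_2|$ and $d_8(x,y)=\max\{|x_1-y_1|,|x_2-y_2|\}$; for $\alpha\in\{4,8\}$, $x,y$ are $\alpha$-adjacent if $d_\alpha(x,y)=1$. Two pixels are $\alpha$-connected if they are equal or joined by a sequence of pixels each $\alpha$-adjacent to its predecessor; a white $\alpha$-connected component of $I$ is a maximal set of mutually $\alpha$-connected white pixels (connected within the white pixels), and its size is its number of pixels. The white pixel density of $I$ is $\rho(I)=\liminf_{j\to\infty,\ j\text{ odd}} W_j/j^2$, where $W_j$ is the number of white pixels in the $j\times j$ box of pixels centered at the origin. For $\alpha\in\{4,8\}$ and $k\in\mathbb{N}$, $\Phi_\alpha(k)$ is the supremum of $\rho(I)$ over all infinite binary images $I$ all of whose white $\alpha$-connected components have size at most $k$. -}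

module Defs where

open import Data.Bool using (Bool; true; false)
open import Data.Nat as ℕ using (ℕ; zero; suc; _∸_)
open import Data.Integer as ℤ using (ℤ; +_; -[1+_]; ∣_∣)
open import Data.Rational as ℚ using (ℚ; 0ℚ; _/_)
open import Data.Product using (_×_; _,_; Σ; ∃; ∃-syntax)
open import Data.Sum using (_⊎_)
open import Data.List using (List; []; _∷_; length; filter; map; concatMap; upTo)
open import Data.List.Relation.Unary.All using (All)
open import Data.List.Relation.Unary.Unique.Propositional using (Unique)
open import Relation.Binary.PropositionalEquality using (_≡_)

Pixel : Set
Pixel = ℤ × ℤ

Image : Set
Image = Pixel → Bool

White : Image → Pixel → Set
White I x = I x ≡ true

d₄ : Pixel → Pixel → ℕ
d₄ (a₁ , a₂) (b₁ , b₂) = ∣ a₁ ℤ.- b₁ ∣ ℕ.+ ∣ a₂ ℤ.- b₂ ∣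

d₈ : Pixel → Pixel → ℕ
d₈ (a₁ , a₂) (b₁ , b₂) = ∣ a₁ ℤ.- b₁ ∣ ℕ.⊔ ∣ a₂ ℤ.- b₂ ∣

data Conn : Set where
  four eight : Conn

dist : Conn → Pixel → Pixel → ℕ
dist four  = d₄
dist eight = d₈

Adj : Conn → Pixel → Pixel → Set
Adj α x y = dist α x y ≡ 1

data WhitePath (I : Image) (α : Conn) : Pixel → Pixel → Set where
  here : ∀ {x} → White I x → WhitePath I α x x
  step : ∀ {x y z} → White I x → Adj α x y → WhitePath I α y z → WhitePath I α x z

ComponentsAtMost : Conn → ℕ → Image → Set
ComponentsAtMost α k I =
  ∀ x → White I x → (ys : List Pixel) → Unique ys →
  All (WhitePath I α x) ys → length ys ℕ.≤ k

range : ℕ → List ℤ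
range r = map (λ i → + i ℤ.- + r) (upTo (suc (2 ℕ.* r)))

box : ℕ → List Pixel
box r = concatMap (λ a → map (λ b → (a , b)) (range r)) (range r)

isWhite : Image → Pixel → Bool
isWhite I x = I x

countTrue : List Bool → ℕ
countTrue []           = 0
countTrue (true  ∷ bs) = suc (countTrue bs)
countTrue (false ∷ bs) = countTrue bs

W : Image → ℕ → ℕ
W I r = countTrue (map I (box r))

-- W_j / j² with j = 2r+1
ratio : Image → ℕ → ℚ
ratio I r = (+ W I r) / suc (4 ℕ.* r ℕ.* r ℕ.+ 4 ℕ.* r)   -- (2r+1)²

-- Density ρ(I) = liminf_{j odd} W_j/j², compared with rationals

DensityLe : Image → ℚ → Set
DensityLe I a = ∀ ε → ℚ.Positive ε → ∀ N → ∃[ r ] (N ℕ.≤ r × ratio I r ℚ.< a ℚ.+ ε)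

DensityGe : Image → ℚ → Set
DensityGe I a = ∀ ε → ℚ.Positive ε → ∃[ N ] (∀ r → N ℕ.≤ r → a ℚ.- ε ℚ.< ratio I r)

-- Φ_α(k) = sup { ρ(I) | all white α-components of I have size ≤ k },
-- compared with rationals

PhiLe : Conn → ℕ → ℚ → Set
PhiLe α k a = ∀ I → ComponentsAtMost α k I → DensityLe I a

PhiGe : Conn → ℕ → ℚ → Set
PhiGe α k a = ∀ ε → ℚ.Positive ε →
  ∃[ I ] (ComponentsAtMost α k I × DensityGe I (a ℚ.- ε))

PhiEq : Conn → ℕ → ℚ → Set
PhiEq α k a = PhiLe α k a × PhiGe α k a

PhiLt : Conn → ℕ → ℚ → Set
PhiLt α k a = ∃[ b ] (b ℚ.< a × PhiLe α k b)

-- ⌈√m⌉ = number of c ∈ ℕ with c² < m  (c ranges over 0..m-1 suffices)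
ceilSqrt : ℕ → ℕ
ceilSqrt m = length (filter (λ c → c ℕ.* c ℕ.<? m) (upTo m))

-- n/d as a rational (only used with d > 0)
frac : ℕ → ℕ → ℚ
frac n zero    = 0ℚ
frac n (suc d) = (+ n) / suc d

-- j / (j + ⌈2√j⌉ + 1),   ⌈2√j⌉ = ⌈√(4j)⌉
term₈ : ℕ → ℚ
term₈ j = frac j (j ℕ.+ ceilSqrt (4 ℕ.* j) ℕ.+ 1)

-- j / (j + ⌈2√(2j-1)⌉/2) = 2j / (2j + ⌈√(4(2j-1))⌉)
term₄ : ℕ → ℚ
term₄ j = frac (2 ℕ.* j) (2 ℕ.* j ℕ.+ ceilSqrt (4 ℕ.* (2 ℕ.* j ∸ 1)))

maxUpTo : (ℕ → ℚ) → ℕ → ℚ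
maxUpTo f zero          = 0ℚ
maxUpTo f (suc zero)    = f 1
maxUpTo f (suc (suc k)) = maxUpTo f (suc k) ℚ.⊔ f (suc (suc k))

F₈ : ℕ → ℚ
F₈ = maxUpTo term₈

F₄ : ℕ → ℚ
F₄ = maxUpTo term₄

-- The sets 𝒮 and 𝒰 (half-integer endpoints handled by doubling)

s₀ s₁ s₂ s₃ : ℕ → ℕ
s₀ n = (n ∸ 1) ℕ.* (n ∸ 1) ℕ.+ n ℕ.* n
s₁ n = n ℕ.* (2 ℕ.* n ∸ 1)
s₂ n = 2 ℕ.* n ℕ.* n
s₃ n = n ℕ.* (2 ℕ.* n ℕ.+ 1)

-- a ≤ k ≤ b with a = A/2, b = B/2  ⇔  A ≤ 2k ≤ B  (A ≥ 0 here)
InS : ℕ → Set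
InS k = 1 ℕ.≤ k × ∃[ n ] (1 ℕ.≤ n ×
  ( (2 ℕ.* s₀ n ∸ n ℕ.≤ 2 ℕ.* k × 2 ℕ.* k ℕ.≤ 2 ℕ.* s₀ n ℕ.+ n ∸ 1)
  ⊎ (2 ℕ.* s₂ n ∸ n ℕ.≤ 2 ℕ.* k × 2 ℕ.* k ℕ.≤ 2 ℕ.* s₂ n ℕ.+ n)))

InU : ℕ → Set
InU k = 2 ℕ.≤ k × ∃[ n ] (1 ℕ.≤ n ×
  ( (s₁ n ℕ.≤ k × 2 ℕ.* k ℕ.≤ 2 ℕ.* s₁ n ℕ.+ n ∸ 1)
  ⊎ (s₃ n ℕ.≤ k × 2 ℕ.* k ℕ.≤ 2 ℕ.* s₃ n ℕ.+ n)))

module Submission where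

-- Cut the plane into the unit squares whose corners are pixels; squares and pixels are equally dense.
-- 8-connectivity: a square meets at most one component C, and when C spans a p × q box with pq ≥ |C|,
-- the number |C + {0,1}²| of squares that C meets is at least |C| + p + q + 1.
-- 4-connectivity: for each square that it meets, C takes one token for each of the two diagonals of
-- the square on which it has a pixel, so a square without lost tokens gives two. If C meets U of the
-- lines x + y = u and V of the lines x - y = v, it takes at least 2|C| + U + V tokens, while its
-- connectedness forces 2|C| ≤ UV + 1. Bounding the box on the plane by tokens gives both upper bounds.
-- Equality: translates of one component by a lattice {N ∣ y + w x}, with black pixels chosen so that
-- no token is lost. Strictness: for k ∈ 𝒰 a component without loss must be a full diagonal
-- m × (m + 1) rectangle. Such rectangles cannot fit around their truncated ends, so that within
-- bounded distance of every component tokens are lost, which costs a positive density.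

-- Tokens are counted per diagonal because two 4-components may share a square by opposite corners,
-- so squares alone would be counted twice. With `2q = U + V` the token bound allows `q` black
-- pixels per component, and tiles with exactly this many exist. For `k ∈ 𝒰` the best ratio has
-- `U + V = 2m + 1`, and `2|C| ≤ UV + 1` then forces sides `m` and `m + 1` with every pixel present.
-- Pixels satisfy `u ≡ v` modulo 2, and one side length is odd while the other is even. Hence
-- exactly one of the two sides of odd length is truncated: its outermost diagonal contains neither
-- corner. Near one end of it the lossless neighbours are forced: the component facing that side
-- starts one step later in `v` and has length `m` or `m + 1`, so that a square with three black
-- corners remains at the other end. `PhiLt` asks for one rational bound below `F₄ k` for all
-- images, so this loss is made quantitative: balls of a fixed radius around the defects cover all
-- white pixels, and the number of defects enters the token count.

open import Defs
open import Data.Bool as Bool using (Bool; true; false; if_then_else_; _∧_; T)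
open import Data.Empty using (⊥; ⊥-elim)
open import Data.Unit using (⊤; tt)
open import Data.Nat as ℕ using (ℕ; zero; suc; z≤n; s≤s; _+_; _*_; _∸_; _≤_; _<_)
import Data.Nat.Properties as ℕₚ
open import Data.Nat.DivMod using (m%n<n; m≡m%n+[m/n]*n)
open import Data.Integer as ℤ using (ℤ; +_; -[1+_]; ∣_∣; 0ℤ; 1ℤ)
import Data.Integer.Properties as ℤₚ
open import Data.Integer.DivMod using (_/ℕ_; _%ℕ_; n%ℕd<d; a≡a%ℕn+[a/ℕn]*n)
open import Data.Integer.Divisibility.Signed as Signed using (divides)
open import Data.Integer.Tactic.RingSolver using (solve-∀)
open import Data.Rational as ℚ using (ℚ; mkℚ)
import Data.Rational.Properties as ℚₚ
open import Data.Rational.Unnormalised as ℚᵘ using (ℚᵘ; mkℚᵘ; *<*; *≤*)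
import Data.Rational.Unnormalised.Properties as ℚᵘₚ
open import Data.Product using (_×_; _,_; ∃-syntax; proj₁; proj₂)
import Data.Product.Properties as Productₚ
open import Data.Sum using (_⊎_; inj₁; inj₂; [_,_]′)
open import Data.List using (List; []; _∷_; _++_; map; concat; concatMap; filter; length; upTo; drop; deduplicate; cartesianProduct)
open import Data.List.Properties using (≡-dec; length-map; length-upTo; length-++; map-upTo)
open import Data.List.Relation.Unary.All as All using (All; []; _∷_)
import Data.List.Relation.Unary.All.Properties as Allₚ
open import Data.List.Relation.Unary.Any as Any using (Any; any?)
open import Data.List.Relation.Unary.AllPairs as AllPairs using (AllPairs; []; _∷_)
import Data.List.Relation.Unary.AllPairs.Properties as AllPairsₚ
open import Data.List.Relation.Unary.Unique.Propositional using (Unique)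
import Data.List.Relation.Unary.Unique.Propositional.Properties as Uniqueₚ
import Data.List.Relation.Unary.Unique.DecPropositional.Properties as UniqueDecₚ
open import Data.List.Membership.Propositional using (_∈_; _∉_; find; lose)
open import Data.List.Membership.Propositional.Properties using (∈-∃++; ∈-++⁺ˡ; ∈-++⁺ʳ; ∈-++⁻; ∈-map⁺; ∈-map⁻; ∈-filter⁺; ∈-filter⁻; ∈-concat⁺′; ∈-concat⁻′; ∈-upTo⁺; ∈-upTo⁻; ∈-cartesianProduct⁺; ∈-deduplicate⁺; ∈-deduplicate⁻)
import Data.List.Membership.DecPropositional as DecMembership
open import Relation.Binary using (Tri; tri<; tri≈; tri>)
open import Relation.Binary.PropositionalEquality using (_≡_; _≢_; refl; sym; trans; cong; cong₂; subst; subst₂)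
open import Relation.Nullary using (¬_; Dec; yes; no; does; contradiction; ¬?; map′; _×-dec_)
open import Function using (_∘_)

-- Linear arithmetic over ℕ and ℤ, products of variables being treated as unknowns.
-- In linarith (ns ∣ᵉ zs) fs g hs, the proofs hs of the formulas fs imply g;
-- ν i and ζ i stand for the i-th entries of ns and zs, and κ c for the numeral c.

data NExp : Set where
  ν   : ℕ → NExp
  κ   : ℕ → NExp
  _⊕_ : NExp → NExp → NExp
  _⊗_ : NExp → NExp → NExp

data ZExp : Set where
  ζ   : ℕ → ZExp
  ⌞_⌟ : NExp → ZExp
  _⊞_ : ZExp → ZExp → ZExp
  _⊠_ : ZExp → ZExp → ZExp
  ⊟_  : ZExp → ZExp

data Form : Set where
  _≼_ _≐_ : NExp → NExp → Form
  _≼ᶻ_ _≺ᶻ_ _≐ᶻ_ : ZExp → ZExp → Form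
  falsum : Form

infixl 8 _⊗_ _⊠_
infixl 7 _⊕_ _⊞_ _⊖_
infix 9 ⊟_
infix 6 _≼_ _≐_ _≼ᶻ_ _≺ᶻ_ _≐ᶻ_

κᶻ ι : ℕ → ZExp
κᶻ c = ⌞ κ c ⌟
ι i  = ⌞ ν i ⌟

_⊖_ : ZExp → ZExp → ZExp
a ⊖ b = a ⊞ ⊟ b

record Env : Set where
  constructor _∣ᵉ_
  field
    nats : List ℕ
    ints : List ℤ

infix 4 _∣ᵉ_

nthᴺ : List ℕ → ℕ → ℕ
nthᴺ []       _       = 0
nthᴺ (x ∷ _)  zero    = x
nthᴺ (_ ∷ xs) (suc i) = nthᴺ xs i

nthᶻ : List ℤ → ℕ → ℤ
nthᶻ []       _       = 0ℤ
nthᶻ (x ∷ _)  zero    = x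
nthᶻ (_ ∷ xs) (suc i) = nthᶻ xs i

⟦_⟧ᴺ : NExp → Env → ℕ
⟦ ν i ⟧ᴺ ρ = nthᴺ (Env.nats ρ) i
⟦ κ c ⟧ᴺ ρ = c
⟦ a ⊕ b ⟧ᴺ ρ = ⟦ a ⟧ᴺ ρ + ⟦ b ⟧ᴺ ρ
⟦ a ⊗ b ⟧ᴺ ρ = ⟦ a ⟧ᴺ ρ * ⟦ b ⟧ᴺ ρ

⟦_⟧ᶻ : ZExp → Env → ℤ
⟦ ζ i ⟧ᶻ ρ = nthᶻ (Env.ints ρ) i
⟦ ⌞ a ⌟ ⟧ᶻ ρ = + ⟦ a ⟧ᴺ ρ
⟦ a ⊞ b ⟧ᶻ ρ = ⟦ a ⟧ᶻ ρ ℤ.+ ⟦ b ⟧ᶻ ρ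
⟦ a ⊠ b ⟧ᶻ ρ = ⟦ a ⟧ᶻ ρ ℤ.* ⟦ b ⟧ᶻ ρ
⟦ ⊟ a ⟧ᶻ ρ = ℤ.- ⟦ a ⟧ᶻ ρ

⟦_⟧ : Form → Env → Set
⟦ a ≼ b ⟧ ρ = ⟦ a ⟧ᴺ ρ ≤ ⟦ b ⟧ᴺ ρ
⟦ a ≐ b ⟧ ρ = ⟦ a ⟧ᴺ ρ ≡ ⟦ b ⟧ᴺ ρ
⟦ a ≼ᶻ b ⟧ ρ = ⟦ a ⟧ᶻ ρ ℤ.≤ ⟦ b ⟧ᶻ ρ
⟦ a ≺ᶻ b ⟧ ρ = ⟦ a ⟧ᶻ ρ ℤ.< ⟦ b ⟧ᶻ ρ
⟦ a ≐ᶻ b ⟧ ρ = ⟦ a ⟧ᶻ ρ ≡ ⟦ b ⟧ᶻ ρ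
⟦ falsum ⟧ ρ = ⊥

⟦_⟧* : List Form → Env → Set
⟦ [] ⟧* ρ = ⊤
⟦ f ∷ fs ⟧* ρ = ⟦ f ⟧ ρ × ⟦ fs ⟧* ρ

-- Polynomials are sorted lists of coefficient and monomial; the even variables stand for naturals.

Mono : Set
Mono = List ℕ

Poly : Set
Poly = List (ℤ × Mono)

dbl : ℕ → ℕ
dbl zero    = zero
dbl (suc i) = suc (suc (dbl i))

val : List ℕ → List ℤ → ℕ → ℤ
val ns zs zero          = + nthᴺ ns 0
val ns zs (suc zero)    = nthᶻ zs 0
val ns zs (suc (suc k)) = val (drop 1 ns) (drop 1 zs) k

val-even : ∀ ns zs i → val ns zs (dbl i) ≡ + nthᴺ ns i
val-even ns zs zero = refl
val-even [] zs (suc i) = trans (val-even [] (drop 1 zs) i) (cong +_ (nth[] i))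
  where
  nth[] : ∀ i → nthᴺ [] i ≡ 0
  nth[] _ = refl
val-even (x ∷ ns) zs (suc i) = val-even ns (drop 1 zs) i

val-odd : ∀ ns zs i → val ns zs (suc (dbl i)) ≡ nthᶻ zs i
val-odd ns zs zero = refl
val-odd ns [] (suc i) = val-odd (drop 1 ns) [] i
val-odd ns (x ∷ zs) (suc i) = val-odd (drop 1 ns) zs i

_<ᴹ_ : Mono → Mono → Bool
[]      <ᴹ []      = false
[]      <ᴹ (_ ∷ _) = true
(_ ∷ _) <ᴹ []      = false
(x ∷ m) <ᴹ (y ∷ n) = if x ℕ.≡ᵇ y then m <ᴹ n else x ℕ.<ᵇ y

_≟ᴹ_ : (m n : Mono) → Dec (m ≡ n)
_≟ᴹ_ = ≡-dec ℕ._≟_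

isZero : ℤ → Bool
isZero (+ zero) = true
isZero _        = false

insertT : ℤ → Mono → Poly → Poly
insertT c m [] = (c , m) ∷ []
insertT c m ((d , n) ∷ p) =
  if does (m ≟ᴹ n)
  then (if isZero (c ℤ.+ d) then p else (c ℤ.+ d , m) ∷ p)
  else (if m <ᴹ n then (c , m) ∷ (d , n) ∷ p else (d , n) ∷ insertT c m p)

_+ᴾ_ : Poly → Poly → Poly
[]            +ᴾ q = q
((c , m) ∷ p) +ᴾ q = insertT c m (p +ᴾ q)

insertV : ℕ → Mono → Mono
insertV x [] = x ∷ []
insertV x (y ∷ m) = if x ℕ.≤ᵇ y then x ∷ y ∷ m else y ∷ insertV x m

_*ᴹ_ : Mono → Mono → Mono
[]      *ᴹ n = n
(x ∷ m) *ᴹ n = insertV x (m *ᴹ n)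

scaleT : ℤ → Mono → Poly → Poly
scaleT c m []            = []
scaleT c m ((d , n) ∷ p) = insertT (c ℤ.* d) (m *ᴹ n) (scaleT c m p)

_*ᴾ_ : Poly → Poly → Poly
[]            *ᴾ q = []
((c , m) ∷ p) *ᴾ q = scaleT c m q +ᴾ (p *ᴾ q)

constᴾ : ℤ → Poly
constᴾ c = if isZero c then [] else (c , []) ∷ []

polyᴺ : NExp → Poly
polyᴺ (ν i)   = (1ℤ , dbl i ∷ []) ∷ []
polyᴺ (κ c)   = constᴾ (+ c)
polyᴺ (a ⊕ b) = polyᴺ a +ᴾ polyᴺ b
polyᴺ (a ⊗ b) = polyᴺ a *ᴾ polyᴺ b

polyᶻ : ZExp → Poly
polyᶻ (ζ i)   = (1ℤ , suc (dbl i) ∷ []) ∷ []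
polyᶻ ⌞ a ⌟   = polyᴺ a
polyᶻ (a ⊞ b) = polyᶻ a +ᴾ polyᶻ b
polyᶻ (a ⊠ b) = polyᶻ a *ᴾ polyᶻ b
polyᶻ (⊟ a)   = scaleT (ℤ.- 1ℤ) [] (polyᶻ a)

-- A strict inequality is rounded to `1 + a ≤ b`. This is where integrality enters; the elimination
-- itself reasons as over the rationals.
nonneg : Form → List Poly
nonneg (a ≼ b)  = polyᶻ (⌞ b ⌟ ⊞ ⊟ ⌞ a ⌟) ∷ []
nonneg (a ≐ b)  = polyᶻ (⌞ b ⌟ ⊞ ⊟ ⌞ a ⌟) ∷ polyᶻ (⌞ a ⌟ ⊞ ⊟ ⌞ b ⌟) ∷ []
nonneg (a ≼ᶻ b) = polyᶻ (b ⊞ ⊟ a) ∷ []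
nonneg (a ≺ᶻ b) = polyᶻ (b ⊞ ⊟ (⌞ κ 1 ⌟ ⊞ a)) ∷ []
nonneg (a ≐ᶻ b) = polyᶻ (b ⊞ ⊟ a) ∷ polyᶻ (a ⊞ ⊟ b) ∷ []
nonneg falsum   = constᴾ (ℤ.- 1ℤ) ∷ []

isEven : ℕ → Bool
isEven zero          = true
isEven (suc zero)    = false
isEven (suc (suc n)) = isEven n

allEven : Mono → Bool
allEven []      = true
allEven (x ∷ m) = isEven x ∧ allEven m

elemᴹ : Mono → List Mono → Bool
elemᴹ m []       = false
elemᴹ m (n ∷ ns) = if does (m ≟ᴹ n) then true else elemᴹ m ns

consᴹ : Mono → List Mono → List Mono
consᴹ m ms = if elemᴹ m ms then ms else m ∷ ms

monosᴾ : Poly → List Mono → List Mono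
monosᴾ []            ms = ms
monosᴾ ((_ , []) ∷ p) ms = monosᴾ p ms
monosᴾ ((_ , m@(_ ∷ _)) ∷ p) ms = monosᴾ p (consᴹ m ms)

monos : List Poly → List Mono
monos []       = []
monos (p ∷ ps) = monosᴾ p (monos ps)

-- A product of natural variables is nonnegative. Products containing an integer variable get no
-- sign.
evenMonos : List Mono → List Poly
evenMonos []             = []
evenMonos (m ∷ ms) =
  if allEven m then ((1ℤ , m) ∷ []) ∷ evenMonos ms else evenMonos ms

coeff : Mono → Poly → ℤ
coeff m [] = 0ℤ
coeff m ((c , n) ∷ p) = if does (m ≟ᴹ n) then c else coeff m p

isPos isNeg : ℤ → Bool
isPos (+ suc _)  = true
isPos _          = false
isNeg (-[1+ _ ]) = true
isNeg _          = false

countᵇ : (Poly → Bool) → List Poly → ℕ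
countᵇ f []       = 0
countᵇ f (p ∷ ps) = if f p then suc (countᵇ f ps) else countᵇ f ps

-- The number of inequalities that eliminating `m` would create; `pick` minimises it to slow down
-- the growth of the system.
score : Mono → List Poly → ℕ
score m ps = countᵇ (isPos ∘ coeff m) ps * countᵇ (isNeg ∘ coeff m) ps

best : ℕ → Mono → List Mono → List Poly → Mono
better : ℕ → ℕ → Mono → Mono → List Mono → List Poly → Mono
best s m []       ps = m
best s m (n ∷ ns) ps = better s (score n ps) m n ns ps
better s t m n ns ps = if t ℕ.<ᵇ s then best t n ns ps else best s m ns ps

pick : List Poly → Mono
pick ps = go (monos ps)
  where
  go : List Mono → Mono
  go []       = []
  go (m ∷ ms) = best (score m ps) m ms ps

-- Eliminates m between a polynomial where its coefficient is positive and one where it is negative.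
combine : Mono → Poly → Poly → Poly
combine m p q = scaleT (+ ∣ coeff m q ∣) [] p +ᴾ scaleT (+ ∣ coeff m p ∣) [] q

selectᵇ : (Poly → Bool) → List Poly → List Poly
selectᵇ f []       = []
selectᵇ f (p ∷ ps) = if f p then p ∷ selectᵇ f ps else selectᵇ f ps

combineAll : Mono → List Poly → List Poly → List Poly
combineAll m ps qs = concatMap (λ p → map (combine m p) qs) ps

negConst : Poly → Bool
negConst ((-[1+ _ ] , []) ∷ []) = true
negConst _                      = false

anyᵇ : (Poly → Bool) → List Poly → Bool
anyᵇ f []       = false
anyᵇ f (p ∷ ps) = if f p then true else anyᵇ f ps

-- Sums of several nonnegative terms follow from evenMonos.
informative : Poly → Bool
informative []       = false
informative (t ∷ []) = true
informative (t ∷ p)  = anyTerm (t ∷ p)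
  where
  anyTerm : Poly → Bool
  anyTerm [] = false
  anyTerm ((c , m) ∷ p) = if isNeg c then true else (if allEven m then anyTerm p else true)

-- Fourier–Motzkin elimination with the monomials as unknowns.
refute : ℕ → List Poly → Bool
eliminate : ℕ → List Poly → Mono → Bool
refute zero    ps = anyᵇ negConst ps
refute (suc f) ps = if anyᵇ negConst ps then true else eliminate f ps (pick ps)
eliminate f ps m = refute f
  (selectᵇ informative (combineAll m (selectᵇ (isPos ∘ coeff m) ps) (selectᵇ (isNeg ∘ coeff m) ps))
   ++ selectᵇ (isZero ∘ coeff m) ps)

premises : List Form → List Poly
premises fs = concatMap nonneg fs

-- Most goals follow without the signs of the monomials, so the smaller system is tried first.
contradictory : ℕ → List Form → Bool
contradictory k fs = if refute k (premises fs) then true else refute k (evenMonos (monos (premises fs)) ++ premises fs)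

-- The goal follows once each listed formula contradicts the hypotheses. An equation needs both
-- strict orders excluded; for `falsum` a true formula is added, so that the hypotheses themselves
-- must be contradictory.
negations : Form → List Form
negations (a ≼ b)  = κ 1 ⊕ b ≼ a ∷ []
negations (a ≐ b)  = κ 1 ⊕ b ≼ a ∷ κ 1 ⊕ a ≼ b ∷ []
negations (a ≼ᶻ b) = b ≺ᶻ a ∷ []
negations (a ≺ᶻ b) = b ≼ᶻ a ∷ []
negations (a ≐ᶻ b) = b ≺ᶻ a ∷ a ≺ᶻ b ∷ []
negations falsum   = κ 0 ≼ κ 0 ∷ []

implied : ℕ → List Form → Form → Bool
implied k fs g = go (negations g)
  where
  go : List Form → Bool
  go []       = true
  go (n ∷ ns) = if contradictory k (n ∷ fs) then go ns else false

-- Soundness of the arithmetic procedure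

module Soundness (ρ : Env) where
  v : ℕ → ℤ
  v = val (Env.nats ρ) (Env.ints ρ)

  evM : Mono → ℤ
  evM []      = 1ℤ
  evM (x ∷ m) = v x ℤ.* evM m

  ev : Poly → ℤ
  ev []            = 0ℤ
  ev ((c , m) ∷ p) = c ℤ.* evM m ℤ.+ ev p

  Holds : Poly → Set
  Holds p = 0ℤ ℤ.≤ ev p

  isZero-sound : ∀ c → isZero c ≡ true → c ≡ 0ℤ
  isZero-sound (+ zero) _ = refl

  ev-insertT : ∀ c m p → ev (insertT c m p) ≡ c ℤ.* evM m ℤ.+ ev p
  ev-insertT c m [] = refl
  ev-insertT c m ((d , n) ∷ p) with m ≟ᴹ n
  ... | no _ with m <ᴹ n
  ...   | true  = refl
  ...   | false = trans (cong (ℤ._+_ (d ℤ.* evM n)) (ev-insertT c m p)) (swap (d ℤ.* evM n) (c ℤ.* evM m) (ev p))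
    where
    swap : ∀ x y z → x ℤ.+ (y ℤ.+ z) ≡ y ℤ.+ (x ℤ.+ z)
    swap = solve-∀
  ev-insertT c m ((d , .m) ∷ p) | yes refl with isZero (c ℤ.+ d) in eq
  ... | false = lem c d (evM m) (ev p)
    where
    lem : ∀ c d x y → (c ℤ.+ d) ℤ.* x ℤ.+ y ≡ c ℤ.* x ℤ.+ (d ℤ.* x ℤ.+ y)
    lem = solve-∀
  ... | true = sym (trans (lem c d (evM m) (ev p))
                   (trans (cong (λ t → t ℤ.* evM m ℤ.+ ev p) (isZero-sound (c ℤ.+ d) eq)) (lem₀ (evM m) (ev p))))
    where
    lem : ∀ c d x y → c ℤ.* x ℤ.+ (d ℤ.* x ℤ.+ y) ≡ (c ℤ.+ d) ℤ.* x ℤ.+ y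
    lem = solve-∀
    lem₀ : ∀ x y → 0ℤ ℤ.* x ℤ.+ y ≡ y
    lem₀ = solve-∀

  ev-+ : ∀ p q → ev (p +ᴾ q) ≡ ev p ℤ.+ ev q
  ev-+ [] q = sym (ℤₚ.+-identityˡ (ev q))
  ev-+ ((c , m) ∷ p) q = trans (ev-insertT c m (p +ᴾ q))
    (trans (cong (ℤ._+_ (c ℤ.* evM m)) (ev-+ p q)) (sym (ℤₚ.+-assoc (c ℤ.* evM m) (ev p) (ev q))))

  evM-insertV : ∀ x m → evM (insertV x m) ≡ v x ℤ.* evM m
  evM-insertV x [] = refl
  evM-insertV x (y ∷ m) with x ℕ.≤ᵇ y
  ... | true  = refl
  ... | false = trans (cong (ℤ._*_ (v y)) (evM-insertV x m)) (swap (v y) (v x) (evM m))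
    where
    swap : ∀ x y z → x ℤ.* (y ℤ.* z) ≡ y ℤ.* (x ℤ.* z)
    swap = solve-∀

  evM-* : ∀ m n → evM (m *ᴹ n) ≡ evM m ℤ.* evM n
  evM-* [] n = sym (ℤₚ.*-identityˡ (evM n))
  evM-* (x ∷ m) n = trans (evM-insertV x (m *ᴹ n))
    (trans (cong (ℤ._*_ (v x)) (evM-* m n)) (sym (ℤₚ.*-assoc (v x) (evM m) (evM n))))

  ev-scaleT : ∀ c m p → ev (scaleT c m p) ≡ c ℤ.* evM m ℤ.* ev p
  ev-scaleT c m [] = sym (ℤₚ.*-zeroʳ (c ℤ.* evM m))
  ev-scaleT c m ((d , n) ∷ p) = trans (ev-insertT (c ℤ.* d) (m *ᴹ n) (scaleT c m p))
    (trans (cong₂ (λ s t → c ℤ.* d ℤ.* s ℤ.+ t) (evM-* m n) (ev-scaleT c m p)) (lem c d (evM m) (evM n) (ev p)))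
    where
    lem : ∀ c d x y z → c ℤ.* d ℤ.* (x ℤ.* y) ℤ.+ c ℤ.* x ℤ.* z ≡ c ℤ.* x ℤ.* (d ℤ.* y ℤ.+ z)
    lem = solve-∀

  ev-* : ∀ p q → ev (p *ᴾ q) ≡ ev p ℤ.* ev q
  ev-* [] q = sym (ℤₚ.*-zeroˡ (ev q))
  ev-* ((c , m) ∷ p) q = trans (ev-+ (scaleT c m q) (p *ᴾ q))
    (trans (cong₂ ℤ._+_ (ev-scaleT c m q) (ev-* p q)) (sym (ℤₚ.*-distribʳ-+ (ev q) (c ℤ.* evM m) (ev p))))

  ev-const : ∀ c → ev (constᴾ c) ≡ c
  ev-const c with isZero c in eq
  ... | true  = sym (isZero-sound c eq)
  ... | false = lem c
    where
    lem : ∀ c → c ℤ.* 1ℤ ℤ.+ 0ℤ ≡ c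
    lem = solve-∀

  unit : ∀ x → 1ℤ ℤ.* (x ℤ.* 1ℤ) ℤ.+ 0ℤ ≡ x
  unit = solve-∀

  ev-polyᴺ : ∀ a → ev (polyᴺ a) ≡ + ⟦ a ⟧ᴺ ρ
  ev-polyᴺ (ν i) = trans (unit _) (val-even (Env.nats ρ) (Env.ints ρ) i)
  ev-polyᴺ (κ c) = ev-const (+ c)
  ev-polyᴺ (a ⊕ b) = trans (ev-+ (polyᴺ a) (polyᴺ b)) (cong₂ ℤ._+_ (ev-polyᴺ a) (ev-polyᴺ b))
  ev-polyᴺ (a ⊗ b) = trans (ev-* (polyᴺ a) (polyᴺ b))
    (trans (cong₂ ℤ._*_ (ev-polyᴺ a) (ev-polyᴺ b)) (sym (ℤₚ.pos-* (⟦ a ⟧ᴺ ρ) (⟦ b ⟧ᴺ ρ))))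

  ev-polyᶻ : ∀ a → ev (polyᶻ a) ≡ ⟦ a ⟧ᶻ ρ
  ev-polyᶻ (ζ i) = trans (unit _) (val-odd (Env.nats ρ) (Env.ints ρ) i)
  ev-polyᶻ ⌞ a ⌟ = ev-polyᴺ a
  ev-polyᶻ (a ⊞ b) = trans (ev-+ (polyᶻ a) (polyᶻ b)) (cong₂ ℤ._+_ (ev-polyᶻ a) (ev-polyᶻ b))
  ev-polyᶻ (a ⊠ b) = trans (ev-* (polyᶻ a) (polyᶻ b)) (cong₂ ℤ._*_ (ev-polyᶻ a) (ev-polyᶻ b))
  ev-polyᶻ (⊟ a) = trans (ev-scaleT (ℤ.- 1ℤ) [] (polyᶻ a))
    (trans (cong (ℤ._*_ (ℤ.- 1ℤ ℤ.* 1ℤ)) (ev-polyᶻ a)) (lem (⟦ a ⟧ᶻ ρ)))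
    where
    lem : ∀ x → ℤ.- 1ℤ ℤ.* 1ℤ ℤ.* x ≡ ℤ.- x
    lem = solve-∀

  holds-≤ : ∀ a b → ⟦ a ⟧ᶻ ρ ℤ.≤ ⟦ b ⟧ᶻ ρ → Holds (polyᶻ (b ⊞ ⊟ a))
  holds-≤ a b h = subst (0ℤ ℤ.≤_) (sym (ev-polyᶻ (b ⊞ ⊟ a))) (ℤₚ.i≤j⇒0≤j-i h)

  nonneg-sound : ∀ f → ⟦ f ⟧ ρ → All Holds (nonneg f)
  nonneg-sound (a ≼ b) h = holds-≤ ⌞ a ⌟ ⌞ b ⌟ (ℤ.+≤+ h) ∷ []
  nonneg-sound (a ≐ b) h = holds-≤ ⌞ a ⌟ ⌞ b ⌟ (ℤ.+≤+ (ℕₚ.≤-reflexive h))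
                         ∷ holds-≤ ⌞ b ⌟ ⌞ a ⌟ (ℤ.+≤+ (ℕₚ.≤-reflexive (sym h))) ∷ []
  nonneg-sound (a ≼ᶻ b) h = holds-≤ a b h ∷ []
  nonneg-sound (a ≺ᶻ b) h = holds-≤ (⌞ κ 1 ⌟ ⊞ a) b (ℤₚ.i<j⇒suc[i]≤j h) ∷ []
  nonneg-sound (a ≐ᶻ b) h = holds-≤ a b (ℤₚ.≤-reflexive h) ∷ holds-≤ b a (ℤₚ.≤-reflexive (sym h)) ∷ []
  nonneg-sound falsum ()

  premises-sound : ∀ fs → ⟦ fs ⟧* ρ → All Holds (premises fs)
  premises-sound [] _ = []
  premises-sound (f ∷ fs) (h , hs) = Allₚ.++⁺ (nonneg-sound f h) (premises-sound fs hs)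

  val-nonneg : ∀ ns zs x → isEven x ≡ true → 0ℤ ℤ.≤ val ns zs x
  val-nonneg ns zs zero _ = ℤ.+≤+ z≤n
  val-nonneg ns zs (suc (suc x)) e = val-nonneg (drop 1 ns) (drop 1 zs) x e

  *-nonneg : ∀ {x y} → 0ℤ ℤ.≤ x → 0ℤ ℤ.≤ y → 0ℤ ℤ.≤ x ℤ.* y
  *-nonneg {+ m} {+ n} _ _ = subst (0ℤ ℤ.≤_) (ℤₚ.pos-* m n) (ℤ.+≤+ z≤n)

  evM-nonneg : ∀ m → allEven m ≡ true → 0ℤ ℤ.≤ evM m
  evM-nonneg [] _ = ℤ.+≤+ z≤n
  evM-nonneg (x ∷ m) e with isEven x in eq
  ... | true = *-nonneg (val-nonneg (Env.nats ρ) (Env.ints ρ) x eq) (evM-nonneg m e)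

  evenMonos-sound : ∀ ms → All Holds (evenMonos ms)
  evenMonos-sound [] = []
  evenMonos-sound (m ∷ ms) with allEven m in eq
  ... | false = evenMonos-sound ms
  ... | true  = subst (0ℤ ℤ.≤_) (lem (evM m)) (evM-nonneg m eq) ∷ evenMonos-sound ms
    where
    lem : ∀ x → x ≡ 1ℤ ℤ.* x ℤ.+ 0ℤ
    lem = solve-∀

  combine-sound : ∀ m p q → Holds p → Holds q → Holds (combine m p q)
  combine-sound m p q hp hq = subst (0ℤ ℤ.≤_)
    (sym (trans (ev-+ (scaleT (+ a) [] p) (scaleT (+ b) [] q)) (cong₂ ℤ._+_ (lem a p) (lem b q))))
    (ℤₚ.+-mono-≤ (*-nonneg {+ a} (ℤ.+≤+ z≤n) hp) (*-nonneg {+ b} (ℤ.+≤+ z≤n) hq))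
    where
    a b : ℕ
    a = ∣ coeff m q ∣
    b = ∣ coeff m p ∣
    lem : ∀ a p → ev (scaleT (+ a) [] p) ≡ + a ℤ.* ev p
    lem a p = trans (ev-scaleT (+ a) [] p) (cong (ℤ._* ev p) (ℤₚ.*-identityʳ (+ a)))

  select-sound : ∀ f ps → All Holds ps → All Holds (selectᵇ f ps)
  select-sound f [] [] = []
  select-sound f (p ∷ ps) (h ∷ hs) with f p
  ... | true  = h ∷ select-sound f ps hs
  ... | false = select-sound f ps hs

  combineRow-sound : ∀ m p qs → Holds p → All Holds qs → All Holds (map (combine m p) qs)
  combineRow-sound m p [] hp [] = []
  combineRow-sound m p (q ∷ qs) hp (h ∷ hs) = combine-sound m p q hp h ∷ combineRow-sound m p qs hp hs

  combineAll-sound : ∀ m ps qs → All Holds ps → All Holds qs → All Holds (combineAll m ps qs)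
  combineAll-sound m [] qs [] hq = []
  combineAll-sound m (p ∷ ps) qs (h ∷ hs) hq =
    Allₚ.++⁺ (combineRow-sound m p qs h hq) (combineAll-sound m ps qs hs hq)

  negConst-sound : ∀ p → T (negConst p) → ¬ Holds p
  negConst-sound ((-[1+ c ] , []) ∷ []) _ h = neg (subst (0ℤ ℤ.≤_) (lem -[1+ c ]) h)
    where
    lem : ∀ x → x ℤ.* 1ℤ ℤ.+ 0ℤ ≡ x
    lem = solve-∀
    neg : ¬ 0ℤ ℤ.≤ -[1+ c ]
    neg ()

  anyNeg-sound : ∀ ps → T (anyᵇ negConst ps) → ¬ All Holds ps
  anyNeg-sound (p ∷ ps) t (h ∷ hs) with negConst p in eq
  ... | true  = negConst-sound p (subst T (sym eq) tt) h
  ... | false = anyNeg-sound ps t hs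

  -- Every inequality passed on is an old one or a nonnegative combination of two old ones.
  refute-sound : ∀ f ps → T (refute f ps) → ¬ All Holds ps
  eliminate-sound : ∀ f ps m → T (eliminate f ps m) → ¬ All Holds ps
  refute-sound zero ps t = anyNeg-sound ps t
  refute-sound (suc f) ps t with anyᵇ negConst ps in eq
  ... | true  = anyNeg-sound ps (subst T (sym eq) tt)
  ... | false = eliminate-sound f ps (pick ps) t
  eliminate-sound f ps m t hs = refute-sound f _ t
    (Allₚ.++⁺ (select-sound informative _ (combineAll-sound m _ _ (select-sound _ ps hs) (select-sound _ ps hs))) (select-sound _ ps hs))

  contradictory-sound : ∀ k fs → T (contradictory k fs) → ¬ ⟦ fs ⟧* ρ
  contradictory-sound k fs t hs with refute k (premises fs) in eq
  ... | true  = refute-sound k _ (subst T (sym eq) tt) (premises-sound fs hs)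
  ... | false = refute-sound k _ t
    (Allₚ.++⁺ (evenMonos-sound (monos (premises fs))) (premises-sound fs hs))

  split : ∀ {b c} → T (if b then c else false) → T b × T c
  split {true} t = tt , t

  implied-sound : ∀ k fs g → T (implied k fs g) → ⟦ fs ⟧* ρ → ⟦ g ⟧ ρ
  implied-sound k fs (a ≼ b) t hs = ℕₚ.≮⇒≥ λ h →
    contradictory-sound k (κ 1 ⊕ b ≼ a ∷ fs) (proj₁ (split t)) (h , hs)
  implied-sound k fs (a ≐ b) t hs with split t
  ... | t₁ , t₂ = ℕₚ.≤-antisym
    (ℕₚ.≮⇒≥ λ h → contradictory-sound k (κ 1 ⊕ b ≼ a ∷ fs) t₁ (h , hs))
    (ℕₚ.≮⇒≥ λ h → contradictory-sound k (κ 1 ⊕ a ≼ b ∷ fs) (proj₁ (split t₂)) (h , hs))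
  implied-sound k fs (a ≼ᶻ b) t hs = ℤₚ.≮⇒≥ λ h →
    contradictory-sound k (b ≺ᶻ a ∷ fs) (proj₁ (split t)) (h , hs)
  implied-sound k fs (a ≺ᶻ b) t hs = ℤₚ.≰⇒> λ h →
    contradictory-sound k (b ≼ᶻ a ∷ fs) (proj₁ (split t)) (h , hs)
  implied-sound k fs (a ≐ᶻ b) t hs with split t
  ... | t₁ , t₂ = ℤₚ.≤-antisym
    (ℤₚ.≮⇒≥ λ h → contradictory-sound k (b ≺ᶻ a ∷ fs) t₁ (h , hs))
    (ℤₚ.≮⇒≥ λ h → contradictory-sound k (a ≺ᶻ b ∷ fs) (proj₁ (split t₂)) (h , hs))
  implied-sound k fs falsum t hs =
    contradictory-sound k (κ 0 ≼ κ 0 ∷ fs) (proj₁ (split t)) (z≤n , hs)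

-- The implicit argument has type `⊤` once the search succeeds, so it is found by evaluation and a
-- failing search is a type error. At most 40 monomials are eliminated.
linarith : ∀ ρ fs g {_ : T (implied 40 fs g)} → ⟦ fs ⟧* ρ → ⟦ g ⟧ ρ
linarith ρ fs g {t} = Soundness.implied-sound ρ 40 fs g t

-- Finite lists and counting

length-mono : ∀ {A : Set} {xs ys : List A} → Unique xs → (∀ {x} → x ∈ xs → x ∈ ys) → length xs ≤ length ys
length-mono {xs = []} _ _ = z≤n
length-mono {xs = x ∷ xs} {ys} (x∉ ∷ u) ⊆ with ∈-∃++ (⊆ (Any.here refl))
... | as , bs , refl = subst (suc (length xs) ℕ.≤_) (sym len) (s≤s (length-mono u sub))
  where
  len : length (as ++ x ∷ bs) ≡ suc (length (as ++ bs))
  len = trans (length-++ as)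
    (trans (ℕₚ.+-suc (length as) (length bs)) (cong suc (sym (length-++ as))))
  sub : ∀ {y} → y ∈ xs → y ∈ as ++ bs
  sub {y} y∈ with ∈-++⁻ as (⊆ (Any.there y∈))
  ... | inj₁ p = ∈-++⁺ˡ p
  ... | inj₂ (Any.here refl) = contradiction refl (All.lookup x∉ y∈)
  ... | inj₂ (Any.there p) = ∈-++⁺ʳ as p

_≟ₚ_ : (p q : Pixel) → Dec (p ≡ q)
_≟ₚ_ = Productₚ.≡-dec ℤ._≟_ ℤ._≟_

open DecMembership _≟ₚ_ public using (_∈?_)

-- An element of `ys` outside `xs` could be put in front of `xs`, giving a repetition-free list
-- inside `ys` that is too long. This is how a component with as many pixels as its rectangle is
-- seen to fill it.
⊆-reverse : ∀ {xs ys : List Pixel} → Unique xs → (∀ {x} → x ∈ xs → x ∈ ys) → length ys ≤ length xs →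
            ∀ {y} → y ∈ ys → y ∈ xs
⊆-reverse {xs} {ys} u ⊆ len {y} y∈ with y ∈? xs
... | yes p = p
... | no y∉ = contradiction (length-mono {xs = y ∷ xs} (All.tabulate (λ x∈ e → y∉ (subst (_∈ xs) (sym e) x∈)) ∷ u) sub) (ℕₚ.<⇒≱ (s≤s len))
  where
  sub : ∀ {x} → x ∈ y ∷ xs → x ∈ ys
  sub (Any.here refl) = y∈
  sub (Any.there p) = ⊆ p

concatMap-unique : ∀ {A B : Set} (f : A → List B) {xs} → Unique xs → (∀ x → Unique (f x)) →
                   (∀ {x y b} → x ∈ xs → y ∈ xs → b ∈ f x → b ∈ f y → x ≡ y) → Unique (concatMap f xs)
concatMap-unique f [] uf inj = []
concatMap-unique f {x ∷ xs} (x∉ ∷ u) uf inj = Uniqueₚ.++⁺ (uf x)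
  (concatMap-unique f u uf λ p q → inj (Any.there p) (Any.there q)) disjoint
  where
  disjoint : ∀ {b} → ¬ (b ∈ f x × b ∈ concatMap f xs)
  disjoint (p , q) with ∈-concat⁻′ (map f xs) q
  ... | _ , b∈ , fy∈ with ∈-map⁻ f fy∈
  ...   | y , y∈ , refl = All.lookup x∉ y∈ (inj (Any.here refl) (Any.there y∈) p b∈)

𝟙 : {P : Set} → Dec P → ℕ
𝟙 d = if does d then 1 else 0

𝟙≤1 : ∀ {P : Set} (d : Dec P) → 𝟙 d ≤ 1
𝟙≤1 (yes _) = s≤s z≤n
𝟙≤1 (no _)  = z≤n

𝟙-mono : ∀ {P Q : Set} (d : Dec P) (e : Dec Q) → (P → Q) → 𝟙 d ≤ 𝟙 e
𝟙-mono (no _)  _       _ = z≤n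
𝟙-mono (yes p) (yes _) _ = s≤s z≤n
𝟙-mono (yes p) (no ¬q) f = contradiction (f p) ¬q

𝟙-yes : ∀ {P : Set} (d : Dec P) → P → 𝟙 d ≡ 1
𝟙-yes (yes _) _ = refl
𝟙-yes (no ¬p) p = contradiction p ¬p

𝟙-no : ∀ {P : Set} (d : Dec P) → ¬ P → 𝟙 d ≡ 0
𝟙-no (yes p) ¬p = contradiction p ¬p
𝟙-no (no _)  _  = refl

-- Abstract, so that sums over boxes are not unfolded by the type checker.
abstract
  ∑ : {A : Set} → List A → (A → ℕ) → ℕ
  ∑ []       f = 0
  ∑ (x ∷ xs) f = f x + ∑ xs f

  ∑-mono : ∀ {A : Set} {f g : A → ℕ} xs → (∀ {x} → x ∈ xs → f x ≤ g x) → ∑ xs f ≤ ∑ xs g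
  ∑-mono [] h = z≤n
  ∑-mono (x ∷ xs) h = ℕₚ.+-mono-≤ (h (Any.here refl)) (∑-mono xs (h ∘ Any.there))

  ∑-+ : ∀ {A : Set} (f g : A → ℕ) xs → ∑ xs (λ x → f x + g x) ≡ ∑ xs f + ∑ xs g
  ∑-+ f g [] = refl
  ∑-+ f g (x ∷ xs) = linarith (f x ∷ g x ∷ ∑ xs (λ x₁ → f x₁ + g x₁) ∷ ∑ xs f ∷ ∑ xs g ∷ [] ∣ᵉ [])
    (ν 2 ≐ ν 3 ⊕ ν 4 ∷ []) (ν 0 ⊕ ν 1 ⊕ ν 2 ≐ ν 0 ⊕ ν 3 ⊕ (ν 1 ⊕ ν 4)) (∑-+ f g xs , tt)

  ∑-* : ∀ {A : Set} k (f : A → ℕ) xs → ∑ xs (λ x → k * f x) ≡ k * ∑ xs f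
  ∑-* k f [] = sym (ℕₚ.*-zeroʳ k)
  ∑-* k f (x ∷ xs) = trans (cong (k * f x ℕ.+_) (∑-* k f xs)) (sym (ℕₚ.*-distribˡ-+ k (f x) (∑ xs f)))

  ∑-const : ∀ {A : Set} k (xs : List A) → ∑ xs (λ _ → k) ≡ k * length xs
  ∑-const k [] = sym (ℕₚ.*-zeroʳ k)
  ∑-const k (x ∷ xs) = trans (cong (k ℕ.+_) (∑-const k xs)) (sym (ℕₚ.*-suc k (length xs)))

  ∑-swap : ∀ {A B : Set} (f : A → B → ℕ) xs ys → ∑ xs (λ x → ∑ ys (f x)) ≡ ∑ ys (λ y → ∑ xs (λ x → f x y))
  ∑-swap f [] ys = sym (∑-const 0 ys)
  ∑-swap f (x ∷ xs) ys = trans (cong (∑ ys (f x) ℕ.+_) (∑-swap f xs ys)) (sym (∑-+ (f x) (λ y → ∑ xs (λ x → f x y)) ys))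

  length-concat : ∀ {A : Set} (xss : List (List A)) → length (concat xss) ≡ ∑ xss length
  length-concat [] = refl
  length-concat (xs ∷ xss) = trans (length-++ xs) (cong (length xs ℕ.+_) (length-concat xss))

  ∑-cong : ∀ {A : Set} {f g : A → ℕ} xs → (∀ x → f x ≡ g x) → ∑ xs f ≡ ∑ xs g
  ∑-cong []       h = refl
  ∑-cong (x ∷ xs) h = cong₂ ℕ._+_ (h x) (∑-cong xs h)

  ∑-map : ∀ {A B : Set} (g : A → B) (f : B → ℕ) xs → ∑ (map g xs) f ≡ ∑ xs (f ∘ g)
  ∑-map g f []       = refl
  ∑-map g f (x ∷ xs) = cong (f (g x) ℕ.+_) (∑-map g f xs)

  length-filter≡∑ : ∀ {A : Set} {P : A → Set} (P? : ∀ x → Dec (P x)) xs → length (filter P? xs) ≡ ∑ xs (λ x → 𝟙 (P? x))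
  length-filter≡∑ P? [] = refl
  length-filter≡∑ P? (x ∷ xs) with P? x
  ... | yes _ = cong suc (length-filter≡∑ P? xs)
  ... | no _  = length-filter≡∑ P? xs

  ≤∑𝟙 : ∀ {A : Set} {P : A → Set} (P? : ∀ x → Dec (P x)) {xs ys} → Unique xs →
        (∀ {x} → x ∈ xs → x ∈ ys × P x) → length xs ≤ ∑ ys (λ x → 𝟙 (P? x))
  ≤∑𝟙 P? {xs} {ys} u h = subst (length xs ℕ.≤_) (length-filter≡∑ P? ys)
    (length-mono u (λ x∈ → ∈-filter⁺ P? (proj₁ (h x∈)) (proj₂ (h x∈))))

  ∑𝟙≤1 : ∀ {A : Set} {P : A → Set} (P? : ∀ x → Dec (P x)) {xs} →
         AllPairs (λ x y → ¬ (P x × P y)) xs → ∑ xs (λ x → 𝟙 (P? x)) ≤ 1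
  ∑𝟙≤1 P? [] = z≤n
  ∑𝟙≤1 P? {x ∷ xs} (hx ∷ hs) with P? x
  ... | no _  = ∑𝟙≤1 P? hs
  ... | yes p = s≤s (subst (∑ xs (λ y → 𝟙 (P? y)) ℕ.≤_) (∑-const 0 xs)
                     (∑-mono xs (λ {y} y∈ → ℕₚ.≤-reflexive (𝟙-no (P? y) (λ q → All.lookup hx y∈ (p , q))))))

  ∑𝟙≡0 : ∀ {A : Set} {P : A → Set} (P? : ∀ x → Dec (P x)) {xs} → (∀ {x} → x ∈ xs → ¬ P x) → ∑ xs (λ x → 𝟙 (P? x)) ≡ 0
  ∑𝟙≡0 P? {[]} h = refl
  ∑𝟙≡0 P? {x ∷ xs} h with P? x
  ... | yes p = contradiction p (h (Any.here refl))
  ... | no _  = ∑𝟙≡0 P? (h ∘ Any.there)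

  ∑-empty : ∀ {A : Set} (f : A → ℕ) → ∑ [] f ≡ 0
  ∑-empty f = refl

  ∑-cons : ∀ {A : Set} x (xs : List A) f → ∑ (x ∷ xs) f ≡ f x + ∑ xs f
  ∑-cons x xs f = refl

  ∑-concatMap : ∀ {A B : Set} (g : A → List B) (f : B → ℕ) xs → ∑ (concatMap g xs) f ≡ ∑ xs (λ x → ∑ (g x) f)
  ∑-concatMap g f [] = refl
  ∑-concatMap g f (x ∷ xs) = trans (∑-++ (g x) (concatMap g xs)) (cong (∑ (g x) f ℕ.+_) (∑-concatMap g f xs))
    where
    ∑-++ : ∀ ys zs → ∑ (ys ++ zs) f ≡ ∑ ys f + ∑ zs f
    ∑-++ [] zs = refl
    ∑-++ (y ∷ ys) zs = trans (cong (f y ℕ.+_) (∑-++ ys zs)) (sym (ℕₚ.+-assoc (f y) (∑ ys f) (∑ zs f)))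

  ∑-upTo-suc : ∀ n (g : ℕ → ℕ) → ∑ (upTo (suc n)) g ≡ g 0 + ∑ (upTo n) (g ∘ suc)
  ∑-upTo-suc n g = cong (g 0 ℕ.+_) (trans (cong (λ is → ∑ is g) (sym (map-upTo suc n))) (∑-map suc g (upTo n)))

  ∑-upTo-+ : ∀ m n (g : ℕ → ℕ) → ∑ (upTo (m + n)) g ≡ ∑ (upTo m) g + ∑ (upTo n) (λ i → g (m + i))
  ∑-upTo-+ zero n g = refl
  ∑-upTo-+ (suc m) n g = trans (∑-upTo-suc (m + n) g) (trans (cong (g 0 ℕ.+_) (∑-upTo-+ m n (g ∘ suc)))
    (trans (sym (ℕₚ.+-assoc (g 0) _ _)) (cong (ℕ._+ ∑ (upTo n) (λ i → g (suc m + i))) (sym (∑-upTo-suc m g)))))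

-- The first `Q * N` indices are cut into `Q` consecutive windows, and the remaining `s` terms are
-- discarded.
∑-windows : ∀ N c Q s (g : ℕ → ℕ) → (∀ m → c ≤ ∑ (upTo N) (λ i → g (m + i))) → Q * c ≤ ∑ (upTo (Q * N + s)) g
∑-windows N c zero    s g h = z≤n
∑-windows N c (suc Q) s g h = subst (suc Q * c ℕ.≤_)
  (trans (sym (∑-upTo-+ N (Q * N + s) g)) (cong (λ t → ∑ (upTo t) g) (sym (ℕₚ.+-assoc N (Q * N) s))))
  (ℕₚ.+-mono-≤ (h 0) (∑-windows N c Q s (λ i → g (N + i))
    λ m → subst (c ℕ.≤_) (∑-cong (upTo N) λ i → cong g (ℕₚ.+-assoc N m i)) (h (N + m))))

map-unique : ∀ {A B : Set} (f : A → B) {xs} → Unique xs → (∀ {x y} → x ∈ xs → y ∈ xs → f x ≡ f y → x ≡ y) → Unique (map f xs)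
map-unique f [] inj = []
map-unique f {x ∷ xs} (x∉ ∷ u) inj = Allₚ.map⁺ (All.tabulate λ y∈ e → All.lookup x∉ y∈ (inj (Any.here refl) (Any.there y∈) e))
  ∷ map-unique f u λ p q → inj (Any.there p) (Any.there q)

-- Fractions, densities and the functions defining the bounds

toℚᵘ-/ : ∀ n d → ℚ.toℚᵘ ((+ n) ℚ./ suc d) ℚᵘ.≃ mkℚᵘ (+ n) d
toℚᵘ-/ n d = ℚₚ.toℚᵘ-fromℚᵘ (mkℚᵘ (+ n) d)

frac-mono-≤ : ∀ {a b c d} → 1 ≤ b → 1 ≤ d → a * d ≤ c * b → frac a b ℚ.≤ frac c d
frac-mono-≤ {a} {suc b} {c} {suc d} _ _ h = ℚₚ.toℚᵘ-cancel-≤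
  (ℚᵘₚ.≤-respˡ-≃ (ℚᵘₚ.≃-sym (toℚᵘ-/ a b)) (ℚᵘₚ.≤-respʳ-≃ (ℚᵘₚ.≃-sym (toℚᵘ-/ c d))
    (*≤* (subst₂ ℤ._≤_ (ℤₚ.pos-* a (suc d)) (ℤₚ.pos-* c (suc b)) (ℤ.+≤+ h)))))

frac-mono-< : ∀ {a b c d} → 1 ≤ b → 1 ≤ d → a * d < c * b → frac a b ℚ.< frac c d
frac-mono-< {a} {suc b} {c} {suc d} _ _ h = ℚₚ.toℚᵘ-cancel-<
  (ℚᵘₚ.<-respˡ-≃ (ℚᵘₚ.≃-sym (toℚᵘ-/ a b)) (ℚᵘₚ.<-respʳ-≃ (ℚᵘₚ.≃-sym (toℚᵘ-/ c d))
    (*<* (subst₂ ℤ._<_ (ℤₚ.pos-* a (suc d)) (ℤₚ.pos-* c (suc b)) (ℤ.+<+ h)))))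

frac-cancel-≤ : ∀ {a b c d} → 1 ≤ b → 1 ≤ d → frac a b ℚ.≤ frac c d → a * d ≤ c * b
frac-cancel-≤ {a} {b} {c} {d} hb hd h =
  ℕₚ.≮⇒≥ λ k → ℚₚ.<-irrefl refl (ℚₚ.<-≤-trans (frac-mono-< {c} {d} {a} {b} hd hb k) h)

pos-*₃ : ∀ a b c → + (a * b * c) ≡ + a ℤ.* + b ℤ.* + c
pos-*₃ a b c = trans (ℤₚ.pos-* (a * b) c) (cong (ℤ._* + c) (ℤₚ.pos-* a b))

pos-*+* : ∀ a b c d → + ((a * b + c) * d) ≡ (+ a ℤ.* + b ℤ.+ + c) ℤ.* + d
pos-*+* a b c d = trans (ℤₚ.pos-* (a * b + c) d) (cong (λ t → (t ℤ.+ + c) ℤ.* + d) (ℤₚ.pos-* a b))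

scale≤ : ∀ d n e → + d ℤ.* + n ℤ.≤ + suc e ℤ.* (+ d ℤ.* + n)
scale≤ d n e = subst₂ ℤ._≤_ (ℤₚ.pos-* d n) (trans (ℤₚ.pos-* (suc e) (d * n)) (cong (+ suc e ℤ.*_) (ℤₚ.pos-* d n)))
  (ℤ.+≤+ (ℕₚ.m≤m+n (d * n) (e * (d * n))))

-- A positive ε has numerator at least one, so it is at least `1 / D` with `D` its denominator. The
-- hypothesis is the inequality with `1 / D` in place of ε, cleared of denominators.
frac<+ε : ∀ w n p d ε → ℚ.Positive ε →
          w * suc d * ℚ.denominatorℕ ε < (p * ℚ.denominatorℕ ε + suc d) * suc n →
          (+ w) ℚ./ suc n ℚ.< (+ p) ℚ./ suc d ℚ.+ ε
frac<+ε w n p d ε@(mkℚ (+ suc e) D _) _ h = ℚₚ.toℚᵘ-cancel-<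
  (ℚᵘₚ.<-respˡ-≃ (ℚᵘₚ.≃-sym (toℚᵘ-/ w n))
  (ℚᵘₚ.<-respʳ-≃ (ℚᵘₚ.≃-sym (ℚᵘₚ.≃-trans (ℚₚ.toℚᵘ-homo-+ ((+ p) ℚ./ suc d) ε) (ℚᵘₚ.+-congˡ (ℚ.toℚᵘ ε) (toℚᵘ-/ p d))))
  (*<* (subst (λ t → + w ℤ.* t ℤ.< (+ p ℤ.* + suc D ℤ.+ + suc e ℤ.* + suc d) ℤ.* + suc n) (sym (ℤₚ.pos-* (suc d) (suc D)))
    (arith (+ w) (+ suc d) (+ suc D) (+ p) (+ suc n) (+ suc e)
      (subst₂ ℤ._<_ (pos-*₃ w (suc d) (suc D)) (pos-*+* p (suc D) (suc d) (suc n)) (ℤ.+<+ h)) (scale≤ (suc d) (suc n) e))))))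
  where
  arith : ∀ w d D p n e → w ℤ.* d ℤ.* D ℤ.< (p ℤ.* D ℤ.+ d) ℤ.* n → d ℤ.* n ℤ.≤ e ℤ.* (d ℤ.* n) →
          w ℤ.* (d ℤ.* D) ℤ.< (p ℤ.* D ℤ.+ e ℤ.* d) ℤ.* n
  arith w d D p n e h h₁ = linarith ([] ∣ᵉ w ∷ d ∷ D ∷ p ∷ e ∷ n ∷ [])
    (ζ 0 ⊠ ζ 1 ⊠ ζ 2 ≺ᶻ (ζ 3 ⊠ ζ 2 ⊞ ζ 1) ⊠ ζ 5 ∷ ζ 1 ⊠ ζ 5 ≼ᶻ ζ 4 ⊠ (ζ 1 ⊠ ζ 5) ∷ [])
    (ζ 0 ⊠ (ζ 1 ⊠ ζ 2) ≺ᶻ (ζ 3 ⊠ ζ 2 ⊞ ζ 4 ⊠ ζ 1) ⊠ ζ 5) (h , h₁ , tt)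

frac-ε< : ∀ w n p d ε → ℚ.Positive ε →
          p * ℚ.denominatorℕ ε * suc n < (w * ℚ.denominatorℕ ε + suc n) * suc d →
          (+ p) ℚ./ suc d ℚ.- ε ℚ.< (+ w) ℚ./ suc n
frac-ε< w n p d ε@(mkℚ (+ suc e) D _) _ h = ℚₚ.toℚᵘ-cancel-<
  (ℚᵘₚ.<-respʳ-≃ (ℚᵘₚ.≃-sym (toℚᵘ-/ w n))
  (ℚᵘₚ.<-respˡ-≃ (ℚᵘₚ.≃-sym (ℚᵘₚ.≃-trans (ℚₚ.toℚᵘ-homo-+ ((+ p) ℚ./ suc d) (ℚ.- ε)) (ℚᵘₚ.+-congˡ (ℚ.toℚᵘ (ℚ.- ε)) (toℚᵘ-/ p d))))
  (*<* (subst (λ t → (+ p ℤ.* + suc D ℤ.+ -[1+ e ] ℤ.* + suc d) ℤ.* + suc n ℤ.< + w ℤ.* t) (sym (ℤₚ.pos-* (suc d) (suc D)))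
    (arith (+ w) (+ suc d) (+ suc D) (+ p) (+ suc n) (+ suc e)
      (subst₂ ℤ._<_ (pos-*₃ p (suc D) (suc n)) (pos-*+* w (suc D) (suc n) (suc d)) (ℤ.+<+ h)) (scale≤ (suc d) (suc n) e))))))
  where
  arith : ∀ w d D p n e → p ℤ.* D ℤ.* n ℤ.< (w ℤ.* D ℤ.+ n) ℤ.* d → d ℤ.* n ℤ.≤ e ℤ.* (d ℤ.* n) →
          (p ℤ.* D ℤ.+ ℤ.- e ℤ.* d) ℤ.* n ℤ.< w ℤ.* (d ℤ.* D)
  arith w d D p n e h h₁ = linarith ([] ∣ᵉ p ∷ D ∷ e ∷ d ∷ n ∷ w ∷ [])
    (ζ 0 ⊠ ζ 1 ⊠ ζ 4 ≺ᶻ (ζ 5 ⊠ ζ 1 ⊞ ζ 4) ⊠ ζ 3 ∷ ζ 3 ⊠ ζ 4 ≼ᶻ ζ 2 ⊠ (ζ 3 ⊠ ζ 4) ∷ [])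
    ((ζ 0 ⊠ ζ 1 ⊞ ⊟ ζ 2 ⊠ ζ 3) ⊠ ζ 4 ≺ᶻ ζ 5 ⊠ (ζ 3 ⊠ ζ 1)) (h , h₁ , tt)

odd-square : ∀ r → (2 * r + 1) * (2 * r + 1) ≡ suc (4 * r * r + 4 * r)
odd-square r = linarith (r ∷ [] ∣ᵉ []) [] ((κ 2 ⊗ ν 0 ⊕ κ 1) ⊗ (κ 2 ⊗ ν 0 ⊕ κ 1) ≐ κ 1 ⊕ (κ 4 ⊗ ν 0 ⊗ ν 0 ⊕ κ 4 ⊗ ν 0)) tt

-- Widening the box by `K` costs `pD(2nK + K²) ≤ n · pD(2K + K²)`, which is less than `n²` for this
-- large an `n`.
upper-margin : ∀ p D K w A n → 1 ≤ A → p * D * (2 * K + K * K) < n →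
               w * A ≤ p * ((n + K) * (n + K)) →
               w * A * D < (p * D + A) * (n * n)
upper-margin p D K w A n hA hn hw = linarith (w ∷ A ∷ D ∷ p ∷ n ∷ K ∷ [] ∣ᵉ [])
  (ν 0 ⊗ ν 1 ⊗ ν 2 ≼ ν 3 ⊗ ((ν 4 ⊕ ν 5) ⊗ (ν 4 ⊕ ν 5)) ⊗ ν 2 ∷ (κ 1 ⊕ ν 3 ⊗ ν 2 ⊗ (κ 2 ⊗ ν 5 ⊕ ν 5 ⊗ ν 5)) ⊗ ν 4 ≼ ν 4 ⊗ ν 4 ∷ κ 1 ⊗ (ν 4 ⊗ ν 4) ≼ ν 1 ⊗ (ν 4 ⊗ ν 4) ∷ ν 3 ⊗ ν 2 ⊗ (ν 5 ⊗ ν 5) ⊗ κ 1 ≼ ν 3 ⊗ ν 2 ⊗ (ν 5 ⊗ ν 5) ⊗ ν 4 ∷ κ 1 ≼ ν 4 ∷ [])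
  (κ 1 ⊕ ν 0 ⊗ ν 1 ⊗ ν 2 ≼ (ν 3 ⊗ ν 2 ⊕ ν 1) ⊗ (ν 4 ⊗ ν 4)) (h₁ , h₂ , h₃ , h₄ , h₅ , tt)
  where
  h₅ : 1 ≤ n
  h₅ = ℕₚ.≤-trans (s≤s z≤n) hn
  h₁ : w * A * D ≤ p * ((n + K) * (n + K)) * D
  h₁ = ℕₚ.*-monoˡ-≤ D hw
  h₂ : (1 + p * D * (2 * K + K * K)) * n ≤ n * n
  h₂ = ℕₚ.*-monoˡ-≤ n hn
  h₃ : 1 * (n * n) ≤ A * (n * n)
  h₃ = ℕₚ.*-monoˡ-≤ (n * n) hA
  h₄ : p * D * (K * K) * 1 ≤ p * D * (K * K) * n
  h₄ = ℕₚ.*-monoʳ-≤ (p * D * (K * K)) h₅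

-- The error `nAj`, linear in the side of the box, is smaller than `n²A / D` as soon as `jD < n`.
lower-margin : ∀ j D w A n → 1 ≤ A → j * D < n → n * n * j ≤ A * w + n * A * j →
               j * D * (n * n) < (w * D + n * n) * A
lower-margin j D w A n hA hn hw = linarith (j ∷ D ∷ n ∷ w ∷ A ∷ [] ∣ᵉ [])
  (ν 2 ⊗ ν 2 ⊗ ν 0 ⊗ ν 1 ≼ (ν 4 ⊗ ν 3 ⊕ ν 2 ⊗ ν 4 ⊗ ν 0) ⊗ ν 1 ∷ (κ 1 ⊕ ν 0 ⊗ ν 1) ⊗ (ν 2 ⊗ ν 4) ≼ ν 2 ⊗ (ν 2 ⊗ ν 4) ∷ κ 1 ≼ ν 2 ⊗ ν 4 ∷ [])
  (κ 1 ⊕ ν 0 ⊗ ν 1 ⊗ (ν 2 ⊗ ν 2) ≼ (ν 3 ⊗ ν 1 ⊕ ν 2 ⊗ ν 2) ⊗ ν 4) (h₁ , h₂ , h₃ , tt)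
  where
  h₁ : n * n * j * D ≤ (A * w + n * A * j) * D
  h₁ = ℕₚ.*-monoˡ-≤ D hw
  h₂ : (1 + j * D) * (n * A) ≤ n * (n * A)
  h₂ = ℕₚ.*-monoˡ-≤ (n * A) hn
  h₃ : 1 ≤ n * A
  h₃ = ℕₚ.*-mono-≤ (ℕₚ.≤-trans (s≤s z≤n) hn) hA

upper-ratio : ∀ w r p d K ε → ℚ.Positive ε →
  p * ℚ.denominatorℕ ε * (2 * K + K * K) < 2 * r + 1 →
  w * suc d ≤ p * ((2 * r + 1 + K) * (2 * r + 1 + K)) →
  (+ w) ℚ./ suc (4 * r * r + 4 * r) ℚ.< frac p (suc d) ℚ.+ ε
upper-ratio w r p d K ε ε>0 hr hw = frac<+ε w (4 * r * r + 4 * r) p d ε ε>0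
  (subst (λ t → w * suc d * ℚ.denominatorℕ ε < (p * ℚ.denominatorℕ ε + suc d) * t) (odd-square r)
    (upper-margin p (ℚ.denominatorℕ ε) K w (suc d) (2 * r + 1) (s≤s z≤n) hr hw))

lower-ratio : ∀ w r j d ε → ℚ.Positive ε → j * ℚ.denominatorℕ ε < 2 * r + 1 →
  (2 * r + 1) * (2 * r + 1) * j ≤ suc d * w + (2 * r + 1) * suc d * j →
  frac j (suc d) ℚ.- ε ℚ.< (+ w) ℚ./ suc (4 * r * r + 4 * r)
lower-ratio w r j d ε ε>0 hr hw = frac-ε< w (4 * r * r + 4 * r) j d ε ε>0
  (subst (λ t → j * ℚ.denominatorℕ ε * t < (w * ℚ.denominatorℕ ε + t) * suc d) (odd-square r)
    (lower-margin j (ℚ.denominatorℕ ε) w (suc d) (2 * r + 1) (s≤s z≤n) hr hw))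

-- The count may refer to a box wider by a constant `K`, since the squares met by pixels of a box
-- stick out of it; the limit does not see the difference.
density-upper : ∀ I p A K → 1 ≤ A →
  (∀ r → W I r * A ≤ p * ((2 * r + 1 + K) * (2 * r + 1 + K))) →
  DensityLe I (frac p A)
density-upper I p (suc d) K _ h ε ε>0 N = N + X , ℕₚ.m≤m+n N X ,
  upper-ratio (W I (N + X)) (N + X) p d K ε ε>0 (X<n N X) (h (N + X))
  where
  X : ℕ
  X = p * ℚ.denominatorℕ ε * (2 * K + K * K)
  X<n : ∀ N X → X < 2 * (N + X) + 1
  X<n N X = linarith (X ∷ N ∷ [] ∣ᵉ []) [] (κ 1 ⊕ ν 0 ≼ κ 2 ⊗ (ν 1 ⊕ ν 0) ⊕ κ 1) tt

-- The additional term on the right pays for the incomplete period at the end of each line of the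
-- box.
density-lower : ∀ I j A → 1 ≤ A →
  (∀ r → (2 * r + 1) * (2 * r + 1) * j ≤ A * W I r + (2 * r + 1) * A * j) →
  DensityGe I (frac j A)
density-lower I j (suc d) _ h ε ε>0 = j * ℚ.denominatorℕ ε , λ r hr →
  lower-ratio (W I r) r j d ε ε>0 (X<n (j * ℚ.denominatorℕ ε) r hr) (h r)
  where
  X<n : ∀ X r → X ≤ r → X < 2 * r + 1
  X<n X r h = linarith (X ∷ r ∷ [] ∣ᵉ []) (ν 0 ≼ ν 1 ∷ []) (κ 1 ⊕ ν 0 ≼ κ 2 ⊗ ν 1 ⊕ κ 1) (h , tt)

DensityGe-antimono : ∀ {I a b} → b ℚ.≤ a → DensityGe I a → DensityGe I b
DensityGe-antimono b≤a h ε ε>0 = proj₁ (h ε ε>0) , λ r hr → ℚₚ.≤-<-trans (ℚₚ.+-monoˡ-≤ (ℚ.- ε) b≤a) (proj₂ (h ε ε>0) r hr)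

PhiGe-intro : ∀ {α k a} I → ComponentsAtMost α k I → DensityGe I a → PhiGe α k a
PhiGe-intro {a = a} I c h ε ε>0 = I , c , DensityGe-antimono {I} a-ε≤a h
  where
  a-ε≤a : a ℚ.- ε ℚ.≤ a
  a-ε≤a = subst (a ℚ.- ε ℚ.≤_) (ℚₚ.+-identityʳ a)
    (ℚₚ.+-monoʳ-≤ a (ℚₚ.neg-antimono-≤ (ℚₚ.<⇒≤ (ℚₚ.positive⁻¹ ε {{ε>0}}))))

PhiGe-mono : ∀ {α j k a} → j ≤ k → PhiGe α j a → PhiGe α k a
PhiGe-mono j≤k h ε ε>0 = let I , c , g = h ε ε>0 in
  I , (λ x wx ys u p → ℕₚ.≤-trans (c x wx ys u p) j≤k) , g

maxUpTo-attained : ∀ f k → 1 ≤ k → ∃[ j ] (1 ≤ j × j ≤ k × maxUpTo f k ≡ f j)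
maxUpTo-attained f (suc zero) _ = 1 , s≤s z≤n , s≤s z≤n , refl
maxUpTo-attained f (suc (suc k)) _ with maxUpTo-attained f (suc k) (s≤s z≤n) | ℚₚ.⊔-sel (maxUpTo f (suc k)) (f (suc (suc k)))
... | j , p , q , e | inj₁ r = j , p , ℕₚ.m≤n⇒m≤1+n q , trans r e
... | _ | inj₂ r = suc (suc k) , s≤s z≤n , ℕₚ.≤-refl , r

maxUpTo-upper : ∀ f k {j} → 1 ≤ j → j ≤ k → f j ℚ.≤ maxUpTo f k
maxUpTo-upper f zero 1≤j j≤0 = contradiction (ℕₚ.≤-trans 1≤j j≤0) λ ()
maxUpTo-upper f (suc zero) {suc zero} _ _ = ℚₚ.≤-refl
maxUpTo-upper f (suc zero) {suc (suc j)} _ (s≤s ())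
maxUpTo-upper f (suc (suc k)) 1≤j j≤k =
  [ (λ j<k → ℚₚ.≤-trans (maxUpTo-upper f (suc k) 1≤j (ℕₚ.≤-pred j<k)) (ℚₚ.p≤p⊔q (maxUpTo f (suc k)) (f (suc (suc k)))))
  , (λ { refl → ℚₚ.p≤q⊔p (maxUpTo f (suc k)) (f (suc (suc k))) }) ]′ (ℕₚ.m≤n⇒m<n∨m≡n j≤k)

-- `ceilSqrt m` counts the numbers whose square is below `m`, and under the hypothesis all of them
-- lie below `c`.
ceilSqrt-least : ∀ m c → m ≤ c * c → ceilSqrt m ≤ c
ceilSqrt-least m c h = subst (ceilSqrt m ℕ.≤_) (length-upTo c)
  (length-mono (Uniqueₚ.filter⁺ (λ c → c * c ℕ.<? m) (Uniqueₚ.upTo⁺ m)) sub)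
  where
  sub : ∀ {x} → x ∈ filter (λ c → c * c ℕ.<? m) (upTo m) → x ∈ upTo c
  sub {x} x∈ with ∈-filter⁻ (λ c → c * c ℕ.<? m) {xs = upTo m} x∈
  ... | _ , x²<m = ∈-upTo⁺ (ℕₚ.≰⇒> λ c≤x → ℕₚ.<⇒≱ (ℕₚ.<-≤-trans x²<m h) (ℕₚ.*-mono-≤ c≤x c≤x))

-- Otherwise the `L + 1` numbers up to `L` would all have squares below `m`, although only `L` such
-- numbers are counted.
ceilSqrt-upper : ∀ m → m ≤ ceilSqrt m * ceilSqrt m
ceilSqrt-upper m = ℕₚ.≮⇒≥ λ L²<m → ℕₚ.<⇒≱ (ℕₚ.n<1+n L)
  (subst (ℕ._≤ L) (length-upTo (suc L)) (length-mono (Uniqueₚ.upTo⁺ (suc L)) (sub L²<m)))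
  where
  L : ℕ
  L = ceilSqrt m
  m≤m*m : ∀ x → x ≤ x * x
  m≤m*m zero = z≤n
  m≤m*m (suc x) = ℕₚ.m≤m*n (suc x) (suc x)
  sub : L * L < m → ∀ {x} → x ∈ upTo (suc L) → x ∈ filter (λ c → c * c ℕ.<? m) (upTo m)
  sub L²<m {x} x∈ = ∈-filter⁺ (λ c → c * c ℕ.<? m) (∈-upTo⁺ (ℕₚ.≤-<-trans (m≤m*m x) x²<m)) x²<m
    where
    x≤L : x ≤ L
    x≤L = ℕₚ.≤-pred (∈-upTo⁻ x∈)
    x²<m : x * x < m
    x²<m = ℕₚ.≤-<-trans (ℕₚ.*-mono-≤ x≤L x≤L) L²<m

-- Decomposition into connected components

dist-sym : ∀ α x y → dist α x y ≡ dist α y x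
dist-sym four  (a , b) (c , d) = cong₂ ℕ._+_ (ℤₚ.∣i-j∣≡∣j-i∣ a c) (ℤₚ.∣i-j∣≡∣j-i∣ b d)
dist-sym eight (a , b) (c , d) = cong₂ ℕ._⊔_ (ℤₚ.∣i-j∣≡∣j-i∣ a c) (ℤₚ.∣i-j∣≡∣j-i∣ b d)

dist-refl : ∀ α x → dist α x x ≡ 0
dist-refl four  (a , b) = cong₂ (λ s t → ∣ s ∣ + ∣ t ∣) (ℤₚ.+-inverseʳ a) (ℤₚ.+-inverseʳ b)
dist-refl eight (a , b) = cong₂ (λ s t → ∣ s ∣ ℕ.⊔ ∣ t ∣) (ℤₚ.+-inverseʳ a) (ℤₚ.+-inverseʳ b)

∣i-j∣≡0 : ∀ i j → ∣ i ℤ.- j ∣ ≤ 0 → i ≡ j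
∣i-j∣≡0 i j h = ℤₚ.i-j≡0⇒i≡j i j (ℤₚ.∣i∣≡0⇒i≡0 (ℕₚ.n≤0⇒n≡0 h))

dist≤0 : ∀ α x y → dist α x y ≤ 0 → x ≡ y
dist≤0 four  (a , b) (c , d) h = cong₂ _,_ (∣i-j∣≡0 a c (ℕₚ.m+n≤o⇒m≤o _ h)) (∣i-j∣≡0 b d (ℕₚ.m+n≤o⇒n≤o ∣ a ℤ.- c ∣ h))
dist≤0 eight (a , b) (c , d) h = cong₂ _,_ (∣i-j∣≡0 a c (ℕₚ.m⊔n≤o⇒m≤o _ _ h)) (∣i-j∣≡0 b d (ℕₚ.m⊔n≤o⇒n≤o ∣ a ℤ.- c ∣ _ h))

Near : Conn → Pixel → Pixel → Set
Near α x y = dist α x y ≤ 1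

near? : ∀ α x y → Dec (Near α x y)
near? α x y = dist α x y ℕ.≤? 1

near-refl : ∀ α x → Near α x x
near-refl α x = subst (ℕ._≤ 1) (sym (dist-refl α x)) z≤n

near-sym : ∀ α {x y} → Near α x y → Near α y x
near-sym α {x} {y} = subst (ℕ._≤ 1) (dist-sym α x y)

near-cases : ∀ α x y → Near α x y → x ≡ y ⊎ Adj α x y
near-cases α x y h with ℕₚ.m≤n⇒m<n∨m≡n h
... | inj₁ d<1 = inj₁ (dist≤0 α x y (ℕₚ.≤-pred d<1))
... | inj₂ d≡1 = inj₂ d≡1

path-start : ∀ {I α x y} → WhitePath I α x y → White I x
path-start (here w)     = w
path-start (step w _ _) = w

path-end : ∀ {I α x y} → WhitePath I α x y → White I y
path-end (here w)     = w
path-end (step _ _ p) = path-end p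

path-mono : ∀ {I J α x y} → (∀ {z} → White I z → White J z) → WhitePath I α x y → WhitePath J α x y
path-mono f (here w)     = here (f w)
path-mono f (step w a p) = step (f w) a (path-mono f p)

path-trans : ∀ {I α x y z} → WhitePath I α x y → WhitePath I α y z → WhitePath I α x z
path-trans (here _)     q = q
path-trans (step w a p) q = step w a (path-trans p q)

path-sym : ∀ {I α x y} → WhitePath I α x y → WhitePath I α y x
path-sym (here w) = here w
path-sym {α = α} (step {x} {y} w a p) =
  path-trans (path-sym p) (step (path-start p) (trans (dist-sym α y x) a) (here w))

mem : List Pixel → Image
mem C z = does (z ∈? C)

∈⇒white : ∀ {C z} → z ∈ C → White (mem C) z
∈⇒white {C} {z} z∈ with z ∈? C
... | yes _ = refl
... | no z∉ = contradiction z∈ z∉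

white⇒∈ : ∀ {C z} → White (mem C) z → z ∈ C
white⇒∈ {C} {z} w with z ∈? C
... | yes z∈ = z∈

-- `Near` includes equality, so separated lists are disjoint as well as nonadjacent.
Separated : Conn → List Pixel → List Pixel → Set
Separated α C D = ∀ {z w} → z ∈ C → w ∈ D → ¬ Near α z w

record Cluster (α : Conn) (C : List Pixel) : Set where
  field
    unique    : Unique C
    connected : ∀ {z w} → z ∈ C → w ∈ C → WhitePath (mem C) α z w
    point     : Pixel
    point∈    : point ∈ C

record Components (α : Conn) (L : List Pixel) : Set where
  field
    parts     : List (List Pixel)
    clusters  : ∀ {C} → C ∈ parts → Cluster α C
    separated : AllPairs (Separated α) parts
    covers    : ∀ {z} → z ∈ L → ∃[ C ] (C ∈ parts × z ∈ C)
    inside    : ∀ {C z} → C ∈ parts → z ∈ C → z ∈ L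

AllPairs-lookup : ∀ {A : Set} {R : A → A → Set} {xs} → (∀ {x y} → R x y → R y x) → AllPairs R xs →
                  ∀ {x y} → x ∈ xs → y ∈ xs → x ≡ y ⊎ R x y
AllPairs-lookup R-sym (_ ∷ _)  (Any.here refl) (Any.here refl) = inj₁ refl
AllPairs-lookup R-sym (h ∷ _)  (Any.here refl) (Any.there y∈)  = inj₂ (All.lookup h y∈)
AllPairs-lookup R-sym (h ∷ _)  (Any.there x∈)  (Any.here refl) = inj₂ (R-sym (All.lookup h x∈))
AllPairs-lookup R-sym (_ ∷ hs) (Any.there x∈)  (Any.there y∈)  = AllPairs-lookup R-sym hs x∈ y∈

separated-sym : ∀ {α C D} → Separated α C D → Separated α D C
separated-sym {α} s z∈ w∈ n = s w∈ z∈ (near-sym α n)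

module _ {α : Conn} where
  Touches : Pixel → List Pixel → Set
  Touches x = Any (Near α x)

  touches? : ∀ x C → Dec (Touches x C)
  touches? x = any? (near? α x)

  -- The new pixel merges all parts that it touches into one. It is the hub of the new part: each of
  -- the others is joined to `x`, and two of them are joined through `x`.
  addPixel : ∀ {L} x → x ∉ L → Components α L → Components α (x ∷ L)
  addPixel {L} x x∉ K = record
    { parts = merged ∷ rest
    ; clusters = λ { (Any.here refl) → cluster ; (Any.there C∈) → clusters (proj₁ (∈rest C∈)) }
    ; separated = All.tabulate (λ D∈ → sep D∈) ∷ AllPairsₚ.filter⁺ apart? separated
    ; covers = cov
    ; inside = λ { (Any.here refl) (Any.here refl) → Any.here refl
                 ; (Any.here refl) (Any.there z∈) → Any.there (let C , z∈C , C∈ = ∈-concat⁻′ touching z∈ in inside (proj₁ (∈touching C∈)) z∈C)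
                 ; (Any.there C∈) z∈ → Any.there (inside (proj₁ (∈rest C∈)) z∈) }
    }
    where
    open Components K
    apart? : ∀ C → Dec (¬ Touches x C)
    apart? C = ¬? (touches? x C)
    touching rest : List (List Pixel)
    touching = filter (touches? x) parts
    rest = filter apart? parts
    merged : List Pixel
    merged = x ∷ concat touching
    ∈touching : ∀ {C} → C ∈ touching → C ∈ parts × Touches x C
    ∈touching = ∈-filter⁻ (touches? x)
    ∈rest : ∀ {C} → C ∈ rest → C ∈ parts × ¬ Touches x C
    ∈rest = ∈-filter⁻ apart?
    sep : ∀ {D} → D ∈ rest → Separated α merged D
    sep D∈ (Any.here refl) w∈ n = proj₂ (∈rest D∈) (lose w∈ n)
    sep D∈ (Any.there z∈) w∈ n with ∈-concat⁻′ touching z∈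
    ... | C , z∈C , C∈ with AllPairs-lookup (separated-sym {α}) separated (proj₁ (∈touching C∈)) (proj₁ (∈rest D∈))
    ...   | inj₁ refl = proj₂ (∈rest D∈) (proj₂ (∈touching C∈))
    ...   | inj₂ s = s z∈C w∈ n
    sub : ∀ {C} → C ∈ touching → ∀ {z} → White (mem C) z → White (mem merged) z
    sub C∈ w = ∈⇒white {merged} (Any.there (∈-concat⁺′ (white⇒∈ w) C∈))
    fromHub : ∀ {z} → z ∈ merged → WhitePath (mem merged) α x z
    fromHub (Any.here refl) = here (∈⇒white {merged} (Any.here refl))
    fromHub {z} (Any.there z∈) with ∈-concat⁻′ touching z∈
    ... | C , z∈C , C∈ with find (proj₂ (∈touching C∈))
    ...   | w , w∈C , n with path-mono (sub C∈) (Cluster.connected (clusters (proj₁ (∈touching C∈))) w∈C z∈C) | near-cases α x w n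
    ...     | p | inj₁ refl = p
    ...     | p | inj₂ a = step (∈⇒white {merged} (Any.here refl)) a p
    cluster : Cluster α merged
    cluster = record
      { unique = All.tabulate x≢ ∷ Uniqueₚ.concat⁺ (All.tabulate (λ C∈ → Cluster.unique (clusters (proj₁ (∈touching C∈)))))
                 (AllPairs.map (λ s {z} (p , q) → s p q (near-refl α z)) (AllPairsₚ.filter⁺ (touches? x) separated))
      ; connected = λ z∈ w∈ → path-trans (path-sym (fromHub z∈)) (fromHub w∈)
      ; point = x ; point∈ = Any.here refl }
      where
      x≢ : ∀ {z} → z ∈ concat touching → x ≢ z
      x≢ z∈ refl = let C , z∈C , C∈ = ∈-concat⁻′ touching z∈ in x∉ (inside (proj₁ (∈touching C∈)) z∈C)
    cov : ∀ {z} → z ∈ x ∷ L → ∃[ C ] (C ∈ merged ∷ rest × z ∈ C)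
    cov (Any.here refl) = merged , Any.here refl , Any.here refl
    cov (Any.there z∈) with covers z∈
    ... | C , C∈ , z∈C with touches? x C
    ...   | yes t = merged , Any.here refl , Any.there (∈-concat⁺′ z∈C (∈-filter⁺ (touches? x) C∈ t))
    ...   | no ¬t = C , Any.there (∈-filter⁺ apart? C∈ ¬t) , z∈C

  components : ∀ L → Unique L → Components α L
  components [] _ = record { parts = [] ; clusters = λ () ; separated = [] ; covers = λ () ; inside = λ () }
  components (x ∷ L) (x∉ ∷ u) = addPixel x (λ x∈ → All.lookup x∉ x∈ refl) (components L u)

module ComponentsProperties {α : Conn} {L : List Pixel} (K : Components α L) where
  open Components K

  same-part : ∀ {C D z w} → C ∈ parts → D ∈ parts → z ∈ C → w ∈ D → Near α z w → C ≡ D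
  same-part C∈ D∈ z∈ w∈ n with AllPairs-lookup (separated-sym {α}) separated C∈ D∈
  ... | inj₁ e = e
  ... | inj₂ s = contradiction n (s z∈ w∈)

  absorbs : ∀ {C z w} → C ∈ parts → z ∈ C → w ∈ L → Near α z w → w ∈ C
  absorbs C∈ z∈ w∈ n = let D , D∈ , w∈D = covers w∈ in subst (_ ∈_) (sym (same-part C∈ D∈ z∈ w∈D n)) w∈D

  length≤∑ : Unique L → length L ≤ ∑ parts length
  length≤∑ u = subst (length L ℕ.≤_) (length-concat parts)
    (length-mono u λ z∈ → let C , C∈ , z∈C = covers z∈ in ∈-concat⁺′ z∈C C∈)

  ∑-member≤1 : ∀ z → ∑ parts (λ C → 𝟙 (z ∈? C)) ≤ 1
  ∑-member≤1 z = ∑𝟙≤1 (z ∈?_) (AllPairs.map (λ s (p , q) → s p q (near-refl α z)) separated)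

  ∑-member≤ : ∀ z → ∑ parts (λ C → 𝟙 (z ∈? C)) ≤ 𝟙 (z ∈? L)
  ∑-member≤ z with z ∈? L
  ... | yes _ = ∑-member≤1 z
  ... | no z∉ = ℕₚ.≤-reflexive (∑𝟙≡0 (z ∈?_) (λ C∈ z∈C → z∉ (inside C∈ z∈C)))

  -- The part may be only a piece of a component of `I`, cut off by the box, but its own paths are
  -- paths of `I`, so the size bound for `I` applies to it.
  bounded : ∀ {I k} → ComponentsAtMost α k I → (∀ {z} → z ∈ L → White I z) → ∀ {C} → C ∈ parts → length C ≤ k
  bounded {I} h L⊆I {C} C∈ = h point (w point∈) C unique (All.tabulate λ z∈ → path-mono (w ∘ white⇒∈) (connected point∈ z∈))
    where
    open Cluster (clusters C∈)
    w : ∀ {z} → z ∈ C → White I z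
    w = L⊆I ∘ inside C∈

-- Squares with corners in the pixel lattice, and the squares met by a finite set of pixels

abs≤ : ∀ {i n} → ℤ.- + n ℤ.≤ i → i ℤ.≤ + n → ∣ i ∣ ≤ n
abs≤ {+ m}       _ (ℤ.+≤+ h) = h
abs≤ { -[1+ m ]} {suc n} (ℤ.-≤- h) _ = s≤s h

abs≤⁻ : ∀ {i n} → ∣ i ∣ ≤ n → (ℤ.- + n ℤ.≤ i) × (i ℤ.≤ + n)
abs≤⁻ {+ m} {n} h = ℤₚ.≤-trans (ℤₚ.neg-mono-≤ (ℤ.+≤+ (z≤n {n}))) (ℤ.+≤+ z≤n) , ℤ.+≤+ h
abs≤⁻ { -[1+ m ]} {suc n} (s≤s h) = ℤ.-≤- h , ℤ.-≤+

record InBox (r : ℕ) (z : Pixel) : Set where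
  constructor inBox
  field
    xlo : ℤ.- + r ℤ.≤ proj₁ z
    xhi : proj₁ z ℤ.≤ + r
    ylo : ℤ.- + r ℤ.≤ proj₂ z
    yhi : proj₂ z ℤ.≤ + r

range-unique : ∀ r → Unique (range r)
range-unique r = Uniqueₚ.map⁺ inj (Uniqueₚ.upTo⁺ (suc (2 * r)))
  where
  inj : ∀ {i j} → + i ℤ.- + r ≡ + j ℤ.- + r → i ≡ j
  inj {i} {j} e = linarith (i ∷ j ∷ r ∷ [] ∣ᵉ []) (ι 0 ⊖ ι 2 ≐ᶻ ι 1 ⊖ ι 2 ∷ []) (ν 0 ≐ ν 1) (e , tt)

length-range : ∀ r → length (range r) ≡ 2 * r + 1
length-range r = trans (length-map _ (upTo (suc (2 * r))))
  (trans (length-upTo (suc (2 * r))) (ℕₚ.+-comm 1 (2 * r)))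

nonneg-witness : ∀ i → 0ℤ ℤ.≤ i → ∃[ n ] i ≡ + n
nonneg-witness (+ n) _ = n , refl

∈-range⁺ : ∀ {r a} → ℤ.- + r ℤ.≤ a → a ℤ.≤ + r → a ∈ range r
∈-range⁺ {r} {a} lo hi = go (nonneg-witness (a ℤ.+ + r) (shifted lo))
  where
  shifted : ℤ.- + r ℤ.≤ a → 0ℤ ℤ.≤ a ℤ.+ + r
  shifted lo = linarith (r ∷ [] ∣ᵉ a ∷ []) (⊟ ι 0 ≼ᶻ ζ 0 ∷ []) (κᶻ 0 ≼ᶻ ζ 0 ⊞ ι 0) (lo , tt)
  index< : ∀ i → a ℤ.+ + r ≡ + i → a ℤ.≤ + r → i < suc (2 * r)
  index< i e hi = linarith (i ∷ r ∷ [] ∣ᵉ a ∷ []) (ζ 0 ⊞ ι 1 ≐ᶻ ι 0 ∷ ζ 0 ≼ᶻ ι 1 ∷ []) (κ 1 ⊕ ν 0 ≼ κ 1 ⊕ κ 2 ⊗ ν 1) (e , hi , tt)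
  value : ∀ i → a ℤ.+ + r ≡ + i → + i ℤ.- + r ≡ a
  value i e = linarith (i ∷ r ∷ [] ∣ᵉ a ∷ []) (ζ 0 ⊞ ι 1 ≐ᶻ ι 0 ∷ []) (ι 0 ⊖ ι 1 ≐ᶻ ζ 0) (e , tt)
  go : ∃[ i ] a ℤ.+ + r ≡ + i → a ∈ range r
  go (i , e) = subst (λ t → t ∈ range r) (value i e) (∈-map⁺ (λ i → + i ℤ.- + r) (∈-upTo⁺ (index< i e hi)))

∈-range⁻ : ∀ {r a} → a ∈ range r → (ℤ.- + r ℤ.≤ a) × (a ℤ.≤ + r)
∈-range⁻ {r} a∈ with ∈-map⁻ (λ i → + i ℤ.- + r) a∈
... | i , i∈ , refl = bounds i (∈-upTo⁻ i∈)
  where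
  bounds : ∀ i → i < suc (2 * r) → (ℤ.- + r ℤ.≤ + i ℤ.- + r) × (+ i ℤ.- + r ℤ.≤ + r)
  bounds i h = (linarith (r ∷ i ∷ [] ∣ᵉ []) [] (⊟ ι 0 ≼ᶻ ι 1 ⊖ ι 0) tt) , (linarith (i ∷ r ∷ [] ∣ᵉ []) (κ 1 ⊕ ν 0 ≼ κ 1 ⊕ κ 2 ⊗ ν 1 ∷ []) (ι 0 ⊖ ι 1 ≼ᶻ ι 1) (h , tt))

box-unique : ∀ r → Unique (box r)
box-unique r = concatMap-unique (λ a → map (λ b → (a , b)) (range r)) (range-unique r)
  (λ a → Uniqueₚ.map⁺ (cong proj₂) (range-unique r))
  λ _ _ p q → trans (sym (first p)) (first q)
  where
  first : ∀ {a z} → z ∈ map (λ b → (a , b)) (range r) → proj₁ z ≡ a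
  first {a} p with ∈-map⁻ (λ b → (a , b)) p
  ... | _ , _ , refl = refl

∈-box⁺ : ∀ {r z} → InBox r z → z ∈ box r
∈-box⁺ {r} {a , b} (inBox p q s t) =
  ∈-concat⁺′ (∈-map⁺ (λ b → (a , b)) (∈-range⁺ {r} s t)) (∈-map⁺ (λ a → map (λ b → (a , b)) (range r)) (∈-range⁺ {r} p q))

∈-box⁻ : ∀ {r z} → z ∈ box r → InBox r z
∈-box⁻ {r} {a , b} z∈ with ∈-concat⁻′ (map (λ a → map (λ b → (a , b)) (range r)) (range r)) z∈
... | row , z∈row , row∈ with ∈-map⁻ (λ a → map (λ b → (a , b)) (range r)) row∈
...   | a′ , a∈ , refl with ∈-map⁻ (λ b → (a′ , b)) z∈row
...     | b′ , b∈ , refl = inBox (proj₁ (∈-range⁻ {r} a∈)) (proj₂ (∈-range⁻ {r} a∈)) (proj₁ (∈-range⁻ {r} b∈)) (proj₂ (∈-range⁻ {r} b∈))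

length-box : ∀ r → length (box r) ≡ (2 * r + 1) * (2 * r + 1)
length-box r = trans (length-concat (map row (range r))) (trans (∑-map row length (range r))
  (trans (∑-cong (range r) λ a → trans (length-map (a ,_) (range r)) (length-range r))
  (trans (∑-const (2 * r + 1) (range r)) (cong ((2 * r + 1) ℕ.*_) (length-range r)))))
  where
  row : ℤ → List Pixel
  row a = map (λ b → (a , b)) (range r)

white? : ∀ I z → Dec (White I z)
white? I z = I z Bool.≟ true

whites : Image → ℕ → List Pixel
whites I r = filter (white? I) (box r)

countTrue-filter : ∀ I zs → countTrue (map I zs) ≡ length (filter (white? I) zs)
countTrue-filter I [] = refl
countTrue-filter I (z ∷ zs) with I z
... | true  = cong suc (countTrue-filter I zs)
... | false = countTrue-filter I zs

whites-unique : ∀ I r → Unique (whites I r)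
whites-unique I r = Uniqueₚ.filter⁺ (white? I) (box-unique r)

-- Extending a finite set of pixels by one step along lines

record Translation : Set where
  field
    fwd back  : Pixel → Pixel
    fwd-back  : ∀ z → fwd (back z) ≡ z
    back-fwd  : ∀ z → back (fwd z) ≡ z

i-j+j≡i : ∀ i j → i ℤ.- j ℤ.+ j ≡ i
i-j+j≡i = solve-∀

i+j-j≡i : ∀ i j → i ℤ.+ j ℤ.- j ≡ i
i+j-j≡i = solve-∀

translation : ℤ → ℤ → Translation
translation a b = record
  { fwd = λ (x , y) → x ℤ.+ a , y ℤ.+ b
  ; back = λ (x , y) → x ℤ.- a , y ℤ.- b
  ; fwd-back = λ (x , y) → cong₂ _,_ (i-j+j≡i x a) (i-j+j≡i y b)
  ; back-fwd = λ (x , y) → cong₂ _,_ (i+j-j≡i x a) (i+j-j≡i y b) }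

-- `extension` is the union of `C` and its translate by one step back, that is, the set of `z` with
-- `z` or `fwd z` in `C`. The new pixels precede the `starts`, the pixels of `C` whose predecessor
-- lies outside.
module Extension (τ : Translation) (C : List Pixel) where
  open Translation τ

  starts : List Pixel
  starts = filter (λ z → ¬? (back z ∈? C)) C

  extension : List Pixel
  extension = C ++ map back starts

  extension-unique : Unique C → Unique extension
  extension-unique u = Uniqueₚ.++⁺ u
    (Uniqueₚ.map⁺ (λ {z} {w} e → trans (sym (fwd-back z)) (trans (cong fwd e) (fwd-back w))) (Uniqueₚ.filter⁺ _ u))
    λ {z} (p , q) → new p q
    where
    new : ∀ {z} → z ∈ C → z ∉ map back starts
    new z∈ q with ∈-map⁻ back q
    ... | w , w∈ , refl = proj₂ (∈-filter⁻ (λ z → ¬? (back z ∈? C)) {xs = C} w∈) z∈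

  ∈-extension⁻ : ∀ {z} → z ∈ extension → z ∈ C ⊎ fwd z ∈ C
  ∈-extension⁻ z∈ with ∈-++⁻ C z∈
  ... | inj₁ p = inj₁ p
  ... | inj₂ q with ∈-map⁻ back q
  ...   | w , w∈ , refl = inj₂ (subst (_∈ C) (sym (fwd-back w)) (proj₁ (∈-filter⁻ (λ z → ¬? (back z ∈? C)) {xs = C} w∈)))

  ∈-extension⁺ : ∀ {z} → z ∈ C → z ∈ extension
  ∈-extension⁺ = ∈-++⁺ˡ

  back∈extension : ∀ {z} → z ∈ C → back z ∈ extension
  back∈extension {z} z∈ with back z ∈? C
  ... | yes p = ∈-++⁺ˡ p
  ... | no q = ∈-++⁺ʳ C (∈-map⁺ back (∈-filter⁺ (λ z → ¬? (back z ∈? C)) z∈ q))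

  -- Going back from a pixel of C along its line, one leaves C after finitely many steps.
  module _ (μ : Pixel → ℤ) (μ-back : ∀ z → μ (back z) ≡ μ z ℤ.- 1ℤ) (lo : ℤ) (lo≤ : ∀ {z} → z ∈ C → lo ℤ.≤ μ z)
           {B : Set} (key : Pixel → B) (key-back : ∀ z → key (back z) ≡ key z) where

    above : ∀ a b n → a ℤ.- b ≡ + n → a ℤ.≤ b ℤ.+ + n
    above a b n e = linarith (n ∷ [] ∣ᵉ a ∷ b ∷ []) (ζ 0 ⊖ ζ 1 ≐ᶻ ι 0 ∷ []) (ζ 0 ≼ᶻ ζ 1 ⊞ ι 0) (e , tt)

    below : ∀ a b → a ℤ.≤ b ℤ.+ 0ℤ → ¬ b ℤ.≤ a ℤ.- 1ℤ
    below a b h h′ = linarith ([] ∣ᵉ a ∷ b ∷ []) (ζ 0 ≼ᶻ ζ 1 ⊞ κᶻ 0 ∷ ζ 1 ≼ᶻ ζ 0 ⊖ κᶻ 1 ∷ []) falsum (h , h′ , tt)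

    further : ∀ a b n → a ℤ.≤ b ℤ.+ + suc n → a ℤ.- 1ℤ ℤ.≤ b ℤ.+ + n
    further a b n h = linarith (n ∷ [] ∣ᵉ a ∷ b ∷ []) (ζ 0 ≼ᶻ ζ 1 ⊞ ⌞ κ 1 ⊕ ν 0 ⌟ ∷ []) (ζ 0 ⊖ κᶻ 1 ≼ᶻ ζ 1 ⊞ ι 0) (h , tt)

    Start : Pixel → Set
    Start z = ∃[ s ] (s ∈ starts × key s ≡ key z)

    start-of-line : ∀ n {z} → z ∈ C → μ z ℤ.≤ lo ℤ.+ + n → Dec (back z ∈ C) → Start z
    start-of-line n       {z} z∈ h (no q)  = z , ∈-filter⁺ (λ z → ¬? (back z ∈? C)) z∈ q , refl
    start-of-line zero    {z} z∈ h (yes p) = contradiction (subst (lo ℤ.≤_) (μ-back z) (lo≤ p)) (below (μ z) lo h)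
    start-of-line (suc n) {z} z∈ h (yes p) = s , s∈ , trans e (key-back z)
      where
      earlier : Start (back z)
      earlier = start-of-line n p (subst (ℤ._≤ lo ℤ.+ + n) (sym (μ-back z)) (further (μ z) lo n h)) (back (back z) ∈? C)
      s = proj₁ earlier
      s∈ = proj₁ (proj₂ earlier)
      e = proj₂ (proj₂ earlier)

    -- `key` is constant along each line and every line meeting `C` has a start, so distinct keys
    -- give distinct starts and each of these adds a pixel.
    length-extension : ∀ {ks} → Unique ks → (∀ {k} → k ∈ ks → ∃[ z ] (z ∈ C × key z ≡ k)) →
                       length C + length ks ≤ length extension
    length-extension {ks} u h = subst (length C + length ks ℕ.≤_) (sym (length-++ C))
      (ℕₚ.+-monoʳ-≤ (length C) (subst (length ks ℕ.≤_)
        (trans (length-map key starts) (sym (length-map back starts)))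
        (length-mono u sub)))
      where
      started : ∀ {z} → z ∈ C → ∃[ n ] μ z ℤ.- lo ≡ + n → Start z
      started {z} z∈ (n , e) = start-of-line n z∈ (above (μ z) lo n e) (back z ∈? C)
      covered : ∀ {z} → Start z → key z ∈ map key starts
      covered (s , s∈ , e) = subst (λ t → t ∈ map key starts) e (∈-map⁺ key s∈)
      sub : ∀ {k} → k ∈ ks → k ∈ map key starts
      sub k∈ = let z , z∈ , e = h k∈ in
        subst (λ t → t ∈ map key starts) e (covered (started z∈ (nonneg-witness (μ z ℤ.- lo) (ℤₚ.i≤j⇒0≤j-i (lo≤ z∈)))))

argmin : ∀ (μ : Pixel → ℤ) {C p} → p ∈ C → ∃[ m ] (m ∈ C × (∀ {z} → z ∈ C → μ m ℤ.≤ μ z))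
argmin μ {c ∷ []} _ = c , Any.here refl , λ { (Any.here refl) → ℤₚ.≤-refl }
argmin μ {c ∷ d ∷ C} _ with argmin μ {d ∷ C} (Any.here refl)
... | m , m∈ , h with ℤₚ.≤-total (μ c) (μ m)
...   | inj₁ c≤m = c , Any.here refl , λ { (Any.here refl) → ℤₚ.≤-refl ; (Any.there z∈) → ℤₚ.≤-trans c≤m (h z∈) }
...   | inj₂ m≤c = m , Any.there m∈ , λ { (Any.here refl) → m≤c ; (Any.there z∈) → h z∈ }

e₁ e₂ e₁₂ : Pixel → Pixel
e₁  (x , y) = x ℤ.+ 1ℤ , y
e₂  (x , y) = x , y ℤ.+ 1ℤ
e₁₂ (x , y) = x ℤ.+ 1ℤ , y ℤ.+ 1ℤ

length-cartesianProduct : ∀ {A B : Set} (xs : List A) (ys : List B) →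
  length (cartesianProduct xs ys) ≡ length xs * length ys
length-cartesianProduct []       ys = refl
length-cartesianProduct (x ∷ xs) ys = trans (length-++ (map (x ,_) ys))
  (cong₂ ℕ._+_ (length-map (x ,_) ys) (length-cartesianProduct xs ys))

right up diag antidiag : Translation
right = record
  { fwd = e₁ ; back = λ (x , y) → x ℤ.- 1ℤ , y
  ; fwd-back = λ (x , y) → cong (_, y) (i-j+j≡i x 1ℤ) ; back-fwd = λ (x , y) → cong (_, y) (i+j-j≡i x 1ℤ) }
up = record
  { fwd = e₂ ; back = λ (x , y) → x , y ℤ.- 1ℤ
  ; fwd-back = λ (x , y) → cong (x ,_) (i-j+j≡i y 1ℤ) ; back-fwd = λ (x , y) → cong (x ,_) (i+j-j≡i y 1ℤ) }
diag = translation 1ℤ 1ℤ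
antidiag = translation 1ℤ (ℤ.- 1ℤ)

-- With the larger number written as `m + d`, the difference of the sides is `d²`, a product of
-- naturals whose sign `linarith` knows.
4mn≤[m+n]² : ∀ m n → 4 * (m * n) ≤ (m + n) * (m + n)
4mn≤[m+n]² m n = [ (λ h → below m n h) , (λ h → subst₂ (λ s t → 4 * s ≤ t * t) (ℕₚ.*-comm n m) (ℕₚ.+-comm n m) (below n m h)) ]′ (ℕₚ.≤-total m n)
  where
  alg : ∀ m d → 4 * (m * (m + d)) ≤ (m + (m + d)) * (m + (m + d))
  alg m d = linarith (m ∷ d ∷ [] ∣ᵉ []) [] (κ 4 ⊗ (ν 0 ⊗ (ν 0 ⊕ ν 1)) ≼ (ν 0 ⊕ (ν 0 ⊕ ν 1)) ⊗ (ν 0 ⊕ (ν 0 ⊕ ν 1))) tt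
  below : ∀ m n → m ≤ n → 4 * (m * n) ≤ (m + n) * (m + n)
  below m n h = subst (λ t → 4 * (m * t) ≤ (m + t) * (m + t)) (ℕₚ.m+[n∸m]≡n h) (alg m (n ∸ m))

-- Squares met by an 8-component, and the upper bound for 8-connectivity

corners : Pixel → List Pixel
corners z = z ∷ e₁ z ∷ e₂ z ∷ e₁₂ z ∷ []

corner-bounds : ∀ {z p} → p ∈ corners z →
  (proj₁ z ℤ.≤ proj₁ p × proj₁ p ℤ.≤ proj₁ z ℤ.+ 1ℤ) × (proj₂ z ℤ.≤ proj₂ p × proj₂ p ℤ.≤ proj₂ z ℤ.+ 1ℤ)
corner-bounds {x , y} p∈ = go p∈
  where
  up≤ : ∀ a → a ℤ.≤ a ℤ.+ 1ℤ
  up≤ a = linarith ([] ∣ᵉ a ∷ []) [] (ζ 0 ≼ᶻ ζ 0 ⊞ κᶻ 1) tt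
  eq≤ : ∀ {a : ℤ} → a ℤ.≤ a
  eq≤ = ℤₚ.≤-refl
  go : ∀ {p} → p ∈ corners (x , y) →
    (x ℤ.≤ proj₁ p × proj₁ p ℤ.≤ x ℤ.+ 1ℤ) × (y ℤ.≤ proj₂ p × proj₂ p ℤ.≤ y ℤ.+ 1ℤ)
  go (Any.here refl) = (eq≤ , up≤ x) , (eq≤ , up≤ y)
  go (Any.there (Any.here refl)) = (up≤ x , eq≤) , (eq≤ , up≤ y)
  go (Any.there (Any.there (Any.here refl))) = (eq≤ , up≤ x) , (up≤ y , eq≤)
  go (Any.there (Any.there (Any.there (Any.here refl)))) = (up≤ x , eq≤) , (up≤ y , eq≤)

corners-near : ∀ {z p q} → p ∈ corners z → q ∈ corners z → Near eight p q
corners-near {z} {p} {q} p∈ q∈ with corner-bounds {z} p∈ | corner-bounds {z} q∈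
... | (a , b) , (c , d) | (a′ , b′) , (c′ , d′) = ℕₚ.⊔-lub (close (proj₁ z) _ _ a b a′ b′) (close (proj₂ z) _ _ c d c′ d′)
  where
  lower : ∀ t s s′ → t ℤ.≤ s → s′ ℤ.≤ t ℤ.+ 1ℤ → ℤ.- 1ℤ ℤ.≤ s ℤ.- s′
  lower t s s′ h h′ = linarith ([] ∣ᵉ s ∷ s′ ∷ t ∷ []) (ζ 2 ≼ᶻ ζ 0 ∷ ζ 1 ≼ᶻ ζ 2 ⊞ κᶻ 1 ∷ []) (⊟ κᶻ 1 ≼ᶻ ζ 0 ⊖ ζ 1) (h , h′ , tt)
  upper : ∀ t s s′ → s ℤ.≤ t ℤ.+ 1ℤ → t ℤ.≤ s′ → s ℤ.- s′ ℤ.≤ 1ℤ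
  upper t s s′ h h′ = linarith ([] ∣ᵉ s ∷ s′ ∷ t ∷ []) (ζ 0 ≼ᶻ ζ 2 ⊞ κᶻ 1 ∷ ζ 2 ≼ᶻ ζ 1 ∷ []) (ζ 0 ⊖ ζ 1 ≼ᶻ κᶻ 1) (h , h′ , tt)
  close : ∀ t s s′ → t ℤ.≤ s → s ℤ.≤ t ℤ.+ 1ℤ → t ℤ.≤ s′ → s′ ℤ.≤ t ℤ.+ 1ℤ → ∣ s ℤ.- s′ ∣ ≤ 1
  close t s s′ a b a′ b′ = abs≤ (lower t s s′ a b′) (upper t s s′ b a′)

corner-in-box : ∀ {r R z p} → p ∈ corners z → suc r ≤ R → InBox r p → InBox R z
corner-in-box {r} {R} {z} {p} p∈ r<R (inBox a b c d) with corner-bounds {z} p∈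
... | (x≤ , ≤x) , (y≤ , ≤y) = inBox (lo (proj₁ z) (proj₁ p) a ≤x) (hi (proj₁ z) (proj₁ p) b x≤) (lo (proj₂ z) (proj₂ p) c ≤y) (hi (proj₂ z) (proj₂ p) d y≤)
  where
  lo : ∀ t s → ℤ.- + r ℤ.≤ s → s ℤ.≤ t ℤ.+ 1ℤ → ℤ.- + R ℤ.≤ t
  lo t s h h′ = linarith (R ∷ r ∷ [] ∣ᵉ t ∷ s ∷ [])
    (⊟ ι 1 ≼ᶻ ζ 1 ∷ ζ 1 ≼ᶻ ζ 0 ⊞ κᶻ 1 ∷ κ 1 ⊕ ν 1 ≼ ν 0 ∷ []) (⊟ ι 0 ≼ᶻ ζ 0) (h , h′ , r<R , tt)
  hi : ∀ t s → s ℤ.≤ + r → t ℤ.≤ s → t ℤ.≤ + R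
  hi t s h h′ = linarith (R ∷ r ∷ [] ∣ᵉ t ∷ s ∷ [])
    (ζ 1 ≼ᶻ ι 1 ∷ ζ 0 ≼ᶻ ζ 1 ∷ κ 1 ⊕ ν 1 ≼ ν 0 ∷ []) (ζ 0 ≼ᶻ ι 0) (h , h′ , r<R , tt)

Meets : List Pixel → List Pixel → Set
Meets C ps = Any (_∈ C) ps

meets? : ∀ C ps → Dec (Meets C ps)
meets? C = any? (_∈? C)

squares₈ : List Pixel → Pixel → ℕ
squares₈ C z = 𝟙 (meets? C (corners z))

module _ {C : List Pixel} (cluster : Cluster eight C) where
  open Cluster cluster

  private
    xs ys : List ℤ
    xs = deduplicate ℤ._≟_ (map proj₁ C)
    ys = deduplicate ℤ._≟_ (map proj₂ C)
    module H = Extension right C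
    D : List Pixel
    D = H.extension
    module V = Extension up D

    ∈xs⁻ : ∀ {x} → x ∈ xs → ∃[ z ] (z ∈ C × proj₁ z ≡ x)
    ∈xs⁻ x∈ with ∈-map⁻ proj₁ (∈-deduplicate⁻ ℤ._≟_ (map proj₁ C) x∈)
    ... | z , z∈ , e = z , z∈ , sym e

    ∈ys⁻ : ∀ {y} → y ∈ ys → ∃[ z ] (z ∈ C × proj₂ z ≡ y)
    ∈ys⁻ y∈ with ∈-map⁻ proj₂ (∈-deduplicate⁻ ℤ._≟_ (map proj₂ C) y∈)
    ... | z , z∈ , e = z , z∈ , sym e

    leftmost = argmin proj₁ point∈
    m₀ : Pixel
    m₀ = proj₁ leftmost
    x₀ : ℤ
    x₀ = proj₁ m₀

    -- Extending one step to the left adds a pixel in each row.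
    rows : length C + length ys ≤ length D
    rows = H.length-extension proj₁ (λ _ → refl) x₀ (proj₂ (proj₂ leftmost)) proj₂ (λ _ → refl)
      (UniqueDecₚ.deduplicate-! ℤ._≟_ (map proj₂ C)) ∈ys⁻

    -- Extending `D` downwards adds a pixel in each of its columns. `D` has one column more than
    -- `C`, to the left of the leftmost pixel; this column is the `+ 1` in the bound.
    columns : length D + suc (length xs) ≤ length V.extension
    columns = V.length-extension proj₂ (λ _ → refl) (proj₂ (proj₁ lowest)) (proj₂ (proj₂ lowest)) proj₁ (λ _ → refl)
      {x₀ ℤ.- 1ℤ ∷ xs} (All.tabulate new ∷ UniqueDecₚ.deduplicate-! ℤ._≟_ (map proj₁ C)) attained
      where
      lowest = argmin proj₂ (H.∈-extension⁺ point∈)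
      before : ∀ a b → a ≡ b → b ℤ.≤ a ℤ.- 1ℤ → ⊥
      before a b e h = linarith ([] ∣ᵉ a ∷ b ∷ []) (ζ 0 ≐ᶻ ζ 1 ∷ ζ 1 ≼ᶻ ζ 0 ⊖ κᶻ 1 ∷ []) falsum (e , h , tt)
      new : ∀ {x} → x ∈ xs → x₀ ℤ.- 1ℤ ≢ x
      new x∈ refl = let z , z∈ , e = ∈xs⁻ x∈ in before x₀ x₀ refl (subst (x₀ ℤ.≤_) e (proj₂ (proj₂ leftmost) z∈))
      attained : ∀ {x} → x ∈ x₀ ℤ.- 1ℤ ∷ xs → ∃[ z ] (z ∈ D × proj₁ z ≡ x)
      attained (Any.here refl) = _ , H.back∈extension (proj₁ (proj₂ leftmost)) , refl
      attained (Any.there x∈) = let z , z∈ , e = ∈xs⁻ x∈ in z , H.∈-extension⁺ z∈ , e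

    area : length C ≤ length xs * length ys
    area = subst (length C ℕ.≤_) (length-cartesianProduct xs ys)
      (length-mono unique λ z∈ → ∈-cartesianProduct⁺ (∈-deduplicate⁺ ℤ._≟_ (∈-map⁺ proj₁ z∈)) (∈-deduplicate⁺ ℤ._≟_ (∈-map⁺ proj₂ z∈)))

    perimeter : ceilSqrt (4 * length C) ≤ length xs + length ys
    perimeter = ceilSqrt-least _ _ (ℕₚ.≤-trans (ℕₚ.*-monoʳ-≤ 4 area) (4mn≤[m+n]² (length xs) (length ys)))

    total : ∀ c p q s d e → c + q ≤ d → d + suc p ≤ e → s ≤ p + q → c + s + 1 ≤ e
    total c p q s d e h h′ h″ = linarith (c ∷ s ∷ e ∷ q ∷ d ∷ p ∷ [] ∣ᵉ [])
      (ν 0 ⊕ ν 3 ≼ ν 4 ∷ ν 4 ⊕ (κ 1 ⊕ ν 5) ≼ ν 2 ∷ ν 1 ≼ ν 5 ⊕ ν 3 ∷ []) (ν 0 ⊕ ν 1 ⊕ κ 1 ≼ ν 2) (h , h′ , h″ , tt)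

    meets : ∀ {z} → z ∈ V.extension → Meets C (corners z)
    meets z∈ with V.∈-extension⁻ z∈
    ... | inj₁ z∈D = [ Any.here , Any.there ∘ Any.here ]′ (H.∈-extension⁻ z∈D)
    ... | inj₂ u∈D = Any.there (Any.there ([ Any.here , Any.there ∘ Any.here ]′ (H.∈-extension⁻ u∈D)))

  -- Squares are named by their lower left corners, and `V.extension` consists of such corners of
  -- squares that `C` meets. They may lie one step outside the box of `C`, hence `R > r`.
  cluster-squares₈ : ∀ {r R} → (∀ {z} → z ∈ C → InBox r z) → suc r ≤ R →
                     length C + ceilSqrt (4 * length C) + 1 ≤ ∑ (box R) (squares₈ C)
  cluster-squares₈ {r} {R} C⊆ r<R = ℕₚ.≤-trans
    (total (length C) (length xs) (length ys) _ (length D) (length V.extension) rows columns perimeter)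
    (≤∑𝟙 (λ z → meets? C (corners z)) (V.extension-unique (H.extension-unique unique)) inside)
    where
    inside : ∀ {z} → z ∈ V.extension → z ∈ box R × Meets C (corners z)
    inside {z} z∈ = let m = meets z∈ ; p , p∈ , p∈C = find m in ∈-box⁺ (corner-in-box {z = z} p∈ r<R (C⊆ p∈C)) , m

∑-length≤ : ∀ (parts : List (List Pixel)) A p (f : List Pixel → ℕ) →
            (∀ {C} → C ∈ parts → length C * A ≤ p * f C) → ∑ parts length * A ≤ p * ∑ parts f
∑-length≤ parts A p f h = subst₂ ℕ._≤_
  (trans (∑-* A length parts) (ℕₚ.*-comm A _)) (∑-* p f parts)
  (∑-mono parts λ {C} C∈ → subst (ℕ._≤ p * f C) (ℕₚ.*-comm (length C) A) (h C∈))

-- Any two corners of a square are 8-near, so separated parts cannot both meet it.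
squares₈≤1 : ∀ {L} (K : Components eight L) z → ∑ (Components.parts K) (λ C → squares₈ C z) ≤ 1
squares₈≤1 K z = ∑𝟙≤1 (λ C → meets? C (corners z)) (AllPairs.map disjoint (Components.separated K))
  where
  disjoint : ∀ {C D} → Separated eight C D → ¬ (Meets C (corners z) × Meets D (corners z))
  disjoint s (m , n) = let p , p∈ , p∈C = find m ; q , q∈ , q∈D = find n in s p∈C q∈D (corners-near {z} p∈ q∈)

module _ (I : Image) (r : ℕ) where
  ∈-whites : ∀ {z} → z ∈ whites I r → InBox r z × White I z
  ∈-whites z∈ = let p , q = ∈-filter⁻ (white? I) {xs = box r} z∈ in ∈-box⁻ p , q

  W≤∑ : ∀ {α} (K : Components α (whites I r)) → W I r ≤ ∑ (Components.parts K) length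
  W≤∑ K = subst (ℕ._≤ _) (sym (countTrue-filter I (box r))) (ComponentsProperties.length≤∑ K (whites-unique I r))

upper-bound₈ : ∀ k j d → 1 ≤ d →
  (∀ i → 1 ≤ i → i ≤ k → i * d ≤ j * (i + ceilSqrt (4 * i) + 1)) →
  PhiLe eight k (frac j d)
-- The squares lie in the box of radius `r + 1`, whose side is larger by 2.
upper-bound₈ k j d 1≤d h I comps = density-upper I j d 2 1≤d bound
  where
  bound : ∀ r → W I r * d ≤ j * ((2 * r + 1 + 2) * (2 * r + 1 + 2))
  bound r = ℕₚ.≤-trans (ℕₚ.*-monoˡ-≤ d (W≤∑ I r K)) (ℕₚ.≤-trans (∑-length≤ parts d j tok each) (ℕₚ.*-monoʳ-≤ j tokens))
    where
    K : Components eight (whites I r)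
    K = components (whites I r) (whites-unique I r)
    open Components K
    tok : List Pixel → ℕ
    tok C = ∑ (box (suc r)) (squares₈ C)
    each : ∀ {C} → C ∈ parts → length C * d ≤ j * tok C
    each {C} C∈ = ℕₚ.≤-trans
      (h (length C) (nonempty (Cluster.point∈ (clusters C∈))) (ComponentsProperties.bounded K comps (proj₂ ∘ ∈-whites I r) C∈))
      (ℕₚ.*-monoʳ-≤ j (cluster-squares₈ (clusters C∈) (proj₁ ∘ ∈-whites I r ∘ inside C∈) ℕₚ.≤-refl))
      where
      nonempty : ∀ {z : Pixel} {C} → z ∈ C → 1 ≤ length C
      nonempty (Any.here _) = s≤s z≤n
      nonempty (Any.there _) = s≤s z≤n
    widen : ∀ r → 2 * suc r + 1 ≡ 2 * r + 1 + 2
    widen r = linarith (r ∷ [] ∣ᵉ []) [] (κ 2 ⊗ (κ 1 ⊕ ν 0) ⊕ κ 1 ≐ κ 2 ⊗ ν 0 ⊕ κ 1 ⊕ κ 2) tt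
    tokens : ∑ parts tok ≤ (2 * r + 1 + 2) * (2 * r + 1 + 2)
    tokens = subst₂ ℕ._≤_ (sym (∑-swap squares₈ parts (box (suc r))))
      (trans (∑-const 1 (box (suc r))) (trans (ℕₚ.*-identityˡ _) (trans (length-box (suc r)) (cong₂ ℕ._*_ (widen r) (widen r)))))
      (∑-mono (box (suc r)) λ {z} _ → squares₈≤1 K z)

-- Diagonal coordinates: every step of a 4-path changes both by one.

u v : Pixel → ℤ
u (x , y) = x ℤ.+ y
v (x , y) = x ℤ.- y

Step : ℤ → ℤ → Set
Step a b = (a ℤ.≤ b ℤ.+ 1ℤ) × (b ℤ.≤ a ℤ.+ 1ℤ)

∣i-j∣+≤1 : ∀ a b c d → ∣ a ℤ.- c ∣ + ∣ b ℤ.- d ∣ ≤ 1 →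
           (a ≡ c × Step b d) ⊎ (b ≡ d × Step a c)
∣i-j∣+≤1 a b c d h with ∣ a ℤ.- c ∣ ℕ.≤? 0
... | yes h₀ = inj₁ (∣i-j∣≡0 a c h₀ , step′ b d (abs≤⁻ (ℕₚ.m+n≤o⇒n≤o ∣ a ℤ.- c ∣ h)))
  where
  step′ : ∀ s t → (ℤ.- 1ℤ ℤ.≤ s ℤ.- t) × (s ℤ.- t ℤ.≤ 1ℤ) → Step s t
  step′ s t (p , q) = (linarith ([] ∣ᵉ s ∷ t ∷ []) (ζ 0 ⊖ ζ 1 ≼ᶻ κᶻ 1 ∷ []) (ζ 0 ≼ᶻ ζ 1 ⊞ κᶻ 1) (q , tt)) , (linarith ([] ∣ᵉ t ∷ s ∷ []) (⊟ κᶻ 1 ≼ᶻ ζ 1 ⊖ ζ 0 ∷ []) (ζ 0 ≼ᶻ ζ 1 ⊞ κᶻ 1) (p , tt))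
... | no h₀ = inj₂ (∣i-j∣≡0 b d (rest _ _ (ℕₚ.≰⇒> h₀) h) , step′ a c (abs≤⁻ (ℕₚ.m+n≤o⇒m≤o _ h)))
  where
  rest : ∀ m n → 1 ≤ m → m + n ≤ 1 → n ≤ 0
  rest m n p q = linarith (n ∷ m ∷ [] ∣ᵉ []) (κ 1 ≼ ν 1 ∷ ν 1 ⊕ ν 0 ≼ κ 1 ∷ []) (ν 0 ≼ κ 0) (p , q , tt)
  step′ : ∀ s t → (ℤ.- 1ℤ ℤ.≤ s ℤ.- t) × (s ℤ.- t ℤ.≤ 1ℤ) → Step s t
  step′ s t (p , q) = (linarith ([] ∣ᵉ s ∷ t ∷ []) (ζ 0 ⊖ ζ 1 ≼ᶻ κᶻ 1 ∷ []) (ζ 0 ≼ᶻ ζ 1 ⊞ κᶻ 1) (q , tt)) , (linarith ([] ∣ᵉ t ∷ s ∷ []) (⊟ κᶻ 1 ≼ᶻ ζ 1 ⊖ ζ 0 ∷ []) (ζ 0 ≼ᶻ ζ 1 ⊞ κᶻ 1) (p , tt))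

near-u : ∀ {z w} → Near four z w → Step (u z) (u w)
near-u {a , b} {c , d} h = [ (λ (p , q) → vert a b c d p q) , (λ (p , q) → horiz a b c d p q) ]′ (∣i-j∣+≤1 a b c d h)
  where
  vert : ∀ a b c d → a ≡ c → Step b d → Step (a ℤ.+ b) (c ℤ.+ d)
  vert a b c d e (p , q) = (linarith ([] ∣ᵉ a ∷ b ∷ c ∷ d ∷ []) (ζ 0 ≐ᶻ ζ 2 ∷ ζ 1 ≼ᶻ ζ 3 ⊞ κᶻ 1 ∷ []) (ζ 0 ⊞ ζ 1 ≼ᶻ ζ 2 ⊞ ζ 3 ⊞ κᶻ 1) (e , p , tt)) , (linarith ([] ∣ᵉ c ∷ d ∷ a ∷ b ∷ []) (ζ 2 ≐ᶻ ζ 0 ∷ ζ 1 ≼ᶻ ζ 3 ⊞ κᶻ 1 ∷ []) (ζ 0 ⊞ ζ 1 ≼ᶻ ζ 2 ⊞ ζ 3 ⊞ κᶻ 1) (e , q , tt))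
  horiz : ∀ a b c d → b ≡ d → Step a c → Step (a ℤ.+ b) (c ℤ.+ d)
  horiz a b c d e (p , q) = (linarith ([] ∣ᵉ a ∷ b ∷ c ∷ d ∷ []) (ζ 1 ≐ᶻ ζ 3 ∷ ζ 0 ≼ᶻ ζ 2 ⊞ κᶻ 1 ∷ []) (ζ 0 ⊞ ζ 1 ≼ᶻ ζ 2 ⊞ ζ 3 ⊞ κᶻ 1) (e , p , tt)) , (linarith ([] ∣ᵉ c ∷ d ∷ a ∷ b ∷ []) (ζ 3 ≐ᶻ ζ 1 ∷ ζ 0 ≼ᶻ ζ 2 ⊞ κᶻ 1 ∷ []) (ζ 0 ⊞ ζ 1 ≼ᶻ ζ 2 ⊞ ζ 3 ⊞ κᶻ 1) (e , q , tt))

near-v : ∀ {z w} → Near four z w → Step (v z) (v w)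
near-v {a , b} {c , d} h = [ (λ (p , q) → vert a b c d p q) , (λ (p , q) → horiz a b c d p q) ]′ (∣i-j∣+≤1 a b c d h)
  where
  vert : ∀ a b c d → a ≡ c → Step b d → Step (a ℤ.- b) (c ℤ.- d)
  vert a b c d e (p , q) = (linarith ([] ∣ᵉ a ∷ b ∷ c ∷ d ∷ []) (ζ 0 ≐ᶻ ζ 2 ∷ ζ 3 ≼ᶻ ζ 1 ⊞ κᶻ 1 ∷ []) (ζ 0 ⊖ ζ 1 ≼ᶻ ζ 2 ⊖ ζ 3 ⊞ κᶻ 1) (e , q , tt)) , (linarith ([] ∣ᵉ c ∷ d ∷ a ∷ b ∷ []) (ζ 2 ≐ᶻ ζ 0 ∷ ζ 3 ≼ᶻ ζ 1 ⊞ κᶻ 1 ∷ []) (ζ 0 ⊖ ζ 1 ≼ᶻ ζ 2 ⊖ ζ 3 ⊞ κᶻ 1) (e , p , tt))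
  horiz : ∀ a b c d → b ≡ d → Step a c → Step (a ℤ.- b) (c ℤ.- d)
  horiz a b c d e (p , q) = (linarith ([] ∣ᵉ a ∷ b ∷ c ∷ d ∷ []) (ζ 1 ≐ᶻ ζ 3 ∷ ζ 0 ≼ᶻ ζ 2 ⊞ κᶻ 1 ∷ []) (ζ 0 ⊖ ζ 1 ≼ᶻ ζ 2 ⊖ ζ 3 ⊞ κᶻ 1) (e , p , tt)) , (linarith ([] ∣ᵉ c ∷ d ∷ a ∷ b ∷ []) (ζ 3 ≐ᶻ ζ 1 ∷ ζ 0 ≼ᶻ ζ 2 ⊞ κᶻ 1 ∷ []) (ζ 0 ⊖ ζ 1 ≼ᶻ ζ 2 ⊖ ζ 3 ⊞ κᶻ 1) (e , q , tt))

adj⇒near : ∀ α {z w} → Adj α z w → Near α z w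
adj⇒near α = ℕₚ.≤-reflexive

-- A discrete intermediate value theorem. It makes the values of `u`, and those of `v`, on a
-- 4-component an interval, which is recorded as `Extent`.
path-attains : ∀ (key : Pixel → ℤ) → (∀ {z w} → Near four z w → Step (key z) (key w)) →
               ∀ {C z w} → WhitePath (mem C) four z w → ∀ g → key z ℤ.≤ g → g ℤ.≤ key w → ∃[ p ] (p ∈ C × key p ≡ g)
path-attains key st (here {z} wz) g lo hi = z , white⇒∈ wz , ℤₚ.≤-antisym lo hi
path-attains key st (step {x} {y} wx a p) g lo hi with key x ℤ.≟ g
... | yes e = x , white⇒∈ wx , e
... | no ne = path-attains key st p g (next (key x) (key y) g (proj₂ (st (adj⇒near four {x} {y} a))) (ℤₚ.≤∧≢⇒< lo ne)) hi
  where
  next : ∀ a b g → b ℤ.≤ a ℤ.+ 1ℤ → a ℤ.< g → b ℤ.≤ g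
  next a b g h h′ = linarith ([] ∣ᵉ b ∷ g ∷ a ∷ []) (ζ 0 ≼ᶻ ζ 2 ⊞ κᶻ 1 ∷ ζ 2 ≺ᶻ ζ 1 ∷ []) (ζ 0 ≼ᶻ ζ 1) (h , h′ , tt)

record Extent (key : Pixel → ℤ) (C : List Pixel) : Set where
  field
    lo       : ℤ
    len      : ℕ
    positive : 1 ≤ len
    lower    : ∀ {z} → z ∈ C → lo ℤ.≤ key z
    upper    : ∀ {z} → z ∈ C → key z ℤ.< lo ℤ.+ + len
    attained : ∀ g → lo ℤ.≤ g → g ℤ.< lo ℤ.+ + len → ∃[ z ] (z ∈ C × key z ≡ g)

  values : List ℤ
  values = map (λ i → lo ℤ.+ + i) (upTo len)

  values-unique : Unique values
  values-unique = Uniqueₚ.map⁺ (λ {i} {j} → inj lo i j) (Uniqueₚ.upTo⁺ len)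
    where
    inj : ∀ a i j → a ℤ.+ + i ≡ a ℤ.+ + j → i ≡ j
    inj a i j e = linarith (i ∷ j ∷ [] ∣ᵉ a ∷ []) (ζ 0 ⊞ ι 0 ≐ᶻ ζ 0 ⊞ ι 1 ∷ []) (ν 0 ≐ ν 1) (e , tt)

  length-values : length values ≡ len
  length-values = trans (length-map _ (upTo len)) (length-upTo len)

  values-attained : ∀ {g} → g ∈ values → ∃[ z ] (z ∈ C × key z ≡ g)
  values-attained g∈ with ∈-map⁻ (λ i → lo ℤ.+ + i) g∈
  ... | i , i∈ , refl = attained (lo ℤ.+ + i) (≤+ lo i) (+< lo i len (∈-upTo⁻ i∈))
    where
    ≤+ : ∀ a i → a ℤ.≤ a ℤ.+ + i
    ≤+ a i = linarith (i ∷ [] ∣ᵉ a ∷ []) [] (ζ 0 ≼ᶻ ζ 0 ⊞ ι 0) tt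
    +< : ∀ a i n → i < n → a ℤ.+ + i ℤ.< a ℤ.+ + n
    +< a i n h = linarith (i ∷ n ∷ [] ∣ᵉ a ∷ []) (κ 1 ⊕ ν 0 ≼ ν 1 ∷ []) (ζ 0 ⊞ ι 0 ≺ᶻ ζ 0 ⊞ ι 1) (h , tt)

extent : ∀ (key : Pixel → ℤ) → (∀ {z w} → Near four z w → Step (key z) (key w)) →
         ∀ {C} → Cluster four C → Extent key C
extent key st {C} cluster = make (nonneg-witness (key q ℤ.- key p) (ℤₚ.i≤j⇒0≤j-i (p≤ q∈)))
  where
  open Cluster cluster
  minimum = argmin key point∈
  maximum = argmin (λ z → ℤ.- key z) point∈
  p q : Pixel
  p = proj₁ minimum
  q = proj₁ maximum
  p∈ = proj₁ (proj₂ minimum)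
  q∈ = proj₁ (proj₂ maximum)
  p≤ : ∀ {z} → z ∈ C → key p ℤ.≤ key z
  p≤ = proj₂ (proj₂ minimum)
  ≤q : ∀ {z} → z ∈ C → key z ℤ.≤ key q
  ≤q z∈ = ℤₚ.neg-cancel-≤ (proj₂ (proj₂ maximum) z∈)
  top : ∀ a b c n → b ℤ.- a ≡ + n → c ℤ.≤ b → c ℤ.< a ℤ.+ + suc n
  top a b c n e h = linarith (n ∷ [] ∣ᵉ c ∷ a ∷ b ∷ [])
    (ζ 2 ⊖ ζ 1 ≐ᶻ ι 0 ∷ ζ 0 ≼ᶻ ζ 2 ∷ []) (ζ 0 ≺ᶻ ζ 1 ⊞ ⌞ κ 1 ⊕ ν 0 ⌟) (e , h , tt)
  untop : ∀ a b c n → b ℤ.- a ≡ + n → c ℤ.< a ℤ.+ + suc n → c ℤ.≤ b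
  untop a b c n e h = linarith (n ∷ [] ∣ᵉ c ∷ b ∷ a ∷ [])
    (ζ 1 ⊖ ζ 2 ≐ᶻ ι 0 ∷ ζ 0 ≺ᶻ ζ 2 ⊞ ⌞ κ 1 ⊕ ν 0 ⌟ ∷ []) (ζ 0 ≼ᶻ ζ 1) (e , h , tt)
  make : ∃[ n ] key q ℤ.- key p ≡ + n → Extent key C
  make (n , e) = record
    { lo = key p ; len = suc n ; positive = s≤s z≤n
    ; lower = p≤ ; upper = λ z∈ → top (key p) (key q) _ n e (≤q z∈)
    ; attained = λ g h h′ → path-attains key st (connected p∈ q∈) g h (untop (key p) (key q) g n e h′) }

-- The pixels with u₀ ≤ u < u₀ + U and v₀ ≤ v < v₀ + V.
record DiagRect : Set where
  constructor diagRect
  field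
    u₀ v₀ : ℤ
    U V   : ℕ

record _∈ᴿ_ (z : Pixel) (R : DiagRect) : Set where
  constructor inRect
  open DiagRect R
  field
    ulo : u₀ ℤ.≤ u z
    uhi : u z ℤ.< u₀ ℤ.+ + U
    vlo : v₀ ℤ.≤ v z
    vhi : v z ℤ.< v₀ ℤ.+ + V

-- Here `n` is the number of consecutive values of `v` available on a line of constant `u`. Only
-- every second value belongs to a pixel, hence the recursion by two.
diagonal : ℕ → Pixel → List Pixel
diagonal zero          _ = []
diagonal (suc zero)    p = p ∷ []
diagonal (suc (suc n)) (x , y) = (x , y) ∷ diagonal n (x ℤ.+ 1ℤ , y ℤ.- 1ℤ)

∈-diagonal : ∀ n {x y} i → 2 * i < n → (x ℤ.+ + i , y ℤ.- + i) ∈ diagonal n (x , y)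
∈-diagonal (suc zero) {x} {y} zero _ = Any.here (cong₂ _,_ (ℤₚ.+-identityʳ x) (ℤₚ.+-identityʳ y))
∈-diagonal (suc zero) (suc i) h = ⊥-elim (absurd i h)
  where
  absurd : ∀ i → 2 * suc i < 1 → ⊥
  absurd i h = linarith (i ∷ [] ∣ᵉ []) (κ 1 ⊕ κ 2 ⊗ (κ 1 ⊕ ν 0) ≼ κ 1 ∷ []) falsum (h , tt)
∈-diagonal (suc (suc n)) {x} {y} zero _ = Any.here (cong₂ _,_ (ℤₚ.+-identityʳ x) (ℤₚ.+-identityʳ y))
∈-diagonal (suc (suc n)) {x} {y} (suc i) h = Any.there
  (subst (λ t → t ∈ diagonal n (x ℤ.+ 1ℤ , y ℤ.- 1ℤ)) (cong₂ _,_ (shift⁺ x i) (shift⁻ y i)) (∈-diagonal n i (smaller i n h)))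
  where
  shift⁺ : ∀ x i → x ℤ.+ 1ℤ ℤ.+ + i ≡ x ℤ.+ + suc i
  shift⁺ x i = linarith (i ∷ [] ∣ᵉ x ∷ []) [] (ζ 0 ⊞ κᶻ 1 ⊞ ι 0 ≐ᶻ ζ 0 ⊞ ⌞ κ 1 ⊕ ν 0 ⌟) tt
  shift⁻ : ∀ y i → y ℤ.- 1ℤ ℤ.- + i ≡ y ℤ.- + suc i
  shift⁻ y i = linarith (i ∷ [] ∣ᵉ y ∷ []) [] (ζ 0 ⊖ κᶻ 1 ⊖ ι 0 ≐ᶻ ζ 0 ⊖ ⌞ κ 1 ⊕ ν 0 ⌟) tt
  smaller : ∀ i n → 2 * suc i < suc (suc n) → 2 * i < n
  smaller i n h = linarith (i ∷ n ∷ [] ∣ᵉ []) (κ 1 ⊕ κ 2 ⊗ (κ 1 ⊕ ν 0) ≼ κ 1 ⊕ (κ 1 ⊕ ν 1) ∷ []) (κ 1 ⊕ κ 2 ⊗ ν 0 ≼ ν 1) (h , tt)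

-- Consecutive diagonals start alternately at v₀ (short = false) and at v₀ + 1 (short = true).
diagonals : Bool → ℕ → ℕ → Pixel → List Pixel
diagonals _     zero    V _ = []
diagonals false (suc U) V (x , y) = diagonal V (x , y) ++ diagonals true U V (x ℤ.+ 1ℤ , y)
diagonals true  (suc U) V (x , y) = diagonal (V ∸ 1) (x , y) ++ diagonals false U V (x , y ℤ.+ 1ℤ)

-- This is `n / 2` rounded up.
half : ℕ → ℕ
half zero          = 0
half (suc zero)    = 1
half (suc (suc n)) = suc (half n)

length-diagonal≡ : ∀ n p → length (diagonal n p) ≡ half n
length-diagonal≡ zero p = refl
length-diagonal≡ (suc zero) p = refl
length-diagonal≡ (suc (suc n)) (x , y) = cong suc (length-diagonal≡ n (x ℤ.+ 1ℤ , y ℤ.- 1ℤ))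

half+half : ∀ n → half n + half (n ∸ 1) ≡ n
half+half zero = refl
half+half (suc n) = trans (ℕₚ.+-comm (half (suc n)) (half n)) (go n)
  where
  go : ∀ n → half n + half (suc n) ≡ suc n
  go zero = refl
  go (suc n) = trans (ℕₚ.+-suc (half (suc n)) (half n)) (cong suc (trans (ℕₚ.+-comm (half (suc n)) (half n)) (go n)))

half-mono : ∀ n → half (n ∸ 1) ≤ half n
half-mono zero = z≤n
half-mono (suc zero) = z≤n
half-mono (suc (suc zero)) = ℕₚ.≤-refl
half-mono (suc (suc (suc n))) = s≤s (half-mono (suc n))

half≤ : ∀ n → 2 * half n ≤ n + 1
half≤ zero = z≤n
half≤ (suc zero) = ℕₚ.≤-refl
half≤ (suc (suc n)) = arith (half n) n (half≤ n)
  where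
  arith : ∀ l n → 2 * l ≤ n + 1 → 2 * suc l ≤ suc (suc n) + 1
  arith l n h = linarith (l ∷ n ∷ [] ∣ᵉ []) (κ 2 ⊗ ν 0 ≼ ν 1 ⊕ κ 1 ∷ []) (κ 2 ⊗ (κ 1 ⊕ ν 0) ≼ κ 1 ⊕ (κ 1 ⊕ ν 1) ⊕ κ 1) (h , tt)

length-diagonal-++ : ∀ n p zs → length (diagonal n p ++ zs) ≡ half n + length zs
length-diagonal-++ n p zs = trans (length-++ (diagonal n p)) (cong (ℕ._+ length zs) (length-diagonal≡ n p))

-- Two consecutive diagonals contain `V` pixels together. When `U` is odd, one diagonal with at most
-- `(V + 1) / 2` pixels is left over, which accounts for the `+ 1`.
length-diagonals : ∀ b U V p → 2 * length (diagonals b U V p) ≤ U * V + 1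
length-diagonals b zero V p = z≤n
length-diagonals false (suc zero) V (x , y) = subst (λ t → 2 * t ≤ 1 * V + 1)
  (sym (length-diagonal-++ V (x , y) [])) (one (half V) V (half≤ V))
  where
  one : ∀ a V → 2 * a ≤ V + 1 → 2 * (a + 0) ≤ 1 * V + 1
  one a V h = linarith (a ∷ V ∷ [] ∣ᵉ []) (κ 2 ⊗ ν 0 ≼ ν 1 ⊕ κ 1 ∷ []) (κ 2 ⊗ (ν 0 ⊕ κ 0) ≼ κ 1 ⊗ ν 1 ⊕ κ 1) (h , tt)
length-diagonals true (suc zero) V (x , y) = subst (λ t → 2 * t ≤ 1 * V + 1)
  (sym (length-diagonal-++ (V ∸ 1) (x , y) [])) (one (half V) (half (V ∸ 1)) V (half≤ V) (half-mono V))
  where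
  one : ∀ a b V → 2 * a ≤ V + 1 → b ≤ a → 2 * (b + 0) ≤ 1 * V + 1
  one a b V h h′ = linarith (b ∷ V ∷ a ∷ [] ∣ᵉ [])
    (κ 2 ⊗ ν 2 ≼ ν 1 ⊕ κ 1 ∷ ν 0 ≼ ν 2 ∷ []) (κ 2 ⊗ (ν 0 ⊕ κ 0) ≼ κ 1 ⊗ ν 1 ⊕ κ 1) (h , h′ , tt)
length-diagonals false (suc (suc U)) V (x , y) = subst (λ t → 2 * t ≤ suc (suc U) * V + 1)
  (sym (trans (length-diagonal-++ V (x , y) _) (cong (half V ℕ.+_) (length-diagonal-++ (V ∸ 1) (x ℤ.+ 1ℤ , y) _))))
  (step₂ (half V) (half (V ∸ 1)) V _ (U * V) (half+half V) (length-diagonals false U V (x ℤ.+ 1ℤ , y ℤ.+ 1ℤ)))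
  where
  step₂ : ∀ a b V l m → a + b ≡ V → 2 * l ≤ m + 1 → 2 * (a + (b + l)) ≤ V + (V + m) + 1
  step₂ a b V l m e h = linarith (a ∷ b ∷ l ∷ V ∷ m ∷ [] ∣ᵉ [])
    (ν 0 ⊕ ν 1 ≐ ν 3 ∷ κ 2 ⊗ ν 2 ≼ ν 4 ⊕ κ 1 ∷ []) (κ 2 ⊗ (ν 0 ⊕ (ν 1 ⊕ ν 2)) ≼ ν 3 ⊕ (ν 3 ⊕ ν 4) ⊕ κ 1) (e , h , tt)
length-diagonals true (suc (suc U)) V (x , y) = subst (λ t → 2 * t ≤ suc (suc U) * V + 1)
  (sym (trans (length-diagonal-++ (V ∸ 1) (x , y) _) (cong (half (V ∸ 1) ℕ.+_) (length-diagonal-++ V (x , y ℤ.+ 1ℤ) _))))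
  (step₂ (half V) (half (V ∸ 1)) V _ (U * V) (half+half V) (length-diagonals true U V (x ℤ.+ 1ℤ , y ℤ.+ 1ℤ)))
  where
  step₂ : ∀ a b V l m → a + b ≡ V → 2 * l ≤ m + 1 → 2 * (b + (a + l)) ≤ V + (V + m) + 1
  step₂ a b V l m e h = linarith (b ∷ a ∷ l ∷ V ∷ m ∷ [] ∣ᵉ [])
    (ν 1 ⊕ ν 0 ≐ ν 3 ∷ κ 2 ⊗ ν 2 ≼ ν 4 ⊕ κ 1 ∷ []) (κ 2 ⊗ (ν 0 ⊕ (ν 1 ⊕ ν 2)) ≼ ν 3 ⊕ (ν 3 ⊕ ν 4) ⊕ κ 1) (e , h , tt)

-- The distance in `v` from the edge `v₀` of the rectangle to the first pixel of the current
-- diagonal.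
offset : Bool → ℤ
offset false = 0ℤ
offset true  = 1ℤ

∈-line : ∀ n {x y z} → u z ≡ x ℤ.+ y → x ℤ.≤ proj₁ z → v z ℤ.< x ℤ.- y ℤ.+ + n → z ∈ diagonal n (x , y)
∈-line n {x} {y} {a , b} e h h′ = go (nonneg-witness (a ℤ.- x) (ℤₚ.i≤j⇒0≤j-i h))
  where
  xeq : ∀ i → a ℤ.- x ≡ + i → x ℤ.+ + i ≡ a
  xeq i p = linarith (i ∷ [] ∣ᵉ x ∷ a ∷ []) (ζ 1 ⊖ ζ 0 ≐ᶻ ι 0 ∷ []) (ζ 0 ⊞ ι 0 ≐ᶻ ζ 1) (p , tt)
  yeq : ∀ i → a ℤ.- x ≡ + i → a ℤ.+ b ≡ x ℤ.+ y → y ℤ.- + i ≡ b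
  yeq i p e = linarith (i ∷ [] ∣ᵉ y ∷ b ∷ a ∷ x ∷ [])
    (ζ 2 ⊖ ζ 3 ≐ᶻ ι 0 ∷ ζ 2 ⊞ ζ 1 ≐ᶻ ζ 3 ⊞ ζ 0 ∷ []) (ζ 0 ⊖ ι 0 ≐ᶻ ζ 1) (p , e , tt)
  small : ∀ i → a ℤ.- x ≡ + i → a ℤ.+ b ≡ x ℤ.+ y → a ℤ.- b ℤ.< x ℤ.- y ℤ.+ + n → 2 * i < n
  small i p e h = linarith (i ∷ n ∷ [] ∣ᵉ a ∷ x ∷ b ∷ y ∷ [])
    (ζ 0 ⊖ ζ 1 ≐ᶻ ι 0 ∷ ζ 0 ⊞ ζ 2 ≐ᶻ ζ 1 ⊞ ζ 3 ∷ ζ 0 ⊖ ζ 2 ≺ᶻ ζ 1 ⊖ ζ 3 ⊞ ι 1 ∷ []) (κ 1 ⊕ κ 2 ⊗ ν 0 ≼ ν 1)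
    (p , e , h , tt)
  go : ∃[ i ] a ℤ.- x ≡ + i → (a , b) ∈ diagonal n (x , y)
  go (i , p) = subst (λ t → t ∈ diagonal n (x , y)) (cong₂ _,_ (xeq i p) (yeq i p e)) (∈-diagonal n i (small i p e h′))

∈-diagonals : ∀ b U V {x y z} → x ℤ.+ y ℤ.≤ u z → u z ℤ.< x ℤ.+ y ℤ.+ + U →
              x ℤ.- y ℤ.- offset b ℤ.≤ v z → v z ℤ.< x ℤ.- y ℤ.- offset b ℤ.+ + V → z ∈ diagonals b U V (x , y)
∈-diagonals b zero V {x} {y} {z} h₁ h₂ _ _ = ⊥-elim (absurd (x ℤ.+ y) (u z) h₁ h₂)
  where
  absurd : ∀ s t → s ℤ.≤ t → ¬ t ℤ.< s ℤ.+ 0ℤ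
  absurd s t h h′ = linarith ([] ∣ᵉ s ∷ t ∷ []) (ζ 0 ≼ᶻ ζ 1 ∷ ζ 1 ≺ᶻ ζ 0 ⊞ κᶻ 0 ∷ []) falsum (h , h′ , tt)
∈-diagonals false (suc U) V {x} {y} {z@(a , b)} h₁ h₂ h₃ h₄ with u z ℤ.≟ x ℤ.+ y
... | yes e = ∈-++⁺ˡ (∈-line V e (left a b x y e h₃) (bound (a ℤ.- b) (x ℤ.- y) h₄))
  where
  left : ∀ a b x y → a ℤ.+ b ≡ x ℤ.+ y → x ℤ.- y ℤ.- 0ℤ ℤ.≤ a ℤ.- b → x ℤ.≤ a
  left a b x y e h = linarith ([] ∣ᵉ x ∷ a ∷ b ∷ y ∷ [])
    (ζ 1 ⊞ ζ 2 ≐ᶻ ζ 0 ⊞ ζ 3 ∷ ζ 0 ⊖ ζ 3 ⊖ κᶻ 0 ≼ᶻ ζ 1 ⊖ ζ 2 ∷ []) (ζ 0 ≼ᶻ ζ 1) (e , h , tt)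
  bound : ∀ s t → s ℤ.< t ℤ.- 0ℤ ℤ.+ + V → s ℤ.< t ℤ.+ + V
  bound s t h = linarith (V ∷ [] ∣ᵉ s ∷ t ∷ []) (ζ 0 ≺ᶻ ζ 1 ⊖ κᶻ 0 ⊞ ι 0 ∷ []) (ζ 0 ≺ᶻ ζ 1 ⊞ ι 0) (h , tt)
... | no ne = ∈-++⁺ʳ (diagonal V (x , y)) (∈-diagonals true U V
      (lo (a ℤ.+ b) x y (ℤₚ.≤∧≢⇒< h₁ (ne ∘ sym))) (hi (a ℤ.+ b) x y h₂) (vlo (a ℤ.- b) x y h₃) (vhi (a ℤ.- b) x y h₄))
  where
  lo : ∀ s x y → x ℤ.+ y ℤ.< s → x ℤ.+ 1ℤ ℤ.+ y ℤ.≤ s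
  lo s x y h = linarith ([] ∣ᵉ x ∷ y ∷ s ∷ []) (ζ 0 ⊞ ζ 1 ≺ᶻ ζ 2 ∷ []) (ζ 0 ⊞ κᶻ 1 ⊞ ζ 1 ≼ᶻ ζ 2) (h , tt)
  hi : ∀ s x y → s ℤ.< x ℤ.+ y ℤ.+ + suc U → s ℤ.< x ℤ.+ 1ℤ ℤ.+ y ℤ.+ + U
  hi s x y h = linarith (U ∷ [] ∣ᵉ s ∷ x ∷ y ∷ [])
    (ζ 0 ≺ᶻ ζ 1 ⊞ ζ 2 ⊞ ⌞ κ 1 ⊕ ν 0 ⌟ ∷ []) (ζ 0 ≺ᶻ ζ 1 ⊞ κᶻ 1 ⊞ ζ 2 ⊞ ι 0) (h , tt)
  vlo : ∀ s x y → x ℤ.- y ℤ.- 0ℤ ℤ.≤ s → x ℤ.+ 1ℤ ℤ.- y ℤ.- 1ℤ ℤ.≤ s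
  vlo s x y h = linarith ([] ∣ᵉ x ∷ y ∷ s ∷ []) (ζ 0 ⊖ ζ 1 ⊖ κᶻ 0 ≼ᶻ ζ 2 ∷ []) (ζ 0 ⊞ κᶻ 1 ⊖ ζ 1 ⊖ κᶻ 1 ≼ᶻ ζ 2) (h , tt)
  vhi : ∀ s x y → s ℤ.< x ℤ.- y ℤ.- 0ℤ ℤ.+ + V → s ℤ.< x ℤ.+ 1ℤ ℤ.- y ℤ.- 1ℤ ℤ.+ + V
  vhi s x y h = linarith (V ∷ [] ∣ᵉ s ∷ x ∷ y ∷ [])
    (ζ 0 ≺ᶻ ζ 1 ⊖ ζ 2 ⊖ κᶻ 0 ⊞ ι 0 ∷ []) (ζ 0 ≺ᶻ ζ 1 ⊞ κᶻ 1 ⊖ ζ 2 ⊖ κᶻ 1 ⊞ ι 0) (h , tt)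
∈-diagonals true (suc U) V {x} {y} {z@(a , b)} h₁ h₂ h₃ h₄ with u z ℤ.≟ x ℤ.+ y
... | yes e = ∈-++⁺ˡ (∈-line (V ∸ 1) e (left a b x y e h₃) (bound V (a ℤ.- b) (x ℤ.- y) (above a b x y e h₃) h₄))
  where
  -- On this diagonal v has the parity of x - y, so it cannot equal x - y - 1.
  left : ∀ a b x y → a ℤ.+ b ≡ x ℤ.+ y → x ℤ.- y ℤ.- 1ℤ ℤ.≤ a ℤ.- b → x ℤ.≤ a
  left a b x y e h = linarith ([] ∣ᵉ x ∷ a ∷ b ∷ y ∷ [])
    (ζ 1 ⊞ ζ 2 ≐ᶻ ζ 0 ⊞ ζ 3 ∷ ζ 0 ⊖ ζ 3 ⊖ κᶻ 1 ≼ᶻ ζ 1 ⊖ ζ 2 ∷ []) (ζ 0 ≼ᶻ ζ 1) (e , h , tt)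
  above : ∀ a b x y → a ℤ.+ b ≡ x ℤ.+ y → x ℤ.- y ℤ.- 1ℤ ℤ.≤ a ℤ.- b → x ℤ.- y ℤ.≤ a ℤ.- b
  above a b x y e h = linarith ([] ∣ᵉ x ∷ y ∷ a ∷ b ∷ [])
    (ζ 2 ⊞ ζ 3 ≐ᶻ ζ 0 ⊞ ζ 1 ∷ ζ 0 ≼ᶻ ζ 2 ∷ []) (ζ 0 ⊖ ζ 1 ≼ᶻ ζ 2 ⊖ ζ 3) (e , left a b x y e h , tt)
  pred< : ∀ V s t → s ℤ.< t ℤ.- 1ℤ ℤ.+ + suc V → s ℤ.< t ℤ.+ + V
  pred< V s t h = linarith (V ∷ [] ∣ᵉ s ∷ t ∷ []) (ζ 0 ≺ᶻ ζ 1 ⊖ κᶻ 1 ⊞ ⌞ κ 1 ⊕ ν 0 ⌟ ∷ []) (ζ 0 ≺ᶻ ζ 1 ⊞ ι 0) (h , tt)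
  bound : ∀ V s t → t ℤ.≤ s → s ℤ.< t ℤ.- 1ℤ ℤ.+ + V → s ℤ.< t ℤ.+ + (V ∸ 1)
  bound zero s t h h′ = linarith (0 ∸ 1 ∷ [] ∣ᵉ s ∷ t ∷ [])
    (ζ 1 ≼ᶻ ζ 0 ∷ ζ 0 ≺ᶻ ζ 1 ⊖ κᶻ 1 ⊞ κᶻ 0 ∷ []) (ζ 0 ≺ᶻ ζ 1 ⊞ ι 0) (h , h′ , tt)
  bound (suc V) s t h h′ = pred< V s t h′
... | no ne = ∈-++⁺ʳ (diagonal (V ∸ 1) (x , y)) (∈-diagonals false U V
      (lo (a ℤ.+ b) x y (ℤₚ.≤∧≢⇒< h₁ (ne ∘ sym))) (hi (a ℤ.+ b) x y h₂) (vlo (a ℤ.- b) x y h₃) (vhi (a ℤ.- b) x y h₄))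
  where
  lo : ∀ s x y → x ℤ.+ y ℤ.< s → x ℤ.+ (y ℤ.+ 1ℤ) ℤ.≤ s
  lo s x y h = linarith ([] ∣ᵉ x ∷ y ∷ s ∷ []) (ζ 0 ⊞ ζ 1 ≺ᶻ ζ 2 ∷ []) (ζ 0 ⊞ (ζ 1 ⊞ κᶻ 1) ≼ᶻ ζ 2) (h , tt)
  hi : ∀ s x y → s ℤ.< x ℤ.+ y ℤ.+ + suc U → s ℤ.< x ℤ.+ (y ℤ.+ 1ℤ) ℤ.+ + U
  hi s x y h = linarith (U ∷ [] ∣ᵉ s ∷ x ∷ y ∷ [])
    (ζ 0 ≺ᶻ ζ 1 ⊞ ζ 2 ⊞ ⌞ κ 1 ⊕ ν 0 ⌟ ∷ []) (ζ 0 ≺ᶻ ζ 1 ⊞ (ζ 2 ⊞ κᶻ 1) ⊞ ι 0) (h , tt)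
  vlo : ∀ s x y → x ℤ.- y ℤ.- 1ℤ ℤ.≤ s → x ℤ.- (y ℤ.+ 1ℤ) ℤ.- 0ℤ ℤ.≤ s
  vlo s x y h = linarith ([] ∣ᵉ x ∷ y ∷ s ∷ []) (ζ 0 ⊖ ζ 1 ⊖ κᶻ 1 ≼ᶻ ζ 2 ∷ []) (ζ 0 ⊖ (ζ 1 ⊞ κᶻ 1) ⊖ κᶻ 0 ≼ᶻ ζ 2) (h , tt)
  vhi : ∀ s x y → s ℤ.< x ℤ.- y ℤ.- 1ℤ ℤ.+ + V → s ℤ.< x ℤ.- (y ℤ.+ 1ℤ) ℤ.- 0ℤ ℤ.+ + V
  vhi s x y h = linarith (V ∷ [] ∣ᵉ s ∷ x ∷ y ∷ [])
    (ζ 0 ≺ᶻ ζ 1 ⊖ ζ 2 ⊖ κᶻ 1 ⊞ ι 0 ∷ []) (ζ 0 ≺ᶻ ζ 1 ⊖ (ζ 2 ⊞ κᶻ 1) ⊖ κᶻ 0 ⊞ ι 0) (h , tt)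

halve : ∀ n → ∃[ k ] (n ≡ + 2 ℤ.* k ⊎ n ≡ + 2 ℤ.* k ℤ.+ 1ℤ)
halve n = n /ℕ 2 , cases (n %ℕ 2) (n%ℕd<d n 2) (a≡a%ℕn+[a/ℕn]*n n 2)
  where
  cases : ∀ {k} m → m < 2 → n ≡ + m ℤ.+ k ℤ.* + 2 → n ≡ + 2 ℤ.* k ⊎ n ≡ + 2 ℤ.* k ℤ.+ 1ℤ
  cases {k} 0 _ e = inj₁ (even n k e)
    where
    even : ∀ n k → n ≡ 0ℤ ℤ.+ k ℤ.* + 2 → n ≡ + 2 ℤ.* k
    even n k e = linarith ([] ∣ᵉ n ∷ k ∷ []) (ζ 0 ≐ᶻ κᶻ 0 ⊞ ζ 1 ⊠ κᶻ 2 ∷ []) (ζ 0 ≐ᶻ κᶻ 2 ⊠ ζ 1) (e , tt)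
  cases {k} 1 _ e = inj₂ (odd n k e)
    where
    odd : ∀ n k → n ≡ 1ℤ ℤ.+ k ℤ.* + 2 → n ≡ + 2 ℤ.* k ℤ.+ 1ℤ
    odd n k e = linarith ([] ∣ᵉ n ∷ k ∷ []) (ζ 0 ≐ᶻ κᶻ 1 ⊞ ζ 1 ⊠ κᶻ 2 ∷ []) (ζ 0 ≐ᶻ κᶻ 2 ⊠ ζ 1 ⊞ κᶻ 1) (e , tt)
  cases (suc (suc m)) (s≤s (s≤s ())) _

-- A pixel with coordinates `u`, `v` exists only when `u + v = 2x` is even, so the parity of
-- `u₀ + v₀` decides whether the first diagonal contains the corner of the rectangle or begins one
-- value of `v` later.
pixels : DiagRect → List Pixel
pixels (diagRect u₀ v₀ U V) with halve (u₀ ℤ.+ v₀)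
... | k , inj₁ _ = diagonals false U V (k , u₀ ℤ.- k)
... | k , inj₂ _ = diagonals true U V (k ℤ.+ 1ℤ , u₀ ℤ.- k ℤ.- 1ℤ)

length-pixels : ∀ R → 2 * length (pixels R) ≤ DiagRect.U R * DiagRect.V R + 1
length-pixels (diagRect u₀ v₀ U V) with halve (u₀ ℤ.+ v₀)
... | k , inj₁ _ = length-diagonals false U V _
... | k , inj₂ _ = length-diagonals true U V _

∈-pixels : ∀ R {z} → z ∈ᴿ R → z ∈ pixels R
∈-pixels (diagRect u₀ v₀ U V) {z} (inRect a b c d) with halve (u₀ ℤ.+ v₀)
... | k , inj₁ e = ∈-diagonals false U V
  (subst (ℤ._≤ u z) (ueq u₀ k) a) (subst (λ t → u z ℤ.< t ℤ.+ + U) (ueq u₀ k) b)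
  (subst (ℤ._≤ v z) (veq u₀ v₀ k e) c) (subst (λ t → v z ℤ.< t ℤ.+ + V) (veq u₀ v₀ k e) d)
  where
  ueq : ∀ s k → s ≡ k ℤ.+ (s ℤ.- k)
  ueq = solve-∀
  veq : ∀ s t k → s ℤ.+ t ≡ + 2 ℤ.* k → t ≡ k ℤ.- (s ℤ.- k) ℤ.- 0ℤ
  veq s t k e = linarith ([] ∣ᵉ t ∷ k ∷ s ∷ []) (ζ 2 ⊞ ζ 0 ≐ᶻ κᶻ 2 ⊠ ζ 1 ∷ []) (ζ 0 ≐ᶻ ζ 1 ⊖ (ζ 2 ⊖ ζ 1) ⊖ κᶻ 0) (e , tt)
... | k , inj₂ e = ∈-diagonals true U V
  (subst (ℤ._≤ u z) (ueq u₀ k) a) (subst (λ t → u z ℤ.< t ℤ.+ + U) (ueq u₀ k) b)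
  (subst (ℤ._≤ v z) (veq u₀ v₀ k e) c) (subst (λ t → v z ℤ.< t ℤ.+ + V) (veq u₀ v₀ k e) d)
  where
  ueq : ∀ s k → s ≡ k ℤ.+ 1ℤ ℤ.+ (s ℤ.- k ℤ.- 1ℤ)
  ueq = solve-∀
  veq : ∀ s t k → s ℤ.+ t ≡ + 2 ℤ.* k ℤ.+ 1ℤ → t ≡ k ℤ.+ 1ℤ ℤ.- (s ℤ.- k ℤ.- 1ℤ) ℤ.- 1ℤ
  veq s t k e = linarith ([] ∣ᵉ t ∷ k ∷ s ∷ [])
    (ζ 2 ⊞ ζ 0 ≐ᶻ κᶻ 2 ⊠ ζ 1 ⊞ κᶻ 1 ∷ []) (ζ 0 ≐ᶻ ζ 1 ⊞ κᶻ 1 ⊖ (ζ 2 ⊖ ζ 1 ⊖ κᶻ 1) ⊖ κᶻ 1) (e , tt)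

-- Tokens of a 4-component, and the upper bound for 4-connectivity

near-right : ∀ z → Near four z (e₁ z)
near-right (x , y) = subst (ℕ._≤ 1) (sym (cong₂ (λ s t → ∣ s ∣ + ∣ t ∣) (eq x) (ℤₚ.+-inverseʳ y))) ℕₚ.≤-refl
  where
  eq : ∀ x → x ℤ.- (x ℤ.+ 1ℤ) ≡ ℤ.- 1ℤ
  eq = solve-∀

near-up : ∀ z → Near four z (e₂ z)
near-up (x , y) = subst (ℕ._≤ 1) (sym (cong₂ (λ s t → ∣ s ∣ + ∣ t ∣) (ℤₚ.+-inverseʳ x) (eq y))) ℕₚ.≤-refl
  where
  eq : ∀ x → x ℤ.- (x ℤ.+ 1ℤ) ≡ ℤ.- 1ℤ
  eq = solve-∀

mainCorners antiCorners : Pixel → List Pixel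
mainCorners z = z ∷ e₁₂ z ∷ []
antiCorners z = e₁ z ∷ e₂ z ∷ []

mainHit antiHit squares₄ : List Pixel → Pixel → ℕ
mainHit C z = 𝟙 (meets? C (mainCorners z))
antiHit C z = 𝟙 (meets? C (antiCorners z))
squares₄ C z = mainHit C z + antiHit C z

module _ {C : List Pixel} (cluster : Cluster four C) where
  open Cluster cluster

  uExtent : Extent u C
  uExtent = extent u (λ {z} {w} → near-u {z} {w}) cluster

  vExtent : Extent v C
  vExtent = extent v (λ {z} {w} → near-v {z} {w}) cluster

  boundingRect : DiagRect
  boundingRect = diagRect (Extent.lo uExtent) (Extent.lo vExtent) (Extent.len uExtent) (Extent.len vExtent)

  ∈-boundingRect : ∀ {z} → z ∈ C → z ∈ᴿ boundingRect
  ∈-boundingRect z∈ = inRect (Extent.lower uExtent z∈) (Extent.upper uExtent z∈) (Extent.lower vExtent z∈) (Extent.upper vExtent z∈)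

  open DiagRect boundingRect using (U; V)

  2*length≤ : 2 * length C ≤ U * V + 1
  2*length≤ = ℕₚ.≤-trans (ℕₚ.*-monoʳ-≤ 2 (length-mono unique (∈-pixels boundingRect ∘ ∈-boundingRect))) (length-pixels boundingRect)

  -- From `2|C| - 1 ≤ UV` and `4UV ≤ (U + V)²`.
  diameter : ceilSqrt (4 * (2 * length C ∸ 1)) ≤ U + V
  diameter = ceilSqrt-least _ _ (ℕₚ.≤-trans (ℕₚ.*-monoʳ-≤ 4 (ℕₚ.m≤n+o⇒m∸n≤o _ 1 (subst (2 * length C ℕ.≤_) (ℕₚ.+-comm (U * V) 1) 2*length≤)))
    (4mn≤[m+n]² U V))

  private
    leftmost = argmin proj₁ point∈
    module M = Extension diag C
    module A = Extension antidiag C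
    module Up = Translation up

    main-length : length C + V ≤ length M.extension
    main-length = subst (λ t → length C + t ≤ length M.extension) (Extent.length-values vExtent)
      (M.length-extension proj₁ (λ _ → refl) (proj₁ (proj₁ leftmost)) (proj₂ (proj₂ leftmost)) v (λ (x , y) → eq x y)
        (Extent.values-unique vExtent) (Extent.values-attained vExtent))
      where
      eq : ∀ x y → x ℤ.- 1ℤ ℤ.- (y ℤ.- 1ℤ) ≡ x ℤ.- y
      eq = solve-∀

    anti-length : length C + U ≤ length A.extension
    anti-length = subst (λ t → length C + t ≤ length A.extension) (Extent.length-values uExtent)
      (A.length-extension proj₁ (λ _ → refl) (proj₁ (proj₁ leftmost)) (proj₂ (proj₂ leftmost)) u (λ (x , y) → eq x y)
        (Extent.values-unique uExtent) (Extent.values-attained uExtent))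
      where
      eq : ∀ x y → x ℤ.- 1ℤ ℤ.+ (y ℤ.- ℤ.- 1ℤ) ≡ x ℤ.+ y
      eq = solve-∀

  module _ {r R} (C⊆ : ∀ {z} → z ∈ C → InBox r z) (r<R : suc r ≤ R) where
    private
      in-box : ∀ {z p} → p ∈ corners z → p ∈ C → z ∈ box R
      in-box {z} p∈ p∈C = ∈-box⁺ (corner-in-box {z = z} p∈ r<R (C⊆ p∈C))

      main≤ : length M.extension ≤ ∑ (box R) (mainHit C)
      main≤ = ≤∑𝟙 (λ z → meets? C (mainCorners z)) (M.extension-unique unique) inside
        where
        first : ∀ {z} → z ∈ C → z ∈ box R × Meets C (mainCorners z)
        first {z} p = in-box {z} (Any.here refl) p , Any.here p
        second : ∀ {z} → e₁₂ z ∈ C → z ∈ box R × Meets C (mainCorners z)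
        second {z} p = in-box {z} (Any.there (Any.there (Any.there (Any.here refl)))) p , Any.there (Any.here p)
        inside : ∀ {z} → z ∈ M.extension → z ∈ box R × Meets C (mainCorners z)
        inside {z} z∈ = [ first , second ]′ (M.∈-extension⁻ z∈)

      anti≤ : length A.extension ≤ ∑ (box R) (antiHit C)
      -- Moved down by one, the pixels of `A.extension` become lower left corners: a pixel of `C` is
      -- then the upper left corner of its square, and a pixel whose successor along the
      -- antidiagonal lies in `C` makes that successor the lower right corner.
      anti≤ = subst (ℕ._≤ ∑ (box R) (antiHit C)) (length-map Up.back A.extension)
        (≤∑𝟙 (λ z → meets? C (antiCorners z)) (Uniqueₚ.map⁺ (λ {z} {w} e → trans (sym (Up.fwd-back z)) (trans (cong Up.fwd e) (Up.fwd-back w))) (A.extension-unique unique)) inside)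
        where
        first : ∀ {w} → w ∈ C → Up.back w ∈ box R × Meets C (antiCorners (Up.back w))
        first {w} p = in-box {Up.back w} (Any.there (Any.there (Any.here refl))) p′ , Any.there (Any.here p′)
          where
          p′ : e₂ (Up.back w) ∈ C
          p′ = subst (_∈ C) (sym (Up.fwd-back w)) p
        second : ∀ {w} → e₁ (Up.back w) ∈ C → Up.back w ∈ box R × Meets C (antiCorners (Up.back w))
        second {w} p = in-box {Up.back w} (Any.there (Any.here refl)) p , Any.here p
        hit : ∀ {w} → w ∈ A.extension → Up.back w ∈ box R × Meets C (antiCorners (Up.back w))
        hit {w} w∈ = [ first {w} , second {w} ]′ (A.∈-extension⁻ {w} w∈)
        inside : ∀ {z} → z ∈ map Up.back A.extension → z ∈ box R × Meets C (antiCorners z)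
        inside z∈ = let w , w∈ , e = ∈-map⁻ Up.back z∈ in subst (λ t → t ∈ box R × Meets C (antiCorners t)) (sym e) (hit w∈)

    -- The squares whose main diagonal meets `C` correspond to `C` extended one step back in
    -- direction (1, 1), where `v` tells the lines apart; this gives `|C| + V`. The other diagonal
    -- runs along lines of constant `u` and gives `|C| + U`.
    cluster-squares₄ : 2 * length C + (U + V) ≤ ∑ (box R) (squares₄ C)
    cluster-squares₄ = subst (2 * length C + (U + V) ℕ.≤_) (sym (∑-+ (mainHit C) (antiHit C) (box R)))
      (add (length C) U V (length M.extension) (length A.extension) (∑ (box R) (mainHit C)) (∑ (box R) (antiHit C)) main-length anti-length main≤ anti≤)
      where
      add : ∀ c U V m a m′ a′ → c + V ≤ m → c + U ≤ a → m ≤ m′ → a ≤ a′ → 2 * c + (U + V) ≤ m′ + a′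
      add c U V m a m′ a′ h₁ h₂ h₃ h₄ = linarith (c ∷ U ∷ V ∷ m′ ∷ a′ ∷ m ∷ a ∷ [] ∣ᵉ [])
        (ν 0 ⊕ ν 2 ≼ ν 5 ∷ ν 0 ⊕ ν 1 ≼ ν 6 ∷ ν 5 ≼ ν 3 ∷ ν 6 ≼ ν 4 ∷ []) (κ 2 ⊗ ν 0 ⊕ (ν 1 ⊕ ν 2) ≼ ν 3 ⊕ ν 4)
        (h₁ , h₂ , h₃ , h₄ , tt)

-- The decisions are arguments, so that proofs can match on the colours of the four corners.
count₄ : {P Q R S : Set} → Dec P → Dec Q → Dec R → Dec S → ℕ
count₄ p q r s = 𝟙 p + 𝟙 q + (𝟙 r + 𝟙 s)

cornerCount : List Pixel → Pixel → ℕ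
cornerCount L z = count₄ (z ∈? L) (e₁₂ z ∈? L) (e₁ z ∈? L) (e₂ z ∈? L)

Waste : List Pixel → Pixel → Set
Waste L z = cornerCount L z ≤ 1

waste? : ∀ L z → Dec (Waste L z)
waste? L z = cornerCount L z ℕ.≤? 1

module SquareCount {L : List Pixel} (K : Components four L) where
  open Components K
  open ComponentsProperties K

  𝟙-meets≤ : ∀ C p q → 𝟙 (meets? C (p ∷ q ∷ [])) ≤ 𝟙 (p ∈? C) + 𝟙 (q ∈? C)
  𝟙-meets≤ C p q with p ∈? C | q ∈? C
  ... | yes _ | _     = s≤s z≤n
  ... | no _  | yes _ = ℕₚ.≤-refl
  ... | no _  | no _  = ℕₚ.≤-refl

  -- Each token is paid for by a white corner in the component taking it, and the components are
  -- disjoint.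
  ∑≤cornerCount : ∀ z → ∑ parts (λ C → squares₄ C z) ≤ cornerCount L z
  ∑≤cornerCount z = ℕₚ.≤-trans
    (∑-mono parts λ {C} _ → ℕₚ.+-mono-≤ (𝟙-meets≤ C z (e₁₂ z)) (𝟙-meets≤ C (e₁ z) (e₂ z)))
    (subst (ℕ._≤ cornerCount L z) (sym (trans (∑-+ _ _ parts) (cong₂ ℕ._+_ (∑-+ _ _ parts) (∑-+ _ _ parts))))
      (ℕₚ.+-mono-≤ (ℕₚ.+-mono-≤ (∑-member≤ z) (∑-member≤ (e₁₂ z))) (ℕₚ.+-mono-≤ (∑-member≤ (e₁ z)) (∑-member≤ (e₂ z)))))

  -- If every component taking a token contains `p`, there is only one such component, and it takes
  -- at most one token per diagonal. With three or four white corners, a suitable corner `p` is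
  -- joined to the others along edges of the square.
  hub : ∀ z p → (∀ {C} → C ∈ parts → Meets C (mainCorners z) → p ∈ C) → (∀ {C} → C ∈ parts → Meets C (antiCorners z) → p ∈ C) →
        ∑ parts (λ C → squares₄ C z) ≤ 2
  hub z p h h′ = ℕₚ.≤-trans
    (∑-mono parts λ {C} C∈ → ℕₚ.+-mono-≤ (𝟙-mono (meets? C (mainCorners z)) (p ∈? C) (h C∈)) (𝟙-mono (meets? C (antiCorners z)) (p ∈? C) (h′ C∈)))
    (subst (ℕ._≤ 2) (sym (∑-+ _ _ parts)) (ℕₚ.+-mono-≤ (∑-member≤1 p) (∑-member≤1 p)))

  absorb : ∀ {C p q} → C ∈ parts → Near four p q → q ∈ L → p ∈ C → q ∈ C
  absorb C∈ n q∈ p∈ = absorbs C∈ p∈ q∈ n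

  module _ (z : Pixel) where
    private
      ab : Near four z (e₁ z)
      ab = near-right z
      ad : Near four z (e₂ z)
      ad = near-up z
      bc : Near four (e₁ z) (e₁₂ z)
      bc = near-up (e₁ z)
      dc : Near four (e₂ z) (e₁₂ z)
      dc = near-right (e₂ z)
      flip : ∀ {p q} → Near four p q → Near four q p
      flip {p} {q} = near-sym four {p} {q}

    three-corners : (a : Dec (z ∈ L)) (c : Dec (e₁₂ z ∈ L)) (b : Dec (e₁ z ∈ L)) (d : Dec (e₂ z ∈ L)) →
                    3 ≤ count₄ a c b d → ∑ parts (λ C → squares₄ C z) ≤ 2
    three-corners (yes a) _ (yes b) (yes d) _ = hub z z
      (λ { _ (Any.here p) → p ; C∈ (Any.there (Any.here p)) → absorb C∈ (flip {z} {e₁ z} ab) a (absorb C∈ (flip {e₁ z} {e₁₂ z} bc) b p) })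
      (λ { C∈ (Any.here p) → absorb C∈ (flip {z} {e₁ z} ab) a p ; C∈ (Any.there (Any.here p)) → absorb C∈ (flip {z} {e₂ z} ad) a p })
    three-corners (yes a) (yes c) (yes b) (no _) _ = hub z (e₁ z)
      (λ { C∈ (Any.here p) → absorb C∈ ab b p ; C∈ (Any.there (Any.here p)) → absorb C∈ (flip {e₁ z} {e₁₂ z} bc) b p })
      (λ { _ (Any.here p) → p ; C∈ (Any.there (Any.here p)) → absorb C∈ ab b (absorb C∈ (flip {z} {e₂ z} ad) a p) })
    three-corners (yes a) (yes c) (no _) (yes d) _ = hub z (e₂ z)
      (λ { C∈ (Any.here p) → absorb C∈ ad d p ; C∈ (Any.there (Any.here p)) → absorb C∈ (flip {e₂ z} {e₁₂ z} dc) d p })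
      (λ { C∈ (Any.here p) → absorb C∈ ad d (absorb C∈ (flip {z} {e₁ z} ab) a p) ; _ (Any.there (Any.here p)) → p })
    three-corners (no _) (yes c) (yes b) (yes d) _ = hub z (e₁₂ z)
      (λ { C∈ (Any.here p) → absorb C∈ bc c (absorb C∈ ab b p) ; _ (Any.there (Any.here p)) → p })
      (λ { C∈ (Any.here p) → absorb C∈ bc c p ; C∈ (Any.there (Any.here p)) → absorb C∈ dc c p })
    three-corners (yes _) (yes _) (no _) (no _) (s≤s (s≤s ()))
    three-corners (yes _) (no _) (yes _) (no _) (s≤s (s≤s ()))
    three-corners (yes _) (no _) (no _) (yes _) (s≤s (s≤s ()))
    three-corners (yes _) (no _) (no _) (no _) (s≤s ())
    three-corners (no _) (yes _) (yes _) (no _) (s≤s (s≤s ()))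
    three-corners (no _) (yes _) (no _) (yes _) (s≤s (s≤s ()))
    three-corners (no _) (yes _) (no _) (no _) (s≤s ())
    three-corners (no _) (no _) (yes _) (yes _) (s≤s (s≤s ()))
    three-corners (no _) (no _) (yes _) (no _) (s≤s ())
    three-corners (no _) (no _) (no _) (yes _) (s≤s ())
    three-corners (no _) (no _) (no _) (no _) ()

  -- Up to two white corners, the number of corners bounds the tokens; from three on, connectedness
  -- does. A square with at most one white corner loses a token for certain, and only this kind of
  -- loss is recorded as waste.
  squares₄+waste≤2 : ∀ z → ∑ parts (λ C → squares₄ C z) + 𝟙 (waste? L z) ≤ 2
  squares₄+waste≤2 z = by-cases (waste? L z)
    where
    S : ℕ
    S = ∑ parts (λ C → squares₄ C z)
    by-cases : (w : Dec (Waste L z)) → S + 𝟙 w ≤ 2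
    by-cases (yes w) = ℕₚ.+-monoˡ-≤ 1 (ℕₚ.≤-trans (∑≤cornerCount z) w)
    by-cases (no ¬w) = subst (ℕ._≤ 2) (sym (ℕₚ.+-identityʳ S))
      ([ (λ n<3 → ℕₚ.≤-trans (∑≤cornerCount z) (ℕₚ.≤-pred n<3)) , three-corners z (z ∈? L) (e₁₂ z ∈? L) (e₁ z ∈? L) (e₂ z ∈? L) ]′
        (ℕₚ.<-≤-connex (cornerCount L z) 3))

nonempty : ∀ {A : Set} {x : A} {xs} → x ∈ xs → 1 ≤ length xs
nonempty (Any.here _)  = s≤s z≤n
nonempty (Any.there _) = s≤s z≤n

-- A component takes at least `2i + ⌈2√(2i - 1)⌉` tokens and a square gives at most two, so the
-- factor 2 in the numerator of `term₄` cancels.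
upper-bound₄ : ∀ k p d → 1 ≤ d →
  (∀ i → 1 ≤ i → i ≤ k → 2 * i * d ≤ p * (2 * i + ceilSqrt (4 * (2 * i ∸ 1)))) →
  PhiLe four k (frac p d)
upper-bound₄ k p d 1≤d h I comps = density-upper I p d 2 1≤d bound
  where
  widen : ∀ r → 2 * suc r + 1 ≡ 2 * r + 1 + 2
  widen r = linarith (r ∷ [] ∣ᵉ []) [] (κ 2 ⊗ (κ 1 ⊕ ν 0) ⊕ κ 1 ≐ κ 2 ⊗ ν 0 ⊕ κ 1 ⊕ κ 2) tt
  bound : ∀ r → W I r * d ≤ p * ((2 * r + 1 + 2) * (2 * r + 1 + 2))
  bound r = double (W I r) _ d p _ _ (W≤∑ I r K) (∑-length≤ parts (2 * d) p tok each) tokens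
    where
    K : Components four (whites I r)
    K = components (whites I r) (whites-unique I r)
    open Components K
    tok : List Pixel → ℕ
    tok C = ∑ (box (suc r)) (squares₄ C)
    each : ∀ {C} → C ∈ parts → length C * (2 * d) ≤ p * tok C
    each {C} C∈ = ℕₚ.≤-trans (subst (ℕ._≤ p * (2 * length C + ceilSqrt (4 * (2 * length C ∸ 1)))) (comm (length C) d)
      (h (length C) (nonempty (Cluster.point∈ (clusters C∈))) (ComponentsProperties.bounded K comps (proj₂ ∘ ∈-whites I r) C∈)))
      (ℕₚ.*-monoʳ-≤ p (ℕₚ.≤-trans (ℕₚ.+-monoʳ-≤ (2 * length C) (diameter (clusters C∈)))
        (cluster-squares₄ (clusters C∈) (proj₁ ∘ ∈-whites I r ∘ inside C∈) ℕₚ.≤-refl)))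
      where
      comm : ∀ c d → 2 * c * d ≡ c * (2 * d)
      comm c d = linarith (c ∷ d ∷ [] ∣ᵉ []) [] (κ 2 ⊗ ν 0 ⊗ ν 1 ≐ ν 0 ⊗ (κ 2 ⊗ ν 1)) tt
    tokens : ∑ parts tok ≤ 2 * ((2 * r + 1 + 2) * (2 * r + 1 + 2))
    tokens = subst₂ ℕ._≤_ (sym (∑-swap squares₄ parts (box (suc r))))
      (trans (∑-const 2 (box (suc r))) (cong (2 ℕ.*_) (trans (length-box (suc r)) (cong₂ ℕ._*_ (widen r) (widen r)))))
      (∑-mono (box (suc r)) λ {z} _ → ℕₚ.m+n≤o⇒m≤o _ (SquareCount.squares₄+waste≤2 K z))
    double : ∀ w s d p t b → w ≤ s → s * (2 * d) ≤ p * t → t ≤ 2 * b → w * d ≤ p * b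
    double w s d p t b h₁ h₂ h₃ = linarith (w ∷ d ∷ p ∷ b ∷ s ∷ t ∷ [] ∣ᵉ [])
      (ν 0 ⊗ ν 1 ≼ ν 4 ⊗ ν 1 ∷ ν 4 ⊗ (κ 2 ⊗ ν 1) ≼ ν 2 ⊗ ν 5 ∷ ν 2 ⊗ ν 5 ≼ ν 2 ⊗ (κ 2 ⊗ ν 3) ∷ [])
      (ν 0 ⊗ ν 1 ≼ ν 2 ⊗ ν 3) (h₄ , h₂ , h₅ , tt)
      where
      h₄ : w * d ≤ s * d
      h₄ = ℕₚ.*-monoˡ-≤ d h₁
      h₅ : p * t ≤ p * (2 * b)
      h₅ = ℕₚ.*-monoʳ-≤ p h₃

-- Images that are periodic with respect to the lattice of all (x , y) with N ∣ y + w x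

dist-shift : ∀ α a b c d s t → dist α (a ℤ.- s , b ℤ.- t) (c ℤ.- s , d ℤ.- t) ≡ dist α (a , b) (c , d)
dist-shift α a b c d s t = go α
  where
  cancel : ∀ x y z → x ℤ.- z ℤ.- (y ℤ.- z) ≡ x ℤ.- y
  cancel = solve-∀
  go : ∀ α → dist α (a ℤ.- s , b ℤ.- t) (c ℤ.- s , d ℤ.- t) ≡ dist α (a , b) (c , d)
  go four  = cong₂ (λ i j → ∣ i ∣ + ∣ j ∣) (cancel a c s) (cancel b d t)
  go eight = cong₂ (λ i j → ∣ i ∣ ℕ.⊔ ∣ j ∣) (cancel a c s) (cancel b d t)

-- If every vertical window of `N` pixels contains at least `c` white ones, cutting the columns of a
-- box into windows gives density at least `c / N`.
module Windows (I : Image) (N c : ℕ) (1≤N : 1 ≤ N) where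
  instance
    nonZero : ℕ.NonZero N
    nonZero = ℕ.>-nonZero 1≤N

  Window : Set
  Window = ∀ x y → c ≤ ∑ (upTo N) (λ i → 𝟙 (white? I (x , y ℤ.+ + i)))

  module _ (window : Window) where
    row : ∀ r x → ((2 * r + 1) ℕ./ N) * c ≤ ∑ (map (x ,_) (range r)) (λ z → 𝟙 (white? I z))
    row r x = subst (λ t → Q * c ≤ t)
      (sym (trans (∑-map (x ,_) (λ z → 𝟙 (white? I z)) (range r))
           (trans (∑-map (λ i → + i ℤ.- + r) (λ b → 𝟙 (white? I (x , b))) (upTo (suc (2 * r))))
                  (cong (λ n → ∑ (upTo n) g) size))))
      (∑-windows N c Q s g windows)
      where
      g : ℕ → ℕ
      g i = 𝟙 (white? I (x , + i ℤ.- + r))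
      Q s : ℕ
      Q = (2 * r + 1) ℕ./ N
      s = (2 * r + 1) ℕ.% N
      size : suc (2 * r) ≡ Q * N + s
      size = trans (ℕₚ.+-comm 1 (2 * r)) (trans (m≡m%n+[m/n]*n (2 * r + 1) N) (ℕₚ.+-comm s (Q * N)))
      shift : ∀ m i → + m ℤ.- + r ℤ.+ + i ≡ + (m + i) ℤ.- + r
      shift m i = linarith (m ∷ r ∷ i ∷ [] ∣ᵉ []) [] (ι 0 ⊖ ι 1 ⊞ ι 2 ≐ᶻ ⌞ ν 0 ⊕ ν 2 ⌟ ⊖ ι 1) tt
      windows : ∀ m → c ≤ ∑ (upTo N) (λ i → g (m + i))
      windows m = subst (λ t → c ≤ t) (∑-cong (upTo N) λ i → cong (λ t → 𝟙 (white? I (x , t))) (shift m i)) (window x (+ m ℤ.- + r))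

    W-lower : ∀ r → ((2 * r + 1) ℕ./ N) * c * (2 * r + 1) ≤ W I r
    W-lower r = subst₂ ℕ._≤_ (trans (∑-const (((2 * r + 1) ℕ./ N) * c) (range r)) (cong (((2 * r + 1) ℕ./ N) * c ℕ.*_) (length-range r)))
      (sym (trans (countTrue-filter I (box r)) (trans (length-filter≡∑ (white? I) (box r))
        (∑-concatMap (λ a → map (a ,_) (range r)) (λ z → 𝟙 (white? I z)) (range r)))))
      (∑-mono (range r) λ {x} _ → row r x)

    density : DensityGe I (frac c N)
    density = density-lower I c N 1≤N λ r → ℕₚ.≤-trans
      (arith (2 * r + 1) ((2 * r + 1) ℕ./ N) ((2 * r + 1) ℕ.% N) N c
        (m≡m%n+[m/n]*n (2 * r + 1) N) (ℕₚ.<⇒≤ (m%n<n (2 * r + 1) N)))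
      (ℕₚ.+-monoˡ-≤ ((2 * r + 1) * N * c) (ℕₚ.*-monoʳ-≤ N (W-lower r)))
      where
      arith : ∀ n Q s N l → n ≡ s + Q * N → s ≤ N → n * n * l ≤ N * (Q * l * n) + n * N * l
      arith n Q s N l e h = subst (λ t → t * n * l ≤ N * (Q * l * n) + n * N * l) (sym e) (bound (ℕₚ.*-monoˡ-≤ (n * l) h))
        where
        bound : s * (n * l) ≤ N * (n * l) → (s + Q * N) * n * l ≤ N * (Q * l * n) + n * N * l
        bound h = linarith (s ∷ Q ∷ N ∷ n ∷ l ∷ [] ∣ᵉ [])
          (ν 0 ⊗ (ν 3 ⊗ ν 4) ≼ ν 2 ⊗ (ν 3 ⊗ ν 4) ∷ [])
          ((ν 0 ⊕ ν 1 ⊗ ν 2) ⊗ ν 3 ⊗ ν 4 ≼ ν 2 ⊗ (ν 1 ⊗ ν 4 ⊗ ν 3) ⊕ ν 3 ⊗ ν 2 ⊗ ν 4) (h , tt)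

does⁺ : ∀ {P : Set} (d : Dec P) → P → does d ≡ true
does⁺ (yes _) _ = refl
does⁺ (no ¬p) p = contradiction p ¬p

does⁻ : ∀ {P : Set} (d : Dec P) → does d ≡ true → P
does⁻ (yes p) _ = p

module Periodic (N : ℕ) (1≤N : 1 ≤ N) (w : ℤ) (R : List Pixel) where

  instance
    N≢0 : ℕ.NonZero N
    N≢0 = ℕ.>-nonZero 1≤N

  -- The lattice is the kernel of `f` modulo `N`, so two pixels are lattice translates of each other
  -- exactly when their values are congruent.
  f : Pixel → ℤ
  f (x , y) = y ℤ.+ w ℤ.* x

  infix 4 _≈_ _≈?_
  _≈_ : ℤ → ℤ → Set
  a ≈ b = ∃[ t ] a ≡ b ℤ.+ t ℤ.* + N

  _≈?_ : ∀ a b → Dec (a ≈ b)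
  a ≈? b = map′ (λ { (divides q e) → q , to a b q e }) (λ (q , e) → divides q (from a b q e)) (+ N Signed.∣? (a ℤ.- b))
    where
    to : ∀ a b q → a ℤ.- b ≡ q ℤ.* + N → a ≡ b ℤ.+ q ℤ.* + N
    to a b q e = linarith (N ∷ [] ∣ᵉ a ∷ b ∷ q ∷ []) (ζ 0 ⊖ ζ 1 ≐ᶻ ζ 2 ⊠ ι 0 ∷ []) (ζ 0 ≐ᶻ ζ 1 ⊞ ζ 2 ⊠ ι 0) (e , tt)
    from : ∀ a b q → a ≡ b ℤ.+ q ℤ.* + N → a ℤ.- b ≡ q ℤ.* + N
    from a b q e = linarith (N ∷ [] ∣ᵉ a ∷ b ∷ q ∷ []) (ζ 0 ≐ᶻ ζ 1 ⊞ ζ 2 ⊠ ι 0 ∷ []) (ζ 0 ⊖ ζ 1 ≐ᶻ ζ 2 ⊠ ι 0) (e , tt)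

  Represented : Pixel → Set
  Represented z = Any (λ r → f z ≈ f r) R

  represented? : ∀ z → Dec (Represented z)
  represented? z = any? (λ r → f z ≈? f r) R

  image : Image
  image z = does (represented? z)

  white⁺ : ∀ {z} → Represented z → White image z
  white⁺ {z} = does⁺ (represented? z)

  white⁻ : ∀ {z} → White image z → Represented z
  white⁻ {z} = does⁻ (represented? z)

  module _ (α : Conn) (closed : ∀ {r r′ s} → r ∈ R → r′ ∈ R → Adj α r s → f s ≈ f r′ → r′ ≡ s) where

    module _ (a b : ℤ) (t : ℤ) (period : b ℤ.+ w ℤ.* a ≡ t ℤ.* + N) where
      shifted : Pixel → Pixel
      shifted (x , y) = x ℤ.- a , y ℤ.- b

      f-shifted : ∀ z r → f z ≈ f r → f (shifted z) ≈ f r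
      f-shifted (x , y) r (t′ , e) = t′ ℤ.- t , lemma x y a b w (f r) t′ t (+ N) e period
        where
        lemma : ∀ x y a b w c t′ t n → y ℤ.+ w ℤ.* x ≡ c ℤ.+ t′ ℤ.* n → b ℤ.+ w ℤ.* a ≡ t ℤ.* n →
                y ℤ.- b ℤ.+ w ℤ.* (x ℤ.- a) ≡ c ℤ.+ (t′ ℤ.- t) ℤ.* n
        lemma x y a b w c t′ t n e e′ = linarith ([] ∣ᵉ y ∷ b ∷ w ∷ x ∷ a ∷ c ∷ t′ ∷ t ∷ n ∷ [])
          (ζ 0 ⊞ ζ 2 ⊠ ζ 3 ≐ᶻ ζ 5 ⊞ ζ 6 ⊠ ζ 8 ∷ ζ 1 ⊞ ζ 2 ⊠ ζ 4 ≐ᶻ ζ 7 ⊠ ζ 8 ∷ [])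
          (ζ 0 ⊖ ζ 1 ⊞ ζ 2 ⊠ (ζ 3 ⊖ ζ 4) ≐ᶻ ζ 5 ⊞ (ζ 6 ⊖ ζ 7) ⊠ ζ 8) (e , e′ , tt)

      stays : ∀ {x y} → WhitePath image α x y → shifted x ∈ R → shifted y ∈ R
      stays (here _) x∈ = x∈
      stays (step {x} {y} _ adj p) x∈ = stays p (advance (find (white⁻ {y} (path-start p))))
        where
        advance : (∃[ r ] (r ∈ R × f y ≈ f r)) → shifted y ∈ R
        advance (r , r∈ , e) = subst (_∈ R) (closed x∈ r∈ (trans (dist-shift α (proj₁ x) (proj₂ x) (proj₁ y) (proj₂ y) a b) adj) (f-shifted y r e)) r∈

      shifted-injective : ∀ {x y} → shifted x ≡ shifted y → x ≡ y
      shifted-injective {x₁ , x₂} {y₁ , y₂} e = cong₂ _,_ (inj x₁ y₁ a (cong proj₁ e)) (inj x₂ y₂ b (cong proj₂ e))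
        where
        inj : ∀ x y c → x ℤ.- c ≡ y ℤ.- c → x ≡ y
        inj x y c e = linarith ([] ∣ᵉ x ∷ y ∷ c ∷ []) (ζ 0 ⊖ ζ 2 ≐ᶻ ζ 1 ⊖ ζ 2 ∷ []) (ζ 0 ≐ᶻ ζ 1) (e , tt)

    -- A lattice vector carries `x` to its representative in `R`. By `closed`, the translate of a
    -- white path starting there never leaves `R`, so the translation embeds the component into `R`.
    components-bounded : ComponentsAtMost α (length R) image
    components-bounded x@(x₁ , x₂) wx ys u paths = bound (find (white⁻ {x} wx))
      where
      bound : (∃[ r ] (r ∈ R × f x ≈ f r)) → length ys ≤ length R
      bound (r@(r₁ , r₂) , r∈ , t , e) = subst (ℕ._≤ length R) (length-map S ys)
        (length-mono (Uniqueₚ.map⁺ (shifted-injective (x₁ ℤ.- r₁) (x₂ ℤ.- r₂) t p) u) sub)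
        where
        period : ∀ x₁ x₂ r₁ r₂ w n → x₂ ℤ.+ w ℤ.* x₁ ≡ r₂ ℤ.+ w ℤ.* r₁ ℤ.+ t ℤ.* n → x₂ ℤ.- r₂ ℤ.+ w ℤ.* (x₁ ℤ.- r₁) ≡ t ℤ.* n
        period x₁ x₂ r₁ r₂ w n e = linarith ([] ∣ᵉ x₂ ∷ r₂ ∷ w ∷ x₁ ∷ r₁ ∷ t ∷ n ∷ [])
          (ζ 0 ⊞ ζ 2 ⊠ ζ 3 ≐ᶻ ζ 1 ⊞ ζ 2 ⊠ ζ 4 ⊞ ζ 5 ⊠ ζ 6 ∷ []) (ζ 0 ⊖ ζ 1 ⊞ ζ 2 ⊠ (ζ 3 ⊖ ζ 4) ≐ᶻ ζ 5 ⊠ ζ 6) (e , tt)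
        p : x₂ ℤ.- r₂ ℤ.+ w ℤ.* (x₁ ℤ.- r₁) ≡ t ℤ.* + N
        p = period x₁ x₂ r₁ r₂ w (+ N) e
        S : Pixel → Pixel
        S = shifted (x₁ ℤ.- r₁) (x₂ ℤ.- r₂) t p
        back : ∀ x r → x ℤ.- (x ℤ.- r) ≡ r
        back = solve-∀
        start : S x ∈ R
        start = subst (_∈ R) (sym (cong₂ _,_ (back x₁ r₁) (back x₂ r₂))) r∈
        sub : ∀ {z} → z ∈ map S ys → z ∈ R
        sub z∈ = let y , y∈ , e = ∈-map⁻ S z∈ in subst (_∈ R) (sym e) (stays _ _ t p (All.lookup paths y∈) start)

  module _ (R-unique : Unique R) (separate : ∀ {r r′} → r ∈ R → r′ ∈ R → f r ≈ f r′ → r ≡ r′) where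

    -- Along a vertical window `f` takes `N` consecutive values, so every class of a tile pixel
    -- occurs; `separate` makes these classes distinct.
    window : ∀ x y → length R ≤ ∑ (upTo N) (λ i → 𝟙 (white? image (x , y ℤ.+ + i)))
    window x y = subst (ℕ._≤ ∑ (upTo N) (λ i → 𝟙 (white? image (x , y ℤ.+ + i)))) (length-map index R)
      (≤∑𝟙 (λ i → white? image (x , y ℤ.+ + i)) {map index R} {upTo N} (map-unique index R-unique inj) inside)
      where
      base : ℤ
      base = f (x , y)
      index : Pixel → ℕ
      index r = (f r ℤ.- base) %ℕ N
      quot : Pixel → ℤ
      quot r = (f r ℤ.- base) /ℕ N
      index≈ : ∀ r → f r ℤ.- base ≡ + index r ℤ.+ quot r ℤ.* + N
      index≈ r = a≡a%ℕn+[a/ℕn]*n (f r ℤ.- base) N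
      inj : ∀ {r r′} → r ∈ R → r′ ∈ R → index r ≡ index r′ → r ≡ r′
      inj {r} {r′} r∈ r∈′ e = separate r∈ r∈′ (quot r ℤ.- quot r′ , lemma (f r) (f r′) base (index r) (index r′) (quot r) (quot r′) (+ N) (index≈ r) (index≈ r′) e)
        where
        lemma : ∀ a b c i j s t n → a ℤ.- c ≡ + i ℤ.+ s ℤ.* n → b ℤ.- c ≡ + j ℤ.+ t ℤ.* n → i ≡ j → a ≡ b ℤ.+ (s ℤ.- t) ℤ.* n
        lemma a b c i j s t n h h′ e = linarith (i ∷ j ∷ [] ∣ᵉ a ∷ b ∷ s ∷ t ∷ n ∷ c ∷ [])
          (ζ 0 ⊖ ζ 5 ≐ᶻ ι 0 ⊞ ζ 2 ⊠ ζ 4 ∷ ζ 1 ⊖ ζ 5 ≐ᶻ ι 1 ⊞ ζ 3 ⊠ ζ 4 ∷ ν 0 ≐ ν 1 ∷ [])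
          (ζ 0 ≐ᶻ ζ 1 ⊞ (ζ 2 ⊖ ζ 3) ⊠ ζ 4) (h , h′ , e , tt)
      hit : ∀ {r} → r ∈ R → White image (x , y ℤ.+ + index r)
      hit {r} r∈ = white⁺ {x , y ℤ.+ + index r} (lose r∈ (ℤ.- quot r , lemma (f r) x y w (index r) (quot r) (+ N) (index≈ r)))
        where
        lemma : ∀ a x y w i s n → a ℤ.- (y ℤ.+ w ℤ.* x) ≡ + i ℤ.+ s ℤ.* n → y ℤ.+ + i ℤ.+ w ℤ.* x ≡ a ℤ.+ (ℤ.- s) ℤ.* n
        lemma a x y w i s n e = linarith (i ∷ [] ∣ᵉ y ∷ w ∷ x ∷ a ∷ s ∷ n ∷ [])
          (ζ 3 ⊖ (ζ 0 ⊞ ζ 1 ⊠ ζ 2) ≐ᶻ ι 0 ⊞ ζ 4 ⊠ ζ 5 ∷ []) (ζ 0 ⊞ ι 0 ⊞ ζ 1 ⊠ ζ 2 ≐ᶻ ζ 3 ⊞ ⊟ ζ 4 ⊠ ζ 5) (e , tt)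
      inside : ∀ {i} → i ∈ map index R → i ∈ upTo N × White image (x , y ℤ.+ + i)
      inside i∈ = let r , r∈ , e = ∈-map⁻ index i∈ in
        subst (λ i → i ∈ upTo N × White image (x , y ℤ.+ + i)) (sym e)
          (∈-upTo⁺ (n%ℕd<d (f r ℤ.- base) N) , hit r∈)

  tiling⇒PhiGe : ∀ α → Unique R → (∀ {r r′} → r ∈ R → r′ ∈ R → f r ≈ f r′ → r ≡ r′) →
                 (∀ {r r′ s} → r ∈ R → r′ ∈ R → Adj α r s → f s ≈ f r′ → r′ ≡ s) → PhiGe α (length R) (frac (length R) N)
  tiling⇒PhiGe α R-unique separate closed = PhiGe-intro {α} {length R} {frac (length R) N} image (components-bounded α closed) (Windows.density image N (length R) 1≤N (window R-unique separate))

-- The extremal images for 8-connectivity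

nonneg-* : ∀ m n → 0ℤ ℤ.≤ + m ℤ.* + n
nonneg-* m n = subst (0ℤ ℤ.≤_) (ℤₚ.pos-* m n) (ℤ.+≤+ z≤n)

residue-unique : ∀ N {g h} t → g ℤ.< h ℤ.+ + N → h ℤ.< g ℤ.+ + N → g ≡ h ℤ.+ t ℤ.* + N → g ≡ h
residue-unique N {g} {h} (+ zero) _ _ e = trans e (ℤₚ.+-identityʳ h)
residue-unique N {g} {h} (+ suc n) g< _ e = ⊥-elim (above (+ N) (+ n) (nonneg-* n N) e g<)
  where
  above : ∀ N n → 0ℤ ℤ.≤ n ℤ.* N → g ≡ h ℤ.+ (1ℤ ℤ.+ n) ℤ.* N → ¬ g ℤ.< h ℤ.+ N
  above N n k e p = linarith ([] ∣ᵉ n ∷ N ∷ g ∷ h ∷ [])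
    (κᶻ 0 ≼ᶻ ζ 0 ⊠ ζ 1 ∷ ζ 2 ≐ᶻ ζ 3 ⊞ (κᶻ 1 ⊞ ζ 0) ⊠ ζ 1 ∷ ζ 2 ≺ᶻ ζ 3 ⊞ ζ 1 ∷ []) falsum (k , e , p , tt)
residue-unique N {g} {h} -[1+ n ] _ h< e = ⊥-elim (below (+ N) (+ n) (nonneg-* n N) e h<)
  where
  below : ∀ N n → 0ℤ ℤ.≤ n ℤ.* N → g ≡ h ℤ.+ (ℤ.- (1ℤ ℤ.+ n)) ℤ.* N → ¬ h ℤ.< g ℤ.+ N
  below N n k e p = linarith ([] ∣ᵉ n ∷ N ∷ g ∷ h ∷ [])
    (κᶻ 0 ≼ᶻ ζ 0 ⊠ ζ 1 ∷ ζ 2 ≐ᶻ ζ 3 ⊞ ⊟ (κᶻ 1 ⊞ ζ 0) ⊠ ζ 1 ∷ ζ 3 ≺ᶻ ζ 2 ⊞ ζ 1 ∷ []) falsum (k , e , p , tt)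

-- Integers at distance at most one are those for which the pairs `a`, `a + 1` and `b`, `b + 1`
-- overlap. In this form near pixels give overlapping enlarged pixels.
unit-difference : ∀ a b → ∣ a ℤ.- b ∣ ≤ 1 → ∃[ i ] ∃[ k ] (i ≤ 1 × k ≤ 1 × a ℤ.+ + i ≡ b ℤ.+ + k)
unit-difference a b h = go (a ℤ.- b) refl h
  where
  none : a ℤ.- b ≡ 0ℤ → a ℤ.+ 0ℤ ≡ b ℤ.+ 0ℤ
  none e = linarith ([] ∣ᵉ a ∷ b ∷ []) (ζ 0 ⊖ ζ 1 ≐ᶻ κᶻ 0 ∷ []) (ζ 0 ⊞ κᶻ 0 ≐ᶻ ζ 1 ⊞ κᶻ 0) (e , tt)
  plus : a ℤ.- b ≡ 1ℤ → a ℤ.+ 0ℤ ≡ b ℤ.+ 1ℤ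
  plus e = linarith ([] ∣ᵉ a ∷ b ∷ []) (ζ 0 ⊖ ζ 1 ≐ᶻ κᶻ 1 ∷ []) (ζ 0 ⊞ κᶻ 0 ≐ᶻ ζ 1 ⊞ κᶻ 1) (e , tt)
  minus : a ℤ.- b ≡ ℤ.- 1ℤ → a ℤ.+ 1ℤ ≡ b ℤ.+ 0ℤ
  minus e = linarith ([] ∣ᵉ a ∷ b ∷ []) (ζ 0 ⊖ ζ 1 ≐ᶻ ⊟ κᶻ 1 ∷ []) (ζ 0 ⊞ κᶻ 1 ≐ᶻ ζ 1 ⊞ κᶻ 0) (e , tt)
  go : ∀ d → a ℤ.- b ≡ d → ∣ d ∣ ≤ 1 → ∃[ i ] ∃[ k ] (i ≤ 1 × k ≤ 1 × a ℤ.+ + i ≡ b ℤ.+ + k)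
  go (+ 0) e _ = 0 , 0 , z≤n , z≤n , none e
  go (+ 1) e _ = 0 , 1 , z≤n , s≤s z≤n , plus e
  go (+ suc (suc _)) e (s≤s ())
  go -[1+ 0 ] e _ = 1 , 0 , s≤s z≤n , z≤n , minus e
  go -[1+ suc _ ] e (s≤s ())

rowMajor-injective : ∀ w a b a′ b′ → b < w → b′ < w → b + w * a ≡ b′ + w * a′ → a ≡ a′ × b ≡ b′
rowMajor-injective w a b a′ b′ h h′ e = go (ℕₚ.<-cmp a a′)
  where
  less : ∀ w a b a′ b′ → b < w → b + w * a ≡ b′ + w * a′ → w * suc a ≤ w * a′ → ⊥
  less w a b a′ b′ h e k = linarith (b ∷ w ∷ a ∷ b′ ∷ a′ ∷ [] ∣ᵉ [])
    (κ 1 ⊕ ν 0 ≼ ν 1 ∷ ν 0 ⊕ ν 1 ⊗ ν 2 ≐ ν 3 ⊕ ν 1 ⊗ ν 4 ∷ ν 1 ⊗ (κ 1 ⊕ ν 2) ≼ ν 1 ⊗ ν 4 ∷ []) falsum (h , e , k , tt)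
  go : Tri (a < a′) (a ≡ a′) (a ℕ.> a′) → a ≡ a′ × b ≡ b′
  go (tri< lt _ _)   = ⊥-elim (less w a b a′ b′ h e (ℕₚ.*-monoʳ-≤ w lt))
  go (tri≈ _ refl _) = refl , ℕₚ.+-cancelʳ-≡ (w * a) b b′ e
  go (tri> _ _ gt)   = ⊥-elim (less w a′ b′ a b h′ (sym e) (ℕₚ.*-monoʳ-≤ w gt))

-- j pixels filling p × q row by row; enlarged by {0,1}² they fill (p + 1) × (q + 1) row by row,
-- so that y + (p + 1) x takes each value modulo j + p + q + 1 once on the enlarged set.
module RowTile (p q j : ℕ) (1≤p : 1 ≤ p) (j≤pq : j ≤ p * q) where
  instance
    p≢0 : ℕ.NonZero p
    p≢0 = ℕ.>-nonZero 1≤p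

  N : ℕ
  N = j + p + q + 1

  cell : ℕ → Pixel
  cell ρ = + (ρ ℕ./ p) , + (ρ ℕ.% p)

  R : List Pixel
  R = map cell (upTo j)

  length-R : length R ≡ j
  length-R = trans (length-map cell (upTo j)) (length-upTo j)

  1≤N : 1 ≤ N
  1≤N = ℕₚ.m≤n+m 1 (j + p + q)

  open Periodic N 1≤N (+ (p + 1)) R

  record Cell (r : Pixel) : Set where
    constructor mkCell
    field
      a b  : ℕ
      eq   : r ≡ (+ a , + b)
      b<p  : b < p
      fits : b + a * p < j

  ∈R⁻ : ∀ {r} → r ∈ R → Cell r
  ∈R⁻ r∈ = let ρ , ρ∈ , e = ∈-map⁻ cell r∈ in
    mkCell (ρ ℕ./ p) (ρ ℕ.% p) e (m%n<n ρ p) (subst (ℕ._< j) (m≡m%n+[m/n]*n ρ p) (∈-upTo⁻ ρ∈))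

  R-unique : Unique R
  R-unique = Uniqueₚ.map⁺ (λ {ρ} {σ} e → trans (m≡m%n+[m/n]*n ρ p)
    (trans (cong₂ (λ s t → s + t * p) (ℤₚ.+-injective (cong proj₂ e)) (ℤₚ.+-injective (cong proj₁ e)))
      (sym (m≡m%n+[m/n]*n σ p)))) (Uniqueₚ.upTo⁺ j)

  module _ {a b i k : ℕ} (b<p : b < p) (fits : b + a * p < j) (i≤1 : i ≤ 1) (k≤1 : k ≤ 1) where
    a<q : a < q
    a<q = ℕₚ.*-cancelˡ-< p a q (below b a p (ℕₚ.<-≤-trans fits j≤pq))
      where
      below : ∀ b a p {m} → b + a * p < m → p * a < m
      below b a p {m} h = linarith (p ∷ a ∷ m ∷ b ∷ [] ∣ᵉ [])
        (κ 1 ⊕ (ν 3 ⊕ ν 1 ⊗ ν 0) ≼ ν 2 ∷ []) (κ 1 ⊕ ν 0 ⊗ ν 1 ≼ ν 2) (h , tt)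

    -- The index is at most `(b + ap) + a + p + 2`, and `b + ap ≤ j - 1` and `a ≤ q - 1` bound this
    -- by `j + p + q = N - 1`.
    enlarged< : b + k + (p + 1) * (a + i) < N
    enlarged< = bound p q j a b i k a<q fits k≤1 (ℕₚ.*-monoʳ-≤ (p + 1) (ℕₚ.+-monoʳ-≤ a i≤1))
      where
      bound : ∀ p q j a b i k → a < q → b + a * p < j → k ≤ 1 → (p + 1) * (a + i) ≤ (p + 1) * (a + 1) →
              b + k + (p + 1) * (a + i) < j + p + q + 1
      bound p q j a b i k h₁ h₂ h₃ h₄ = linarith (b ∷ k ∷ p ∷ a ∷ i ∷ j ∷ q ∷ [] ∣ᵉ [])
        (κ 1 ⊕ ν 3 ≼ ν 6 ∷ κ 1 ⊕ (ν 0 ⊕ ν 3 ⊗ ν 2) ≼ ν 5 ∷ ν 1 ≼ κ 1 ∷ (ν 2 ⊕ κ 1) ⊗ (ν 3 ⊕ ν 4) ≼ (ν 2 ⊕ κ 1) ⊗ (ν 3 ⊕ κ 1) ∷ [])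
        (κ 1 ⊕ (ν 0 ⊕ ν 1 ⊕ (ν 2 ⊕ κ 1) ⊗ (ν 3 ⊕ ν 4)) ≼ ν 5 ⊕ ν 2 ⊕ ν 6 ⊕ κ 1) (h₁ , h₂ , h₃ , h₄ , tt)

    b+k<w : b + k < p + 1
    b+k<w = ℕₚ.+-mono-<-≤ b<p k≤1

  f-cast : ∀ a b → + (b + (p + 1) * a) ≡ + b ℤ.+ + (p + 1) ℤ.* + a
  f-cast a b = cong (λ t → + b ℤ.+ t) (ℤₚ.pos-* (p + 1) a)

  module _ (t : ℤ) (X Y : ℤ) (a b a′ b′ : ℕ) (b<p : b < p) (fits : b + a * p < j) (b′<p : b′ < p) (fits′ : b′ + a′ * p < j)
           (e : Y ℤ.+ + (p + 1) ℤ.* X ≡ + b′ ℤ.+ + (p + 1) ℤ.* + a′ ℤ.+ t ℤ.* + N) where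
    -- The tile pixel `(a , b)` and the near pixel `(X , Y)` share a point after enlargement by 0 or
    -- 1 in each coordinate. Moved to the representative `(a′ , b′)` of `(X , Y)`, that point has
    -- the same residue; residues are unique on the enlarged tile, so it did not move, and `(X , Y)`
    -- is its own representative.
    displaced : ∃[ i ] ∃[ i′ ] (i ≤ 1 × i′ ≤ 1 × + a ℤ.+ + i ≡ X ℤ.+ + i′) →
                ∃[ k ] ∃[ k′ ] (k ≤ 1 × k′ ≤ 1 × + b ℤ.+ + k ≡ Y ℤ.+ + k′) → (+ a′ , + b′) ≡ (X , Y)
    displaced (i , i′ , i≤1 , i′≤1 , ei) (k , k′ , k≤1 , k′≤1 , ek) =
      cong₂ _,_ (back (+ a) X (+ a′) (+ i) (+ i′) ei (cong +_ (proj₁ same))) (back (+ b) Y (+ b′) (+ k) (+ k′) ek (cong +_ (proj₂ same)))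
      where
      rest : ∀ X Y a′ b′ i′ k′ w t n → Y ℤ.+ w ℤ.* X ≡ b′ ℤ.+ w ℤ.* a′ ℤ.+ t ℤ.* n →
             Y ℤ.+ k′ ℤ.+ w ℤ.* (X ℤ.+ i′) ≡ b′ ℤ.+ k′ ℤ.+ w ℤ.* (a′ ℤ.+ i′) ℤ.+ t ℤ.* n
      rest X Y a′ b′ i′ k′ w t n e = linarith ([] ∣ᵉ Y ∷ k′ ∷ w ∷ X ∷ i′ ∷ b′ ∷ a′ ∷ t ∷ n ∷ [])
        (ζ 0 ⊞ ζ 2 ⊠ ζ 3 ≐ᶻ ζ 5 ⊞ ζ 2 ⊠ ζ 6 ⊞ ζ 7 ⊠ ζ 8 ∷ [])
        (ζ 0 ⊞ ζ 1 ⊞ ζ 2 ⊠ (ζ 3 ⊞ ζ 4) ≐ᶻ ζ 5 ⊞ ζ 1 ⊞ ζ 2 ⊠ (ζ 6 ⊞ ζ 4) ⊞ ζ 7 ⊠ ζ 8) (e , tt)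
      lemma : ∀ a b X Y a′ b′ i i′ k k′ w t n → a ℤ.+ i ≡ X ℤ.+ i′ → b ℤ.+ k ≡ Y ℤ.+ k′ →
              Y ℤ.+ w ℤ.* X ≡ b′ ℤ.+ w ℤ.* a′ ℤ.+ t ℤ.* n →
              b ℤ.+ k ℤ.+ w ℤ.* (a ℤ.+ i) ≡ b′ ℤ.+ k′ ℤ.+ w ℤ.* (a′ ℤ.+ i′) ℤ.+ t ℤ.* n
      lemma a b X Y a′ b′ i i′ k k′ w t n ei ek e = trans (cong₂ (λ s t → s ℤ.+ w ℤ.* t) ek ei) (rest X Y a′ b′ i′ k′ w t n e)
      congruent : + (b + k + (p + 1) * (a + i)) ≡ + (b′ + k′ + (p + 1) * (a′ + i′)) ℤ.+ t ℤ.* + N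
      congruent = trans (f-cast (a + i) (b + k))
        (trans (lemma (+ a) (+ b) X Y (+ a′) (+ b′) (+ i) (+ i′) (+ k) (+ k′) (+ (p + 1)) t (+ N) ei ek e)
          (cong (ℤ._+ t ℤ.* + N) (sym (f-cast (a′ + i′) (b′ + k′)))))
      same : a + i ≡ a′ + i′ × b + k ≡ b′ + k′
      same = rowMajor-injective (p + 1) (a + i) (b + k) (a′ + i′) (b′ + k′)
        (b+k<w {a} {b} {i} {k} b<p fits i≤1 k≤1) (b+k<w {a′} {b′} {i′} {k′} b′<p fits′ i′≤1 k′≤1)
        (ℤₚ.+-injective (residue-unique N t
          (ℤ.+<+ (ℕₚ.<-≤-trans (enlarged< {a} {b} {i} {k} b<p fits i≤1 k≤1) (ℕₚ.m≤n+m N (b′ + k′ + (p + 1) * (a′ + i′)))))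
          (ℤ.+<+ (ℕₚ.<-≤-trans (enlarged< {a′} {b′} {i′} {k′} b′<p fits′ i′≤1 k′≤1) (ℕₚ.m≤n+m N (b + k + (p + 1) * (a + i)))))
          congruent))
      back : ∀ a X a′ i i′ → a ℤ.+ i ≡ X ℤ.+ i′ → a ℤ.+ i ≡ a′ ℤ.+ i′ → a′ ≡ X
      back a X a′ i i′ e e′ = linarith ([] ∣ᵉ a′ ∷ X ∷ a ∷ i ∷ i′ ∷ [])
        (ζ 2 ⊞ ζ 3 ≐ᶻ ζ 1 ⊞ ζ 4 ∷ ζ 2 ⊞ ζ 3 ≐ᶻ ζ 0 ⊞ ζ 4 ∷ []) (ζ 0 ≐ᶻ ζ 1) (e , e′ , tt)

  near-closed : ∀ {r r′ s} → r ∈ R → r′ ∈ R → Near eight r s → f s ≈ f r′ → r′ ≡ s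
  near-closed {r} {r′} {s} r∈ r′∈ n c = go (∈R⁻ r∈) (∈R⁻ r′∈) n c
    where
    go : Cell r → Cell r′ → Near eight r s → f s ≈ f r′ → r′ ≡ s
    go (mkCell a b refl b<p fits) (mkCell a′ b′ refl b′<p fits′) n (t , e) =
      displaced t (proj₁ s) (proj₂ s) a b a′ b′ b<p fits b′<p fits′ e
        (unit-difference (+ a) (proj₁ s) (ℕₚ.m⊔n≤o⇒m≤o _ _ n)) (unit-difference (+ b) (proj₂ s) (ℕₚ.m⊔n≤o⇒n≤o ∣ + a ℤ.- proj₁ s ∣ _ n))

  phi : PhiGe eight j (frac j N)
  phi = subst (λ l → PhiGe eight l (frac l N)) length-R
    (tiling⇒PhiGe eight R-unique (λ {r} {r′} r∈ r′∈ c → sym (near-closed r∈ r′∈ (near-refl eight r) c))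
      (λ {r} {r′} {s} r∈ r′∈ a → near-closed {r} {r′} {s} r∈ r′∈ (adj⇒near eight {r} {s} a)))

-- Choice of the box and the value for 8-connectivity

even-or-odd : ∀ n → ∃[ h ] (n ≡ h + h ⊎ n ≡ h + suc h)
even-or-odd zero = 0 , inj₁ refl
even-or-odd (suc n) with even-or-odd n
... | h , inj₁ e = h , inj₂ (trans (cong suc e) (sym (ℕₚ.+-suc h h)))
... | h , inj₂ e = suc h , inj₁ (cong suc e)

-- With c = ⌈2√j⌉, j ≤ ⌊c/2⌋⌈c/2⌉.
near-square : ∀ j c → 4 * j ≤ c * c → ∃[ p ] ∃[ q ] (p + q ≡ c × j ≤ p * q)
near-square j c h with even-or-odd c
... | m , inj₁ refl = m , m , refl , even m j h
  where
  even : ∀ m j → 4 * j ≤ (m + m) * (m + m) → j ≤ m * m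
  even m j h = linarith (j ∷ m ∷ [] ∣ᵉ []) (κ 4 ⊗ ν 0 ≼ (ν 1 ⊕ ν 1) ⊗ (ν 1 ⊕ ν 1) ∷ []) (ν 0 ≼ ν 1 ⊗ ν 1) (h , tt)
... | m , inj₂ refl = m , suc m , refl , odd m j h
  where
  odd : ∀ m j → 4 * j ≤ (m + suc m) * (m + suc m) → j ≤ m * suc m
  odd m j h = linarith (j ∷ m ∷ [] ∣ᵉ [])
    (κ 4 ⊗ ν 0 ≼ (ν 1 ⊕ (κ 1 ⊕ ν 1)) ⊗ (ν 1 ⊕ (κ 1 ⊕ ν 1)) ∷ []) (ν 0 ≼ ν 1 ⊗ (κ 1 ⊕ ν 1)) (h , tt)

lower-bound₈ : ∀ j → 1 ≤ j → PhiGe eight j (term₈ j)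
lower-bound₈ j 1≤j = go (near-square j (ceilSqrt (4 * j)) (ceilSqrt-upper (4 * j)))
  where
  positive : ∀ p q → j ≤ p * q → 1 ≤ p
  positive zero q h = contradiction (ℕₚ.≤-trans 1≤j h) λ ()
  positive (suc p) q h = s≤s z≤n
  go : ∃[ p ] ∃[ q ] (p + q ≡ ceilSqrt (4 * j) × j ≤ p * q) → PhiGe eight j (term₈ j)
  go (p , q , e , h) = subst (λ n → PhiGe eight j (frac j n))
    (cong (ℕ._+ 1) (trans (ℕₚ.+-assoc j p q) (cong (j ℕ.+_) e))) (RowTile.phi p q j (positive p q h) h)

theorem₈ : ∀ k → 1 ≤ k → PhiEq eight k (F₈ k)
theorem₈ k 1≤k = go (maxUpTo-attained term₈ k 1≤k)
  where
  denominator : ∀ i → 1 ≤ i + ceilSqrt (4 * i) + 1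
  denominator i = ℕₚ.m≤n+m 1 (i + ceilSqrt (4 * i))
  go : ∃[ j ] (1 ≤ j × j ≤ k × F₈ k ≡ term₈ j) → PhiEq eight k (F₈ k)
  go (j , 1≤j , j≤k , e) = subst (PhiEq eight k) (sym e)
    ( upper-bound₈ k j _ (denominator j) (λ i 1≤i i≤k → frac-cancel-≤ (denominator i) (denominator j)
        (subst (term₈ i ℚ.≤_) e (maxUpTo-upper term₈ k 1≤i i≤k)))
    , PhiGe-mono {a = term₈ j} j≤k (lower-bound₈ j 1≤j))

-- The extremal images for 4-connectivity. One tile consists of columns that grow, keep their slanted
-- position and shrink again; the black pixels have the residues of the column ends modulo N.

module ColumnTile (A c : ℕ) (β : ℕ → ℕ) (β-zero : β 0 ≡ 0) (β-inc : ∀ i → i < c → β i < β (suc i))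
                  (β-lo : ∀ i → β i + 2 * A ≤ β (suc i)) (β-hi : ∀ i → β (suc i) ≤ β i + 2 * A + 2)
                  (1≤N : 1 ≤ 2 * (A * A) + 2 * A + β c) where
  N M : ℕ
  M = 2 * (A * A) + 2 * A
  N = M + β c

  s : ℤ
  s = + (2 * A + 1)

  -- Column `X` lies at first coordinate `-X`. `lo` and `hi` are the residues of the black pixels at
  -- its ends, and the white ones lie strictly between. The lengths are 1, 3, ..., `2A - 1`, then
  -- between `2A - 1` and `2A + 1`, then `2A - 1`, ..., 3, 1. The shrinking column with `i = 0` is
  -- empty and serves as the successor of the last one.
  data Column (X : ℕ) (lo hi : ℤ) : Set where
    growing   : ∀ i → X + suc i ≡ A → lo ≡ ℤ.- + (2 * (A * suc i)) → hi ≡ ℤ.- + (2 * (A * i) + 2 * i) → Column X lo hi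
    steady    : ∀ i → i < c → X ≡ A + i → lo ≡ + β i → hi ≡ + β (suc i) → Column X lo hi
    shrinking : ∀ i → i ≤ A → X + i ≡ A + A + c →
                lo ≡ + N ℤ.- + (2 * (A * i) + 2 * i) → hi ≡ + N ℤ.- + (2 * (A * i)) → Column X lo hi

  Next : ℕ → ℤ → Set
  Next X g = ∃[ lo ] ∃[ hi ] (Column X lo hi × lo ℤ.≤ g × g ℤ.≤ hi)

  -- A step to the left adds `s` to the residue and ends in the next column or on one of its ends,
  -- so the left neighbour of a tile pixel is in the tile or has the residue of a column end.
  next : ∀ {X lo hi φ} → Column X lo hi → lo ℤ.< φ → φ ℤ.< hi → Next (suc X) (φ ℤ.+ s)
  next {X} {φ = φ} (growing (suc i) e refl refl) l h = _ , _ , growing i (trans (sym (ℕₚ.+-suc X (suc i))) e) refl refl , lower A i φ l , upper A i φ h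
    where
    lower : ∀ A i φ → ℤ.- + (2 * (A * suc (suc i))) ℤ.< φ → ℤ.- + (2 * (A * suc i)) ℤ.≤ φ ℤ.+ + (2 * A + 1)
    lower A i φ l = linarith (A ∷ i ∷ [] ∣ᵉ φ ∷ [])
      (⊟ ⌞ κ 2 ⊗ (ν 0 ⊗ (κ 1 ⊕ (κ 1 ⊕ ν 1))) ⌟ ≺ᶻ ζ 0 ∷ [])
      (⊟ ⌞ κ 2 ⊗ (ν 0 ⊗ (κ 1 ⊕ ν 1)) ⌟ ≼ᶻ ζ 0 ⊞ ⌞ κ 2 ⊗ ν 0 ⊕ κ 1 ⌟) (l , tt)
    upper : ∀ A i φ → φ ℤ.< ℤ.- + (2 * (A * suc i) + 2 * suc i) → φ ℤ.+ + (2 * A + 1) ℤ.≤ ℤ.- + (2 * (A * i) + 2 * i)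
    upper A i φ h = linarith (A ∷ i ∷ [] ∣ᵉ φ ∷ [])
      (ζ 0 ≺ᶻ ⊟ ⌞ κ 2 ⊗ (ν 0 ⊗ (κ 1 ⊕ ν 1)) ⊕ κ 2 ⊗ (κ 1 ⊕ ν 1) ⌟ ∷ [])
      (ζ 0 ⊞ ⌞ κ 2 ⊗ ν 0 ⊕ κ 1 ⌟ ≼ᶻ ⊟ ⌞ κ 2 ⊗ (ν 0 ⊗ ν 1) ⊕ κ 2 ⊗ ν 1 ⌟) (h , tt)
  next {X} {φ = φ} (growing zero e refl refl) l h = go (ℕₚ.m≤n⇒m<n∨m≡n (z≤n {c}))
    where
    lower : ∀ A φ b → b ≡ 0 → ℤ.- + (2 * (A * 1)) ℤ.< φ → + b ℤ.≤ φ ℤ.+ + (2 * A + 1)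
    lower A φ b e l = linarith (b ∷ A ∷ [] ∣ᵉ φ ∷ [])
      (⊟ ⌞ κ 2 ⊗ (ν 1 ⊗ κ 1) ⌟ ≺ᶻ ζ 0 ∷ ν 0 ≐ κ 0 ∷ []) (ι 0 ≼ᶻ ζ 0 ⊞ ⌞ κ 2 ⊗ ν 1 ⊕ κ 1 ⌟) (l , e , tt)
    upper : ∀ A φ b b₁ → b ≡ 0 → b + 2 * A ≤ b₁ → φ ℤ.< ℤ.- + (2 * (A * 0) + 0) → φ ℤ.+ + (2 * A + 1) ℤ.≤ + b₁
    upper A φ b b₁ e k h = linarith (A ∷ b₁ ∷ b ∷ [] ∣ᵉ φ ∷ [])
      (ζ 0 ≺ᶻ ⊟ ⌞ κ 2 ⊗ (ν 0 ⊗ κ 0) ⊕ κ 0 ⌟ ∷ ν 2 ⊕ κ 2 ⊗ ν 0 ≼ ν 1 ∷ ν 2 ≐ κ 0 ∷ []) (ζ 0 ⊞ ⌞ κ 2 ⊗ ν 0 ⊕ κ 1 ⌟ ≼ᶻ ι 1)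
      (h , k , e , tt)
    lower′ : ∀ A φ b → b ≡ 0 → ℤ.- + (2 * (A * 1)) ℤ.< φ →
             + (2 * (A * A) + 2 * A + b) ℤ.- + (2 * (A * A) + 2 * A) ℤ.≤ φ ℤ.+ + (2 * A + 1)
    lower′ A φ b e l = linarith (A ∷ b ∷ [] ∣ᵉ φ ∷ [])
      (⊟ ⌞ κ 2 ⊗ (ν 0 ⊗ κ 1) ⌟ ≺ᶻ ζ 0 ∷ ν 1 ≐ κ 0 ∷ [])
      (⌞ κ 2 ⊗ (ν 0 ⊗ ν 0) ⊕ κ 2 ⊗ ν 0 ⊕ ν 1 ⌟ ⊖ ⌞ κ 2 ⊗ (ν 0 ⊗ ν 0) ⊕ κ 2 ⊗ ν 0 ⌟ ≼ᶻ ζ 0 ⊞ ⌞ κ 2 ⊗ ν 0 ⊕ κ 1 ⌟)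
      (l , e , tt)
    upper′ : ∀ A φ b → φ ℤ.< ℤ.- + (2 * (A * 0) + 0) →
             φ ℤ.+ + (2 * A + 1) ℤ.≤ + (2 * (A * A) + 2 * A + b) ℤ.- + (2 * (A * A))
    upper′ A φ b h = linarith (A ∷ b ∷ [] ∣ᵉ φ ∷ [])
      (ζ 0 ≺ᶻ ⊟ ⌞ κ 2 ⊗ (ν 0 ⊗ κ 0) ⊕ κ 0 ⌟ ∷ [])
      (ζ 0 ⊞ ⌞ κ 2 ⊗ ν 0 ⊕ κ 1 ⌟ ≼ᶻ ⌞ κ 2 ⊗ (ν 0 ⊗ ν 0) ⊕ κ 2 ⊗ ν 0 ⊕ ν 1 ⌟ ⊖ ⌞ κ 2 ⊗ (ν 0 ⊗ ν 0) ⌟) (h , tt)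
    place : ∀ X A → X + 1 ≡ A → suc X ≡ A + 0
    place X A e = linarith (X ∷ A ∷ [] ∣ᵉ []) (ν 0 ⊕ κ 1 ≐ ν 1 ∷ []) (κ 1 ⊕ ν 0 ≐ ν 1 ⊕ κ 0) (e , tt)
    place′ : ∀ X A c → X + 1 ≡ A → 0 ≡ c → suc X + A ≡ A + A + c
    place′ X A c e e′ = linarith (X ∷ A ∷ c ∷ [] ∣ᵉ [])
      (ν 0 ⊕ κ 1 ≐ ν 1 ∷ κ 0 ≐ ν 2 ∷ []) (κ 1 ⊕ ν 0 ⊕ ν 1 ≐ ν 1 ⊕ ν 1 ⊕ ν 2) (e , e′ , tt)
    -- For `c = 0` there are no steady columns, and the last growing one is followed directly by a
    -- shrinking one.
    go : 0 < c ⊎ 0 ≡ c → Next (suc X) (φ ℤ.+ s)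
    go (inj₁ 0<c) = _ , _ , steady 0 0<c (place X A e) refl refl , lower A φ (β 0) β-zero l , upper A φ (β 0) (β 1) β-zero (β-lo 0) h
    go (inj₂ 0≡c) = _ , _ , shrinking A ℕₚ.≤-refl (place′ X A c e 0≡c) refl refl ,
      lower′ A φ (β c) (trans (cong β (sym 0≡c)) β-zero) l , upper′ A φ (β c) h
  next {X} {φ = φ} (steady i i<c refl refl refl) l h = go (ℕₚ.m≤n⇒m<n∨m≡n i<c)
    where
    lower : ∀ A b b₁ φ → b₁ ≤ b + 2 * A + 2 → + b ℤ.< φ → + b₁ ℤ.≤ φ ℤ.+ + (2 * A + 1)
    lower A b b₁ φ k l = linarith (b₁ ∷ A ∷ b ∷ [] ∣ᵉ φ ∷ [])
      (ν 0 ≼ ν 2 ⊕ κ 2 ⊗ ν 1 ⊕ κ 2 ∷ ι 2 ≺ᶻ ζ 0 ∷ []) (ι 0 ≼ᶻ ζ 0 ⊞ ⌞ κ 2 ⊗ ν 1 ⊕ κ 1 ⌟) (k , l , tt)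
    upper : ∀ A b₁ b₂ φ → b₁ + 2 * A ≤ b₂ → φ ℤ.< + b₁ → φ ℤ.+ + (2 * A + 1) ℤ.≤ + b₂
    upper A b₁ b₂ φ k h = linarith (A ∷ b₂ ∷ b₁ ∷ [] ∣ᵉ φ ∷ [])
      (ν 2 ⊕ κ 2 ⊗ ν 0 ≼ ν 1 ∷ ζ 0 ≺ᶻ ι 2 ∷ []) (ζ 0 ⊞ ⌞ κ 2 ⊗ ν 0 ⊕ κ 1 ⌟ ≼ᶻ ι 1) (k , h , tt)
    lower′ : ∀ A b b₁ φ → b₁ ≤ b + 2 * A + 2 → + b ℤ.< φ →
             + (2 * (A * A) + 2 * A + b₁) ℤ.- + (2 * (A * A) + 2 * A) ℤ.≤ φ ℤ.+ + (2 * A + 1)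
    lower′ A b b₁ φ k l = linarith (A ∷ b₁ ∷ b ∷ [] ∣ᵉ φ ∷ [])
      (ν 1 ≼ ν 2 ⊕ κ 2 ⊗ ν 0 ⊕ κ 2 ∷ ι 2 ≺ᶻ ζ 0 ∷ [])
      (⌞ κ 2 ⊗ (ν 0 ⊗ ν 0) ⊕ κ 2 ⊗ ν 0 ⊕ ν 1 ⌟ ⊖ ⌞ κ 2 ⊗ (ν 0 ⊗ ν 0) ⊕ κ 2 ⊗ ν 0 ⌟ ≼ᶻ ζ 0 ⊞ ⌞ κ 2 ⊗ ν 0 ⊕ κ 1 ⌟)
      (k , l , tt)
    upper′ : ∀ A b₁ φ → φ ℤ.< + b₁ → φ ℤ.+ + (2 * A + 1) ℤ.≤ + (2 * (A * A) + 2 * A + b₁) ℤ.- + (2 * (A * A))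
    upper′ A b₁ φ h = linarith (A ∷ b₁ ∷ [] ∣ᵉ φ ∷ [])
      (ζ 0 ≺ᶻ ι 1 ∷ []) (ζ 0 ⊞ ⌞ κ 2 ⊗ ν 0 ⊕ κ 1 ⌟ ≼ᶻ ⌞ κ 2 ⊗ (ν 0 ⊗ ν 0) ⊕ κ 2 ⊗ ν 0 ⊕ ν 1 ⌟ ⊖ ⌞ κ 2 ⊗ (ν 0 ⊗ ν 0) ⌟)
      (h , tt)
    place : ∀ A i c → suc i ≡ c → suc (A + i) + A ≡ A + A + c
    place A i c e = linarith (A ∷ i ∷ c ∷ [] ∣ᵉ []) (κ 1 ⊕ ν 1 ≐ ν 2 ∷ []) (κ 1 ⊕ (ν 0 ⊕ ν 1) ⊕ ν 0 ≐ ν 0 ⊕ ν 0 ⊕ ν 2) (e , tt)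
    go : suc i < c ⊎ suc i ≡ c → Next (suc (A + i)) (φ ℤ.+ s)
    go (inj₁ si<c) = _ , _ , steady (suc i) si<c (sym (ℕₚ.+-suc A i)) refl refl ,
      lower A (β i) (β (suc i)) φ (β-hi i) l , upper A (β (suc i)) (β (suc (suc i))) φ (β-lo (suc i)) h
    go (inj₂ refl) = _ , _ , shrinking A ℕₚ.≤-refl (place A i c refl) refl refl ,
      lower′ A (β i) (β (suc i)) φ (β-hi i) l , upper′ A (β (suc i)) φ h
  next {X} {φ = φ} (shrinking zero _ _ refl refl) l h = ⊥-elim (absurd A (+ N) φ l h)
    where
    absurd : ∀ A N φ → N ℤ.- + (2 * (A * 0) + 0) ℤ.< φ → φ ℤ.< N ℤ.- + (2 * (A * 0)) → ⊥
    absurd A N φ l h = linarith (A ∷ [] ∣ᵉ N ∷ φ ∷ [])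
      (ζ 0 ⊖ ⌞ κ 2 ⊗ (ν 0 ⊗ κ 0) ⊕ κ 0 ⌟ ≺ᶻ ζ 1 ∷ ζ 1 ≺ᶻ ζ 0 ⊖ ⌞ κ 2 ⊗ (ν 0 ⊗ κ 0) ⌟ ∷ []) falsum (l , h , tt)
  next {X} {φ = φ} (shrinking (suc i) i≤ e refl refl) l h =
    _ , _ , shrinking i (ℕₚ.<⇒≤ i≤) (trans (sym (ℕₚ.+-suc X i)) e) refl refl , lower A i (+ N) φ l , upper A i (+ N) φ h
    where
    lower : ∀ A i N φ → N ℤ.- + (2 * (A * suc i) + 2 * suc i) ℤ.< φ → N ℤ.- + (2 * (A * i) + 2 * i) ℤ.≤ φ ℤ.+ + (2 * A + 1)
    lower A i N φ l = linarith (A ∷ i ∷ [] ∣ᵉ N ∷ φ ∷ [])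
      (ζ 0 ⊖ ⌞ κ 2 ⊗ (ν 0 ⊗ (κ 1 ⊕ ν 1)) ⊕ κ 2 ⊗ (κ 1 ⊕ ν 1) ⌟ ≺ᶻ ζ 1 ∷ [])
      (ζ 0 ⊖ ⌞ κ 2 ⊗ (ν 0 ⊗ ν 1) ⊕ κ 2 ⊗ ν 1 ⌟ ≼ᶻ ζ 1 ⊞ ⌞ κ 2 ⊗ ν 0 ⊕ κ 1 ⌟) (l , tt)
    upper : ∀ A i N φ → φ ℤ.< N ℤ.- + (2 * (A * suc i)) → φ ℤ.+ + (2 * A + 1) ℤ.≤ N ℤ.- + (2 * (A * i))
    upper A i N φ h = linarith (A ∷ i ∷ [] ∣ᵉ φ ∷ N ∷ [])
      (ζ 0 ≺ᶻ ζ 1 ⊖ ⌞ κ 2 ⊗ (ν 0 ⊗ (κ 1 ⊕ ν 1)) ⌟ ∷ []) (ζ 0 ⊞ ⌞ κ 2 ⊗ ν 0 ⊕ κ 1 ⌟ ≼ᶻ ζ 1 ⊖ ⌞ κ 2 ⊗ (ν 0 ⊗ ν 1) ⌟)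
      (h , tt)

  -- Moved by -N, the shrinking columns lie between the growing ones, so that all columns lie in [-M , β c].
  data Moved (X : ℕ) (lo hi : ℤ) : Set where
    growing   : ∀ i → i < A → X + suc i ≡ A → lo ≡ ℤ.- + (2 * (A * suc i)) → hi ≡ ℤ.- + (2 * (A * i) + 2 * i) → Moved X lo hi
    steady    : ∀ i → i < c → X ≡ A + i → lo ≡ + β i → hi ≡ + β (suc i) → Moved X lo hi
    shrinking : ∀ i → i ≤ A → X + i ≡ A + A + c →
                lo ≡ ℤ.- + (2 * (A * i) + 2 * i) → hi ≡ ℤ.- + (2 * (A * i)) → Moved X lo hi

  shift : ∀ {X lo hi} → Column X lo hi → ℤ
  shift (growing _ _ _ _)       = 0ℤ
  shift (steady _ _ _ _ _)      = 0ℤ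
  shift (shrinking _ _ _ _ _)   = 1ℤ

  move : ∀ {X lo hi} (C : Column X lo hi) → Moved X (lo ℤ.- shift C ℤ.* + N) (hi ℤ.- shift C ℤ.* + N)
  move {X} (growing i e refl refl) = growing i (ℕₚ.≤-trans (ℕₚ.m≤n+m (suc i) X) (ℕₚ.≤-reflexive e)) e (ℤₚ.+-identityʳ _) (ℤₚ.+-identityʳ _)
  move (steady i i<c e refl refl) = steady i i<c e (ℤₚ.+-identityʳ _) (ℤₚ.+-identityʳ _)
  move (shrinking i i≤ e refl refl) = shrinking i i≤ e (cancel (+ N) _) (cancel (+ N) _)
    where
    cancel : ∀ n x → n ℤ.- x ℤ.- 1ℤ ℤ.* n ≡ ℤ.- x
    cancel = solve-∀

  β-mono : ∀ {i j} → i ≤ j → β i ≤ β j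
  β-mono {j = zero} z≤n = ℕₚ.≤-refl
  β-mono {i} {suc j} h = [ (λ i≤j → ℕₚ.≤-trans (β-mono (ℕₚ.≤-pred i≤j)) (ℕₚ.≤-trans (ℕₚ.m≤m+n (β j) (2 * A)) (β-lo j))) , (λ { refl → ℕₚ.≤-refl }) ]′ (ℕₚ.m≤n⇒m<n∨m≡n h)

  A*-mono : ∀ {i j} → i ≤ j → A * i ≤ A * j
  A*-mono = ℕₚ.*-monoʳ-≤ A

  moved-lo : ∀ {X lo hi} → Moved X lo hi → ℤ.- + M ℤ.≤ lo
  moved-lo (growing i i<A _ refl _) = bound A i (A*-mono i<A)
    where
    bound : ∀ A i → A * suc i ≤ A * A → ℤ.- + (2 * (A * A) + 2 * A) ℤ.≤ ℤ.- + (2 * (A * suc i))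
    bound A i h = linarith (A ∷ i ∷ [] ∣ᵉ [])
      (ν 0 ⊗ (κ 1 ⊕ ν 1) ≼ ν 0 ⊗ ν 0 ∷ []) (⊟ ⌞ κ 2 ⊗ (ν 0 ⊗ ν 0) ⊕ κ 2 ⊗ ν 0 ⌟ ≼ᶻ ⊟ ⌞ κ 2 ⊗ (ν 0 ⊗ (κ 1 ⊕ ν 1)) ⌟)
      (h , tt)
  moved-lo (steady i _ _ refl _) = bound M (β i)
    where
    bound : ∀ m b → ℤ.- + m ℤ.≤ + b
    bound m b = linarith (m ∷ b ∷ [] ∣ᵉ []) [] (⊟ ι 0 ≼ᶻ ι 1) tt
  moved-lo (shrinking i i≤A _ refl _) = bound A i (A*-mono i≤A) i≤A
    where
    bound : ∀ A i → A * i ≤ A * A → i ≤ A → ℤ.- + (2 * (A * A) + 2 * A) ℤ.≤ ℤ.- + (2 * (A * i) + 2 * i)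
    bound A i h h′ = linarith (A ∷ i ∷ [] ∣ᵉ [])
      (ν 0 ⊗ ν 1 ≼ ν 0 ⊗ ν 0 ∷ ν 1 ≼ ν 0 ∷ [])
      (⊟ ⌞ κ 2 ⊗ (ν 0 ⊗ ν 0) ⊕ κ 2 ⊗ ν 0 ⌟ ≼ᶻ ⊟ ⌞ κ 2 ⊗ (ν 0 ⊗ ν 1) ⊕ κ 2 ⊗ ν 1 ⌟) (h , h′ , tt)

  moved-hi : ∀ {X lo hi} → Moved X lo hi → hi ℤ.≤ + β c
  moved-hi (growing i _ _ _ refl) = ℤₚ.≤-trans ℤₚ.neg-≤-pos (ℤ.+≤+ z≤n)
  moved-hi (steady i i<c _ _ refl) = ℤ.+≤+ (β-mono i<c)
  moved-hi (shrinking i _ _ _ refl) = ℤₚ.≤-trans ℤₚ.neg-≤-pos (ℤ.+≤+ z≤n)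

  index : ∀ A i i′ → A * i < A * suc i′ → i ≤ i′
  index A i i′ h = ℕₚ.≤-pred (ℕₚ.*-cancelˡ-< A i (suc i′) h)

  -- From 0 downwards the moved intervals are growing 0, shrinking 1, growing 1, shrinking 2, ...,
  -- shrinking `A`, and from 0 upwards the steady ones. Neighbours share only an end, so a point
  -- inside one of them lies in no other, ends included.
  moved-disjoint : ∀ {X lo hi X′ lo′ hi′ g} → Moved X lo hi → Moved X′ lo′ hi′ → lo ℤ.≤ g → g ℤ.≤ hi → lo′ ℤ.< g → g ℤ.< hi′ → X ≡ X′
  moved-disjoint {X} {X′ = X′} {g = g} (growing i i<A e refl refl) (growing i′ i′<A e′ refl refl) l h l′ h′ =
    ℕₚ.+-cancelʳ-≡ (suc i) X X′ (trans e (trans (sym e′) (cong (λ t → X′ + suc t) (sym i≡i′))))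
    where
    p : ∀ A i i′ g → g ℤ.≤ ℤ.- + (2 * (A * i) + 2 * i) → ℤ.- + (2 * (A * suc i′)) ℤ.< g → A * i < A * suc i′
    p A i i′ g h l = linarith (A ∷ i ∷ i′ ∷ [] ∣ᵉ g ∷ [])
      (ζ 0 ≼ᶻ ⊟ ⌞ κ 2 ⊗ (ν 0 ⊗ ν 1) ⊕ κ 2 ⊗ ν 1 ⌟ ∷ ⊟ ⌞ κ 2 ⊗ (ν 0 ⊗ (κ 1 ⊕ ν 2)) ⌟ ≺ᶻ ζ 0 ∷ [])
      (κ 1 ⊕ ν 0 ⊗ ν 1 ≼ ν 0 ⊗ (κ 1 ⊕ ν 2)) (h , l , tt)
    q : ∀ A i i′ g → g ℤ.< ℤ.- + (2 * (A * i) + 2 * i) → ℤ.- + (2 * (A * suc i′)) ℤ.≤ g → A * i < A * suc i′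
    q A i i′ g h l = linarith (A ∷ i ∷ i′ ∷ [] ∣ᵉ g ∷ [])
      (ζ 0 ≺ᶻ ⊟ ⌞ κ 2 ⊗ (ν 0 ⊗ ν 1) ⊕ κ 2 ⊗ ν 1 ⌟ ∷ ⊟ ⌞ κ 2 ⊗ (ν 0 ⊗ (κ 1 ⊕ ν 2)) ⌟ ≼ᶻ ζ 0 ∷ [])
      (κ 1 ⊕ ν 0 ⊗ ν 1 ≼ ν 0 ⊗ (κ 1 ⊕ ν 2)) (h , l , tt)
    i≡i′ : i ≡ i′
    i≡i′ = ℕₚ.≤-antisym (index A i i′ (p A i i′ g h l′)) (index A i′ i (q A i′ i g h′ l))
  moved-disjoint {g = g} (growing i i<A e refl refl) (steady i′ _ _ refl _) l h l′ h′ = ⊥-elim (absurd _ (β i′) g h l′)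
    where
    absurd : ∀ a b g → g ℤ.≤ ℤ.- + a → + b ℤ.< g → ⊥
    absurd a b g h l = linarith (a ∷ b ∷ [] ∣ᵉ g ∷ []) (ζ 0 ≼ᶻ ⊟ ι 0 ∷ ι 1 ≺ᶻ ζ 0 ∷ []) falsum (h , l , tt)
  moved-disjoint {g = g} (growing i i<A e refl refl) (shrinking i′ i′≤A _ refl refl) l h l′ h′ = ⊥-elim (absurd A i i′ g i≡i′ h l′)
    where
    p : ∀ A i i′ g → i′ ≤ A → g ℤ.≤ ℤ.- + (2 * (A * i) + 2 * i) → ℤ.- + (2 * (A * i′) + 2 * i′) ℤ.< g → A * i < A * suc i′
    p A i i′ g k h l = linarith (A ∷ i ∷ i′ ∷ [] ∣ᵉ g ∷ [])
      (ζ 0 ≼ᶻ ⊟ ⌞ κ 2 ⊗ (ν 0 ⊗ ν 1) ⊕ κ 2 ⊗ ν 1 ⌟ ∷ ⊟ ⌞ κ 2 ⊗ (ν 0 ⊗ ν 2) ⊕ κ 2 ⊗ ν 2 ⌟ ≺ᶻ ζ 0 ∷ ν 2 ≼ ν 0 ∷ [])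
      (κ 1 ⊕ ν 0 ⊗ ν 1 ≼ ν 0 ⊗ (κ 1 ⊕ ν 2)) (h , l , k , tt)
    q : ∀ A i i′ g → g ℤ.< ℤ.- + (2 * (A * i′)) → ℤ.- + (2 * (A * suc i)) ℤ.≤ g → A * i′ < A * suc i
    q A i i′ g h l = linarith (A ∷ i′ ∷ i ∷ [] ∣ᵉ g ∷ [])
      (ζ 0 ≺ᶻ ⊟ ⌞ κ 2 ⊗ (ν 0 ⊗ ν 1) ⌟ ∷ ⊟ ⌞ κ 2 ⊗ (ν 0 ⊗ (κ 1 ⊕ ν 2)) ⌟ ≼ᶻ ζ 0 ∷ [])
      (κ 1 ⊕ ν 0 ⊗ ν 1 ≼ ν 0 ⊗ (κ 1 ⊕ ν 2)) (h , l , tt)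
    i≡i′ : i ≡ i′
    i≡i′ = ℕₚ.≤-antisym (index A i i′ (p A i i′ g i′≤A h l′)) (index A i′ i (q A i i′ g h′ l))
    absurd : ∀ A i i′ g → i ≡ i′ → g ℤ.≤ ℤ.- + (2 * (A * i) + 2 * i) → ℤ.- + (2 * (A * i′) + 2 * i′) ℤ.< g → ⊥
    absurd A i .i g refl h l = linarith (A ∷ i ∷ [] ∣ᵉ g ∷ [])
      (ζ 0 ≼ᶻ ⊟ ⌞ κ 2 ⊗ (ν 0 ⊗ ν 1) ⊕ κ 2 ⊗ ν 1 ⌟ ∷ ⊟ ⌞ κ 2 ⊗ (ν 0 ⊗ ν 1) ⊕ κ 2 ⊗ ν 1 ⌟ ≺ᶻ ζ 0 ∷ []) falsum (h , l , tt)
  moved-disjoint {g = g} (steady i _ _ refl refl) (growing i′ _ _ refl refl) l h l′ h′ = ⊥-elim (absurd _ (β i) g l h′)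
    where
    absurd : ∀ a b g → + b ℤ.≤ g → g ℤ.< ℤ.- + a → ⊥
    absurd a b g h l = linarith (b ∷ a ∷ [] ∣ᵉ g ∷ []) (ι 0 ≼ᶻ ζ 0 ∷ ζ 0 ≺ᶻ ⊟ ι 1 ∷ []) falsum (h , l , tt)
  moved-disjoint {g = g} (steady i _ e refl refl) (steady i′ _ e′ refl refl) l h l′ h′ = trans e (trans (cong (A ℕ.+_) i≡i′) (sym e′))
    where
    p : ∀ b b′ g → + b ℤ.≤ g → g ℤ.< + b′ → b < b′
    p b b′ g h l = linarith (b ∷ b′ ∷ [] ∣ᵉ g ∷ []) (ι 0 ≼ᶻ ζ 0 ∷ ζ 0 ≺ᶻ ι 1 ∷ []) (κ 1 ⊕ ν 0 ≼ ν 1) (h , l , tt)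
    q : ∀ b b′ g → + b ℤ.< g → g ℤ.≤ + b′ → b < b′
    q b b′ g h l = linarith (b ∷ b′ ∷ [] ∣ᵉ g ∷ []) (ι 0 ≺ᶻ ζ 0 ∷ ζ 0 ≼ᶻ ι 1 ∷ []) (κ 1 ⊕ ν 0 ≼ ν 1) (h , l , tt)
    before : ∀ {i j} → β i < β (suc j) → i ≤ j
    before {i} {j} h = ℕₚ.≮⇒≥ λ j<i → ℕₚ.<⇒≱ h (β-mono j<i)
    i≡i′ : i ≡ i′
    i≡i′ = ℕₚ.≤-antisym (before (p _ _ g l h′)) (before (q _ _ g l′ h))
  moved-disjoint {g = g} (steady i _ _ refl refl) (shrinking i′ _ _ refl refl) l h l′ h′ = ⊥-elim (absurd _ (β i) g l h′)
    where
    absurd : ∀ a b g → + b ℤ.≤ g → g ℤ.< ℤ.- + a → ⊥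
    absurd a b g h l = linarith (b ∷ a ∷ [] ∣ᵉ g ∷ []) (ι 0 ≼ᶻ ζ 0 ∷ ζ 0 ≺ᶻ ⊟ ι 1 ∷ []) falsum (h , l , tt)
  moved-disjoint {g = g} (shrinking i i≤A _ refl refl) (growing i′ i′<A _ refl refl) l h l′ h′ = ⊥-elim (absurd A i i′ g i≡i′ l h′)
    where
    p : ∀ A i i′ g → g ℤ.≤ ℤ.- + (2 * (A * i)) → ℤ.- + (2 * (A * suc i′)) ℤ.< g → A * i < A * suc i′
    p A i i′ g h l = linarith (A ∷ i ∷ i′ ∷ [] ∣ᵉ g ∷ [])
      (ζ 0 ≼ᶻ ⊟ ⌞ κ 2 ⊗ (ν 0 ⊗ ν 1) ⌟ ∷ ⊟ ⌞ κ 2 ⊗ (ν 0 ⊗ (κ 1 ⊕ ν 2)) ⌟ ≺ᶻ ζ 0 ∷ [])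
      (κ 1 ⊕ ν 0 ⊗ ν 1 ≼ ν 0 ⊗ (κ 1 ⊕ ν 2)) (h , l , tt)
    q : ∀ A i i′ g → i ≤ A → g ℤ.< ℤ.- + (2 * (A * i′) + 2 * i′) → ℤ.- + (2 * (A * i) + 2 * i) ℤ.≤ g → A * i′ < A * suc i
    q A i i′ g k h l = linarith (A ∷ i′ ∷ i ∷ [] ∣ᵉ g ∷ [])
      (ζ 0 ≺ᶻ ⊟ ⌞ κ 2 ⊗ (ν 0 ⊗ ν 1) ⊕ κ 2 ⊗ ν 1 ⌟ ∷ ⊟ ⌞ κ 2 ⊗ (ν 0 ⊗ ν 2) ⊕ κ 2 ⊗ ν 2 ⌟ ≼ᶻ ζ 0 ∷ ν 2 ≼ ν 0 ∷ [])
      (κ 1 ⊕ ν 0 ⊗ ν 1 ≼ ν 0 ⊗ (κ 1 ⊕ ν 2)) (h , l , k , tt)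
    i≡i′ : i ≡ i′
    i≡i′ = ℕₚ.≤-antisym (index A i i′ (p A i i′ g h l′)) (index A i′ i (q A i i′ g i≤A h′ l))
    absurd : ∀ A i i′ g → i ≡ i′ → ℤ.- + (2 * (A * i) + 2 * i) ℤ.≤ g → g ℤ.< ℤ.- + (2 * (A * i′) + 2 * i′) → ⊥
    absurd A i .i g refl h l = linarith (A ∷ i ∷ [] ∣ᵉ g ∷ [])
      (⊟ ⌞ κ 2 ⊗ (ν 0 ⊗ ν 1) ⊕ κ 2 ⊗ ν 1 ⌟ ≼ᶻ ζ 0 ∷ ζ 0 ≺ᶻ ⊟ ⌞ κ 2 ⊗ (ν 0 ⊗ ν 1) ⊕ κ 2 ⊗ ν 1 ⌟ ∷ []) falsum (h , l , tt)
  moved-disjoint {g = g} (shrinking i i≤A _ refl refl) (steady i′ _ _ refl _) l h l′ h′ = ⊥-elim (absurd _ (β i′) g h l′)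
    where
    absurd : ∀ a b g → g ℤ.≤ ℤ.- + a → + b ℤ.< g → ⊥
    absurd a b g h l = linarith (a ∷ b ∷ [] ∣ᵉ g ∷ []) (ζ 0 ≼ᶻ ⊟ ι 0 ∷ ι 1 ≺ᶻ ζ 0 ∷ []) falsum (h , l , tt)
  moved-disjoint {X} {X′ = X′} {g = g} (shrinking i i≤A e refl refl) (shrinking i′ i′≤A e′ refl refl) l h l′ h′ =
    ℕₚ.+-cancelʳ-≡ i X X′ (trans e (trans (sym e′) (cong (λ t → X′ + t) (sym i≡i′))))
    where
    p : ∀ A i i′ g → i′ ≤ A → g ℤ.≤ ℤ.- + (2 * (A * i)) → ℤ.- + (2 * (A * i′) + 2 * i′) ℤ.< g → A * i < A * suc i′
    p A i i′ g k h l = linarith (A ∷ i ∷ i′ ∷ [] ∣ᵉ g ∷ [])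
      (ζ 0 ≼ᶻ ⊟ ⌞ κ 2 ⊗ (ν 0 ⊗ ν 1) ⌟ ∷ ⊟ ⌞ κ 2 ⊗ (ν 0 ⊗ ν 2) ⊕ κ 2 ⊗ ν 2 ⌟ ≺ᶻ ζ 0 ∷ ν 2 ≼ ν 0 ∷ [])
      (κ 1 ⊕ ν 0 ⊗ ν 1 ≼ ν 0 ⊗ (κ 1 ⊕ ν 2)) (h , l , k , tt)
    q : ∀ A i i′ g → i ≤ A → g ℤ.< ℤ.- + (2 * (A * i′)) → ℤ.- + (2 * (A * i) + 2 * i) ℤ.≤ g → A * i′ < A * suc i
    q A i i′ g k h l = linarith (A ∷ i′ ∷ i ∷ [] ∣ᵉ g ∷ [])
      (ζ 0 ≺ᶻ ⊟ ⌞ κ 2 ⊗ (ν 0 ⊗ ν 1) ⌟ ∷ ⊟ ⌞ κ 2 ⊗ (ν 0 ⊗ ν 2) ⊕ κ 2 ⊗ ν 2 ⌟ ≼ᶻ ζ 0 ∷ ν 2 ≼ ν 0 ∷ [])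
      (κ 1 ⊕ ν 0 ⊗ ν 1 ≼ ν 0 ⊗ (κ 1 ⊕ ν 2)) (h , l , k , tt)
    i≡i′ : i ≡ i′
    i≡i′ = ℕₚ.≤-antisym (index A i i′ (p A i i′ g i′≤A h l′)) (index A i′ i (q A i i′ g i≤A h′ l))

  right-end : ∀ {X lo hi} (C : Column X lo hi) → (X < A + c × shift C ≡ 0ℤ) ⊎ (A + c ≤ X × shift C ≡ 1ℤ)
  right-end {X} (growing i e _ _) = inj₁ (before X A c i e , refl)
    where
    before : ∀ X A c i → X + suc i ≡ A → X < A + c
    before X A c i e = linarith (X ∷ A ∷ c ∷ i ∷ [] ∣ᵉ []) (ν 0 ⊕ (κ 1 ⊕ ν 3) ≐ ν 1 ∷ []) (κ 1 ⊕ ν 0 ≼ ν 1 ⊕ ν 2) (e , tt)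
  right-end (steady i i<c refl _ _) = inj₁ (ℕₚ.+-monoʳ-< A i<c , refl)
  right-end {X} (shrinking i i≤A e _ _) = inj₂ (after X A c i i≤A e , refl)
    where
    after : ∀ X A c i → i ≤ A → X + i ≡ A + A + c → A + c ≤ X
    after X A c i h e = linarith (A ∷ c ∷ X ∷ i ∷ [] ∣ᵉ [])
      (ν 3 ≼ ν 0 ∷ ν 2 ⊕ ν 3 ≐ ν 0 ⊕ ν 0 ⊕ ν 1 ∷ []) (ν 0 ⊕ ν 1 ≼ ν 2) (h , e , tt)

  shift-unique : ∀ {X lo hi lo′ hi′} (C : Column X lo hi) (C′ : Column X lo′ hi′) → shift C ≡ shift C′
  shift-unique C C′ with right-end C | right-end C′
  ... | inj₁ (_ , e) | inj₁ (_ , e′) = trans e (sym e′)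
  ... | inj₂ (_ , e) | inj₂ (_ , e′) = trans e (sym e′)
  ... | inj₁ (h , _) | inj₂ (h′ , _) = contradiction h′ (ℕₚ.<⇒≱ h)
  ... | inj₂ (h , _) | inj₁ (h′ , _) = contradiction h (ℕₚ.<⇒≱ h′)

  -- After the move all residues lie in an interval of length `N` and `φ` is not at its ends, so
  -- congruence becomes equality and `moved-disjoint` gives the same column. The column number
  -- decides whether the move by `N` took place, hence the original residues agree as well.
  disjoint : ∀ {X lo hi X′ lo′ hi′ g φ} t → Column X lo hi → Column X′ lo′ hi′ → lo ℤ.≤ g → g ℤ.≤ hi → lo′ ℤ.< φ → φ ℤ.< hi′ →
             g ≡ φ ℤ.+ t ℤ.* + N → X ≡ X′ × g ≡ φ
  disjoint {X} {lo} {hi} {X′} {lo′} {hi′} {g} {φ} t C C′ l h l′ h′ e = X≡X′ , unshift (shift C) (shift C′) σ≡σ′ g φ (+ N) g≡φ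
    where
    sub≤ : ∀ a b c → a ℤ.≤ b → a ℤ.- c ℤ.≤ b ℤ.- c
    sub≤ a b c h = linarith ([] ∣ᵉ a ∷ c ∷ b ∷ []) (ζ 0 ≼ᶻ ζ 2 ∷ []) (ζ 0 ⊖ ζ 1 ≼ᶻ ζ 2 ⊖ ζ 1) (h , tt)
    sub< : ∀ a b c → a ℤ.< b → a ℤ.- c ℤ.< b ℤ.- c
    sub< a b c h = linarith ([] ∣ᵉ a ∷ c ∷ b ∷ []) (ζ 0 ≺ᶻ ζ 2 ∷ []) (ζ 0 ⊖ ζ 1 ≺ᶻ ζ 2 ⊖ ζ 1) (h , tt)
    g₁ φ₁ : ℤ
    g₁ = g ℤ.- shift C ℤ.* + N
    φ₁ = φ ℤ.- shift C′ ℤ.* + N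
    congruent : ∀ g φ σ σ′ t n → g ≡ φ ℤ.+ t ℤ.* n → g ℤ.- σ ℤ.* n ≡ φ ℤ.- σ′ ℤ.* n ℤ.+ (t ℤ.- σ ℤ.+ σ′) ℤ.* n
    congruent g φ σ σ′ t n e = linarith ([] ∣ᵉ g ∷ σ ∷ n ∷ φ ∷ σ′ ∷ t ∷ [])
      (ζ 0 ≐ᶻ ζ 3 ⊞ ζ 5 ⊠ ζ 2 ∷ []) (ζ 0 ⊖ (ζ 1 ⊠ ζ 2) ≐ᶻ ζ 3 ⊖ (ζ 4 ⊠ ζ 2) ⊞ (ζ 5 ⊖ ζ 1 ⊞ ζ 4) ⊠ ζ 2) (e , tt)
    apart : ∀ m n a b c d → ℤ.- m ℤ.≤ a → a ℤ.< b → c ℤ.≤ d → d ℤ.≤ n → c ℤ.< b ℤ.+ (m ℤ.+ n)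
    apart m n a b c d h₁ h₂ h₃ h₄ = linarith ([] ∣ᵉ c ∷ b ∷ m ∷ n ∷ a ∷ d ∷ [])
      (⊟ ζ 2 ≼ᶻ ζ 4 ∷ ζ 4 ≺ᶻ ζ 1 ∷ ζ 0 ≼ᶻ ζ 5 ∷ ζ 5 ≼ᶻ ζ 3 ∷ []) (ζ 0 ≺ᶻ ζ 1 ⊞ (ζ 2 ⊞ ζ 3)) (h₁ , h₂ , h₃ , h₄ , tt)
    apart′ : ∀ m n a b c d → ℤ.- m ℤ.≤ a → a ℤ.≤ b → c ℤ.< d → d ℤ.≤ n → c ℤ.< b ℤ.+ (m ℤ.+ n)
    apart′ m n a b c d h₁ h₂ h₃ h₄ = linarith ([] ∣ᵉ c ∷ b ∷ m ∷ n ∷ a ∷ d ∷ [])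
      (⊟ ζ 2 ≼ᶻ ζ 4 ∷ ζ 4 ≼ᶻ ζ 1 ∷ ζ 0 ≺ᶻ ζ 5 ∷ ζ 5 ≼ᶻ ζ 3 ∷ []) (ζ 0 ≺ᶻ ζ 1 ⊞ (ζ 2 ⊞ ζ 3)) (h₁ , h₂ , h₃ , h₄ , tt)
    g≡φ : g₁ ≡ φ₁
    g≡φ = residue-unique N (t ℤ.- shift C ℤ.+ shift C′)
      (apart (+ M) (+ β c) (lo′ ℤ.- shift C′ ℤ.* + N) φ₁ g₁ (hi ℤ.- shift C ℤ.* + N)
        (moved-lo (move C′)) (sub< lo′ φ (shift C′ ℤ.* + N) l′) (sub≤ g hi (shift C ℤ.* + N) h) (moved-hi (move C)))
      (apart′ (+ M) (+ β c) (lo ℤ.- shift C ℤ.* + N) g₁ φ₁ (hi′ ℤ.- shift C′ ℤ.* + N)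
        (moved-lo (move C)) (sub≤ lo g (shift C ℤ.* + N) l) (sub< φ hi′ (shift C′ ℤ.* + N) h′) (moved-hi (move C′)))
      (congruent g φ (shift C) (shift C′) t (+ N) e)
    X≡X′ : X ≡ X′
    X≡X′ = moved-disjoint (move C) (move C′) (sub≤ lo g (shift C ℤ.* + N) l) (sub≤ g hi (shift C ℤ.* + N) h)
      (subst (λ z → lo′ ℤ.- shift C′ ℤ.* + N ℤ.< z) (sym g≡φ) (sub< lo′ φ (shift C′ ℤ.* + N) l′))
      (subst (λ z → z ℤ.< hi′ ℤ.- shift C′ ℤ.* + N) (sym g≡φ) (sub< φ hi′ (shift C′ ℤ.* + N) h′))
    σ≡σ′ : shift C ≡ shift C′
    σ≡σ′ = same X≡X′ C C′
      where
      same : ∀ {X X′} → X ≡ X′ → (C : Column X lo hi) (C′ : Column X′ lo′ hi′) → shift C ≡ shift C′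
      same refl = shift-unique
    unshift : ∀ σ σ′ → σ ≡ σ′ → ∀ g φ n → g ℤ.- σ ℤ.* n ≡ φ ℤ.- σ′ ℤ.* n → g ≡ φ
    unshift σ .σ refl g φ n e = linarith ([] ∣ᵉ g ∷ φ ∷ σ ∷ n ∷ [])
      (ζ 0 ⊖ (ζ 2 ⊠ ζ 3) ≐ᶻ ζ 1 ⊖ (ζ 2 ⊠ ζ 3) ∷ []) (ζ 0 ≐ᶻ ζ 1) (e , tt)

  cell : ℕ → ℤ → Pixel
  cell X φ = ℤ.- + X , φ ℤ.- s ℤ.* + X

  column : ℕ → ℤ → ℕ → List Pixel
  column X lo len = map (λ t → cell X (lo ℤ.+ + suc t)) (upTo len)

  -- On both sides `k` counts away from the steady columns, so the two families have the same
  -- lengths.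
  growingLo shrinkingLo : ℕ → ℤ
  growingLo k   = ℤ.- + (2 * (A * suc k))
  shrinkingLo k = + N ℤ.- + (2 * (A * suc (A ∸ suc k)) + 2 * suc (A ∸ suc k))

  oddLength steadyLength : ℕ → ℕ
  oddLength k    = suc (2 * (A ∸ suc k))
  steadyLength i = β (suc i) ∸ suc (β i)

  growingColumn steadyColumn shrinkingColumn : ℕ → List Pixel
  growingColumn k   = column (A ∸ suc k) (growingLo k) (oddLength k)
  steadyColumn i    = column (A + i) (+ β i) (steadyLength i)
  shrinkingColumn k = column (A + c + k) (shrinkingLo k) (oddLength k)

  R G S H : List Pixel
  G = concatMap growingColumn (upTo A)
  S = concatMap steadyColumn (upTo c)
  H = concatMap shrinkingColumn (upTo A)
  R = G ++ S ++ H

  record Cell (z : Pixel) : Set where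
    constructor mkCell
    field
      {X}     : ℕ
      {lo hi} : ℤ
      φ       : ℤ
      col     : Column X lo hi
      lo<     : lo ℤ.< φ
      <hi     : φ ℤ.< hi
      eq      : z ≡ cell X φ

  open Periodic N 1≤N (ℤ.- s) R

  f-cell : ∀ X φ → f (cell X φ) ≡ φ
  f-cell X φ = lemma (+ X) φ s
    where
    lemma : ∀ X φ s → φ ℤ.- s ℤ.* X ℤ.+ ℤ.- s ℤ.* (ℤ.- X) ≡ φ
    lemma = solve-∀

  column-cell : ∀ X lo hi len {z} → Column X lo hi → (∀ t → t < len → lo ℤ.+ + suc t ℤ.< hi) → z ∈ column X lo len → Cell z
  column-cell X lo hi len C below z∈ = let t , t∈ , e = ∈-map⁻ (λ t → cell X (lo ℤ.+ + suc t)) z∈ in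
    mkCell (lo ℤ.+ + suc t) C (above lo t) (below t (∈-upTo⁻ t∈)) e
    where
    above : ∀ a t → a ℤ.< a ℤ.+ + suc t
    above a t = linarith (t ∷ [] ∣ᵉ a ∷ []) [] (ζ 0 ≺ᶻ ζ 0 ⊞ ⌞ κ 1 ⊕ ν 0 ⌟) tt

  growing-index : ∀ {k} → k < A → A ∸ suc k + suc k ≡ A
  growing-index k<A = ℕₚ.m∸n+n≡m k<A

  growing-cell : ∀ {k z} → k < A → z ∈ growingColumn k → Cell z
  growing-cell {k} k<A = column-cell (A ∸ suc k) (growingLo k) _ (oddLength k) (growing k (growing-index k<A) refl refl) (bound A k (A ∸ suc k) (growing-index k<A))
    where
    bound : ∀ A k m → m + suc k ≡ A → ∀ t → t < suc (2 * m) → ℤ.- + (2 * (A * suc k)) ℤ.+ + suc t ℤ.< ℤ.- + (2 * (A * k) + 2 * k)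
    bound A k m e t h = linarith (A ∷ k ∷ t ∷ m ∷ [] ∣ᵉ [])
      (ν 3 ⊕ (κ 1 ⊕ ν 1) ≐ ν 0 ∷ κ 1 ⊕ ν 2 ≼ κ 1 ⊕ κ 2 ⊗ ν 3 ∷ [])
      (⊟ ⌞ κ 2 ⊗ (ν 0 ⊗ (κ 1 ⊕ ν 1)) ⌟ ⊞ ⌞ κ 1 ⊕ ν 2 ⌟ ≺ᶻ ⊟ ⌞ κ 2 ⊗ (ν 0 ⊗ ν 1) ⊕ κ 2 ⊗ ν 1 ⌟) (e , h , tt)

  steady-cell : ∀ {i z} → i < c → z ∈ steadyColumn i → Cell z
  steady-cell {i} i<c = column-cell (A + i) (+ β i) _ (steadyLength i) (steady i i<c refl refl refl) (λ t → bound (β i) (β (suc i)) (β (suc i) ∸ suc (β i)) t (ℕₚ.m∸n+n≡m (β-inc i i<c)))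
    where
    bound : ∀ b b₁ d t → d + suc b ≡ b₁ → t < d → + b ℤ.+ + suc t ℤ.< + b₁
    bound b b₁ d t e h = linarith (b ∷ t ∷ b₁ ∷ d ∷ [] ∣ᵉ [])
      (ν 3 ⊕ (κ 1 ⊕ ν 0) ≐ ν 2 ∷ κ 1 ⊕ ν 1 ≼ ν 3 ∷ []) (ι 0 ⊞ ⌞ κ 1 ⊕ ν 1 ⌟ ≺ᶻ ι 2) (e , h , tt)

  shrinking-cell : ∀ {k z} → k < A → z ∈ shrinkingColumn k → Cell z
  shrinking-cell {k} k<A = column-cell (A + c + k) (shrinkingLo k) _ (oddLength k) (shrinking (suc (A ∸ suc k)) (small A k (A ∸ suc k) (growing-index k<A)) (place A c k (A ∸ suc k) (growing-index k<A)) refl refl)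
    (bound A (+ N) (A ∸ suc k))
    where
    small : ∀ A k m → m + suc k ≡ A → suc m ≤ A
    small A k m e = linarith (m ∷ A ∷ k ∷ [] ∣ᵉ []) (ν 0 ⊕ (κ 1 ⊕ ν 2) ≐ ν 1 ∷ []) (κ 1 ⊕ ν 0 ≼ ν 1) (e , tt)
    place : ∀ A c k m → m + suc k ≡ A → A + c + k + suc m ≡ A + A + c
    place A c k m e = linarith (A ∷ c ∷ k ∷ m ∷ [] ∣ᵉ [])
      (ν 3 ⊕ (κ 1 ⊕ ν 2) ≐ ν 0 ∷ []) (ν 0 ⊕ ν 1 ⊕ ν 2 ⊕ (κ 1 ⊕ ν 3) ≐ ν 0 ⊕ ν 0 ⊕ ν 1) (e , tt)
    bound : ∀ A N m t → t < suc (2 * m) → N ℤ.- + (2 * (A * suc m) + 2 * suc m) ℤ.+ + suc t ℤ.< N ℤ.- + (2 * (A * suc m))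
    bound A N m t h = linarith (A ∷ m ∷ t ∷ [] ∣ᵉ N ∷ [])
      (κ 1 ⊕ ν 2 ≼ κ 1 ⊕ κ 2 ⊗ ν 1 ∷ [])
      (ζ 0 ⊖ ⌞ κ 2 ⊗ (ν 0 ⊗ (κ 1 ⊕ ν 1)) ⊕ κ 2 ⊗ (κ 1 ⊕ ν 1) ⌟ ⊞ ⌞ κ 1 ⊕ ν 2 ⌟ ≺ᶻ ζ 0 ⊖ ⌞ κ 2 ⊗ (ν 0 ⊗ (κ 1 ⊕ ν 1)) ⌟)
      (h , tt)

  ∈-concatMap-upTo : ∀ {g : ℕ → List Pixel} {n z} → z ∈ concatMap g (upTo n) → ∃[ k ] (k < n × z ∈ g k)
  ∈-concatMap-upTo {g} {n} z∈ with ∈-concat⁻′ (map g (upTo n)) z∈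
  ... | _ , z∈g , g∈ with ∈-map⁻ g g∈
  ...   | k , k∈ , refl = k , ∈-upTo⁻ k∈ , z∈g

  ∈R⁻ : ∀ {z} → z ∈ R → Cell z
  ∈R⁻ z∈ = [ (λ p → let k , h , q = ∈-concatMap-upTo {growingColumn} {A} p in growing-cell h q)
           , (λ p → [ (λ p → let k , h , q = ∈-concatMap-upTo {steadyColumn} {c} p in steady-cell h q)
                    , (λ p → let k , h , q = ∈-concatMap-upTo {shrinkingColumn} {A} p in shrinking-cell h q) ]′ (∈-++⁻ S p)) ]′ (∈-++⁻ G z∈)

  column-x : ∀ X lo len {z} → z ∈ column X lo len → proj₁ z ≡ ℤ.- + X
  column-x X lo len z∈ = let t , t∈ , e = ∈-map⁻ (λ t → cell X (lo ℤ.+ + suc t)) z∈ in cong proj₁ e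

  same-x : ∀ {z : Pixel} {X X′} → proj₁ z ≡ ℤ.- + X → proj₁ z ≡ ℤ.- + X′ → X ≡ X′
  same-x p q = ℤₚ.+-injective (ℤₚ.neg-injective (trans (sym p) q))

  growing-x : ∀ k {z} → z ∈ growingColumn k → proj₁ z ≡ ℤ.- + (A ∸ suc k)
  growing-x k = column-x (A ∸ suc k) (growingLo k) (oddLength k)

  steady-x : ∀ i {z} → z ∈ steadyColumn i → proj₁ z ≡ ℤ.- + (A + i)
  steady-x i = column-x (A + i) (+ β i) (steadyLength i)

  shrinking-x : ∀ k {z} → z ∈ shrinkingColumn k → proj₁ z ≡ ℤ.- + (A + c + k)
  shrinking-x k = column-x (A + c + k) (shrinkingLo k) (oddLength k)

  column-unique : ∀ X lo len → Unique (column X lo len)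
  column-unique X lo len = Uniqueₚ.map⁺ (λ {t} {t′} e → inj lo (s ℤ.* + X) t t′ (cong proj₂ e)) (Uniqueₚ.upTo⁺ len)
    where
    inj : ∀ a b t t′ → a ℤ.+ + suc t ℤ.- b ≡ a ℤ.+ + suc t′ ℤ.- b → t ≡ t′
    inj a b t t′ e = linarith (t ∷ t′ ∷ [] ∣ᵉ a ∷ b ∷ [])
      (ζ 0 ⊞ ⌞ κ 1 ⊕ ν 0 ⌟ ⊖ ζ 1 ≐ᶻ ζ 0 ⊞ ⌞ κ 1 ⊕ ν 1 ⌟ ⊖ ζ 1 ∷ []) (ν 0 ≐ ν 1) (e , tt)

  R-unique : Unique R
  R-unique = Uniqueₚ.++⁺ G-unique (Uniqueₚ.++⁺ S-unique H-unique S#H) G#SH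
    where
    G-unique : Unique G
    G-unique = concatMap-unique growingColumn (Uniqueₚ.upTo⁺ A) (λ k → column-unique (A ∸ suc k) (growingLo k) (oddLength k))
      λ {k} {k′} {z} k∈ k′∈ p q → inj A (A ∸ suc k) (A ∸ suc k′) k k′ (growing-index (∈-upTo⁻ k∈)) (growing-index (∈-upTo⁻ k′∈)) (same-x {z} (growing-x k p) (growing-x k′ q))
      where
      inj : ∀ A m m′ k k′ → m + suc k ≡ A → m′ + suc k′ ≡ A → m ≡ m′ → k ≡ k′
      inj A m m′ k k′ e e′ e″ = linarith (k ∷ k′ ∷ m ∷ A ∷ m′ ∷ [] ∣ᵉ [])
        (ν 2 ⊕ (κ 1 ⊕ ν 0) ≐ ν 3 ∷ ν 4 ⊕ (κ 1 ⊕ ν 1) ≐ ν 3 ∷ ν 2 ≐ ν 4 ∷ []) (ν 0 ≐ ν 1) (e , e′ , e″ , tt)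
    S-unique : Unique S
    S-unique = concatMap-unique steadyColumn (Uniqueₚ.upTo⁺ c) (λ i → column-unique (A + i) (+ β i) (steadyLength i))
      λ {i} {i′} {z} _ _ p q → ℕₚ.+-cancelˡ-≡ A i i′ (same-x {z} (steady-x i p) (steady-x i′ q))
    H-unique : Unique H
    H-unique = concatMap-unique shrinkingColumn (Uniqueₚ.upTo⁺ A) (λ k → column-unique (A + c + k) (shrinkingLo k) (oddLength k))
      λ {k} {k′} {z} _ _ p q → ℕₚ.+-cancelˡ-≡ (A + c) k k′ (same-x {z} (shrinking-x k p) (shrinking-x k′ q))
    S#H : ∀ {z} → ¬ (z ∈ S × z ∈ H)
    S#H {z} (p , q) = let i , h , p′ = ∈-concatMap-upTo {steadyColumn} {c} p ; k , h′ , q′ = ∈-concatMap-upTo {shrinkingColumn} {A} q in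
      absurd A c i k h (same-x {z} (steady-x i p′) (shrinking-x k q′))
      where
      absurd : ∀ A c i k → i < c → A + i ≡ A + c + k → ⊥
      absurd A c i k h e = linarith (i ∷ c ∷ A ∷ k ∷ [] ∣ᵉ [])
        (κ 1 ⊕ ν 0 ≼ ν 1 ∷ ν 2 ⊕ ν 0 ≐ ν 2 ⊕ ν 1 ⊕ ν 3 ∷ []) falsum (h , e , tt)
    absurd : ∀ A k m i → m + suc k ≡ A → m ≡ A + i → ⊥
    absurd A k m i e e′ = linarith (m ∷ k ∷ A ∷ i ∷ [] ∣ᵉ [])
      (ν 0 ⊕ (κ 1 ⊕ ν 1) ≐ ν 2 ∷ ν 0 ≐ ν 2 ⊕ ν 3 ∷ []) falsum (e , e′ , tt)
    G#S : ∀ {z} → z ∈ G → ¬ z ∈ S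
    G#S {z} p q = let k , h , p′ = ∈-concatMap-upTo {growingColumn} {A} p ; i , h′ , q′ = ∈-concatMap-upTo {steadyColumn} {c} q in
      absurd A k (A ∸ suc k) i (growing-index h) (same-x {z} (growing-x k p′) (steady-x i q′))
    G#H : ∀ {z} → z ∈ G → ¬ z ∈ H
    G#H {z} p q = let k , h , p′ = ∈-concatMap-upTo {growingColumn} {A} p ; i , h′ , q′ = ∈-concatMap-upTo {shrinkingColumn} {A} q in
      absurd A k (A ∸ suc k) (c + i) (growing-index h) (trans (same-x {z} (growing-x k p′) (shrinking-x i q′)) (ℕₚ.+-assoc A c i))
    G#SH : ∀ {z} → ¬ (z ∈ G × z ∈ S ++ H)
    G#SH (p , q) = [ G#S p , G#H p ]′ (∈-++⁻ S q)

  length-column : ∀ X lo len → length (column X lo len) ≡ len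
  length-column X lo len = trans (length-map (λ t → cell X (lo ℤ.+ + suc t)) (upTo len)) (length-upTo len)

  length-columns : ∀ (g : ℕ → List Pixel) n (l : ℕ → ℕ) → (∀ k → length (g k) ≡ l k) → length (concatMap g (upTo n)) ≡ ∑ (upTo n) l
  length-columns g n l h = trans (length-concat (map g (upTo n))) (trans (∑-map g length (upTo n)) (∑-cong (upTo n) h))

  sum-odd : ∀ n → ∑ (upTo n) (λ k → suc (2 * (n ∸ suc k))) ≡ n * n
  sum-odd zero    = ∑-empty (λ k → suc (2 * (0 ∸ suc k)))
  sum-odd (suc n) = trans (∑-upTo-suc n (λ k → suc (2 * (n ∸ k)))) (trans (cong (suc (2 * n) ℕ.+_) (sum-odd n)) (square n))
    where
    square : ∀ n → suc (2 * n) + n * n ≡ suc n * suc n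
    square n = linarith (n ∷ [] ∣ᵉ []) [] (κ 1 ⊕ κ 2 ⊗ ν 0 ⊕ ν 0 ⊗ ν 0 ≐ (κ 1 ⊕ ν 0) ⊗ (κ 1 ⊕ ν 0)) tt

  telescope : ∀ n (γ : ℕ → ℕ) → (∀ i → i < n → γ i < γ (suc i)) → ∑ (upTo n) (λ i → γ (suc i) ∸ suc (γ i)) + n + γ 0 ≡ γ n
  telescope zero    γ inc = cong (λ t → t + 0 + γ 0) (∑-empty (λ i → γ (suc i) ∸ suc (γ i)))
  telescope (suc n) γ inc = trans (cong (λ t → t + suc n + γ 0) (∑-upTo-suc n (λ i → γ (suc i) ∸ suc (γ i))))
    (trans (arith (γ 1 ∸ suc (γ 0)) _ n (γ 0) (γ 1) (ℕₚ.m∸n+n≡m (inc 0 (s≤s z≤n)))) (telescope n (γ ∘ suc) (λ i h → inc (suc i) (s≤s h))))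
    where
    arith : ∀ d S n g g₁ → d + suc g ≡ g₁ → d + S + suc n + g ≡ S + n + g₁
    arith d S n g g₁ e = linarith (d ∷ S ∷ n ∷ g ∷ g₁ ∷ [] ∣ᵉ [])
      (ν 0 ⊕ (κ 1 ⊕ ν 3) ≐ ν 4 ∷ []) (ν 0 ⊕ ν 1 ⊕ (κ 1 ⊕ ν 2) ⊕ ν 3 ≐ ν 1 ⊕ ν 2 ⊕ ν 4) (e , tt)

  -- Growing and shrinking columns contribute `A²` each as sums of odd numbers, and the steady
  -- lengths telescope to `β c - c`. So `2A + c` residues are left for black pixels, one for each
  -- nonempty column, because adjacent intervals share their ends.
  N≡ : N ≡ length R + (2 * A + c)
  N≡ = arith A c (β c) σ (A * A) (length R) len (trans (cong (λ t → σ + c + t) (sym β-zero)) (telescope c β β-inc))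
    where
    σ : ℕ
    σ = ∑ (upTo c) (λ i → β (suc i) ∸ suc (β i))
    len : length R ≡ A * A + (σ + A * A)
    len = trans (length-++ G) (cong₂ ℕ._+_
      (trans (length-columns growingColumn A oddLength (λ k → length-column (A ∸ suc k) (growingLo k) (oddLength k))) (sum-odd A))
      (trans (length-++ S) (cong₂ ℕ._+_ (length-columns steadyColumn c steadyLength (λ i → length-column (A + i) (+ β i) (steadyLength i)))
        (trans (length-columns shrinkingColumn A oddLength (λ k → length-column (A + c + k) (shrinkingLo k) (oddLength k))) (sum-odd A)))))
    arith : ∀ A c b σ a l → l ≡ a + (σ + a) → σ + c + 0 ≡ b → 2 * a + 2 * A + b ≡ l + (2 * A + c)
    arith A c b σ a l e e′ = linarith (a ∷ A ∷ b ∷ l ∷ c ∷ σ ∷ [] ∣ᵉ [])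
      (ν 3 ≐ ν 0 ⊕ (ν 5 ⊕ ν 0) ∷ ν 5 ⊕ ν 4 ⊕ κ 0 ≐ ν 2 ∷ []) (κ 2 ⊗ ν 0 ⊕ κ 2 ⊗ ν 1 ⊕ ν 2 ≐ ν 3 ⊕ (κ 2 ⊗ ν 1 ⊕ ν 4))
      (e , e′ , tt)

-- Neighbours of the column tile

Unit : ℤ → ℤ → Set
Unit a b = b ≡ a ⊎ b ≡ a ℤ.+ 1ℤ ⊎ b ≡ a ℤ.- 1ℤ

unit-cases : ∀ a b → ∣ a ℤ.- b ∣ ≤ 1 → Unit a b
unit-cases a b h = go (a ℤ.- b) refl h
  where
  none : a ℤ.- b ≡ 0ℤ → b ≡ a
  none e = linarith ([] ∣ᵉ b ∷ a ∷ []) (ζ 1 ⊖ ζ 0 ≐ᶻ κᶻ 0 ∷ []) (ζ 0 ≐ᶻ ζ 1) (e , tt)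
  plus : a ℤ.- b ≡ 1ℤ → b ≡ a ℤ.- 1ℤ
  plus e = linarith ([] ∣ᵉ b ∷ a ∷ []) (ζ 1 ⊖ ζ 0 ≐ᶻ κᶻ 1 ∷ []) (ζ 0 ≐ᶻ ζ 1 ⊖ κᶻ 1) (e , tt)
  minus : a ℤ.- b ≡ ℤ.- 1ℤ → b ≡ a ℤ.+ 1ℤ
  minus e = linarith ([] ∣ᵉ b ∷ a ∷ []) (ζ 1 ⊖ ζ 0 ≐ᶻ ⊟ κᶻ 1 ∷ []) (ζ 0 ≐ᶻ ζ 1 ⊞ κᶻ 1) (e , tt)
  go : ∀ d → a ℤ.- b ≡ d → ∣ d ∣ ≤ 1 → Unit a b
  go (+ 0) e _ = inj₁ (none e)
  go (+ 1) e _ = inj₂ (inj₂ (plus e))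
  go (+ suc (suc _)) e (s≤s ())
  go -[1+ 0 ] e _ = inj₂ (inj₁ (minus e))
  go -[1+ suc _ ] e (s≤s ())

near₄-cases : ∀ a b c d → Near four (a , b) (c , d) → (c ≡ a × Unit b d) ⊎ (d ≡ b × Unit a c)
near₄-cases a b c d h = [ (λ (e , _) → inj₁ (sym e , unit-cases b d (ℕₚ.m+n≤o⇒n≤o ∣ a ℤ.- c ∣ h)))
                        , (λ (e , _) → inj₂ (sym e , unit-cases a c (ℕₚ.m+n≤o⇒m≤o _ h))) ]′ (∣i-j∣+≤1 a b c d h)

module ColumnTiling (A c : ℕ) (β : ℕ → ℕ) (β-zero : β 0 ≡ 0) (β-inc : ∀ i → i < c → β i < β (suc i))
                    (β-lo : ∀ i → β i + 2 * A ≤ β (suc i)) (β-hi : ∀ i → β (suc i) ≤ β i + 2 * A + 2)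
                    (1≤N : 1 ≤ 2 * (A * A) + 2 * A + β c) where
  open ColumnTile A c β β-zero β-inc β-lo β-hi 1≤N
  open Periodic N 1≤N (ℤ.- s) R

  module _ {X lo hi φ X′ lo′ hi′ φ′} (C : Column X lo hi) (l : lo ℤ.< φ) (h : φ ℤ.< hi)
           (C′ : Column X′ lo′ hi′) (l′ : lo′ ℤ.< φ′) (h′ : φ′ ℤ.< hi′) where

    vertical : ∀ g t → Unit φ g → g ≡ φ′ ℤ.+ t ℤ.* + N → cell X′ φ′ ≡ cell X g
    vertical g t d e = let X≡ , g≡ = disjoint t C C′ (lower d) (upper d) l′ h′ e in
      sym (cong₂ cell X≡ g≡)
      where
      lower : Unit φ g → lo ℤ.≤ g
      lower (inj₁ refl) = ℤₚ.<⇒≤ l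
      lower (inj₂ (inj₁ refl)) = lo≤ lo φ l
        where
        lo≤ : ∀ a b → a ℤ.< b → a ℤ.≤ b ℤ.+ 1ℤ
        lo≤ a b h = linarith ([] ∣ᵉ a ∷ b ∷ []) (ζ 0 ≺ᶻ ζ 1 ∷ []) (ζ 0 ≼ᶻ ζ 1 ⊞ κᶻ 1) (h , tt)
      lower (inj₂ (inj₂ refl)) = lo≤ lo φ l
        where
        lo≤ : ∀ a b → a ℤ.< b → a ℤ.≤ b ℤ.- 1ℤ
        lo≤ a b h = linarith ([] ∣ᵉ a ∷ b ∷ []) (ζ 0 ≺ᶻ ζ 1 ∷ []) (ζ 0 ≼ᶻ ζ 1 ⊖ κᶻ 1) (h , tt)
      upper : Unit φ g → g ℤ.≤ hi
      upper (inj₁ refl) = ℤₚ.<⇒≤ h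
      upper (inj₂ (inj₁ refl)) = ≤hi φ hi h
        where
        ≤hi : ∀ a b → a ℤ.< b → a ℤ.+ 1ℤ ℤ.≤ b
        ≤hi a b h = linarith ([] ∣ᵉ a ∷ b ∷ []) (ζ 0 ≺ᶻ ζ 1 ∷ []) (ζ 0 ⊞ κᶻ 1 ≼ᶻ ζ 1) (h , tt)
      upper (inj₂ (inj₂ refl)) = ≤hi φ hi h
        where
        ≤hi : ∀ a b → a ℤ.< b → a ℤ.- 1ℤ ℤ.≤ b
        ≤hi a b h = linarith ([] ∣ᵉ a ∷ b ∷ []) (ζ 0 ≺ᶻ ζ 1 ∷ []) (ζ 0 ⊖ κᶻ 1 ≼ᶻ ζ 1) (h , tt)

    leftward : ∀ t → φ ℤ.+ s ≡ φ′ ℤ.+ t ℤ.* + N → suc X ≡ X′ × φ ℤ.+ s ≡ φ′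
    leftward t e = let _ , _ , C₁ , l₁ , h₁ = next C l h in disjoint t C₁ C′ l₁ h₁ l′ h′ e

  cell-next : ∀ X φ → cell (suc X) (φ ℤ.+ s) ≡ (proj₁ (cell X φ) ℤ.- 1ℤ , proj₂ (cell X φ))
  cell-next X φ = cong₂ _,_ (first X) (second φ s (+ X))
    where
    first : ∀ X → ℤ.- + suc X ≡ ℤ.- + X ℤ.- 1ℤ
    first X = linarith (X ∷ [] ∣ᵉ []) [] (⊟ ⌞ κ 1 ⊕ ν 0 ⌟ ≐ᶻ ⊟ ι 0 ⊖ κᶻ 1) tt
    second : ∀ φ s X → φ ℤ.+ s ℤ.- s ℤ.* (1ℤ ℤ.+ X) ≡ φ ℤ.- s ℤ.* X
    second = solve-∀

  near-closed : ∀ {r r′ p} → r ∈ R → r′ ∈ R → Near four r p → f p ≈ f r′ → r′ ≡ p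
  near-closed {r} {r′} {p} r∈ r′∈ n e = go (∈R⁻ r∈) (∈R⁻ r′∈) n e
    where
    go : Cell r → Cell r′ → Near four r p → f p ≈ f r′ → r′ ≡ p
    go (mkCell {X} φ C l h refl) (mkCell {X′} φ′ C′ l′ h′ refl) n (t , e) = cases (near₄-cases (proj₁ (cell X φ)) (proj₂ (cell X φ)) (proj₁ p) (proj₂ p) n)
      where
      e′ : f p ≡ φ′ ℤ.+ t ℤ.* + N
      e′ = trans e (cong (ℤ._+ t ℤ.* + N) (f-cell X′ φ′))
      up′ : ∀ {y} → Unit (proj₂ (cell X φ)) y → ∃[ g ] (Unit φ g × (ℤ.- + X , y) ≡ cell X g)
      up′ (inj₁ refl) = φ , inj₁ refl , refl
      up′ (inj₂ (inj₁ refl)) = φ ℤ.+ 1ℤ , inj₂ (inj₁ refl) , cong (_ ,_) (lemma φ (s ℤ.* + X))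
        where
        lemma : ∀ a b → a ℤ.- b ℤ.+ 1ℤ ≡ a ℤ.+ 1ℤ ℤ.- b
        lemma = solve-∀
      up′ (inj₂ (inj₂ refl)) = φ ℤ.- 1ℤ , inj₂ (inj₂ refl) , cong (_ ,_) (lemma φ (s ℤ.* + X))
        where
        lemma : ∀ a b → a ℤ.- b ℤ.- 1ℤ ≡ a ℤ.- 1ℤ ℤ.- b
        lemma = solve-∀
      in-column : ∀ {p} → f p ≡ φ′ ℤ.+ t ℤ.* + N → (∃[ g ] (Unit φ g × p ≡ cell X g)) → cell X′ φ′ ≡ p
      in-column e (g , d , refl) = vertical C l h C′ l′ h′ g t d (trans (sym (f-cell X g)) e)
      left-of : ∀ {p} → f p ≡ φ′ ℤ.+ t ℤ.* + N → p ≡ (proj₁ (cell X φ) ℤ.- 1ℤ , proj₂ (cell X φ)) → cell X′ φ′ ≡ p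
      left-of {p} e q = trans (sym (cong₂ cell (proj₁ here′) (proj₂ here′))) p≡
        where
        p≡ : cell (suc X) (φ ℤ.+ s) ≡ p
        p≡ = trans (cell-next X φ) (sym q)
        here′ : suc X ≡ X′ × φ ℤ.+ s ≡ φ′
        here′ = leftward C l h C′ l′ h′ t (trans (sym (f-cell (suc X) (φ ℤ.+ s))) (trans (cong f p≡) e))
      -- Reversing the roles: the left neighbour of `r′` is congruent to `r`, so `leftward` applies
      -- to `r′`.
      right-of : ∀ {p} → f p ≡ φ′ ℤ.+ t ℤ.* + N → p ≡ (proj₁ (cell X φ) ℤ.+ 1ℤ , proj₂ (cell X φ)) → cell X′ φ′ ≡ p
      right-of {p} e q = trans (back (proj₁ (cell X′ φ′)) (proj₂ (cell X′ φ′)) (proj₁ (cell X φ)) (proj₂ (cell X φ)) left′) (sym q)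
        where
        f-right : ∀ x y w → y ℤ.+ w ℤ.* (x ℤ.+ 1ℤ) ≡ y ℤ.+ w ℤ.* x ℤ.+ w
        f-right = solve-∀
        e₁′ : φ ℤ.+ ℤ.- s ≡ φ′ ℤ.+ t ℤ.* + N
        e₁′ = trans (cong (ℤ._+ ℤ.- s) (sym (f-cell X φ))) (trans (sym (f-right (proj₁ (cell X φ)) (proj₂ (cell X φ)) (ℤ.- s))) (trans (cong f (sym q)) e))
        swap : ∀ a b n s → a ℤ.+ ℤ.- s ≡ b ℤ.+ t ℤ.* n → b ℤ.+ s ≡ a ℤ.+ (ℤ.- t) ℤ.* n
        swap a b n s e = linarith ([] ∣ᵉ b ∷ s ∷ a ∷ t ∷ n ∷ [])
          (ζ 2 ⊖ ζ 1 ≐ᶻ ζ 0 ⊞ ζ 3 ⊠ ζ 4 ∷ []) (ζ 0 ⊞ ζ 1 ≐ᶻ ζ 2 ⊞ ⊟ ζ 3 ⊠ ζ 4) (e , tt)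
        here′ : suc X′ ≡ X × φ′ ℤ.+ s ≡ φ
        here′ = leftward C′ l′ h′ C l h (ℤ.- t) (swap φ φ′ (+ N) s e₁′)
        left′ : cell X φ ≡ (proj₁ (cell X′ φ′) ℤ.- 1ℤ , proj₂ (cell X′ φ′))
        left′ = trans (sym (cong₂ cell (proj₁ here′) (proj₂ here′))) (cell-next X′ φ′)
        back : ∀ x′ y′ x y → (x , y) ≡ (x′ ℤ.- 1ℤ , y′) → (x′ , y′) ≡ (x ℤ.+ 1ℤ , y)
        back x′ y′ x y e = cong₂ _,_ (lemma x′ x (cong proj₁ e)) (sym (cong proj₂ e))
          where
          lemma : ∀ x′ x → x ≡ x′ ℤ.- 1ℤ → x′ ≡ x ℤ.+ 1ℤ
          lemma x′ x e = linarith ([] ∣ᵉ x′ ∷ x ∷ []) (ζ 1 ≐ᶻ ζ 0 ⊖ κᶻ 1 ∷ []) (ζ 0 ≐ᶻ ζ 1 ⊞ κᶻ 1) (e , tt)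
      cases : (proj₁ p ≡ proj₁ (cell X φ) × Unit (proj₂ (cell X φ)) (proj₂ p)) ⊎ (proj₂ p ≡ proj₂ (cell X φ) × Unit (proj₁ (cell X φ)) (proj₁ p)) → cell X′ φ′ ≡ p
      cases (inj₁ (q , d)) = in-column e′ (let g , d′ , q′ = up′ d in g , d′ , trans (cong (_, proj₂ p) q) q′)
      cases (inj₂ (q , inj₁ q′)) = in-column e′ (φ , inj₁ refl , cong₂ _,_ q′ q)
      cases (inj₂ (q , inj₂ (inj₁ q′))) = right-of e′ (cong₂ _,_ q′ q)
      cases (inj₂ (q , inj₂ (inj₂ q′))) = left-of e′ (cong₂ _,_ q′ q)

  phi : ∀ j → N ≡ j + (2 * A + c) → PhiGe four j (frac j N)
  phi j e = subst (λ l → PhiGe four l (frac l N)) (ℕₚ.+-cancelʳ-≡ (2 * A + c) (length R) j (trans (sym N≡) e))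
    (tiling⇒PhiGe four R-unique (λ {r} {r′} r∈ r′∈ c → sym (near-closed r∈ r′∈ (near-refl four r) c))
      (λ {r} {r′} {s} r∈ r′∈ a → near-closed {r} {r′} {s} r∈ r′∈ (adj⇒near four {r} {s} a)))

-- Choice of the tile parameters

⊓-suc² : ∀ E i → E ℕ.⊓ (2 * i) ≤ E ℕ.⊓ (2 * suc i) × E ℕ.⊓ (2 * suc i) ≤ E ℕ.⊓ (2 * i) + 2
⊓-suc² E i = ℕₚ.⊓-monoʳ-≤ E (ℕₚ.*-monoʳ-≤ 2 (ℕₚ.n≤1+n i)) , [ small , large ]′ (ℕₚ.≤-total E (2 * i))
  where
  small : E ≤ 2 * i → E ℕ.⊓ (2 * suc i) ≤ E ℕ.⊓ (2 * i) + 2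
  small h = subst (λ t → E ℕ.⊓ (2 * suc i) ≤ t + 2) (sym (ℕₚ.m≤n⇒m⊓n≡m h))
    (ℕₚ.≤-trans (ℕₚ.m⊓n≤m E (2 * suc i)) (ℕₚ.m≤m+n E 2))
  two : ∀ i → 2 * suc i ≡ 2 * i + 2
  two i = linarith (i ∷ [] ∣ᵉ []) [] (κ 2 ⊗ (κ 1 ⊕ ν 0) ≐ κ 2 ⊗ ν 0 ⊕ κ 2) tt
  large : 2 * i ≤ E → E ℕ.⊓ (2 * suc i) ≤ E ℕ.⊓ (2 * i) + 2
  large h = subst (λ t → E ℕ.⊓ (2 * suc i) ≤ t + 2) (sym (ℕₚ.m≥n⇒m⊓n≡n h))
    (ℕₚ.≤-trans (ℕₚ.m⊓n≤n E (2 * suc i)) (ℕₚ.≤-reflexive (two i)))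

-- The surplus `E` is handed out greedily: `β` grows by `2A + 2` while it lasts and by `2A`
-- afterwards, with one step of `2A + 1` in between when `E` is odd. Since `E ≤ 2c`, it is used up
-- after `c` columns.
tile : ∀ A c E → 1 ≤ A → E ≤ 2 * c → ∀ j → j + (2 * A + c) ≡ 2 * (A * A) + 2 * A + (2 * A * c + E) →
       PhiGe four j (frac j (j + (2 * A + c)))
tile A c E 1≤A E≤2c j e = subst (λ n → PhiGe four j (frac j n)) (sym e′)
  (ColumnTiling.phi A c β (trans (cong (2 * A * 0 ℕ.+_) (ℕₚ.⊓-zeroʳ E)) (trans (ℕₚ.+-identityʳ _) (ℕₚ.*-zeroʳ (2 * A)))) (λ i _ → inc i) lo hi 1≤N j (sym e′))
  where
  β : ℕ → ℕ
  β i = 2 * A * i + E ℕ.⊓ (2 * i)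
  e′ : j + (2 * A + c) ≡ 2 * (A * A) + 2 * A + β c
  e′ = trans e (cong (λ t → 2 * (A * A) + 2 * A + (2 * A * c + t)) (sym (ℕₚ.m≤n⇒m⊓n≡m E≤2c)))
  lo : ∀ i → β i + 2 * A ≤ β (suc i)
  lo i = arith A i (E ℕ.⊓ (2 * i)) (E ℕ.⊓ (2 * suc i)) (proj₁ (⊓-suc² E i))
    where
    arith : ∀ A i m m′ → m ≤ m′ → 2 * A * i + m + 2 * A ≤ 2 * A * suc i + m′
    arith A i m m′ h = linarith (A ∷ i ∷ m ∷ m′ ∷ [] ∣ᵉ [])
      (ν 2 ≼ ν 3 ∷ []) (κ 2 ⊗ ν 0 ⊗ ν 1 ⊕ ν 2 ⊕ κ 2 ⊗ ν 0 ≼ κ 2 ⊗ ν 0 ⊗ (κ 1 ⊕ ν 1) ⊕ ν 3) (h , tt)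
  hi : ∀ i → β (suc i) ≤ β i + 2 * A + 2
  hi i = arith A i (E ℕ.⊓ (2 * i)) (E ℕ.⊓ (2 * suc i)) (proj₂ (⊓-suc² E i))
    where
    arith : ∀ A i m m′ → m′ ≤ m + 2 → 2 * A * suc i + m′ ≤ 2 * A * i + m + 2 * A + 2
    arith A i m m′ h = linarith (A ∷ i ∷ m′ ∷ m ∷ [] ∣ᵉ [])
      (ν 2 ≼ ν 3 ⊕ κ 2 ∷ []) (κ 2 ⊗ ν 0 ⊗ (κ 1 ⊕ ν 1) ⊕ ν 2 ≼ κ 2 ⊗ ν 0 ⊗ ν 1 ⊕ ν 3 ⊕ κ 2 ⊗ ν 0 ⊕ κ 2) (h , tt)
  inc : ∀ i → β i < β (suc i)
  inc i = arith A (β i) (β (suc i)) 1≤A (lo i)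
    where
    arith : ∀ A b b₁ → 1 ≤ A → b + 2 * A ≤ b₁ → b < b₁
    arith A b b₁ h k = linarith (b ∷ b₁ ∷ A ∷ [] ∣ᵉ []) (κ 1 ≼ ν 2 ∷ ν 0 ⊕ κ 2 ⊗ ν 2 ≼ ν 1 ∷ []) (κ 1 ⊕ ν 0 ≼ ν 1) (h , k , tt)
  1≤N : 1 ≤ 2 * (A * A) + 2 * A + β c
  1≤N = arith A (A * A) (β c) 1≤A
    where
    arith : ∀ A a b → 1 ≤ A → 1 ≤ 2 * a + 2 * A + b
    arith A a b h = linarith (a ∷ A ∷ b ∷ [] ∣ᵉ []) (κ 1 ≼ ν 1 ∷ []) (κ 1 ≼ κ 2 ⊗ ν 0 ⊕ κ 2 ⊗ ν 1 ⊕ ν 2) (h , tt)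

-- The degenerate tile with `A = 0` and `c = 1`: a single steady column of one pixel, with `N = 2`.
checkerboard : PhiGe four 1 (frac 1 2)
checkerboard = ColumnTiling.phi 0 1 (λ i → 2 * i) refl (λ i _ → ℕₚ.*-monoʳ-< 2 (ℕₚ.n<1+n i))
  (λ i → lo i) (λ i → hi i) (s≤s z≤n) 1 refl
  where
  lo : ∀ i → 2 * i + 2 * 0 ≤ 2 * suc i
  lo i = linarith (i ∷ [] ∣ᵉ []) [] (κ 2 ⊗ ν 0 ⊕ κ 2 ⊗ κ 0 ≼ κ 2 ⊗ (κ 1 ⊕ ν 0)) tt
  hi : ∀ i → 2 * suc i ≤ 2 * i + 2 * 0 + 2
  hi i = linarith (i ∷ [] ∣ᵉ []) [] (κ 2 ⊗ (κ 1 ⊕ ν 0) ≼ κ 2 ⊗ ν 0 ⊕ κ 2 ⊗ κ 0 ⊕ κ 2) tt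

-- For fixed q = 2A + c, the areas reached with E ≤ 2c form an interval, and the intervals for A and A + 1 abut.
tiles : ∀ c A j → 1 ≤ A → 2 * A * (A + c + 1) ≤ j + (2 * A + c) → 2 * j ≤ (2 * A + c) * (2 * A + c) + 1 →
        PhiGe four j (frac j (j + (2 * A + c)))
tiles c A j 1≤A lo hi = go c lo hi (ℕₚ.≤-total (j + (2 * A + c)) (2 * A * (A + c + 1) + 2 * c))
  where
  within : ∀ c → 2 * A * (A + c + 1) ≤ j + (2 * A + c) → j + (2 * A + c) ≤ 2 * A * (A + c + 1) + 2 * c →
           PhiGe four j (frac j (j + (2 * A + c)))
  within c lo hi = tile A c E 1≤A (ℕₚ.m≤n+o⇒m∸n≤o _ (2 * A * (A + c + 1)) hi) j
    (arith A c E (j + (2 * A + c)) (ℕₚ.m∸n+n≡m lo))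
    where
    E : ℕ
    E = j + (2 * A + c) ∸ 2 * A * (A + c + 1)
    arith : ∀ A c E n → E + 2 * A * (A + c + 1) ≡ n → n ≡ 2 * (A * A) + 2 * A + (2 * A * c + E)
    arith A c E n e = linarith (n ∷ A ∷ c ∷ E ∷ [] ∣ᵉ [])
      (ν 3 ⊕ κ 2 ⊗ ν 1 ⊗ (ν 1 ⊕ ν 2 ⊕ κ 1) ≐ ν 0 ∷ []) (ν 0 ≐ κ 2 ⊗ (ν 1 ⊗ ν 1) ⊕ κ 2 ⊗ ν 1 ⊕ (κ 2 ⊗ ν 1 ⊗ ν 2 ⊕ ν 3))
      (e , tt)
  go : ∀ c → 2 * A * (A + c + 1) ≤ j + (2 * A + c) → 2 * j ≤ (2 * A + c) * (2 * A + c) + 1 →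
       j + (2 * A + c) ≤ 2 * A * (A + c + 1) + 2 * c ⊎ 2 * A * (A + c + 1) + 2 * c ≤ j + (2 * A + c) →
       PhiGe four j (frac j (j + (2 * A + c)))
  go c lo _ (inj₁ h) = within c lo h
  go zero lo hi (inj₂ _) = within 0 lo (arith A j hi)
    where
    arith : ∀ A j → 2 * j ≤ (2 * A + 0) * (2 * A + 0) + 1 → j + (2 * A + 0) ≤ 2 * A * (A + 0 + 1) + 2 * 0
    arith A j h = linarith (j ∷ A ∷ [] ∣ᵉ [])
      (κ 2 ⊗ ν 0 ≼ (κ 2 ⊗ ν 1 ⊕ κ 0) ⊗ (κ 2 ⊗ ν 1 ⊕ κ 0) ⊕ κ 1 ∷ [])
      (ν 0 ⊕ (κ 2 ⊗ ν 1 ⊕ κ 0) ≼ κ 2 ⊗ ν 1 ⊗ (ν 1 ⊕ κ 0 ⊕ κ 1) ⊕ κ 2 ⊗ κ 0) (h , tt)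
  go (suc zero) lo hi (inj₂ _) = within 1 lo (arith A j hi)
    where
    arith : ∀ A j → 2 * j ≤ (2 * A + 1) * (2 * A + 1) + 1 → j + (2 * A + 1) ≤ 2 * A * (A + 1 + 1) + 2 * 1
    arith A j h = linarith (j ∷ A ∷ [] ∣ᵉ [])
      (κ 2 ⊗ ν 0 ≼ (κ 2 ⊗ ν 1 ⊕ κ 1) ⊗ (κ 2 ⊗ ν 1 ⊕ κ 1) ⊕ κ 1 ∷ [])
      (ν 0 ⊕ (κ 2 ⊗ ν 1 ⊕ κ 1) ≼ κ 2 ⊗ ν 1 ⊗ (ν 1 ⊕ κ 1 ⊕ κ 1) ⊕ κ 2 ⊗ κ 1) (h , tt)
  go (suc (suc c)) lo hi (inj₂ h) = subst (λ q → PhiGe four j (frac j (j + q))) (same A c)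
    (tiles c (suc A) j (s≤s z≤n) (arith A c j h) (subst (λ q → 2 * j ≤ q * q + 1) (sym (same A c)) hi))
    where
    same : ∀ A c → 2 * suc A + c ≡ 2 * A + suc (suc c)
    same A c = linarith (A ∷ c ∷ [] ∣ᵉ []) [] (κ 2 ⊗ (κ 1 ⊕ ν 0) ⊕ ν 1 ≐ κ 2 ⊗ ν 0 ⊕ (κ 1 ⊕ (κ 1 ⊕ ν 1))) tt
    arith : ∀ A c j → 2 * A * (A + suc (suc c) + 1) + 2 * suc (suc c) ≤ j + (2 * A + suc (suc c)) →
            2 * suc A * (suc A + c + 1) ≤ j + (2 * suc A + c)
    arith A c j h = linarith (A ∷ c ∷ j ∷ [] ∣ᵉ [])
      (κ 2 ⊗ ν 0 ⊗ (ν 0 ⊕ (κ 1 ⊕ (κ 1 ⊕ ν 1)) ⊕ κ 1) ⊕ κ 2 ⊗ (κ 1 ⊕ (κ 1 ⊕ ν 1)) ≼ ν 2 ⊕ (κ 2 ⊗ ν 0 ⊕ (κ 1 ⊕ (κ 1 ⊕ ν 1))) ∷ [])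
      (κ 2 ⊗ (κ 1 ⊕ ν 0) ⊗ (κ 1 ⊕ ν 0 ⊕ ν 1 ⊕ κ 1) ≼ ν 2 ⊕ (κ 2 ⊗ (κ 1 ⊕ ν 0) ⊕ ν 1)) (h , tt)

PhiGe-antimono : ∀ {α k a b} → b ℚ.≤ a → PhiGe α k a → PhiGe α k b
PhiGe-antimono b≤a h ε ε>0 = let I , comps , g = h ε ε>0 in I , comps , DensityGe-antimono {I} (ℚₚ.+-monoˡ-≤ (ℚ.- ε) b≤a) g

-- The search in `tiles` starts at `A = 1` and `c = q - 2`, where its lower limit `2q ≤ j + q` is
-- just `q ≤ j`.
lower-bound₄ : ∀ q j → 1 ≤ q → q ≤ j → 2 * j ≤ q * q + 1 → PhiGe four j (frac j (j + q))
lower-bound₄ (suc zero) j _ q≤j hi = subst (λ j → PhiGe four j (frac j (j + 1))) (one j q≤j hi) checkerboard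
  where
  one : ∀ j → 1 ≤ j → 2 * j ≤ 1 * 1 + 1 → 1 ≡ j
  one j h h′ = linarith (j ∷ [] ∣ᵉ []) (κ 1 ≼ ν 0 ∷ κ 2 ⊗ ν 0 ≼ κ 1 ⊗ κ 1 ⊕ κ 1 ∷ []) (κ 1 ≐ ν 0) (h , h′ , tt)
lower-bound₄ (suc (suc c)) j _ q≤j hi = tiles c 1 j ℕₚ.≤-refl (lo c j q≤j) hi
  where
  lo : ∀ c j → suc (suc c) ≤ j → 2 * 1 * (1 + c + 1) ≤ j + (2 * 1 + c)
  lo c j h = linarith (c ∷ j ∷ [] ∣ᵉ [])
    (κ 1 ⊕ (κ 1 ⊕ ν 0) ≼ ν 1 ∷ []) (κ 2 ⊗ κ 1 ⊗ (κ 1 ⊕ ν 0 ⊕ κ 1) ≼ ν 1 ⊕ (κ 2 ⊗ κ 1 ⊕ ν 0)) (h , tt)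

-- The maximum defining `F₄` on `𝒮`

half-product : ∀ h → ∃[ t ] h * suc h ≡ 2 * t
half-product zero = 0 , refl
half-product (suc h) = let t , e = half-product h in t + suc h , arith h t e
  where
  arith : ∀ h t → h * suc h ≡ 2 * t → suc h * suc (suc h) ≡ 2 * (t + suc h)
  arith h t e = linarith (h ∷ t ∷ [] ∣ᵉ [])
    (ν 0 ⊗ (κ 1 ⊕ ν 0) ≐ κ 2 ⊗ ν 1 ∷ []) ((κ 1 ⊕ ν 0) ⊗ (κ 1 ⊕ (κ 1 ⊕ ν 0)) ≐ κ 2 ⊗ (ν 1 ⊕ (κ 1 ⊕ ν 0))) (e , tt)

-- j pixels in a tile with q black ones: the data for which j / (j + q) is the maximum defining F₄ k.
record Sharp (k q j : ℕ) : Set where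
  field
    1≤q   : 1 ≤ q
    j≤k   : j ≤ k
    upper : 2 * j ≤ q * q + 1
    lower : 2 * (q * q) ≤ 4 * j + q
    next  : 2 * q * k ≤ j * (2 * q + 1)
    kind  : k ≡ j ⊎ q * q ≤ 2 * j

module _ {k q j : ℕ} (sharp : Sharp k q j) where
  open Sharp sharp

  q≤j : q ≤ j
  q≤j = go q lower
    where
    go : ∀ q → 2 * (q * q) ≤ 4 * j + q → q ≤ j
    go 0 h = z≤n
    go 1 h = linarith (j ∷ [] ∣ᵉ []) (κ 2 ⊗ (κ 1 ⊗ κ 1) ≼ κ 4 ⊗ ν 0 ⊕ κ 1 ∷ []) (κ 1 ≼ ν 0) (h , tt)
    go 2 h = linarith (j ∷ [] ∣ᵉ []) (κ 2 ⊗ (κ 2 ⊗ κ 2) ≼ κ 4 ⊗ ν 0 ⊕ κ 2 ∷ []) (κ 2 ≼ ν 0) (h , tt)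
    go (suc (suc (suc r))) h = large r j h
      where
      large : ∀ r j → 2 * (suc (suc (suc r)) * suc (suc (suc r))) ≤ 4 * j + suc (suc (suc r)) → suc (suc (suc r)) ≤ j
      large r j h = linarith (r ∷ j ∷ [] ∣ᵉ [])
        (κ 2 ⊗ ((κ 1 ⊕ (κ 1 ⊕ (κ 1 ⊕ ν 0))) ⊗ (κ 1 ⊕ (κ 1 ⊕ (κ 1 ⊕ ν 0)))) ≼ κ 4 ⊗ ν 1 ⊕ (κ 1 ⊕ (κ 1 ⊕ (κ 1 ⊕ ν 0))) ∷ [])
        (κ 1 ⊕ (κ 1 ⊕ (κ 1 ⊕ ν 0)) ≼ ν 1) (h , tt)

  small-j : ∀ i c → 4 * (2 * i) ≤ c * c + 4 → i ≤ k → c ≤ 2 * q → i ≤ j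
  small-j i c hc i≤k c≤ = [ (λ e → subst (i ℕ.≤_) e i≤k) , (λ h → arith i q j c hc (ℕₚ.*-mono-≤ c≤ c≤) h) ]′ kind
    where
    arith : ∀ i q j c → 4 * (2 * i) ≤ c * c + 4 → c * c ≤ 2 * q * (2 * q) → q * q ≤ 2 * j → i ≤ j
    arith i q j c h₁ h₂ h₃ = linarith (i ∷ j ∷ c ∷ q ∷ [] ∣ᵉ [])
      (κ 4 ⊗ (κ 2 ⊗ ν 0) ≼ ν 2 ⊗ ν 2 ⊕ κ 4 ∷ ν 2 ⊗ ν 2 ≼ κ 2 ⊗ ν 3 ⊗ (κ 2 ⊗ ν 3) ∷ ν 3 ⊗ ν 3 ≼ κ 2 ⊗ ν 1 ∷ [])
      (ν 0 ≼ ν 1) (h₁ , h₂ , h₃ , tt)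

  even-case : ∀ i h → 1 ≤ i → 4 * (2 * i) ≤ (h + h) * (h + h) + 4 → suc h ≤ q → 2 * q * i ≤ j * (h + h)
  even-case i 0 1≤i hc h<q = ⊥-elim (absurd i 1≤i hc)
    where
    absurd : ∀ i → 1 ≤ i → 4 * (2 * i) ≤ 4 → ⊥
    absurd i h h′ = linarith (i ∷ [] ∣ᵉ []) (κ 1 ≼ ν 0 ∷ κ 4 ⊗ (κ 2 ⊗ ν 0) ≼ κ 4 ∷ []) falsum (h , h′ , tt)
  -- The general estimate absorbs the `+ 4` through `2 ≤ h`. For `h = 1` the size is at most one and
  -- `q ≤ j` is enough.
  even-case i 1 1≤i hc h<q = arith q i j (ℕₚ.*-monoʳ-≤ q (small i hc)) q≤j
    where
    small : ∀ i → 4 * (2 * i) ≤ 2 * 2 + 4 → i ≤ 1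
    small i h = linarith (i ∷ [] ∣ᵉ []) (κ 4 ⊗ (κ 2 ⊗ ν 0) ≼ κ 2 ⊗ κ 2 ⊕ κ 4 ∷ []) (ν 0 ≼ κ 1) (h , tt)
    arith : ∀ q i j → q * i ≤ q * 1 → q ≤ j → 2 * q * i ≤ j * 2
    arith q i j h h′ = linarith (q ∷ i ∷ j ∷ [] ∣ᵉ [])
      (ν 0 ⊗ ν 1 ≼ ν 0 ⊗ κ 1 ∷ ν 0 ≼ ν 2 ∷ []) (κ 2 ⊗ ν 0 ⊗ ν 1 ≼ ν 2 ⊗ κ 2) (h , h′ , tt)
  even-case i h@(suc (suc g)) 1≤i hc h<q = arith q i j h (ℕₚ.*-monoʳ-≤ q hc) (ℕₚ.*-monoˡ-≤ h lower) (ℕₚ.*-monoʳ-≤ (h * q) h<q) (ℕₚ.*-monoʳ-≤ q (s≤s (s≤s (z≤n {g}))))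
    where
    arith : ∀ q i j h → q * (4 * (2 * i)) ≤ q * ((h + h) * (h + h) + 4) →
            2 * (q * q) * h ≤ (4 * j + q) * h → h * q * (1 + h) ≤ h * q * q → q * 2 ≤ q * h →
            2 * q * i ≤ j * (h + h)
    arith q i j h h₁ h₂ h₃ h₄ = linarith (q ∷ i ∷ j ∷ h ∷ [] ∣ᵉ [])
      (ν 0 ⊗ (κ 4 ⊗ (κ 2 ⊗ ν 1)) ≼ ν 0 ⊗ ((ν 3 ⊕ ν 3) ⊗ (ν 3 ⊕ ν 3) ⊕ κ 4) ∷ κ 2 ⊗ (ν 0 ⊗ ν 0) ⊗ ν 3 ≼ (κ 4 ⊗ ν 2 ⊕ ν 0) ⊗ ν 3 ∷ ν 3 ⊗ ν 0 ⊗ (κ 1 ⊕ ν 3) ≼ ν 3 ⊗ ν 0 ⊗ ν 0 ∷ ν 0 ⊗ κ 2 ≼ ν 0 ⊗ ν 3 ∷ [])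
      (κ 2 ⊗ ν 0 ⊗ ν 1 ≼ ν 2 ⊗ (ν 3 ⊕ ν 3)) (h₁ , h₂ , h₃ , h₄ , tt)

  odd-case : ∀ i h → 4 * (2 * i) ≤ (h + suc h) * (h + suc h) + 4 → suc h ≤ q → 2 * q * i ≤ j * (h + suc h)
  odd-case i h hc h<q = let t , e = half-product h in
    arith q i j h t e (ℕₚ.*-monoʳ-≤ q (small i h t e hc)) (ℕₚ.*-monoˡ-≤ (h + suc h) lower) (ℕₚ.*-monoʳ-≤ (q * (h + suc h)) h<q) (cong (q ℕ.*_) e)
    where
    -- h (h + 1) is even, so 2 i ≤ h (h + 1) + 1 improves to i ≤ h (h + 1) / 2.
    small : ∀ i h t → h * suc h ≡ 2 * t → 4 * (2 * i) ≤ (h + suc h) * (h + suc h) + 4 → i ≤ t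
    small i h t e hc = linarith (i ∷ t ∷ h ∷ [] ∣ᵉ [])
      (ν 2 ⊗ (κ 1 ⊕ ν 2) ≐ κ 2 ⊗ ν 1 ∷ κ 4 ⊗ (κ 2 ⊗ ν 0) ≼ (ν 2 ⊕ (κ 1 ⊕ ν 2)) ⊗ (ν 2 ⊕ (κ 1 ⊕ ν 2)) ⊕ κ 4 ∷ [])
      (ν 0 ≼ ν 1) (e , hc , tt)
    arith : ∀ q i j h t → h * suc h ≡ 2 * t → q * i ≤ q * t →
            2 * (q * q) * (h + suc h) ≤ (4 * j + q) * (h + suc h) →
            q * (h + suc h) * suc h ≤ q * (h + suc h) * q → q * (h * suc h) ≡ q * (2 * t) →
            2 * q * i ≤ j * (h + suc h)
    arith q i j h t e h₁ h₂ h₃ h₄ = linarith (q ∷ i ∷ j ∷ h ∷ t ∷ [] ∣ᵉ [])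
      (ν 0 ⊗ ν 1 ≼ ν 0 ⊗ ν 4 ∷ κ 2 ⊗ (ν 0 ⊗ ν 0) ⊗ (ν 3 ⊕ (κ 1 ⊕ ν 3)) ≼ (κ 4 ⊗ ν 2 ⊕ ν 0) ⊗ (ν 3 ⊕ (κ 1 ⊕ ν 3)) ∷ ν 0 ⊗ (ν 3 ⊕ (κ 1 ⊕ ν 3)) ⊗ (κ 1 ⊕ ν 3) ≼ ν 0 ⊗ (ν 3 ⊕ (κ 1 ⊕ ν 3)) ⊗ ν 0 ∷ ν 0 ⊗ (ν 3 ⊗ (κ 1 ⊕ ν 3)) ≐ ν 0 ⊗ (κ 2 ⊗ ν 4) ∷ [])
      (κ 2 ⊗ ν 0 ⊗ ν 1 ≼ ν 2 ⊗ (ν 3 ⊕ (κ 1 ⊕ ν 3))) (h₁ , h₂ , h₃ , h₄ , tt)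

  -- The claim is that `i / c` does not exceed `j / 2q`. For `c > 2q` it follows from `next`, and
  -- for `c = 2q` it reads `i ≤ j`, which `kind` gives. For `c < 2q` write `c = 2h` or `2h + 1`;
  -- then `i` is at most `(h² + 1) / 2` or `h(h + 1) / 2`, and `lower` makes `j` large enough.
  sharp-max : ∀ i c → 1 ≤ i → i ≤ k → 4 * (2 * i) ≤ c * c + 4 → 2 * q * i ≤ j * c
  sharp-max i c 1≤i i≤k hc with ℕₚ.<-cmp c (2 * q)
  ... | tri> _ _ c> = ℕₚ.≤-trans (ℕₚ.*-monoʳ-≤ (2 * q) i≤k) (ℕₚ.≤-trans next (ℕₚ.*-monoʳ-≤ j (subst (ℕ._≤ c) (ℕₚ.+-comm 1 (2 * q)) c>)))
  ... | tri≈ _ refl _ = subst (2 * q * i ℕ.≤_) (ℕₚ.*-comm (2 * q) j) (ℕₚ.*-monoʳ-≤ (2 * q) (small-j i c hc i≤k ℕₚ.≤-refl))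
  ... | tri< c< _ _ with even-or-odd c
  ...   | h , inj₁ refl = even-case i h 1≤i hc (below h q c<)
    where
    below : ∀ h q → h + h < 2 * q → h < q
    below h q l = linarith (h ∷ q ∷ [] ∣ᵉ []) (κ 1 ⊕ (ν 0 ⊕ ν 0) ≼ κ 2 ⊗ ν 1 ∷ []) (κ 1 ⊕ ν 0 ≼ ν 1) (l , tt)
  ...   | h , inj₂ refl = odd-case i h hc (below h q c<)
    where
    below : ∀ h q → h + suc h < 2 * q → h < q
    below h q l = linarith (h ∷ q ∷ [] ∣ᵉ []) (κ 1 ⊕ (ν 0 ⊕ (κ 1 ⊕ ν 0)) ≼ κ 2 ⊗ ν 1 ∷ []) (κ 1 ⊕ ν 0 ≼ ν 1) (l , tt)

4*pred : ∀ i → 4 * (2 * i) ≤ 4 * (2 * i ∸ 1) + 4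
4*pred i = subst (4 * (2 * i) ℕ.≤_) (ℕₚ.*-distribˡ-+ 4 (2 * i ∸ 1) 1)
  (ℕₚ.*-monoʳ-≤ 4 (subst (2 * i ℕ.≤_) (ℕₚ.+-comm 1 (2 * i ∸ 1)) (ℕₚ.m≤n+m∸n (2 * i) 1)))

diam : ℕ → ℕ
diam i = ceilSqrt (4 * (2 * i ∸ 1))

diam-upper : ∀ i → 4 * (2 * i) ≤ diam i * diam i + 4
diam-upper i = ℕₚ.≤-trans (4*pred i) (ℕₚ.+-monoˡ-≤ 4 (ceilSqrt-upper (4 * (2 * i ∸ 1))))

denominator₄ : ∀ i → 1 ≤ i → 1 ≤ 2 * i + diam i
denominator₄ (suc i) _ = s≤s z≤n

F₄≤ : ∀ {k q j} → 1 ≤ k → Sharp k q j → F₄ k ℚ.≤ frac j (j + q)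
F₄≤ {k} {q} {j} 1≤k sharp = let i , 1≤i , i≤k , e = maxUpTo-attained term₄ k 1≤k in
  subst (ℚ._≤ frac j (j + q)) (sym e) (frac-mono-≤ (denominator₄ i 1≤i) (ℕₚ.≤-trans (Sharp.1≤q sharp) (ℕₚ.m≤n+m q j))
    (cross i (diam i) j q (sharp-max sharp i (diam i) 1≤i i≤k (diam-upper i))))
  where
  cross : ∀ i c j q → 2 * q * i ≤ j * c → 2 * i * (j + q) ≤ j * (2 * i + c)
  cross i c j q h = linarith (i ∷ j ∷ q ∷ c ∷ [] ∣ᵉ [])
    (κ 2 ⊗ ν 2 ⊗ ν 0 ≼ ν 1 ⊗ ν 3 ∷ []) (κ 2 ⊗ ν 0 ⊗ (ν 1 ⊕ ν 2) ≼ ν 1 ⊗ (κ 2 ⊗ ν 0 ⊕ ν 3)) (h , tt)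

∸≤⇒≤+ : ∀ m {n o} → m ∸ n ≤ o → m ≤ n + o
∸≤⇒≤+ m {n} h = ℕₚ.≤-trans (ℕₚ.m≤n+m∸n m n) (ℕₚ.+-monoʳ-≤ n h)

-- The centres are the largest sizes with `2j ≤ q² + 1`: `s₀ n = (q² + 1) / 2` for `q = 2n - 1`, and
-- `s₂ n = q² / 2` for `q = 2n`. Up to the centre `k` itself is the best size; beyond it the centre
-- remains the best one to the end of the interval.
InS⇒Sharp : ∀ {k} → InS k → ∃[ q ] ∃[ j ] Sharp k q j
InS⇒Sharp {k} (1≤k , suc m , _ , inj₁ (lo , hi)) = go (ℕₚ.≤-total k s)
  where
  s q : ℕ
  s = m * m + suc m * suc m
  q = 2 * m + 1
  lo′ : 2 * s ≤ suc m + 2 * k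
  lo′ = ∸≤⇒≤+ (2 * s) {suc m} lo
  hi′ : 2 * k ≤ 2 * s + m
  hi′ = subst (2 * k ℕ.≤_) (ℕₚ.+-∸-assoc (2 * s) {suc m} (s≤s z≤n)) hi
  go : k ≤ s ⊎ s ≤ k → ∃[ q ] ∃[ j ] Sharp k q j
  go (inj₁ k≤s) = q , k , record { 1≤q = ℕₚ.m≤n+m 1 (2 * m) ; j≤k = ℕₚ.≤-refl ; upper = ub m k k≤s ; lower = low m k lo′ ; next = nx m k ; kind = inj₁ refl }
    where
    ub : ∀ m k → k ≤ m * m + suc m * suc m → 2 * k ≤ (2 * m + 1) * (2 * m + 1) + 1
    ub m k h = linarith (k ∷ m ∷ [] ∣ᵉ [])
      (ν 0 ≼ ν 1 ⊗ ν 1 ⊕ (κ 1 ⊕ ν 1) ⊗ (κ 1 ⊕ ν 1) ∷ []) (κ 2 ⊗ ν 0 ≼ (κ 2 ⊗ ν 1 ⊕ κ 1) ⊗ (κ 2 ⊗ ν 1 ⊕ κ 1) ⊕ κ 1)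
      (h , tt)
    low : ∀ m k → 2 * (m * m + suc m * suc m) ≤ suc m + 2 * k → 2 * ((2 * m + 1) * (2 * m + 1)) ≤ 4 * k + (2 * m + 1)
    low m k h = linarith (m ∷ k ∷ [] ∣ᵉ [])
      (κ 2 ⊗ (ν 0 ⊗ ν 0 ⊕ (κ 1 ⊕ ν 0) ⊗ (κ 1 ⊕ ν 0)) ≼ κ 1 ⊕ ν 0 ⊕ κ 2 ⊗ ν 1 ∷ [])
      (κ 2 ⊗ ((κ 2 ⊗ ν 0 ⊕ κ 1) ⊗ (κ 2 ⊗ ν 0 ⊕ κ 1)) ≼ κ 4 ⊗ ν 1 ⊕ (κ 2 ⊗ ν 0 ⊕ κ 1)) (h , tt)
    nx : ∀ m k → 2 * (2 * m + 1) * k ≤ k * (2 * (2 * m + 1) + 1)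
    nx m k = linarith (m ∷ k ∷ [] ∣ᵉ []) [] (κ 2 ⊗ (κ 2 ⊗ ν 0 ⊕ κ 1) ⊗ ν 1 ≼ ν 1 ⊗ (κ 2 ⊗ (κ 2 ⊗ ν 0 ⊕ κ 1) ⊕ κ 1)) tt
  go (inj₂ s≤k) = q , s , record { 1≤q = ℕₚ.m≤n+m 1 (2 * m) ; j≤k = s≤k ; upper = ub m ; lower = low m ; next = nx m k (ℕₚ.*-monoʳ-≤ q hi′) ; kind = inj₂ (kd m) }
    where
    ub : ∀ m → 2 * (m * m + suc m * suc m) ≤ (2 * m + 1) * (2 * m + 1) + 1
    ub m = linarith (m ∷ [] ∣ᵉ [])
      [] (κ 2 ⊗ (ν 0 ⊗ ν 0 ⊕ (κ 1 ⊕ ν 0) ⊗ (κ 1 ⊕ ν 0)) ≼ (κ 2 ⊗ ν 0 ⊕ κ 1) ⊗ (κ 2 ⊗ ν 0 ⊕ κ 1) ⊕ κ 1) tt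
    low : ∀ m → 2 * ((2 * m + 1) * (2 * m + 1)) ≤ 4 * (m * m + suc m * suc m) + (2 * m + 1)
    low m = linarith (m ∷ [] ∣ᵉ [])
      []
      (κ 2 ⊗ ((κ 2 ⊗ ν 0 ⊕ κ 1) ⊗ (κ 2 ⊗ ν 0 ⊕ κ 1)) ≼ κ 4 ⊗ (ν 0 ⊗ ν 0 ⊕ (κ 1 ⊕ ν 0) ⊗ (κ 1 ⊕ ν 0)) ⊕ (κ 2 ⊗ ν 0 ⊕ κ 1))
      tt
    nx : ∀ m k → (2 * m + 1) * (2 * k) ≤ (2 * m + 1) * (2 * (m * m + suc m * suc m) + m) →
         2 * (2 * m + 1) * k ≤ (m * m + suc m * suc m) * (2 * (2 * m + 1) + 1)
    nx m k h = linarith (m ∷ k ∷ [] ∣ᵉ [])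
      ((κ 2 ⊗ ν 0 ⊕ κ 1) ⊗ (κ 2 ⊗ ν 1) ≼ (κ 2 ⊗ ν 0 ⊕ κ 1) ⊗ (κ 2 ⊗ (ν 0 ⊗ ν 0 ⊕ (κ 1 ⊕ ν 0) ⊗ (κ 1 ⊕ ν 0)) ⊕ ν 0) ∷ [])
      (κ 2 ⊗ (κ 2 ⊗ ν 0 ⊕ κ 1) ⊗ ν 1 ≼ (ν 0 ⊗ ν 0 ⊕ (κ 1 ⊕ ν 0) ⊗ (κ 1 ⊕ ν 0)) ⊗ (κ 2 ⊗ (κ 2 ⊗ ν 0 ⊕ κ 1) ⊕ κ 1))
      (h , tt)
    kd : ∀ m → (2 * m + 1) * (2 * m + 1) ≤ 2 * (m * m + suc m * suc m)
    kd m = linarith (m ∷ [] ∣ᵉ []) [] ((κ 2 ⊗ ν 0 ⊕ κ 1) ⊗ (κ 2 ⊗ ν 0 ⊕ κ 1) ≼ κ 2 ⊗ (ν 0 ⊗ ν 0 ⊕ (κ 1 ⊕ ν 0) ⊗ (κ 1 ⊕ ν 0))) tt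
InS⇒Sharp {k} (1≤k , n , 1≤n , inj₂ (lo , hi)) = go (ℕₚ.≤-total k s)
  where
  s q : ℕ
  s = 2 * n * n
  q = 2 * n
  1≤q′ : 1 ≤ q
  1≤q′ = ℕₚ.≤-trans 1≤n (ℕₚ.m≤m+n n (n + 0))
  lo′ : 2 * s ≤ n + 2 * k
  lo′ = ∸≤⇒≤+ (2 * s) {n} lo
  go : k ≤ s ⊎ s ≤ k → ∃[ q ] ∃[ j ] Sharp k q j
  go (inj₁ k≤s) = q , k , record { 1≤q = 1≤q′ ; j≤k = ℕₚ.≤-refl ; upper = ub n k k≤s ; lower = low n k lo′ ; next = nx n k ; kind = inj₁ refl }
    where
    ub : ∀ n k → k ≤ 2 * n * n → 2 * k ≤ 2 * n * (2 * n) + 1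
    ub n k h = linarith (k ∷ n ∷ [] ∣ᵉ []) (ν 0 ≼ κ 2 ⊗ ν 1 ⊗ ν 1 ∷ []) (κ 2 ⊗ ν 0 ≼ κ 2 ⊗ ν 1 ⊗ (κ 2 ⊗ ν 1) ⊕ κ 1) (h , tt)
    low : ∀ n k → 2 * (2 * n * n) ≤ n + 2 * k → 2 * (2 * n * (2 * n)) ≤ 4 * k + 2 * n
    low n k h = linarith (n ∷ k ∷ [] ∣ᵉ [])
      (κ 2 ⊗ (κ 2 ⊗ ν 0 ⊗ ν 0) ≼ ν 0 ⊕ κ 2 ⊗ ν 1 ∷ []) (κ 2 ⊗ (κ 2 ⊗ ν 0 ⊗ (κ 2 ⊗ ν 0)) ≼ κ 4 ⊗ ν 1 ⊕ κ 2 ⊗ ν 0)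
      (h , tt)
    nx : ∀ n k → 2 * (2 * n) * k ≤ k * (2 * (2 * n) + 1)
    nx n k = linarith (n ∷ k ∷ [] ∣ᵉ []) [] (κ 2 ⊗ (κ 2 ⊗ ν 0) ⊗ ν 1 ≼ ν 1 ⊗ (κ 2 ⊗ (κ 2 ⊗ ν 0) ⊕ κ 1)) tt
  go (inj₂ s≤k) = q , s , record { 1≤q = 1≤q′ ; j≤k = s≤k ; upper = ub n ; lower = low n ; next = nx n k (ℕₚ.*-monoʳ-≤ q hi) ; kind = inj₂ (kd n) }
    where
    ub : ∀ n → 2 * (2 * n * n) ≤ 2 * n * (2 * n) + 1
    ub n = linarith (n ∷ [] ∣ᵉ []) [] (κ 2 ⊗ (κ 2 ⊗ ν 0 ⊗ ν 0) ≼ κ 2 ⊗ ν 0 ⊗ (κ 2 ⊗ ν 0) ⊕ κ 1) tt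
    low : ∀ n → 2 * (2 * n * (2 * n)) ≤ 4 * (2 * n * n) + 2 * n
    low n = linarith (n ∷ [] ∣ᵉ []) [] (κ 2 ⊗ (κ 2 ⊗ ν 0 ⊗ (κ 2 ⊗ ν 0)) ≼ κ 4 ⊗ (κ 2 ⊗ ν 0 ⊗ ν 0) ⊕ κ 2 ⊗ ν 0) tt
    nx : ∀ n k → 2 * n * (2 * k) ≤ 2 * n * (2 * (2 * n * n) + n) →
         2 * (2 * n) * k ≤ 2 * n * n * (2 * (2 * n) + 1)
    nx n k h = linarith (n ∷ k ∷ [] ∣ᵉ [])
      (κ 2 ⊗ ν 0 ⊗ (κ 2 ⊗ ν 1) ≼ κ 2 ⊗ ν 0 ⊗ (κ 2 ⊗ (κ 2 ⊗ ν 0 ⊗ ν 0) ⊕ ν 0) ∷ [])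
      (κ 2 ⊗ (κ 2 ⊗ ν 0) ⊗ ν 1 ≼ κ 2 ⊗ ν 0 ⊗ ν 0 ⊗ (κ 2 ⊗ (κ 2 ⊗ ν 0) ⊕ κ 1)) (h , tt)
    kd : ∀ n → 2 * n * (2 * n) ≤ 2 * (2 * n * n)
    kd n = linarith (n ∷ [] ∣ᵉ []) [] (κ 2 ⊗ ν 0 ⊗ (κ 2 ⊗ ν 0) ≼ κ 2 ⊗ (κ 2 ⊗ ν 0 ⊗ ν 0)) tt

theorem₄-upper : ∀ k → 1 ≤ k → PhiLe four k (F₄ k)
theorem₄-upper k 1≤k = let j , 1≤j , j≤k , e = maxUpTo-attained term₄ k 1≤k in
  subst (PhiLe four k) (sym e) (upper-bound₄ k (2 * j) (2 * j + diam j) (denominator₄ j 1≤j)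
    λ i 1≤i i≤k → frac-cancel-≤ (denominator₄ i 1≤i) (denominator₄ j 1≤j) (subst (term₄ i ℚ.≤_) e (maxUpTo-upper term₄ k 1≤i i≤k)))

theorem₄-S : ∀ k → InS k → PhiEq four k (F₄ k)
theorem₄-S k k∈S = theorem₄-upper k (proj₁ k∈S) , lower (InS⇒Sharp k∈S)
  where
  lower : (∃[ q ] ∃[ j ] Sharp k q j) → PhiGe four k (F₄ k)
  lower (q , j , sharp) = PhiGe-antimono {four} {k} (F₄≤ (proj₁ k∈S) sharp)
    (PhiGe-mono {a = frac j (j + q)} (Sharp.j≤k sharp) (lower-bound₄ q j (Sharp.1≤q sharp) (q≤j sharp) (Sharp.upper sharp)))

-- Diagonal rectangles with sides m and m + 1 cannot fit together without loss.

_∈ᴿ?_ : ∀ z R → Dec (z ∈ᴿ R)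
z ∈ᴿ? diagRect u₀ v₀ U V = map′ (λ (a , b , c , d) → inRect a b c d) (λ (inRect a b c d) → a , b , c , d)
  ((u₀ ℤ.≤? u z) ×-dec (u z ℤ.<? u₀ ℤ.+ + U) ×-dec (v₀ ℤ.≤? v z) ×-dec (v z ℤ.<? v₀ ℤ.+ + V))

-- Describes a lossless component around `z` in terms of an arbitrary predicate `P` for "white", so
-- that the argument can be carried over to rotated images as `P ∘ rot`.
record OptimalRect (m : ℕ) (P : Pixel → Set) (z : Pixel) : Set where
  field
    rect    : DiagRect
  open DiagRect rect public
  field
    sides   : (U ≡ m × V ≡ suc m) ⊎ (U ≡ suc m × V ≡ m)
    member  : z ∈ᴿ rect
    inside  : ∀ {w} → w ∈ᴿ rect → P w
    outside : ∀ {w w′} → w ∈ᴿ rect → ¬ w′ ∈ᴿ rect → Near four w w′ → ¬ P w′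

  U≥ : m ≤ U
  U≥ = [ (λ (e , _) → ℕₚ.≤-reflexive (sym e)) , (λ (e , _) → subst (m ℕ.≤_) (sym e) (ℕₚ.n≤1+n m)) ]′ sides
  V≥ : m ≤ V
  V≥ = [ (λ (_ , e) → subst (m ℕ.≤_) (sym e) (ℕₚ.n≤1+n m)) , (λ (_ , e) → ℕₚ.≤-reflexive (sym e)) ]′ sides
  U≤ : U ≤ suc m
  U≤ = [ (λ (e , _) → subst (ℕ._≤ suc m) (sym e) (ℕₚ.n≤1+n m)) , (λ (e , _) → ℕₚ.≤-reflexive e) ]′ sides
  V≤ : V ≤ suc m
  V≤ = [ (λ (_ , e) → ℕₚ.≤-reflexive e) , (λ (_ , e) → subst (ℕ._≤ suc m) (sym e) (ℕₚ.n≤1+n m)) ]′ sides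

ThreeBlack : (Pixel → Set) → Pixel → Set
ThreeBlack P z = (¬ P z × ¬ P (e₁ z) × ¬ P (e₂ z)) ⊎ (¬ P z × ¬ P (e₁ z) × ¬ P (e₁₂ z))
               ⊎ (¬ P z × ¬ P (e₂ z) × ¬ P (e₁₂ z)) ⊎ (¬ P (e₁ z) × ¬ P (e₂ z) × ¬ P (e₁₂ z))

-- `Bad` stands for the pixels of components that lose tokens by their shape; a square with three
-- black corners loses one by itself.
record Defect (P Bad : Pixel → Set) (K : ℕ) (z : Pixel) : Set where
  constructor defect
  field
    at    : Pixel
    close : InBox K (proj₁ at ℤ.- proj₁ z , proj₂ at ℤ.- proj₂ z)
    why   : Bad at ⊎ ThreeBlack P at

-- The pixel `(x , y)` lies on the edge `v = v₀` and on the last but one diagonal. Since `u ≡ v`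
-- modulo 2 and `V` is odd, the last diagonal runs only from `v₀ + 1` to `v₀ + V - 2`, so the upper
-- right side lacks both corners.
module TruncatedNE {m : ℕ} (2≤m : 2 ≤ m) {P Bad : Pixel → Set} (P? : ∀ z → Dec (P z))
                   (classify : ∀ {w} → P w → OptimalRect m P w ⊎ Bad w)
                   {z : Pixel} (C : OptimalRect m P z) (h : ℕ) (V≡ : OptimalRect.V C ≡ 2 * h + 1)
                   (x y : ℤ) (up≡ : x ℤ.+ y ≡ OptimalRect.u₀ C ℤ.+ + OptimalRect.U C ℤ.- + 2) (vp≡ : x ℤ.- y ≡ OptimalRect.v₀ C) where
  open OptimalRect C

  K : ℕ
  K = 2 * m + 10

  U≥2 : 2 ≤ U
  U≥2 = ℕₚ.≤-trans 2≤m U≥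
  V≥2 : 2 ≤ V
  V≥2 = ℕₚ.≤-trans 2≤m V≥

  black : ∀ {w w′} → w ∈ᴿ rect → ¬ w′ ∈ᴿ rect → Near four w w′ → ¬ P w′
  black = outside

  near-down : ∀ a b → Near four (a , b ℤ.+ 1ℤ) (a , b)
  near-down a b = near-sym four {a , b} {a , b ℤ.+ 1ℤ} (near-up (a , b))

  p q : Pixel
  p = x , y
  q = x , y ℤ.+ 1ℤ

  p∈ : p ∈ᴿ rect
  p∈ = inRect (l₁ x y u₀ U up≡ U≥2) (l₂ x y u₀ U up≡) (l₃ x y v₀ vp≡) (l₄ x y v₀ V vp≡ V≥2)
    where
    l₁ : ∀ x y u₀ U → x ℤ.+ y ≡ u₀ ℤ.+ + U ℤ.- + 2 → 2 ≤ U → u₀ ℤ.≤ x ℤ.+ y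
    l₁ x y u₀ U e h = linarith (U ∷ [] ∣ᵉ u₀ ∷ x ∷ y ∷ [])
      (ζ 1 ⊞ ζ 2 ≐ᶻ ζ 0 ⊞ ι 0 ⊖ κᶻ 2 ∷ κ 2 ≼ ν 0 ∷ []) (ζ 0 ≼ᶻ ζ 1 ⊞ ζ 2) (e , h , tt)
    l₂ : ∀ x y u₀ U → x ℤ.+ y ≡ u₀ ℤ.+ + U ℤ.- + 2 → x ℤ.+ y ℤ.< u₀ ℤ.+ + U
    l₂ x y u₀ U e = linarith (U ∷ [] ∣ᵉ x ∷ y ∷ u₀ ∷ []) (ζ 0 ⊞ ζ 1 ≐ᶻ ζ 2 ⊞ ι 0 ⊖ κᶻ 2 ∷ []) (ζ 0 ⊞ ζ 1 ≺ᶻ ζ 2 ⊞ ι 0) (e , tt)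
    l₃ : ∀ x y v₀ → x ℤ.- y ≡ v₀ → v₀ ℤ.≤ x ℤ.- y
    l₃ x y v₀ e = linarith ([] ∣ᵉ v₀ ∷ x ∷ y ∷ []) (ζ 1 ⊖ ζ 2 ≐ᶻ ζ 0 ∷ []) (ζ 0 ≼ᶻ ζ 1 ⊖ ζ 2) (e , tt)
    l₄ : ∀ x y v₀ V → x ℤ.- y ≡ v₀ → 2 ≤ V → x ℤ.- y ℤ.< v₀ ℤ.+ + V
    l₄ x y v₀ V e h = linarith (V ∷ [] ∣ᵉ x ∷ y ∷ v₀ ∷ [])
      (ζ 0 ⊖ ζ 1 ≐ᶻ ζ 2 ∷ κ 2 ≼ ν 0 ∷ []) (ζ 0 ⊖ ζ 1 ≺ᶻ ζ 2 ⊞ ι 0) (e , h , tt)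

  e₁p∈ : e₁ p ∈ᴿ rect
  e₁p∈ = inRect (l₁ x y u₀ U up≡ U≥2) (l₂ x y u₀ U up≡) (l₃ x y v₀ vp≡) (l₄ x y v₀ V vp≡ V≥2)
    where
    l₁ : ∀ x y u₀ U → x ℤ.+ y ≡ u₀ ℤ.+ + U ℤ.- + 2 → 2 ≤ U → u₀ ℤ.≤ x ℤ.+ 1ℤ ℤ.+ y
    l₁ x y u₀ U e h = linarith (U ∷ [] ∣ᵉ u₀ ∷ x ∷ y ∷ [])
      (ζ 1 ⊞ ζ 2 ≐ᶻ ζ 0 ⊞ ι 0 ⊖ κᶻ 2 ∷ κ 2 ≼ ν 0 ∷ []) (ζ 0 ≼ᶻ ζ 1 ⊞ κᶻ 1 ⊞ ζ 2) (e , h , tt)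
    l₂ : ∀ x y u₀ U → x ℤ.+ y ≡ u₀ ℤ.+ + U ℤ.- + 2 → x ℤ.+ 1ℤ ℤ.+ y ℤ.< u₀ ℤ.+ + U
    l₂ x y u₀ U e = linarith (U ∷ [] ∣ᵉ x ∷ y ∷ u₀ ∷ [])
      (ζ 0 ⊞ ζ 1 ≐ᶻ ζ 2 ⊞ ι 0 ⊖ κᶻ 2 ∷ []) (ζ 0 ⊞ κᶻ 1 ⊞ ζ 1 ≺ᶻ ζ 2 ⊞ ι 0) (e , tt)
    l₃ : ∀ x y v₀ → x ℤ.- y ≡ v₀ → v₀ ℤ.≤ x ℤ.+ 1ℤ ℤ.- y
    l₃ x y v₀ e = linarith ([] ∣ᵉ v₀ ∷ x ∷ y ∷ []) (ζ 1 ⊖ ζ 2 ≐ᶻ ζ 0 ∷ []) (ζ 0 ≼ᶻ ζ 1 ⊞ κᶻ 1 ⊖ ζ 2) (e , tt)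
    l₄ : ∀ x y v₀ V → x ℤ.- y ≡ v₀ → 2 ≤ V → x ℤ.+ 1ℤ ℤ.- y ℤ.< v₀ ℤ.+ + V
    l₄ x y v₀ V e h = linarith (V ∷ [] ∣ᵉ x ∷ y ∷ v₀ ∷ [])
      (ζ 0 ⊖ ζ 1 ≐ᶻ ζ 2 ∷ κ 2 ≼ ν 0 ∷ []) (ζ 0 ⊞ κᶻ 1 ⊖ ζ 1 ≺ᶻ ζ 2 ⊞ ι 0) (e , h , tt)

  q-black : ¬ P q
  q-black = black p∈ (λ r → l x y v₀ vp≡ (_∈ᴿ_.vlo r)) (near-up p)
    where
    l : ∀ x y v₀ → x ℤ.- y ≡ v₀ → ¬ v₀ ℤ.≤ x ℤ.- (y ℤ.+ 1ℤ)
    l x y v₀ e h = linarith ([] ∣ᵉ x ∷ y ∷ v₀ ∷ []) (ζ 0 ⊖ ζ 1 ≐ᶻ ζ 2 ∷ ζ 2 ≼ᶻ ζ 0 ⊖ (ζ 1 ⊞ κᶻ 1) ∷ []) falsum (e , h , tt)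

  e₁q-black : ¬ P (e₁ q)
  e₁q-black = black e₁p∈ (λ r → l x y u₀ U up≡ (_∈ᴿ_.uhi r)) (near-up (e₁ p))
    where
    l : ∀ x y u₀ U → x ℤ.+ y ≡ u₀ ℤ.+ + U ℤ.- + 2 → ¬ x ℤ.+ 1ℤ ℤ.+ (y ℤ.+ 1ℤ) ℤ.< u₀ ℤ.+ + U
    l x y u₀ U e h = linarith (U ∷ [] ∣ᵉ x ∷ y ∷ u₀ ∷ [])
      (ζ 0 ⊞ ζ 1 ≐ᶻ ζ 2 ⊞ ι 0 ⊖ κᶻ 2 ∷ ζ 0 ⊞ κᶻ 1 ⊞ (ζ 1 ⊞ κᶻ 1) ≺ᶻ ζ 2 ⊞ ι 0 ∷ []) falsum (e , h , tt)

  e₁e₁p-black : ¬ P (e₁ (e₁ p))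
  e₁e₁p-black = black e₁p∈ (λ r → l x y u₀ U up≡ (_∈ᴿ_.uhi r)) (near-right (e₁ p))
    where
    l : ∀ x y u₀ U → x ℤ.+ y ≡ u₀ ℤ.+ + U ℤ.- + 2 → ¬ x ℤ.+ 1ℤ ℤ.+ 1ℤ ℤ.+ y ℤ.< u₀ ℤ.+ + U
    l x y u₀ U e h = linarith (U ∷ [] ∣ᵉ x ∷ y ∷ u₀ ∷ [])
      (ζ 0 ⊞ ζ 1 ≐ᶻ ζ 2 ⊞ ι 0 ⊖ κᶻ 2 ∷ ζ 0 ⊞ κᶻ 1 ⊞ κᶻ 1 ⊞ ζ 1 ≺ᶻ ζ 2 ⊞ ι 0 ∷ []) falsum (e , h , tt)

  -- A component above with both pixels over q and e₁ q ends there, so that the next pixel to the right is black.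
  above-black : OptimalRect m P (e₂ q) → P (e₁₂ q) → ¬ P (e₁ (e₁₂ q))
  above-black D Pt = go (e₁₂ q ∈ᴿ? D.rect) (e₁ q ∈ᴿ? D.rect)
    where
    module D = OptimalRect D
    go : Dec (e₁₂ q ∈ᴿ D.rect) → Dec (e₁ q ∈ᴿ D.rect) → ¬ P (e₁ (e₁₂ q))
    go (no t∉) _ _ = D.outside D.member t∉ (near-right (e₂ q)) Pt
    go (yes _) (yes q∈) _ = e₁q-black (D.inside q∈)
    go (yes t∈) (no q∉) = D.outside t∈ (λ r → q∉ (inRect (_∈ᴿ_.ulo u∈) (l₂ x y (D.u₀ ℤ.+ + D.U) (_∈ᴿ_.uhi t∈))
        (l₃ x y D.v₀ (_∈ᴿ_.vlo t∈)) (l₄ x y (D.v₀ ℤ.+ + D.V) (_∈ᴿ_.vhi r)))) (near-right (e₁₂ q))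
      where
      u∈ : e₁ q ∈ᴿ diagRect D.u₀ (v (e₁ q)) D.U 1
      u∈ = inRect (l₁ x y D.u₀ (_∈ᴿ_.ulo D.member)) (l₂′ x y (D.u₀ ℤ.+ + D.U) (_∈ᴿ_.uhi t∈)) ℤₚ.≤-refl (l′ (v (e₁ q)))
        where
        l₁ : ∀ x y c → c ℤ.≤ x ℤ.+ (y ℤ.+ 1ℤ ℤ.+ 1ℤ) → c ℤ.≤ x ℤ.+ 1ℤ ℤ.+ (y ℤ.+ 1ℤ)
        l₁ x y c h = linarith ([] ∣ᵉ c ∷ x ∷ y ∷ [])
          (ζ 0 ≼ᶻ ζ 1 ⊞ (ζ 2 ⊞ κᶻ 1 ⊞ κᶻ 1) ∷ []) (ζ 0 ≼ᶻ ζ 1 ⊞ κᶻ 1 ⊞ (ζ 2 ⊞ κᶻ 1)) (h , tt)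
        l₂′ : ∀ x y c → x ℤ.+ 1ℤ ℤ.+ (y ℤ.+ 1ℤ ℤ.+ 1ℤ) ℤ.< c → x ℤ.+ 1ℤ ℤ.+ (y ℤ.+ 1ℤ) ℤ.< c
        l₂′ x y c h = linarith ([] ∣ᵉ x ∷ y ∷ c ∷ [])
          (ζ 0 ⊞ κᶻ 1 ⊞ (ζ 1 ⊞ κᶻ 1 ⊞ κᶻ 1) ≺ᶻ ζ 2 ∷ []) (ζ 0 ⊞ κᶻ 1 ⊞ (ζ 1 ⊞ κᶻ 1) ≺ᶻ ζ 2) (h , tt)
        l′ : ∀ a → a ℤ.< a ℤ.+ 1ℤ
        l′ a = linarith ([] ∣ᵉ a ∷ []) [] (ζ 0 ≺ᶻ ζ 0 ⊞ κᶻ 1) tt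
      l₂ : ∀ x y c → x ℤ.+ 1ℤ ℤ.+ (y ℤ.+ 1ℤ ℤ.+ 1ℤ) ℤ.< c → x ℤ.+ 1ℤ ℤ.+ (y ℤ.+ 1ℤ) ℤ.< c
      l₂ x y c h = linarith ([] ∣ᵉ x ∷ y ∷ c ∷ [])
        (ζ 0 ⊞ κᶻ 1 ⊞ (ζ 1 ⊞ κᶻ 1 ⊞ κᶻ 1) ≺ᶻ ζ 2 ∷ []) (ζ 0 ⊞ κᶻ 1 ⊞ (ζ 1 ⊞ κᶻ 1) ≺ᶻ ζ 2) (h , tt)
      l₃ : ∀ x y c → c ℤ.≤ x ℤ.+ 1ℤ ℤ.- (y ℤ.+ 1ℤ ℤ.+ 1ℤ) → c ℤ.≤ x ℤ.+ 1ℤ ℤ.- (y ℤ.+ 1ℤ)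
      l₃ x y c h = linarith ([] ∣ᵉ c ∷ x ∷ y ∷ [])
        (ζ 0 ≼ᶻ ζ 1 ⊞ κᶻ 1 ⊖ (ζ 2 ⊞ κᶻ 1 ⊞ κᶻ 1) ∷ []) (ζ 0 ≼ᶻ ζ 1 ⊞ κᶻ 1 ⊖ (ζ 2 ⊞ κᶻ 1)) (h , tt)
      l₄ : ∀ x y c → x ℤ.+ 1ℤ ℤ.+ 1ℤ ℤ.- (y ℤ.+ 1ℤ ℤ.+ 1ℤ) ℤ.< c → x ℤ.+ 1ℤ ℤ.- (y ℤ.+ 1ℤ) ℤ.< c
      l₄ x y c h = linarith ([] ∣ᵉ x ∷ y ∷ c ∷ [])
        (ζ 0 ⊞ κᶻ 1 ⊞ κᶻ 1 ⊖ (ζ 1 ⊞ κᶻ 1 ⊞ κᶻ 1) ≺ᶻ ζ 2 ∷ []) (ζ 0 ⊞ κᶻ 1 ⊖ (ζ 1 ⊞ κᶻ 1) ≺ᶻ ζ 2) (h , tt)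

  r : Pixel
  r = e₁ (e₁ q)

  -- The pixels to the left of, below and above `r` are black. If `D` extended below `v r`, it would
  -- contain the left neighbour, or, when it does not extend below `u r`, the upper one because
  -- `U ≥ 2`. With `v₀ = v r` settled, an extension below `u r` would contain the lower neighbour.
  left-corner : (D : OptimalRect m P r) → ¬ P (e₁ (e₁₂ q)) → OptimalRect.u₀ D ≡ u r × OptimalRect.v₀ D ≡ v r
  left-corner D up-black = ℤₚ.≤-antisym (_∈ᴿ_.ulo D.member) (ℤₚ.≮⇒≥ u-not) , ℤₚ.≤-antisym (_∈ᴿ_.vlo D.member) (ℤₚ.≮⇒≥ v-not)
    where
    module D = OptimalRect D
    a b : ℤ
    a = x ℤ.+ 1ℤ ℤ.+ 1ℤ
    b = y ℤ.+ 1ℤ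
    U₂ : 2 ≤ D.U
    U₂ = ℕₚ.≤-trans 2≤m D.U≥
    V₂ : 2 ≤ D.V
    V₂ = ℕₚ.≤-trans 2≤m D.V≥
    left∉ : ¬ (x ℤ.+ 1ℤ , y ℤ.+ 1ℤ) ∈ᴿ D.rect
    left∉ i = e₁q-black (D.inside i)
    down∉ : ¬ (x ℤ.+ 1ℤ ℤ.+ 1ℤ , y) ∈ᴿ D.rect
    down∉ i = e₁e₁p-black (D.inside i)
    up∉ : ¬ (x ℤ.+ 1ℤ ℤ.+ 1ℤ , y ℤ.+ 1ℤ ℤ.+ 1ℤ) ∈ᴿ D.rect
    up∉ i = up-black (D.inside i)
    M = D.member
    v-not : ¬ D.v₀ ℤ.< v r
    v-not lt = up∉ (inRect (ℤₚ.≤-trans (_∈ᴿ_.ulo M) (up≤ a b)) (u-up (ℤₚ.≮⇒≥ first)) (v-up (a ℤ.- b) D.v₀ lt a b refl) (ℤₚ.≤-<-trans (v≤ a b) (_∈ᴿ_.vhi M)))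
      where
      up≤ : ∀ a b → a ℤ.+ b ℤ.≤ a ℤ.+ (b ℤ.+ 1ℤ)
      up≤ a b = linarith ([] ∣ᵉ a ∷ b ∷ []) [] (ζ 0 ⊞ ζ 1 ≼ᶻ ζ 0 ⊞ (ζ 1 ⊞ κᶻ 1)) tt
      v≤ : ∀ a b → a ℤ.- (b ℤ.+ 1ℤ) ℤ.≤ a ℤ.- b
      v≤ a b = linarith ([] ∣ᵉ a ∷ b ∷ []) [] (ζ 0 ⊖ (ζ 1 ⊞ κᶻ 1) ≼ᶻ ζ 0 ⊖ ζ 1) tt
      v-up : ∀ c d → d ℤ.< c → ∀ a b → a ℤ.- b ≡ c → d ℤ.≤ a ℤ.- (b ℤ.+ 1ℤ)
      v-up c d h a b e = linarith ([] ∣ᵉ d ∷ a ∷ b ∷ c ∷ [])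
        (ζ 0 ≺ᶻ ζ 3 ∷ ζ 1 ⊖ ζ 2 ≐ᶻ ζ 3 ∷ []) (ζ 0 ≼ᶻ ζ 1 ⊖ (ζ 2 ⊞ κᶻ 1)) (h , e , tt)
      first : ¬ D.u₀ ℤ.< a ℤ.+ b
      first ult = left∉ (inRect (lu x b D.u₀ ult) (ru x b (D.u₀ ℤ.+ + D.U) (_∈ᴿ_.uhi M)) (lv x b D.v₀ lt) (rv x b (D.v₀ ℤ.+ + D.V) (_∈ᴿ_.vhi M)))
        where
        lu : ∀ x b c → c ℤ.< x ℤ.+ 1ℤ ℤ.+ 1ℤ ℤ.+ b → c ℤ.≤ x ℤ.+ 1ℤ ℤ.+ b
        lu x b c h = linarith ([] ∣ᵉ c ∷ x ∷ b ∷ []) (ζ 0 ≺ᶻ ζ 1 ⊞ κᶻ 1 ⊞ κᶻ 1 ⊞ ζ 2 ∷ []) (ζ 0 ≼ᶻ ζ 1 ⊞ κᶻ 1 ⊞ ζ 2) (h , tt)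
        ru : ∀ x b c → x ℤ.+ 1ℤ ℤ.+ 1ℤ ℤ.+ b ℤ.< c → x ℤ.+ 1ℤ ℤ.+ b ℤ.< c
        ru x b c h = linarith ([] ∣ᵉ x ∷ b ∷ c ∷ []) (ζ 0 ⊞ κᶻ 1 ⊞ κᶻ 1 ⊞ ζ 1 ≺ᶻ ζ 2 ∷ []) (ζ 0 ⊞ κᶻ 1 ⊞ ζ 1 ≺ᶻ ζ 2) (h , tt)
        lv : ∀ x b c → c ℤ.< x ℤ.+ 1ℤ ℤ.+ 1ℤ ℤ.- b → c ℤ.≤ x ℤ.+ 1ℤ ℤ.- b
        lv x b c h = linarith ([] ∣ᵉ c ∷ x ∷ b ∷ []) (ζ 0 ≺ᶻ ζ 1 ⊞ κᶻ 1 ⊞ κᶻ 1 ⊖ ζ 2 ∷ []) (ζ 0 ≼ᶻ ζ 1 ⊞ κᶻ 1 ⊖ ζ 2) (h , tt)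
        rv : ∀ x b c → x ℤ.+ 1ℤ ℤ.+ 1ℤ ℤ.- b ℤ.< c → x ℤ.+ 1ℤ ℤ.- b ℤ.< c
        rv x b c h = linarith ([] ∣ᵉ x ∷ b ∷ c ∷ []) (ζ 0 ⊞ κᶻ 1 ⊞ κᶻ 1 ⊖ ζ 1 ≺ᶻ ζ 2 ∷ []) (ζ 0 ⊞ κᶻ 1 ⊖ ζ 1 ≺ᶻ ζ 2) (h , tt)
      u-up : a ℤ.+ b ℤ.≤ D.u₀ → a ℤ.+ (b ℤ.+ 1ℤ) ℤ.< D.u₀ ℤ.+ + D.U
      u-up h = l a b D.u₀ D.U h U₂
        where
        l : ∀ a b c U → a ℤ.+ b ℤ.≤ c → 2 ≤ U → a ℤ.+ (b ℤ.+ 1ℤ) ℤ.< c ℤ.+ + U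
        l a b c U h k = linarith (U ∷ [] ∣ᵉ a ∷ b ∷ c ∷ [])
          (ζ 0 ⊞ ζ 1 ≼ᶻ ζ 2 ∷ κ 2 ≼ ν 0 ∷ []) (ζ 0 ⊞ (ζ 1 ⊞ κᶻ 1) ≺ᶻ ζ 2 ⊞ ι 0) (h , k , tt)
    u-not : ¬ D.u₀ ℤ.< u r
    u-not lt = down∉ (inRect (lu a y D.u₀ lt) (ru a y (D.u₀ ℤ.+ + D.U) (_∈ᴿ_.uhi M)) (lv a y D.v₀ (_∈ᴿ_.vlo M)) (rv a y D.v₀ D.V (ℤₚ.≮⇒≥ v-not) V₂))
      where
      lu : ∀ a y c → c ℤ.< a ℤ.+ (y ℤ.+ 1ℤ) → c ℤ.≤ a ℤ.+ y
      lu a y c h = linarith ([] ∣ᵉ c ∷ a ∷ y ∷ []) (ζ 0 ≺ᶻ ζ 1 ⊞ (ζ 2 ⊞ κᶻ 1) ∷ []) (ζ 0 ≼ᶻ ζ 1 ⊞ ζ 2) (h , tt)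
      ru : ∀ a y c → a ℤ.+ (y ℤ.+ 1ℤ) ℤ.< c → a ℤ.+ y ℤ.< c
      ru a y c h = linarith ([] ∣ᵉ a ∷ y ∷ c ∷ []) (ζ 0 ⊞ (ζ 1 ⊞ κᶻ 1) ≺ᶻ ζ 2 ∷ []) (ζ 0 ⊞ ζ 1 ≺ᶻ ζ 2) (h , tt)
      lv : ∀ a y c → c ℤ.≤ a ℤ.- (y ℤ.+ 1ℤ) → c ℤ.≤ a ℤ.- y
      lv a y c h = linarith ([] ∣ᵉ c ∷ a ∷ y ∷ []) (ζ 0 ≼ᶻ ζ 1 ⊖ (ζ 2 ⊞ κᶻ 1) ∷ []) (ζ 0 ≼ᶻ ζ 1 ⊖ ζ 2) (h , tt)
      rv : ∀ a y c V → a ℤ.- (y ℤ.+ 1ℤ) ℤ.≤ c → 2 ≤ V → a ℤ.- y ℤ.< c ℤ.+ + V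
      rv a y c V h k = linarith (V ∷ [] ∣ᵉ a ∷ y ∷ c ∷ [])
        (ζ 0 ⊖ (ζ 1 ⊞ κᶻ 1) ≼ᶻ ζ 2 ∷ κ 2 ≼ ν 0 ∷ []) (ζ 0 ⊖ ζ 1 ≺ᶻ ζ 2 ⊞ ι 0) (h , k , tt)

  -- The lower right end of the truncated side.
  g : Pixel
  g = x ℤ.+ + h ℤ.+ 1ℤ , y ℤ.- + h

  1≤h : 1 ≤ h
  1≤h = l h V V≡ V≥2
    where
    l : ∀ h V → V ≡ 2 * h + 1 → 2 ≤ V → 1 ≤ h
    l h V e k = linarith (h ∷ V ∷ [] ∣ᵉ []) (ν 1 ≐ κ 2 ⊗ ν 0 ⊕ κ 1 ∷ κ 2 ≼ ν 1 ∷ []) (κ 1 ≼ ν 0) (e , k , tt)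

  g-black : ¬ P g
  g-black = black {x ℤ.+ + h , y ℤ.- + h} (inRect (l₁ x y u₀ U h up≡ U≥2) (l₂ x y u₀ U h up≡) (l₃ x y v₀ h vp≡) (l₄ x y v₀ V h vp≡ V≡))
    (λ i → l₅ x y v₀ V h vp≡ V≡ (_∈ᴿ_.vhi i)) (near-right (x ℤ.+ + h , y ℤ.- + h))
    where
    l₁ : ∀ x y u₀ U h → x ℤ.+ y ≡ u₀ ℤ.+ + U ℤ.- + 2 → 2 ≤ U → u₀ ℤ.≤ x ℤ.+ + h ℤ.+ (y ℤ.- + h)
    l₁ x y u₀ U h e k = linarith (h ∷ U ∷ [] ∣ᵉ u₀ ∷ x ∷ y ∷ [])
      (ζ 1 ⊞ ζ 2 ≐ᶻ ζ 0 ⊞ ι 1 ⊖ κᶻ 2 ∷ κ 2 ≼ ν 1 ∷ []) (ζ 0 ≼ᶻ ζ 1 ⊞ ι 0 ⊞ (ζ 2 ⊖ ι 0)) (e , k , tt)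
    l₂ : ∀ x y u₀ U h → x ℤ.+ y ≡ u₀ ℤ.+ + U ℤ.- + 2 → x ℤ.+ + h ℤ.+ (y ℤ.- + h) ℤ.< u₀ ℤ.+ + U
    l₂ x y u₀ U h e = linarith (h ∷ U ∷ [] ∣ᵉ x ∷ y ∷ u₀ ∷ [])
      (ζ 0 ⊞ ζ 1 ≐ᶻ ζ 2 ⊞ ι 1 ⊖ κᶻ 2 ∷ []) (ζ 0 ⊞ ι 0 ⊞ (ζ 1 ⊖ ι 0) ≺ᶻ ζ 2 ⊞ ι 1) (e , tt)
    l₃ : ∀ x y v₀ h → x ℤ.- y ≡ v₀ → v₀ ℤ.≤ x ℤ.+ + h ℤ.- (y ℤ.- + h)
    l₃ x y v₀ h e = linarith (h ∷ [] ∣ᵉ v₀ ∷ x ∷ y ∷ []) (ζ 1 ⊖ ζ 2 ≐ᶻ ζ 0 ∷ []) (ζ 0 ≼ᶻ ζ 1 ⊞ ι 0 ⊖ (ζ 2 ⊖ ι 0)) (e , tt)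
    l₄ : ∀ x y v₀ V h → x ℤ.- y ≡ v₀ → V ≡ 2 * h + 1 → x ℤ.+ + h ℤ.- (y ℤ.- + h) ℤ.< v₀ ℤ.+ + V
    l₄ x y v₀ V h e k = linarith (h ∷ V ∷ [] ∣ᵉ x ∷ y ∷ v₀ ∷ [])
      (ζ 0 ⊖ ζ 1 ≐ᶻ ζ 2 ∷ ν 1 ≐ κ 2 ⊗ ν 0 ⊕ κ 1 ∷ []) (ζ 0 ⊞ ι 0 ⊖ (ζ 1 ⊖ ι 0) ≺ᶻ ζ 2 ⊞ ι 1) (e , k , tt)
    l₅ : ∀ x y v₀ V h → x ℤ.- y ≡ v₀ → V ≡ 2 * h + 1 → ¬ x ℤ.+ + h ℤ.+ 1ℤ ℤ.- (y ℤ.- + h) ℤ.< v₀ ℤ.+ + V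
    l₅ x y v₀ V h e k j = linarith (V ∷ h ∷ [] ∣ᵉ x ∷ y ∷ v₀ ∷ [])
      (ζ 0 ⊖ ζ 1 ≐ᶻ ζ 2 ∷ ν 0 ≐ κ 2 ⊗ ν 1 ⊕ κ 1 ∷ ζ 0 ⊞ ι 1 ⊞ κᶻ 1 ⊖ (ζ 1 ⊖ ι 1) ≺ᶻ ζ 2 ⊞ ι 0 ∷ []) falsum
      (e , k , j , tt)

  e₂g-black : ¬ P (e₂ g)
  e₂g-black = black {x ℤ.+ + h , y ℤ.- + h ℤ.+ 1ℤ} (inRect (l₁ x y u₀ U h up≡ U≥2) (l₂ x y u₀ U h up≡) (l₃ x y v₀ h vp≡ 1≤h) (l₄ x y v₀ V h vp≡ V≡))
    (λ i → l₅ x y u₀ U h up≡ (_∈ᴿ_.uhi i)) (near-right (x ℤ.+ + h , y ℤ.- + h ℤ.+ 1ℤ))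
    where
    l₁ : ∀ x y u₀ U h → x ℤ.+ y ≡ u₀ ℤ.+ + U ℤ.- + 2 → 2 ≤ U → u₀ ℤ.≤ x ℤ.+ + h ℤ.+ (y ℤ.- + h ℤ.+ 1ℤ)
    l₁ x y u₀ U h e k = linarith (h ∷ U ∷ [] ∣ᵉ u₀ ∷ x ∷ y ∷ [])
      (ζ 1 ⊞ ζ 2 ≐ᶻ ζ 0 ⊞ ι 1 ⊖ κᶻ 2 ∷ κ 2 ≼ ν 1 ∷ []) (ζ 0 ≼ᶻ ζ 1 ⊞ ι 0 ⊞ (ζ 2 ⊖ ι 0 ⊞ κᶻ 1)) (e , k , tt)
    l₂ : ∀ x y u₀ U h → x ℤ.+ y ≡ u₀ ℤ.+ + U ℤ.- + 2 → x ℤ.+ + h ℤ.+ (y ℤ.- + h ℤ.+ 1ℤ) ℤ.< u₀ ℤ.+ + U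
    l₂ x y u₀ U h e = linarith (h ∷ U ∷ [] ∣ᵉ x ∷ y ∷ u₀ ∷ [])
      (ζ 0 ⊞ ζ 1 ≐ᶻ ζ 2 ⊞ ι 1 ⊖ κᶻ 2 ∷ []) (ζ 0 ⊞ ι 0 ⊞ (ζ 1 ⊖ ι 0 ⊞ κᶻ 1) ≺ᶻ ζ 2 ⊞ ι 1) (e , tt)
    l₃ : ∀ x y v₀ h → x ℤ.- y ≡ v₀ → 1 ≤ h → v₀ ℤ.≤ x ℤ.+ + h ℤ.- (y ℤ.- + h ℤ.+ 1ℤ)
    l₃ x y v₀ h e k = linarith (h ∷ [] ∣ᵉ v₀ ∷ x ∷ y ∷ [])
      (ζ 1 ⊖ ζ 2 ≐ᶻ ζ 0 ∷ κ 1 ≼ ν 0 ∷ []) (ζ 0 ≼ᶻ ζ 1 ⊞ ι 0 ⊖ (ζ 2 ⊖ ι 0 ⊞ κᶻ 1)) (e , k , tt)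
    l₄ : ∀ x y v₀ V h → x ℤ.- y ≡ v₀ → V ≡ 2 * h + 1 → x ℤ.+ + h ℤ.- (y ℤ.- + h ℤ.+ 1ℤ) ℤ.< v₀ ℤ.+ + V
    l₄ x y v₀ V h e k = linarith (h ∷ V ∷ [] ∣ᵉ x ∷ y ∷ v₀ ∷ [])
      (ζ 0 ⊖ ζ 1 ≐ᶻ ζ 2 ∷ ν 1 ≐ κ 2 ⊗ ν 0 ⊕ κ 1 ∷ []) (ζ 0 ⊞ ι 0 ⊖ (ζ 1 ⊖ ι 0 ⊞ κᶻ 1) ≺ᶻ ζ 2 ⊞ ι 1) (e , k , tt)
    l₅ : ∀ x y u₀ U h → x ℤ.+ y ≡ u₀ ℤ.+ + U ℤ.- + 2 → ¬ x ℤ.+ + h ℤ.+ 1ℤ ℤ.+ (y ℤ.- + h ℤ.+ 1ℤ) ℤ.< u₀ ℤ.+ + U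
    l₅ x y u₀ U h e j = linarith (U ∷ h ∷ [] ∣ᵉ x ∷ y ∷ u₀ ∷ [])
      (ζ 0 ⊞ ζ 1 ≐ᶻ ζ 2 ⊞ ι 0 ⊖ κᶻ 2 ∷ ζ 0 ⊞ ι 1 ⊞ κᶻ 1 ⊞ (ζ 1 ⊖ ι 1 ⊞ κᶻ 1) ≺ᶻ ζ 2 ⊞ ι 0 ∷ []) falsum (e , j , tt)

  -- `D` starts at `v = v₀ + 1`, and its length in `v` differs from `V` by at most one. If it is at
  -- least `V`, then `D` contains `e₁₂ g` and forces `e₁ g` below it to be black; if it is `V - 1`,
  -- then `D` stops just before `e₁₂ g`, which is black. The corners `g` and `e₂ g` are black next
  -- to the given rectangle.
  end-black : (D : OptimalRect m P r) → OptimalRect.u₀ D ≡ u r → OptimalRect.v₀ D ≡ v r → ThreeBlack P g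
  end-black D ue ve = [ shorter , longer ]′ (ℕₚ.<-≤-connex D.V V)
    where
    module D = OptimalRect D
    U₂ : 2 ≤ D.U
    U₂ = ℕₚ.≤-trans 2≤m D.U≥
    V₁ : V ≤ suc D.V
    V₁ = ℕₚ.≤-trans V≤ (s≤s D.V≥)
    u≥ : ∀ h x y c → c ≡ x ℤ.+ 1ℤ ℤ.+ 1ℤ ℤ.+ (y ℤ.+ 1ℤ) → c ℤ.≤ x ℤ.+ + h ℤ.+ 1ℤ ℤ.+ 1ℤ ℤ.+ (y ℤ.- + h ℤ.+ 1ℤ)
    u≥ h x y c e = linarith (h ∷ [] ∣ᵉ c ∷ x ∷ y ∷ [])
      (ζ 0 ≐ᶻ ζ 1 ⊞ κᶻ 1 ⊞ κᶻ 1 ⊞ (ζ 2 ⊞ κᶻ 1) ∷ []) (ζ 0 ≼ᶻ ζ 1 ⊞ ι 0 ⊞ κᶻ 1 ⊞ κᶻ 1 ⊞ (ζ 2 ⊖ ι 0 ⊞ κᶻ 1)) (e , tt)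
    u< : ∀ h x y c U → c ≡ x ℤ.+ 1ℤ ℤ.+ 1ℤ ℤ.+ (y ℤ.+ 1ℤ) → 2 ≤ U → x ℤ.+ + h ℤ.+ 1ℤ ℤ.+ 1ℤ ℤ.+ (y ℤ.- + h ℤ.+ 1ℤ) ℤ.< c ℤ.+ + U
    u< h x y c U e k = linarith (h ∷ U ∷ [] ∣ᵉ x ∷ y ∷ c ∷ [])
      (ζ 2 ≐ᶻ ζ 0 ⊞ κᶻ 1 ⊞ κᶻ 1 ⊞ (ζ 1 ⊞ κᶻ 1) ∷ κ 2 ≼ ν 1 ∷ [])
      (ζ 0 ⊞ ι 0 ⊞ κᶻ 1 ⊞ κᶻ 1 ⊞ (ζ 1 ⊖ ι 0 ⊞ κᶻ 1) ≺ᶻ ζ 2 ⊞ ι 1) (e , k , tt)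
    v≥ : ∀ h x y c → c ≡ x ℤ.+ 1ℤ ℤ.+ 1ℤ ℤ.- (y ℤ.+ 1ℤ) → 1 ≤ h → c ℤ.≤ x ℤ.+ + h ℤ.+ 1ℤ ℤ.+ 1ℤ ℤ.- (y ℤ.- + h ℤ.+ 1ℤ)
    v≥ h x y c e k = linarith (h ∷ [] ∣ᵉ c ∷ x ∷ y ∷ [])
      (ζ 0 ≐ᶻ ζ 1 ⊞ κᶻ 1 ⊞ κᶻ 1 ⊖ (ζ 2 ⊞ κᶻ 1) ∷ κ 1 ≼ ν 0 ∷ []) (ζ 0 ≼ᶻ ζ 1 ⊞ ι 0 ⊞ κᶻ 1 ⊞ κᶻ 1 ⊖ (ζ 2 ⊖ ι 0 ⊞ κᶻ 1))
      (e , k , tt)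
    v< : ∀ h x y c V V′ → c ≡ x ℤ.+ 1ℤ ℤ.+ 1ℤ ℤ.- (y ℤ.+ 1ℤ) → V ≡ 2 * h + 1 → V ≤ V′ →
         x ℤ.+ + h ℤ.+ 1ℤ ℤ.+ 1ℤ ℤ.- (y ℤ.- + h ℤ.+ 1ℤ) ℤ.< c ℤ.+ + V′
    v< h x y c V V′ e k j = linarith (h ∷ V′ ∷ V ∷ [] ∣ᵉ x ∷ y ∷ c ∷ [])
      (ζ 2 ≐ᶻ ζ 0 ⊞ κᶻ 1 ⊞ κᶻ 1 ⊖ (ζ 1 ⊞ κᶻ 1) ∷ ν 2 ≐ κ 2 ⊗ ν 0 ⊕ κ 1 ∷ ν 2 ≼ ν 1 ∷ [])
      (ζ 0 ⊞ ι 0 ⊞ κᶻ 1 ⊞ κᶻ 1 ⊖ (ζ 1 ⊖ ι 0 ⊞ κᶻ 1) ≺ᶻ ζ 2 ⊞ ι 1) (e , k , j , tt)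
    longer : V ≤ D.V → ThreeBlack P g
    longer V≤V′ = inj₁ (g-black , D.outside {e₁₂ g} {e₁ g}
        (inRect (u≥ h x y D.u₀ ue) (u< h x y D.u₀ D.U ue U₂) (v≥ h x y D.v₀ ve 1≤h) (v< h x y D.v₀ V D.V ve V≡ V≤V′))
        (λ i → out h x y D.u₀ ue (_∈ᴿ_.ulo i)) (near-down (x ℤ.+ + h ℤ.+ 1ℤ ℤ.+ 1ℤ) (y ℤ.- + h)) , e₂g-black)
      where
      out : ∀ h x y c → c ≡ x ℤ.+ 1ℤ ℤ.+ 1ℤ ℤ.+ (y ℤ.+ 1ℤ) → ¬ c ℤ.≤ x ℤ.+ + h ℤ.+ 1ℤ ℤ.+ 1ℤ ℤ.+ (y ℤ.- + h)
      out h x y c e j = linarith (h ∷ [] ∣ᵉ c ∷ x ∷ y ∷ [])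
        (ζ 0 ≐ᶻ ζ 1 ⊞ κᶻ 1 ⊞ κᶻ 1 ⊞ (ζ 2 ⊞ κᶻ 1) ∷ ζ 0 ≼ᶻ ζ 1 ⊞ ι 0 ⊞ κᶻ 1 ⊞ κᶻ 1 ⊞ (ζ 2 ⊖ ι 0) ∷ []) falsum
        (e , j , tt)
    shorter : D.V < V → ThreeBlack P g
    shorter V′<V = inj₂ (inj₂ (inj₁ (g-black , e₂g-black , D.outside {e₂ (e₁₂ g)} {e₁₂ g}
        (inRect (a₁ h x y D.u₀ ue) (a₂ h x y D.u₀ D.U ue U₂) (a₃ h x y D.v₀ ve 1≤h) (a₄ h x y D.v₀ V D.V ve V≡ V₁))
        (λ i → out h x y D.v₀ V D.V ve V≡ V′<V (_∈ᴿ_.vhi i)) (near-down (x ℤ.+ + h ℤ.+ 1ℤ ℤ.+ 1ℤ) (y ℤ.- + h ℤ.+ 1ℤ)))))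
      where
      a₁ : ∀ h x y c → c ≡ x ℤ.+ 1ℤ ℤ.+ 1ℤ ℤ.+ (y ℤ.+ 1ℤ) → c ℤ.≤ x ℤ.+ + h ℤ.+ 1ℤ ℤ.+ 1ℤ ℤ.+ (y ℤ.- + h ℤ.+ 1ℤ ℤ.+ 1ℤ)
      a₁ h x y c e = linarith (h ∷ [] ∣ᵉ c ∷ x ∷ y ∷ [])
        (ζ 0 ≐ᶻ ζ 1 ⊞ κᶻ 1 ⊞ κᶻ 1 ⊞ (ζ 2 ⊞ κᶻ 1) ∷ []) (ζ 0 ≼ᶻ ζ 1 ⊞ ι 0 ⊞ κᶻ 1 ⊞ κᶻ 1 ⊞ (ζ 2 ⊖ ι 0 ⊞ κᶻ 1 ⊞ κᶻ 1))
        (e , tt)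
      a₂ : ∀ h x y c U → c ≡ x ℤ.+ 1ℤ ℤ.+ 1ℤ ℤ.+ (y ℤ.+ 1ℤ) → 2 ≤ U → x ℤ.+ + h ℤ.+ 1ℤ ℤ.+ 1ℤ ℤ.+ (y ℤ.- + h ℤ.+ 1ℤ ℤ.+ 1ℤ) ℤ.< c ℤ.+ + U
      a₂ h x y c U e k = linarith (h ∷ U ∷ [] ∣ᵉ x ∷ y ∷ c ∷ [])
        (ζ 2 ≐ᶻ ζ 0 ⊞ κᶻ 1 ⊞ κᶻ 1 ⊞ (ζ 1 ⊞ κᶻ 1) ∷ κ 2 ≼ ν 1 ∷ [])
        (ζ 0 ⊞ ι 0 ⊞ κᶻ 1 ⊞ κᶻ 1 ⊞ (ζ 1 ⊖ ι 0 ⊞ κᶻ 1 ⊞ κᶻ 1) ≺ᶻ ζ 2 ⊞ ι 1) (e , k , tt)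
      a₃ : ∀ h x y c → c ≡ x ℤ.+ 1ℤ ℤ.+ 1ℤ ℤ.- (y ℤ.+ 1ℤ) → 1 ≤ h → c ℤ.≤ x ℤ.+ + h ℤ.+ 1ℤ ℤ.+ 1ℤ ℤ.- (y ℤ.- + h ℤ.+ 1ℤ ℤ.+ 1ℤ)
      a₃ h x y c e k = linarith (h ∷ [] ∣ᵉ c ∷ x ∷ y ∷ [])
        (ζ 0 ≐ᶻ ζ 1 ⊞ κᶻ 1 ⊞ κᶻ 1 ⊖ (ζ 2 ⊞ κᶻ 1) ∷ κ 1 ≼ ν 0 ∷ [])
        (ζ 0 ≼ᶻ ζ 1 ⊞ ι 0 ⊞ κᶻ 1 ⊞ κᶻ 1 ⊖ (ζ 2 ⊖ ι 0 ⊞ κᶻ 1 ⊞ κᶻ 1)) (e , k , tt)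
      a₄ : ∀ h x y c V V′ → c ≡ x ℤ.+ 1ℤ ℤ.+ 1ℤ ℤ.- (y ℤ.+ 1ℤ) → V ≡ 2 * h + 1 → V ≤ suc V′ →
           x ℤ.+ + h ℤ.+ 1ℤ ℤ.+ 1ℤ ℤ.- (y ℤ.- + h ℤ.+ 1ℤ ℤ.+ 1ℤ) ℤ.< c ℤ.+ + V′
      a₄ h x y c V V′ e k j = linarith (h ∷ V′ ∷ V ∷ [] ∣ᵉ x ∷ y ∷ c ∷ [])
        (ζ 2 ≐ᶻ ζ 0 ⊞ κᶻ 1 ⊞ κᶻ 1 ⊖ (ζ 1 ⊞ κᶻ 1) ∷ ν 2 ≐ κ 2 ⊗ ν 0 ⊕ κ 1 ∷ ν 2 ≼ κ 1 ⊕ ν 1 ∷ [])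
        (ζ 0 ⊞ ι 0 ⊞ κᶻ 1 ⊞ κᶻ 1 ⊖ (ζ 1 ⊖ ι 0 ⊞ κᶻ 1 ⊞ κᶻ 1) ≺ᶻ ζ 2 ⊞ ι 1) (e , k , j , tt)
      out : ∀ h x y c V V′ → c ≡ x ℤ.+ 1ℤ ℤ.+ 1ℤ ℤ.- (y ℤ.+ 1ℤ) → V ≡ 2 * h + 1 → V′ < V →
            ¬ x ℤ.+ + h ℤ.+ 1ℤ ℤ.+ 1ℤ ℤ.- (y ℤ.- + h ℤ.+ 1ℤ) ℤ.< c ℤ.+ + V′
      out h x y c V V′ e k j i = linarith (V ∷ h ∷ V′ ∷ [] ∣ᵉ c ∷ x ∷ y ∷ [])
        (ζ 0 ≐ᶻ ζ 1 ⊞ κᶻ 1 ⊞ κᶻ 1 ⊖ (ζ 2 ⊞ κᶻ 1) ∷ ν 0 ≐ κ 2 ⊗ ν 1 ⊕ κ 1 ∷ κ 1 ⊕ ν 2 ≼ ν 0 ∷ ζ 1 ⊞ ι 1 ⊞ κᶻ 1 ⊞ κᶻ 1 ⊖ (ζ 2 ⊖ ι 1 ⊞ κᶻ 1) ≺ᶻ ζ 0 ⊞ ι 2 ∷ [])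
        falsum (e , k , j , i , tt)

  -- Both `z` and `p` lie in the rectangle, whose sides are at most `m + 1`, so their coordinates
  -- differ by about `m` at most; the radius `K` leaves some room.
  close-to-p : ∀ {w} → ℤ.- + (m + 3) ℤ.≤ proj₁ w ℤ.- x → proj₁ w ℤ.- x ℤ.≤ + (m + 3) → ℤ.- + (m + 3) ℤ.≤ proj₂ w ℤ.- y → proj₂ w ℤ.- y ℤ.≤ + (m + 3) →
               InBox K (proj₁ w ℤ.- proj₁ z , proj₂ w ℤ.- proj₂ z)
  close-to-p {w} a b c d = inBox
    (lo₁ x y (proj₁ z) (proj₂ z) (proj₁ w) u₀ v₀ U V m up≡ vp≡ U≤ V≤ (_∈ᴿ_.uhi member) (_∈ᴿ_.vhi member) a)
    (hi₁ x y (proj₁ z) (proj₂ z) (proj₁ w) u₀ v₀ U V m up≡ vp≡ U≤ V≤ (_∈ᴿ_.ulo member) (_∈ᴿ_.vlo member) b)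
    (lo₂ x y (proj₁ z) (proj₂ z) (proj₂ w) u₀ v₀ U V m up≡ vp≡ U≤ V≤ (_∈ᴿ_.uhi member) (_∈ᴿ_.vlo member) c)
    (hi₂ x y (proj₁ z) (proj₂ z) (proj₂ w) u₀ v₀ U V m up≡ vp≡ U≤ V≤ (_∈ᴿ_.ulo member) (_∈ᴿ_.vhi member) d)
    where
    lo₁ : ∀ x y zx zy w u₀ v₀ U V m → x ℤ.+ y ≡ u₀ ℤ.+ + U ℤ.- + 2 → x ℤ.- y ≡ v₀ → U ≤ suc m → V ≤ suc m →
          zx ℤ.+ zy ℤ.< u₀ ℤ.+ + U → zx ℤ.- zy ℤ.< v₀ ℤ.+ + V → ℤ.- + (m + 3) ℤ.≤ w ℤ.- x → ℤ.- + (2 * m + 10) ℤ.≤ w ℤ.- zx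
    lo₁ x y zx zy w u₀ v₀ U V m e₁ e₂ h₁ h₂ h₃ h₄ h₅ = linarith (m ∷ U ∷ V ∷ [] ∣ᵉ w ∷ zx ∷ x ∷ y ∷ u₀ ∷ v₀ ∷ zy ∷ [])
      (ζ 2 ⊞ ζ 3 ≐ᶻ ζ 4 ⊞ ι 1 ⊖ κᶻ 2 ∷ ζ 2 ⊖ ζ 3 ≐ᶻ ζ 5 ∷ ν 1 ≼ κ 1 ⊕ ν 0 ∷ ν 2 ≼ κ 1 ⊕ ν 0 ∷ ζ 1 ⊞ ζ 6 ≺ᶻ ζ 4 ⊞ ι 1 ∷ ζ 1 ⊖ ζ 6 ≺ᶻ ζ 5 ⊞ ι 2 ∷ ⊟ ⌞ ν 0 ⊕ κ 3 ⌟ ≼ᶻ ζ 0 ⊖ ζ 2 ∷ [])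
      (⊟ ⌞ κ 2 ⊗ ν 0 ⊕ κ 10 ⌟ ≼ᶻ ζ 0 ⊖ ζ 1) (e₁ , e₂ , h₁ , h₂ , h₃ , h₄ , h₅ , tt)
    hi₁ : ∀ x y zx zy w u₀ v₀ U V m → x ℤ.+ y ≡ u₀ ℤ.+ + U ℤ.- + 2 → x ℤ.- y ≡ v₀ → U ≤ suc m → V ≤ suc m →
          u₀ ℤ.≤ zx ℤ.+ zy → v₀ ℤ.≤ zx ℤ.- zy → w ℤ.- x ℤ.≤ + (m + 3) → w ℤ.- zx ℤ.≤ + (2 * m + 10)
    hi₁ x y zx zy w u₀ v₀ U V m e₁ e₂ h₁ h₂ h₃ h₄ h₅ = linarith (m ∷ U ∷ V ∷ [] ∣ᵉ w ∷ zx ∷ x ∷ y ∷ u₀ ∷ v₀ ∷ zy ∷ [])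
      (ζ 2 ⊞ ζ 3 ≐ᶻ ζ 4 ⊞ ι 1 ⊖ κᶻ 2 ∷ ζ 2 ⊖ ζ 3 ≐ᶻ ζ 5 ∷ ν 1 ≼ κ 1 ⊕ ν 0 ∷ ν 2 ≼ κ 1 ⊕ ν 0 ∷ ζ 4 ≼ᶻ ζ 1 ⊞ ζ 6 ∷ ζ 5 ≼ᶻ ζ 1 ⊖ ζ 6 ∷ ζ 0 ⊖ ζ 2 ≼ᶻ ⌞ ν 0 ⊕ κ 3 ⌟ ∷ [])
      (ζ 0 ⊖ ζ 1 ≼ᶻ ⌞ κ 2 ⊗ ν 0 ⊕ κ 10 ⌟) (e₁ , e₂ , h₁ , h₂ , h₃ , h₄ , h₅ , tt)
    lo₂ : ∀ x y zx zy w u₀ v₀ U V m → x ℤ.+ y ≡ u₀ ℤ.+ + U ℤ.- + 2 → x ℤ.- y ≡ v₀ → U ≤ suc m → V ≤ suc m →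
          zx ℤ.+ zy ℤ.< u₀ ℤ.+ + U → v₀ ℤ.≤ zx ℤ.- zy → ℤ.- + (m + 3) ℤ.≤ w ℤ.- y → ℤ.- + (2 * m + 10) ℤ.≤ w ℤ.- zy
    lo₂ x y zx zy w u₀ v₀ U V m e₁ e₂ h₁ h₂ h₃ h₄ h₅ = linarith (m ∷ U ∷ V ∷ [] ∣ᵉ w ∷ zy ∷ x ∷ y ∷ u₀ ∷ v₀ ∷ zx ∷ [])
      (ζ 2 ⊞ ζ 3 ≐ᶻ ζ 4 ⊞ ι 1 ⊖ κᶻ 2 ∷ ζ 2 ⊖ ζ 3 ≐ᶻ ζ 5 ∷ ν 1 ≼ κ 1 ⊕ ν 0 ∷ ν 2 ≼ κ 1 ⊕ ν 0 ∷ ζ 6 ⊞ ζ 1 ≺ᶻ ζ 4 ⊞ ι 1 ∷ ζ 5 ≼ᶻ ζ 6 ⊖ ζ 1 ∷ ⊟ ⌞ ν 0 ⊕ κ 3 ⌟ ≼ᶻ ζ 0 ⊖ ζ 3 ∷ [])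
      (⊟ ⌞ κ 2 ⊗ ν 0 ⊕ κ 10 ⌟ ≼ᶻ ζ 0 ⊖ ζ 1) (e₁ , e₂ , h₁ , h₂ , h₃ , h₄ , h₅ , tt)
    hi₂ : ∀ x y zx zy w u₀ v₀ U V m → x ℤ.+ y ≡ u₀ ℤ.+ + U ℤ.- + 2 → x ℤ.- y ≡ v₀ → U ≤ suc m → V ≤ suc m →
          u₀ ℤ.≤ zx ℤ.+ zy → zx ℤ.- zy ℤ.< v₀ ℤ.+ + V → w ℤ.- y ℤ.≤ + (m + 3) → w ℤ.- zy ℤ.≤ + (2 * m + 10)
    hi₂ x y zx zy w u₀ v₀ U V m e₁ e₂ h₁ h₂ h₃ h₄ h₅ = linarith (m ∷ U ∷ V ∷ [] ∣ᵉ w ∷ zy ∷ x ∷ y ∷ u₀ ∷ v₀ ∷ zx ∷ [])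
      (ζ 2 ⊞ ζ 3 ≐ᶻ ζ 4 ⊞ ι 1 ⊖ κᶻ 2 ∷ ζ 2 ⊖ ζ 3 ≐ᶻ ζ 5 ∷ ν 1 ≼ κ 1 ⊕ ν 0 ∷ ν 2 ≼ κ 1 ⊕ ν 0 ∷ ζ 4 ≼ᶻ ζ 6 ⊞ ζ 1 ∷ ζ 6 ⊖ ζ 1 ≺ᶻ ζ 5 ⊞ ι 2 ∷ ζ 0 ⊖ ζ 3 ≼ᶻ ⌞ ν 0 ⊕ κ 3 ⌟ ∷ [])
      (ζ 0 ⊖ ζ 1 ≼ᶻ ⌞ κ 2 ⊗ ν 0 ⊕ κ 10 ⌟) (e₁ , e₂ , h₁ , h₂ , h₃ , h₄ , h₅ , tt)

  at-p : ∀ i k → i ≤ m + 3 → k ≤ m + 3 → ∀ {w} → proj₁ w ≡ x ℤ.+ + i → proj₂ w ≡ y ℤ.+ + k → InBox K (proj₁ w ℤ.- proj₁ z , proj₂ w ℤ.- proj₂ z)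
  at-p i k hi hk {w} e e′ = close-to-p {w} (lo x (proj₁ w) i e) (up′ x (proj₁ w) i e hi) (lo y (proj₂ w) k e′) (up′ y (proj₂ w) k e′ hk)
    where
    lo : ∀ x w i → w ≡ x ℤ.+ + i → ℤ.- + (m + 3) ℤ.≤ w ℤ.- x
    lo x w i e = linarith (m ∷ i ∷ [] ∣ᵉ w ∷ x ∷ []) (ζ 0 ≐ᶻ ζ 1 ⊞ ι 1 ∷ []) (⊟ ⌞ ν 0 ⊕ κ 3 ⌟ ≼ᶻ ζ 0 ⊖ ζ 1) (e , tt)
    up′ : ∀ x w i → w ≡ x ℤ.+ + i → i ≤ m + 3 → w ℤ.- x ℤ.≤ + (m + 3)
    up′ x w i e h = linarith (m ∷ i ∷ [] ∣ᵉ w ∷ x ∷ [])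
      (ζ 0 ≐ᶻ ζ 1 ⊞ ι 1 ∷ ν 1 ≼ ν 0 ⊕ κ 3 ∷ []) (ζ 0 ⊖ ζ 1 ≼ᶻ ⌞ ν 0 ⊕ κ 3 ⌟) (e , h , tt)

  -- The squares at `q`, `e₁ p` and `g` are examined in turn. Each has two corners known to be
  -- black, so in the first two all other corners are white unless a defect is found; the components
  -- of `e₂ q` and `r` are lossless unless they are a defect themselves. Then the third square is
  -- one.
  result : Defect P Bad K z
  result = start (P? (e₂ q)) (P? (e₁₂ q)) (P? r)
    where
    3≤ : ∀ {i} → i ≤ 3 → i ≤ m + 3
    3≤ h = ℕₚ.≤-trans h (ℕₚ.m≤n+m 3 m)
    +1+1 : ∀ a → a ℤ.+ 1ℤ ℤ.+ 1ℤ ≡ a ℤ.+ + 2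
    +1+1 a = linarith ([] ∣ᵉ a ∷ []) [] (ζ 0 ⊞ κᶻ 1 ⊞ κᶻ 1 ≐ᶻ ζ 0 ⊞ κᶻ 2) tt
    h≤m : h ≤ m
    h≤m = l h V m V≡ V≤
      where
      l : ∀ h V m → V ≡ 2 * h + 1 → V ≤ suc m → h ≤ m
      l h V m e k = linarith (h ∷ m ∷ V ∷ [] ∣ᵉ []) (ν 2 ≐ κ 2 ⊗ ν 0 ⊕ κ 1 ∷ ν 2 ≼ κ 1 ⊕ ν 1 ∷ []) (ν 0 ≼ ν 1) (e , k , tt)
    g-close : InBox K (proj₁ g ℤ.- proj₁ z , proj₂ g ℤ.- proj₂ z)
    g-close = close-to-p {g} (l₁ x h) (l₂ x h h≤m) (l₃ y h h≤m) (l₄ y h)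
      where
      l₁ : ∀ x h → ℤ.- + (m + 3) ℤ.≤ x ℤ.+ + h ℤ.+ 1ℤ ℤ.- x
      l₁ x h = linarith (m ∷ h ∷ [] ∣ᵉ x ∷ []) [] (⊟ ⌞ ν 0 ⊕ κ 3 ⌟ ≼ᶻ ζ 0 ⊞ ι 1 ⊞ κᶻ 1 ⊖ ζ 0) tt
      l₂ : ∀ x h → h ≤ m → x ℤ.+ + h ℤ.+ 1ℤ ℤ.- x ℤ.≤ + (m + 3)
      l₂ x h k = linarith (h ∷ m ∷ [] ∣ᵉ x ∷ []) (ν 0 ≼ ν 1 ∷ []) (ζ 0 ⊞ ι 0 ⊞ κᶻ 1 ⊖ ζ 0 ≼ᶻ ⌞ ν 1 ⊕ κ 3 ⌟) (k , tt)
      l₃ : ∀ y h → h ≤ m → ℤ.- + (m + 3) ℤ.≤ y ℤ.- + h ℤ.- y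
      l₃ y h k = linarith (m ∷ h ∷ [] ∣ᵉ y ∷ []) (ν 1 ≼ ν 0 ∷ []) (⊟ ⌞ ν 0 ⊕ κ 3 ⌟ ≼ᶻ ζ 0 ⊖ ι 1 ⊖ ζ 0) (k , tt)
      l₄ : ∀ y h → y ℤ.- + h ℤ.- y ℤ.≤ + (m + 3)
      l₄ y h = linarith (h ∷ m ∷ [] ∣ᵉ y ∷ []) [] (ζ 0 ⊖ ι 0 ⊖ ζ 0 ≼ᶻ ⌞ ν 1 ⊕ κ 3 ⌟) tt
    finish : OptimalRect m P r ⊎ Bad r → ¬ P (e₁ (e₁₂ q)) → Defect P Bad K z
    finish (inj₂ bad) _ = defect r (at-p 2 1 (3≤ (s≤s (s≤s z≤n))) (3≤ (s≤s z≤n)) {r} (+1+1 x) refl) (inj₁ bad)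
    finish (inj₁ D) b = let ue , ve = left-corner D b in defect g g-close (inj₂ (end-black D ue ve))
    rightOf : Dec (P r) → ¬ P (e₁ (e₁₂ q)) → Defect P Bad K z
    rightOf (no ¬r) _ = defect (e₁ p) (at-p 1 0 (3≤ (s≤s z≤n)) (3≤ z≤n) {e₁ p} refl (sym (ℤₚ.+-identityʳ y))) (inj₂ (inj₂ (inj₂ (inj₂ (e₁e₁p-black , e₁q-black , ¬r)))))
    rightOf (yes Pr) b = finish (classify Pr) b
    top : OptimalRect m P (e₂ q) ⊎ Bad (e₂ q) → P (e₁₂ q) → Dec (P r) → Defect P Bad K z
    top (inj₂ bad) _ _ = defect (e₂ q) (at-p 0 2 (3≤ z≤n) (3≤ (s≤s (s≤s z≤n))) {e₂ q} (sym (ℤₚ.+-identityʳ x)) (+1+1 y)) (inj₁ bad)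
    top (inj₁ D) Pt d = rightOf d (above-black D Pt)
    q-close : InBox K (proj₁ q ℤ.- proj₁ z , proj₂ q ℤ.- proj₂ z)
    q-close = at-p 0 1 (3≤ z≤n) (3≤ (s≤s z≤n)) {q} (sym (ℤₚ.+-identityʳ x)) refl
    start : Dec (P (e₂ q)) → Dec (P (e₁₂ q)) → Dec (P r) → Defect P Bad K z
    start (no ¬t) _ _ = defect q q-close (inj₂ (inj₁ (q-black , e₁q-black , ¬t)))
    start (yes _) (no ¬t) _ = defect q q-close (inj₂ (inj₂ (inj₁ (q-black , e₁q-black , ¬t))))
    start (yes Pt₁) (yes Pt₂) d = top (classify Pt₁) Pt₂ d

-- Quarter turns: reduction to a truncated upper right side

rot : Pixel → Pixel
rot (x , y) = ℤ.- y , x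

-- The preimage of the rectangle under `rot`, as `u ∘ rot = v` and `v ∘ rot = -u`. Reflecting a
-- half-open interval produces the 1.
rotateRect : DiagRect → DiagRect
rotateRect (diagRect u₀ v₀ U V) = diagRect (1ℤ ℤ.- v₀ ℤ.- + V) u₀ V U

∈-rotate⁻ : ∀ R w → w ∈ᴿ rotateRect R → rot w ∈ᴿ R
∈-rotate⁻ (diagRect u₀ v₀ U V) (a , b) (inRect h₁ h₂ h₃ h₄) = inRect (l₁ a b u₀ h₃) (l₂ a b (u₀ ℤ.+ + U) h₄) (l₃ a b v₀ V h₂) (l₄ a b v₀ V h₁)
  where
  l₁ : ∀ a b c → c ℤ.≤ a ℤ.- b → c ℤ.≤ ℤ.- b ℤ.+ a
  l₁ a b c h = linarith ([] ∣ᵉ c ∷ b ∷ a ∷ []) (ζ 0 ≼ᶻ ζ 2 ⊖ ζ 1 ∷ []) (ζ 0 ≼ᶻ ⊟ ζ 1 ⊞ ζ 2) (h , tt)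
  l₂ : ∀ a b c → a ℤ.- b ℤ.< c → ℤ.- b ℤ.+ a ℤ.< c
  l₂ a b c h = linarith ([] ∣ᵉ b ∷ a ∷ c ∷ []) (ζ 1 ⊖ ζ 0 ≺ᶻ ζ 2 ∷ []) (⊟ ζ 0 ⊞ ζ 1 ≺ᶻ ζ 2) (h , tt)
  l₃ : ∀ a b v₀ V → a ℤ.+ b ℤ.< 1ℤ ℤ.- v₀ ℤ.- + V ℤ.+ + V → v₀ ℤ.≤ ℤ.- b ℤ.- a
  l₃ a b v₀ V h = linarith (V ∷ [] ∣ᵉ v₀ ∷ b ∷ a ∷ []) (ζ 2 ⊞ ζ 1 ≺ᶻ κᶻ 1 ⊖ ζ 0 ⊖ ι 0 ⊞ ι 0 ∷ []) (ζ 0 ≼ᶻ ⊟ ζ 1 ⊖ ζ 2) (h , tt)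
  l₄ : ∀ a b v₀ V → 1ℤ ℤ.- v₀ ℤ.- + V ℤ.≤ a ℤ.+ b → ℤ.- b ℤ.- a ℤ.< v₀ ℤ.+ + V
  l₄ a b v₀ V h = linarith (V ∷ [] ∣ᵉ b ∷ a ∷ v₀ ∷ []) (κᶻ 1 ⊖ ζ 2 ⊖ ι 0 ≼ᶻ ζ 1 ⊞ ζ 0 ∷ []) (⊟ ζ 0 ⊖ ζ 1 ≺ᶻ ζ 2 ⊞ ι 0) (h , tt)

∈-rotate⁺ : ∀ R w → rot w ∈ᴿ R → w ∈ᴿ rotateRect R
∈-rotate⁺ (diagRect u₀ v₀ U V) (a , b) (inRect h₁ h₂ h₃ h₄) = inRect (l₄ a b v₀ V h₄) (l₃ a b v₀ V h₃) (l₁ a b u₀ h₁) (l₂ a b (u₀ ℤ.+ + U) h₂)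
  where
  l₁ : ∀ a b c → c ℤ.≤ ℤ.- b ℤ.+ a → c ℤ.≤ a ℤ.- b
  l₁ a b c h = linarith ([] ∣ᵉ c ∷ a ∷ b ∷ []) (ζ 0 ≼ᶻ ⊟ ζ 2 ⊞ ζ 1 ∷ []) (ζ 0 ≼ᶻ ζ 1 ⊖ ζ 2) (h , tt)
  l₂ : ∀ a b c → ℤ.- b ℤ.+ a ℤ.< c → a ℤ.- b ℤ.< c
  l₂ a b c h = linarith ([] ∣ᵉ a ∷ b ∷ c ∷ []) (⊟ ζ 1 ⊞ ζ 0 ≺ᶻ ζ 2 ∷ []) (ζ 0 ⊖ ζ 1 ≺ᶻ ζ 2) (h , tt)
  l₃ : ∀ a b v₀ V → v₀ ℤ.≤ ℤ.- b ℤ.- a → a ℤ.+ b ℤ.< 1ℤ ℤ.- v₀ ℤ.- + V ℤ.+ + V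
  l₃ a b v₀ V h = linarith (V ∷ [] ∣ᵉ a ∷ b ∷ v₀ ∷ []) (ζ 2 ≼ᶻ ⊟ ζ 1 ⊖ ζ 0 ∷ []) (ζ 0 ⊞ ζ 1 ≺ᶻ κᶻ 1 ⊖ ζ 2 ⊖ ι 0 ⊞ ι 0) (h , tt)
  l₄ : ∀ a b v₀ V → ℤ.- b ℤ.- a ℤ.< v₀ ℤ.+ + V → 1ℤ ℤ.- v₀ ℤ.- + V ℤ.≤ a ℤ.+ b
  l₄ a b v₀ V h = linarith (V ∷ [] ∣ᵉ v₀ ∷ a ∷ b ∷ []) (⊟ ζ 2 ⊖ ζ 1 ≺ᶻ ζ 0 ⊞ ι 0 ∷ []) (κᶻ 1 ⊖ ζ 0 ⊖ ι 0 ≼ᶻ ζ 1 ⊞ ζ 2) (h , tt)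

near-rot : ∀ {w w′} → Near four w w′ → Near four (rot w) (rot w′)
near-rot {a , b} {c , d} h = subst (ℕ._≤ 1) (trans (ℕₚ.+-comm ∣ a ℤ.- c ∣ ∣ b ℤ.- d ∣)
  (cong (ℕ._+ ∣ a ℤ.- c ∣) (trans (sym (ℤₚ.∣-i∣≡∣i∣ (b ℤ.- d))) (cong ∣_∣ (flip b d))))) h
  where
  flip : ∀ b d → ℤ.- (b ℤ.- d) ≡ ℤ.- b ℤ.- ℤ.- d
  flip = solve-∀

rotateOptimal : ∀ {m P w} → OptimalRect m P (rot w) → OptimalRect m (P ∘ rot) w
rotateOptimal {m} {P} {w} C = record
  { rect    = rotateRect rect
  ; sides   = [ (λ (p , q) → inj₂ (q , p)) , (λ (p , q) → inj₁ (q , p)) ]′ sides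
  ; member  = ∈-rotate⁺ rect w member
  ; inside  = λ {z} z∈ → inside (∈-rotate⁻ rect z z∈)
  ; outside = λ {z} {z′} z∈ z′∉ n → outside (∈-rotate⁻ rect z z∈) (λ i → z′∉ (∈-rotate⁺ rect z′ i)) (near-rot {z} {z′} n) }
  where open OptimalRect C

-- A quarter turn carries the lower left corner of a square to the lower right one, so the rotated
-- square is named by the pixel one step to the left. For the same reason `rotateDefect` enlarges
-- the radius by one.
rotateThreeBlack : ∀ {P} a → ThreeBlack (P ∘ rot) a → ThreeBlack P (ℤ.- proj₂ a ℤ.- 1ℤ , proj₁ a)
rotateThreeBlack {P} (x , y) = λ
  { (inj₁ (p , q , r))                 → inj₂ (inj₁ (to r′ r , to p′ p , to q′ q))
  ; (inj₂ (inj₁ (p , q , r)))          → inj₂ (inj₂ (inj₂ (to p′ p , to s′ r , to q′ q)))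
  ; (inj₂ (inj₂ (inj₁ (p , q , r))))   → inj₁ (to r′ q , to p′ p , to s′ r)
  ; (inj₂ (inj₂ (inj₂ (p , q , r))))   → inj₂ (inj₂ (inj₁ (to r′ q , to s′ r , to q′ p))) }
  where
  b : Pixel
  b = ℤ.- y ℤ.- 1ℤ , x
  neg+ : ∀ y → ℤ.- (y ℤ.+ 1ℤ) ≡ ℤ.- y ℤ.- 1ℤ
  neg+ = solve-∀
  back : ∀ y → ℤ.- y ≡ ℤ.- y ℤ.- 1ℤ ℤ.+ 1ℤ
  back = solve-∀
  p′ : rot (x , y) ≡ e₁ b
  p′ = cong (_, x) (back y)
  q′ : rot (e₁ (x , y)) ≡ e₁₂ b
  q′ = cong (_, x ℤ.+ 1ℤ) (back y)
  r′ : rot (e₂ (x , y)) ≡ b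
  r′ = cong (_, x) (neg+ y)
  s′ : rot (e₁₂ (x , y)) ≡ e₂ b
  s′ = cong (_, x ℤ.+ 1ℤ) (neg+ y)
  to : ∀ {c d} → c ≡ d → ¬ P c → ¬ P d
  to e = subst (λ t → ¬ P t) e

rotateDefect : ∀ {P Bad K w} → Defect (P ∘ rot) (Bad ∘ rot) K w → Defect P Bad (suc K) (rot w)
rotateDefect {P} {Bad} {K} {w₁ , w₂} (defect a@(a₁ , a₂) (inBox h₁ h₂ h₃ h₄) why) = go why
  where
  l₁ : ∀ a w → a ℤ.- w ℤ.≤ + K → ℤ.- + suc K ℤ.≤ ℤ.- a ℤ.- ℤ.- w
  l₁ a w h = linarith (K ∷ [] ∣ᵉ a ∷ w ∷ []) (ζ 0 ⊖ ζ 1 ≼ᶻ ι 0 ∷ []) (⊟ ⌞ κ 1 ⊕ ν 0 ⌟ ≼ᶻ ⊟ ζ 0 ⊖ (⊟ ζ 1)) (h , tt)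
  l₂ : ∀ a w → ℤ.- + K ℤ.≤ a ℤ.- w → ℤ.- a ℤ.- ℤ.- w ℤ.≤ + suc K
  l₂ a w h = linarith (K ∷ [] ∣ᵉ a ∷ w ∷ []) (⊟ ι 0 ≼ᶻ ζ 0 ⊖ ζ 1 ∷ []) (⊟ ζ 0 ⊖ (⊟ ζ 1) ≼ᶻ ⌞ κ 1 ⊕ ν 0 ⌟) (h , tt)
  l₁′ : ∀ a w → a ℤ.- w ℤ.≤ + K → ℤ.- + suc K ℤ.≤ ℤ.- a ℤ.- 1ℤ ℤ.- ℤ.- w
  l₁′ a w h = linarith (K ∷ [] ∣ᵉ a ∷ w ∷ []) (ζ 0 ⊖ ζ 1 ≼ᶻ ι 0 ∷ []) (⊟ ⌞ κ 1 ⊕ ν 0 ⌟ ≼ᶻ ⊟ ζ 0 ⊖ κᶻ 1 ⊖ (⊟ ζ 1)) (h , tt)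
  l₂′ : ∀ a w → ℤ.- + K ℤ.≤ a ℤ.- w → ℤ.- a ℤ.- 1ℤ ℤ.- ℤ.- w ℤ.≤ + suc K
  l₂′ a w h = linarith (K ∷ [] ∣ᵉ a ∷ w ∷ []) (⊟ ι 0 ≼ᶻ ζ 0 ⊖ ζ 1 ∷ []) (⊟ ζ 0 ⊖ κᶻ 1 ⊖ (⊟ ζ 1) ≼ᶻ ⌞ κ 1 ⊕ ν 0 ⌟) (h , tt)
  l₃ : ∀ a w → ℤ.- + K ℤ.≤ a ℤ.- w → ℤ.- + suc K ℤ.≤ a ℤ.- w
  l₃ a w h = linarith (K ∷ [] ∣ᵉ a ∷ w ∷ []) (⊟ ι 0 ≼ᶻ ζ 0 ⊖ ζ 1 ∷ []) (⊟ ⌞ κ 1 ⊕ ν 0 ⌟ ≼ᶻ ζ 0 ⊖ ζ 1) (h , tt)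
  l₄ : ∀ a w → a ℤ.- w ℤ.≤ + K → a ℤ.- w ℤ.≤ + suc K
  l₄ a w h = linarith (K ∷ [] ∣ᵉ a ∷ w ∷ []) (ζ 0 ⊖ ζ 1 ≼ᶻ ι 0 ∷ []) (ζ 0 ⊖ ζ 1 ≼ᶻ ⌞ κ 1 ⊕ ν 0 ⌟) (h , tt)
  go : Bad (rot a) ⊎ ThreeBlack (P ∘ rot) a → Defect P Bad (suc K) (rot (w₁ , w₂))
  go (inj₁ bad) = defect (rot a) (inBox (l₁ a₂ w₂ h₄) (l₂ a₂ w₂ h₃) (l₃ a₁ w₁ h₁) (l₄ a₁ w₁ h₂)) (inj₁ bad)
  go (inj₂ t) = defect (ℤ.- a₂ ℤ.- 1ℤ , a₁) (inBox (l₁′ a₂ w₂ h₄) (l₂′ a₂ w₂ h₃) (l₃ a₁ w₁ h₁) (l₄ a₁ w₁ h₂)) (inj₂ (rotateThreeBlack {P} a t))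

weakenDefect : ∀ {P Bad K K′ z} → K ≤ K′ → Defect P Bad K z → Defect P Bad K′ z
weakenDefect {K = K} {K′} K≤K′ (defect a (inBox h₁ h₂ h₃ h₄) why) = defect a (inBox (lo h₁) (hi h₂) (lo h₃) (hi h₄)) why
  where
  lo : ∀ {t} → ℤ.- + K ℤ.≤ t → ℤ.- + K′ ℤ.≤ t
  lo {t} h = linarith (K′ ∷ K ∷ [] ∣ᵉ t ∷ []) (⊟ ι 1 ≼ᶻ ζ 0 ∷ ν 1 ≼ ν 0 ∷ []) (⊟ ι 0 ≼ᶻ ζ 0) (h , K≤K′ , tt)
  hi : ∀ {t} → t ℤ.≤ + K → t ℤ.≤ + K′
  hi {t} h = linarith (K′ ∷ K ∷ [] ∣ᵉ t ∷ []) (ζ 0 ≼ᶻ ι 1 ∷ ν 1 ≼ ν 0 ∷ []) (ζ 0 ≼ᶻ ι 0) (h , K≤K′ , tt)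

module _ {m : ℕ} (2≤m : 2 ≤ m) where
  Classifies : (P Bad : Pixel → Set) → Set
  Classifies P Bad = ∀ {w} → P w → OptimalRect m P w ⊎ Bad w

  rotateClassifies : ∀ {P Bad} → Classifies P Bad → Classifies (P ∘ rot) (Bad ∘ rot)
  rotateClassifies {P} c {w} p = [ (λ C → inj₁ (rotateOptimal {m} {P} {w} C)) , inj₂ ]′ (c p)

  -- A pixel with `u = u₀ + U - 2` and `v = v₀` exists because `u₀ + U + v₀` is even; its first
  -- coordinate is `k - 1`.
  even-corner : ∀ {P Bad} (P? : ∀ z → Dec (P z)) → Classifies P Bad → ∀ {z} (C : OptimalRect m P z) h → OptimalRect.V C ≡ 2 * h + 1 →
                ∀ k → OptimalRect.u₀ C ℤ.+ + OptimalRect.U C ℤ.+ OptimalRect.v₀ C ≡ + 2 ℤ.* k → Defect P Bad (2 * m + 10) z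
  even-corner P? c C h V≡ k e = TruncatedNE.result 2≤m P? c C h V≡ (k ℤ.- 1ℤ) (u₀ ℤ.+ + U ℤ.- 1ℤ ℤ.- k) (coord-sum k (u₀ ℤ.+ + U)) (difference k u₀ U v₀ e)
    where
    open OptimalRect C
    coord-sum : ∀ k s → k ℤ.- 1ℤ ℤ.+ (s ℤ.- 1ℤ ℤ.- k) ≡ s ℤ.- + 2
    coord-sum k s = linarith ([] ∣ᵉ k ∷ s ∷ []) [] (ζ 0 ⊖ κᶻ 1 ⊞ (ζ 1 ⊖ κᶻ 1 ⊖ ζ 0) ≐ᶻ ζ 1 ⊖ κᶻ 2) tt
    difference : ∀ k u₀ U v₀ → u₀ ℤ.+ + U ℤ.+ v₀ ≡ + 2 ℤ.* k → k ℤ.- 1ℤ ℤ.- (u₀ ℤ.+ + U ℤ.- 1ℤ ℤ.- k) ≡ v₀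
    difference k u₀ U v₀ e = linarith (U ∷ [] ∣ᵉ k ∷ u₀ ∷ v₀ ∷ [])
      (ζ 1 ⊞ ι 0 ⊞ ζ 2 ≐ᶻ κᶻ 2 ⊠ ζ 0 ∷ []) (ζ 0 ⊖ κᶻ 1 ⊖ (ζ 1 ⊞ ι 0 ⊖ κᶻ 1 ⊖ ζ 0) ≐ᶻ ζ 2) (e , tt)

  rot-rot : ∀ z → rot (rot (rot (rot z))) ≡ z
  rot-rot (x , y) = cong₂ _,_ (ℤₚ.neg-involutive x) (ℤₚ.neg-involutive y)

  -- The sides are consecutive numbers, so `U` is even and the first and the last diagonal have
  -- different parities: exactly one of them is truncated. If it is the first, a half turn makes it
  -- the last, at the cost of 2 in the radius.
  odd-V : ∀ {P Bad} (P? : ∀ z → Dec (P z)) → Classifies P Bad → ∀ {z} (C : OptimalRect m P z) h → OptimalRect.V C ≡ 2 * h + 1 →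
          Defect P Bad (2 * m + 12) z
  odd-V {P} {Bad} P? c {z} C h V≡ = let k , e = halve (u₀ ℤ.+ + U ℤ.+ v₀) in go k e
    where
    open OptimalRect C
    U-even : ∃[ j ] U ≡ 2 * j
    U-even = [ (λ (p , q) → h , l₁ U V m h p q V≡) , (λ (p , q) → suc h , l₂ U V m h p q V≡) ]′ sides
      where
      l₁ : ∀ U V m h → U ≡ m → V ≡ suc m → V ≡ 2 * h + 1 → U ≡ 2 * h
      l₁ U V m h p q e = linarith (U ∷ h ∷ m ∷ V ∷ [] ∣ᵉ [])
        (ν 0 ≐ ν 2 ∷ ν 3 ≐ κ 1 ⊕ ν 2 ∷ ν 3 ≐ κ 2 ⊗ ν 1 ⊕ κ 1 ∷ []) (ν 0 ≐ κ 2 ⊗ ν 1) (p , q , e , tt)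
      l₂ : ∀ U V m h → U ≡ suc m → V ≡ m → V ≡ 2 * h + 1 → U ≡ 2 * suc h
      l₂ U V m h p q e = linarith (U ∷ h ∷ m ∷ V ∷ [] ∣ᵉ [])
        (ν 0 ≐ κ 1 ⊕ ν 2 ∷ ν 3 ≐ ν 2 ∷ ν 3 ≐ κ 2 ⊗ ν 1 ⊕ κ 1 ∷ []) (ν 0 ≐ κ 2 ⊗ (κ 1 ⊕ ν 1)) (p , q , e , tt)
    C₂ : OptimalRect m (P ∘ rot ∘ rot) (rot (rot z))
    C₂ = rotateOptimal {m} {P ∘ rot} {rot (rot z)} (rotateOptimal {m} {P} {rot (rot (rot z))}
      (record { rect = rect ; sides = sides ; member = subst (_∈ᴿ rect) (sym (rot-rot z)) member ; inside = inside ; outside = outside }))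
    opposite : ∀ u₀ v₀ U V h j k → U ≡ 2 * j → V ≡ 2 * h + 1 → u₀ ℤ.+ + U ℤ.+ v₀ ≡ + 2 ℤ.* k ℤ.+ 1ℤ →
               1ℤ ℤ.- u₀ ℤ.- + U ℤ.+ + U ℤ.+ (1ℤ ℤ.- v₀ ℤ.- + V) ≡ + 2 ℤ.* (+ j ℤ.- k ℤ.- + h)
    opposite u₀ v₀ U V h j k p q e = linarith (U ∷ V ∷ j ∷ h ∷ [] ∣ᵉ u₀ ∷ v₀ ∷ k ∷ [])
      (ν 0 ≐ κ 2 ⊗ ν 2 ∷ ν 1 ≐ κ 2 ⊗ ν 3 ⊕ κ 1 ∷ ζ 0 ⊞ ι 0 ⊞ ζ 1 ≐ᶻ κᶻ 2 ⊠ ζ 2 ⊞ κᶻ 1 ∷ [])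
      (κᶻ 1 ⊖ ζ 0 ⊖ ι 0 ⊞ ι 0 ⊞ (κᶻ 1 ⊖ ζ 1 ⊖ ι 1) ≐ᶻ κᶻ 2 ⊠ (ι 2 ⊖ ζ 2 ⊖ ι 3)) (p , q , e , tt)
    +2 : ∀ n → n + 10 ≤ n + 12
    +2 n = linarith (n ∷ [] ∣ᵉ []) [] (ν 0 ⊕ κ 10 ≼ ν 0 ⊕ κ 12) tt
    same : ∀ n → suc (suc (n + 10)) ≡ n + 12
    same n = linarith (n ∷ [] ∣ᵉ []) [] (κ 1 ⊕ (κ 1 ⊕ (ν 0 ⊕ κ 10)) ≐ ν 0 ⊕ κ 12) tt
    go : ∀ k → u₀ ℤ.+ + U ℤ.+ v₀ ≡ + 2 ℤ.* k ⊎ u₀ ℤ.+ + U ℤ.+ v₀ ≡ + 2 ℤ.* k ℤ.+ 1ℤ → Defect P Bad (2 * m + 12) z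
    go k (inj₁ e) = weakenDefect {P} {Bad} (+2 (2 * m)) (even-corner P? c C h V≡ k e)
    go k (inj₂ e) = let j , U≡ = U-even in subst₂ (Defect P Bad) (same (2 * m)) (rot-rot z)
      (rotateDefect {P} {Bad} (rotateDefect {P ∘ rot} {Bad ∘ rot}
        (even-corner (P? ∘ rot ∘ rot) (rotateClassifies {P ∘ rot} {Bad ∘ rot} (rotateClassifies {P} {Bad} c)) C₂ h V≡ (+ j ℤ.- k ℤ.- + h) (opposite u₀ v₀ U V h j k U≡ V≡ e))))

  -- One of `m` and `m + 1` is odd. If that is the length in `u`, a quarter turn exchanges the two
  -- directions and adds the last 1 to the radius.
  optimal⇒defect : ∀ {P Bad} (P? : ∀ z → Dec (P z)) → Classifies P Bad → ∀ {z} → OptimalRect m P z → Defect P Bad (2 * m + 13) z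
  optimal⇒defect {P} {Bad} P? c {z} C = go (even-or-odd m) sides
    where
    open OptimalRect C
    +1 : ∀ n → n + 12 ≤ n + 13
    +1 n = linarith (n ∷ [] ∣ᵉ []) [] (ν 0 ⊕ κ 12 ≼ ν 0 ⊕ κ 13) tt
    same : ∀ n → suc (n + 12) ≡ n + 13
    same n = linarith (n ∷ [] ∣ᵉ []) [] (κ 1 ⊕ (ν 0 ⊕ κ 12) ≐ ν 0 ⊕ κ 13) tt
    z₁ : Pixel
    z₁ = proj₂ z , ℤ.- proj₁ z
    rot-z₁ : rot z₁ ≡ z
    rot-z₁ = cong (_, proj₂ z) (ℤₚ.neg-involutive (proj₁ z))
    V-odd : ∀ h → V ≡ 2 * h + 1 → Defect P Bad (2 * m + 13) z
    V-odd h V≡ = weakenDefect {P} {Bad} (+1 (2 * m)) (odd-V P? c C h V≡)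
    U-odd : ∀ h → U ≡ 2 * h + 1 → Defect P Bad (2 * m + 13) z
    U-odd h U≡ = subst₂ (Defect P Bad) (same (2 * m)) rot-z₁ (rotateDefect {P} {Bad}
      (odd-V (P? ∘ rot) (rotateClassifies {P} {Bad} c) (rotateOptimal {m} {P} {z₁}
        (record { rect = rect ; sides = sides ; member = subst (_∈ᴿ rect) (sym rot-z₁) member ; inside = inside ; outside = outside })) h U≡))
    odd-m : ∀ h s → m ≡ h + suc h → s ≡ m → s ≡ 2 * h + 1
    odd-m h s p q = linarith (s ∷ h ∷ m ∷ [] ∣ᵉ [])
      (ν 2 ≐ ν 1 ⊕ (κ 1 ⊕ ν 1) ∷ ν 0 ≐ ν 2 ∷ []) (ν 0 ≐ κ 2 ⊗ ν 1 ⊕ κ 1) (p , q , tt)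
    even-m : ∀ h s → m ≡ h + h → s ≡ suc m → s ≡ 2 * h + 1
    even-m h s p q = linarith (s ∷ h ∷ m ∷ [] ∣ᵉ []) (ν 2 ≐ ν 1 ⊕ ν 1 ∷ ν 0 ≐ κ 1 ⊕ ν 2 ∷ []) (ν 0 ≐ κ 2 ⊗ ν 1 ⊕ κ 1) (p , q , tt)
    go : ∃[ h ] (m ≡ h + h ⊎ m ≡ h + suc h) → (U ≡ m × V ≡ suc m) ⊎ (U ≡ suc m × V ≡ m) → Defect P Bad (2 * m + 13) z
    go (h , inj₁ e) (inj₁ (_ , q)) = V-odd h (even-m h V e q)
    go (h , inj₁ e) (inj₂ (p , _)) = U-odd h (even-m h U e p)
    go (h , inj₂ e) (inj₁ (p , _)) = U-odd h (odd-m h U e p)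
    go (h , inj₂ e) (inj₂ (_ , q)) = V-odd h (odd-m h V e q)

-- Arithmetic of component sizes for `𝒰`

length-concat-filter : ∀ {A : Set} {P : List A → Set} (P? : ∀ xs → Dec (P xs)) xss →
                       length (concat (filter P? xss)) ≡ ∑ xss (λ xs → 𝟙 (P? xs) * length xs)
length-concat-filter P? [] = sym (∑-empty (λ xs → 𝟙 (P? xs) * length xs))
length-concat-filter {P = P} P? (xs ∷ xss) = trans head-case (sym (∑-cons xs xss (λ xs → 𝟙 (P? xs) * length xs)))
  where
  rest : ℕ
  rest = ∑ xss (λ xs → 𝟙 (P? xs) * length xs)
  head-case : length (concat (filter P? (xs ∷ xss))) ≡ 𝟙 (P? xs) * length xs + rest
  head-case with P? xs
  ... | yes _ = trans (length-++ xs) (cong₂ ℕ._+_ (sym (ℕₚ.+-identityʳ (length xs))) (length-concat-filter P? xss))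
  ... | no _  = length-concat-filter P? xss

-- `J` is the size of a full rectangle with sides `m` and `m + 1`. The field `k<` says
-- `k / (2m + 2) < J / (2m + 1)`, so components with larger `U + V` have a smaller ratio of size to
-- `U + V` than such a rectangle.
record Extremal (k m J : ℕ) : Set where
  field
    2≤m  : 2 ≤ m
    2J≡  : 2 * J ≡ m * (m + 1)
    J≤k  : J ≤ k
    k<   : 2 * (k * (2 * m + 1)) < 2 * (m * ((m + 1) * (m + 1)))

  1≤J : 1 ≤ J
  1≤J = ℕₚ.*-cancelˡ-≤ 2 (subst (2 ℕ.≤_) (sym 2J≡) (ℕₚ.*-mono-≤ {2} {m} {1} 2≤m (ℕₚ.m≤n+m 1 m)))

Sides : ℕ → ℕ → ℕ → Set
Sides m U V = (U ≡ m × V ≡ suc m) ⊎ (U ≡ suc m × V ≡ m)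

module _ {k m J : ℕ} (ext : Extremal k m J) where
  open Extremal ext

  -- This compares the ratios `n / (U + V) < J / (2m + 1)`.
  Loss : ℕ → ℕ → ℕ → Set
  Loss n U V = n * (2 * m + 1) < J * (U + V)

  too-wide : ∀ n U V → n ≤ k → 2 * m + 2 ≤ U + V → Loss n U V
  too-wide n U V n≤k h = arith n k m J (U + V) (ℕₚ.*-monoˡ-≤ (2 * m + 1) n≤k) k< (cong (ℕ._* (m + 1)) 2J≡) (ℕₚ.*-monoʳ-≤ J h)
    where
    arith : ∀ n k m J c → n * (2 * m + 1) ≤ k * (2 * m + 1) →
            2 * (k * (2 * m + 1)) < 2 * (m * ((m + 1) * (m + 1))) →
            2 * J * (m + 1) ≡ m * (m + 1) * (m + 1) → J * (2 * m + 2) ≤ J * c → n * (2 * m + 1) < J * c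
    arith n k m J c h₁ h₂ h₃ h₄ = linarith (n ∷ m ∷ J ∷ c ∷ k ∷ [] ∣ᵉ [])
      (ν 0 ⊗ (κ 2 ⊗ ν 1 ⊕ κ 1) ≼ ν 4 ⊗ (κ 2 ⊗ ν 1 ⊕ κ 1) ∷ κ 1 ⊕ κ 2 ⊗ (ν 4 ⊗ (κ 2 ⊗ ν 1 ⊕ κ 1)) ≼ κ 2 ⊗ (ν 1 ⊗ ((ν 1 ⊕ κ 1) ⊗ (ν 1 ⊕ κ 1))) ∷ κ 2 ⊗ ν 2 ⊗ (ν 1 ⊕ κ 1) ≐ ν 1 ⊗ (ν 1 ⊕ κ 1) ⊗ (ν 1 ⊕ κ 1) ∷ ν 2 ⊗ (κ 2 ⊗ ν 1 ⊕ κ 2) ≼ ν 2 ⊗ ν 3 ∷ [])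
      (κ 1 ⊕ ν 0 ⊗ (κ 2 ⊗ ν 1 ⊕ κ 1) ≼ ν 2 ⊗ ν 3) (h₁ , h₂ , h₃ , h₄ , tt)

  fewer : ∀ n U V → U + V ≡ 2 * m + 1 → n < J → Loss n U V
  fewer n U V e h = subst (λ t → n * (2 * m + 1) < J * t) (sym e) (ℕₚ.*-monoˡ-< (2 * m + 1) {{ℕ.>-nonZero (ℕₚ.m≤n+m 1 (2 * m))}} h)

  -- Here `UV = m(m + 1) - d(d + 1) = 2J - d(d + 1)`, and `d(d + 1) ≥ 2` unless `d = 0`.
  balanced : ∀ n d U V → U + d ≡ m → V ≡ m + 1 + d → 2 * n ≤ U * V + 1 → n < J ⊎ (n ≡ J × d ≡ 0)
  balanced n zero U V eU eV h = [ inj₁ , (λ e → inj₂ (e , refl)) ]′ (ℕₚ.m≤n⇒m<n∨m≡n (le n J m U V eU eV 2J≡ h))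
    where
    le : ∀ n J m U V → U + 0 ≡ m → V ≡ m + 1 + 0 → 2 * J ≡ m * (m + 1) → 2 * n ≤ U * V + 1 → n ≤ J
    le n J .(U + 0) U .(U + 0 + 1 + 0) refl refl e h = linarith (n ∷ J ∷ U ∷ [] ∣ᵉ [])
      (κ 2 ⊗ ν 1 ≐ (ν 2 ⊕ κ 0) ⊗ (ν 2 ⊕ κ 0 ⊕ κ 1) ∷ κ 2 ⊗ ν 0 ≼ ν 2 ⊗ (ν 2 ⊕ κ 0 ⊕ κ 1 ⊕ κ 0) ⊕ κ 1 ∷ []) (ν 0 ≼ ν 1)
      (e , h , tt)
  balanced n (suc d) U V eU eV h = inj₁ (lt n J m U V d eU eV 2J≡ h)
    where
    lt : ∀ n J m U V d → U + suc d ≡ m → V ≡ m + 1 + suc d → 2 * J ≡ m * (m + 1) → 2 * n ≤ U * V + 1 → n < J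
    lt n J .(U + suc d) U .(U + suc d + 1 + suc d) d refl refl e h = linarith (n ∷ J ∷ U ∷ d ∷ [] ∣ᵉ [])
      (κ 2 ⊗ ν 1 ≐ (ν 2 ⊕ (κ 1 ⊕ ν 3)) ⊗ (ν 2 ⊕ (κ 1 ⊕ ν 3) ⊕ κ 1) ∷ κ 2 ⊗ ν 0 ≼ ν 2 ⊗ (ν 2 ⊕ (κ 1 ⊕ ν 3) ⊕ κ 1 ⊕ (κ 1 ⊕ ν 3)) ⊕ κ 1 ∷ [])
      (κ 1 ⊕ ν 0 ≼ ν 1) (e , h , tt)

  exact : ∀ n U V → U + V ≡ 2 * m + 1 → 2 * n ≤ U * V + 1 → Loss n U V ⊎ (n ≡ J × Sides m U V)
  exact n U V e h = [ low , high ]′ (ℕₚ.≤-<-connex U m)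
    where
    other : ∀ U V m d → U + V ≡ 2 * m + 1 → U + d ≡ m → V ≡ m + 1 + d
    other U V m d e e′ = linarith (V ∷ m ∷ d ∷ U ∷ [] ∣ᵉ [])
      (ν 3 ⊕ ν 0 ≐ κ 2 ⊗ ν 1 ⊕ κ 1 ∷ ν 3 ⊕ ν 2 ≐ ν 1 ∷ []) (ν 0 ≐ ν 1 ⊕ κ 1 ⊕ ν 2) (e , e′ , tt)
    low : U ≤ m → Loss n U V ⊎ (n ≡ J × Sides m U V)
    low U≤m = result (m ∸ U) (ℕₚ.m+[n∸m]≡n U≤m)
      where
      sides₀ : ∀ U V m d → d ≡ 0 → U + d ≡ m → V ≡ m + 1 + d → Sides m U V
      sides₀ U V m .0 refl p q = inj₁ (l₁ U m p , l₂ V m q)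
        where
        l₁ : ∀ U m → U + 0 ≡ m → U ≡ m
        l₁ U m p = linarith (U ∷ m ∷ [] ∣ᵉ []) (ν 0 ⊕ κ 0 ≐ ν 1 ∷ []) (ν 0 ≐ ν 1) (p , tt)
        l₂ : ∀ V m → V ≡ m + 1 + 0 → V ≡ suc m
        l₂ V m p = linarith (V ∷ m ∷ [] ∣ᵉ []) (ν 0 ≐ ν 1 ⊕ κ 1 ⊕ κ 0 ∷ []) (ν 0 ≐ κ 1 ⊕ ν 1) (p , tt)
      result : ∀ d → U + d ≡ m → Loss n U V ⊎ (n ≡ J × Sides m U V)
      result d eU = [ (λ lt → inj₁ (fewer n U V e lt)) , (λ (p , q) → inj₂ (p , sides₀ U V m d q eU (other U V m d e eU))) ]′
        (balanced n d U V eU (other U V m d e eU) h)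
    high : m < U → Loss n U V ⊎ (n ≡ J × Sides m U V)
    high m<U = result (m ∸ V) (ℕₚ.m+[n∸m]≡n (V≤ U V m e m<U))
      where
      V≤ : ∀ U V m → U + V ≡ 2 * m + 1 → m < U → V ≤ m
      V≤ U V m e h = linarith (V ∷ m ∷ U ∷ [] ∣ᵉ []) (ν 2 ⊕ ν 0 ≐ κ 2 ⊗ ν 1 ⊕ κ 1 ∷ κ 1 ⊕ ν 1 ≼ ν 2 ∷ []) (ν 0 ≼ ν 1) (e , h , tt)
      e′ : V + U ≡ 2 * m + 1
      e′ = trans (ℕₚ.+-comm V U) e
      sides₀ : ∀ U V m d → d ≡ 0 → V + d ≡ m → U ≡ m + 1 + d → Sides m U V
      sides₀ U V m .0 refl p q = inj₂ (l₂ U m q , l₁ V m p)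
        where
        l₁ : ∀ U m → U + 0 ≡ m → U ≡ m
        l₁ U m p = linarith (U ∷ m ∷ [] ∣ᵉ []) (ν 0 ⊕ κ 0 ≐ ν 1 ∷ []) (ν 0 ≐ ν 1) (p , tt)
        l₂ : ∀ V m → V ≡ m + 1 + 0 → V ≡ suc m
        l₂ V m p = linarith (V ∷ m ∷ [] ∣ᵉ []) (ν 0 ≐ ν 1 ⊕ κ 1 ⊕ κ 0 ∷ []) (ν 0 ≐ κ 1 ⊕ ν 1) (p , tt)
      result : ∀ d → V + d ≡ m → Loss n U V ⊎ (n ≡ J × Sides m U V)
      result d eV = [ (λ lt → inj₁ (fewer n U V e lt)) , (λ (p , q) → inj₂ (p , sides₀ U V m d q eV (other V U m d e′ eV))) ]′
        (balanced n d V U eV (other V U m d e′ eV) (subst (λ t → 2 * n ≤ t + 1) (ℕₚ.*-comm U V) h))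

  -- As `h(h + 1)` is even, `2n ≤ h(h + 1)`, and `h(h + 1) / (2h + 1)` increases strictly with `h`.
  narrow-odd : ∀ n h → h < m → 4 * (2 * n) ≤ (h + suc h) * (h + suc h) + 4 → n * (2 * m + 1) < J * (h + suc h)
  narrow-odd n h h<m c = let t , e = half-product h in
    arith n h J m (m ∸ suc h) (sym (ℕₚ.m+[n∸m]≡n h<m)) 2J≡ (small n h t e c)
    where
    small : ∀ n h t → h * suc h ≡ 2 * t → 4 * (2 * n) ≤ (h + suc h) * (h + suc h) + 4 → 2 * n ≤ h * suc h
    small n h t e c = subst (2 * n ℕ.≤_) (sym e) (ℕₚ.*-monoʳ-≤ 2 n≤t)
      where
      n≤t : n ≤ t
      n≤t = linarith (n ∷ t ∷ h ∷ [] ∣ᵉ [])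
        (ν 2 ⊗ (κ 1 ⊕ ν 2) ≐ κ 2 ⊗ ν 1 ∷ κ 4 ⊗ (κ 2 ⊗ ν 0) ≼ (ν 2 ⊕ (κ 1 ⊕ ν 2)) ⊗ (ν 2 ⊕ (κ 1 ⊕ ν 2)) ⊕ κ 4 ∷ [])
        (ν 0 ≼ ν 1) (e , c , tt)
    arith : ∀ n h J m d → m ≡ suc h + d → 2 * J ≡ m * (m + 1) → 2 * n ≤ h * suc h → n * (2 * m + 1) < J * (h + suc h)
    arith n h J .(suc h + d) d refl e l = linarith (n ∷ h ∷ d ∷ J ∷ [] ∣ᵉ [])
      (κ 2 ⊗ ν 3 ⊗ (ν 1 ⊕ (κ 1 ⊕ ν 1)) ≐ (κ 1 ⊕ ν 1 ⊕ ν 2) ⊗ (κ 1 ⊕ ν 1 ⊕ ν 2 ⊕ κ 1) ⊗ (ν 1 ⊕ (κ 1 ⊕ ν 1)) ∷ κ 2 ⊗ ν 0 ⊗ (κ 2 ⊗ (κ 1 ⊕ ν 1 ⊕ ν 2) ⊕ κ 1) ≼ ν 1 ⊗ (κ 1 ⊕ ν 1) ⊗ (κ 2 ⊗ (κ 1 ⊕ ν 1 ⊕ ν 2) ⊕ κ 1) ∷ [])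
      (κ 1 ⊕ ν 0 ⊗ (κ 2 ⊗ (κ 1 ⊕ ν 1 ⊕ ν 2) ⊕ κ 1) ≼ ν 3 ⊗ (ν 1 ⊕ (κ 1 ⊕ ν 1))) (e₁′ , l₁ , tt)
      where
      m′ : ℕ
      m′ = suc h + d
      e₁′ : 2 * J * (h + suc h) ≡ (suc h + d) * (suc h + d + 1) * (h + suc h)
      e₁′ = cong (ℕ._* (h + suc h)) e
      l₁ : 2 * n * (2 * (suc h + d) + 1) ≤ h * suc h * (2 * (suc h + d) + 1)
      l₁ = ℕₚ.*-monoˡ-≤ (2 * (suc h + d) + 1) l

  narrow-even : ∀ n h → 1 ≤ h → h ≤ m → 4 * (2 * n) ≤ (h + h) * (h + h) + 4 → n * (2 * m + 1) < J * (h + h)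
  narrow-even n h 1≤h h≤m c = go h (m ∸ h) 1≤h (sym (ℕₚ.m+[n∸m]≡n h≤m)) c
    where
    scale : ∀ {a b} c → a ≡ b → a * c ≡ b * c
    scale c = cong (ℕ._* c)
    Goal : ℕ → Set
    Goal h = n * (2 * m + 1) < J * (h + h)
    go : ∀ h d → 1 ≤ h → m ≡ h + d → 4 * (2 * n) ≤ (h + h) * (h + h) + 4 → Goal h
    go 0 d () _ _
    go 1 d _ e c = arith n m J (n≤1 n c) 2J≡ 2≤m (ℕₚ.*-monoˡ-≤ m 2≤m)
      where
      n≤1 : ∀ n → 4 * (2 * n) ≤ 2 * 2 + 4 → n ≤ 1
      n≤1 n c = linarith (n ∷ [] ∣ᵉ []) (κ 4 ⊗ (κ 2 ⊗ ν 0) ≼ κ 2 ⊗ κ 2 ⊕ κ 4 ∷ []) (ν 0 ≼ κ 1) (c , tt)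
      arith : ∀ n m J → n ≤ 1 → 2 * J ≡ m * (m + 1) → 2 ≤ m → 2 * m ≤ m * m → n * (2 * m + 1) < J * 2
      arith n m J h e h₂ h₃ = linarith (n ∷ m ∷ J ∷ [] ∣ᵉ [])
        (ν 0 ⊗ (κ 2 ⊗ ν 1 ⊕ κ 1) ≼ κ 1 ⊗ (κ 2 ⊗ ν 1 ⊕ κ 1) ∷ κ 2 ⊗ ν 2 ≐ ν 1 ⊗ (ν 1 ⊕ κ 1) ∷ κ 2 ≼ ν 1 ∷ κ 2 ⊗ ν 1 ≼ ν 1 ⊗ ν 1 ∷ [])
        (κ 1 ⊕ ν 0 ⊗ (κ 2 ⊗ ν 1 ⊕ κ 1) ≼ ν 2 ⊗ κ 2) (h₁ , e , h₂ , h₃ , tt)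
        where
        h₁ : n * (2 * m + 1) ≤ 1 * (2 * m + 1)
        h₁ = ℕₚ.*-monoˡ-≤ (2 * m + 1) h
    -- For `h = 2` the bound `2n ≤ h² + 1 = 5` has to be rounded to `n ≤ 2`: without rounding the
    -- ratio 5/8 would exceed `J / (2m + 1) = 3/5` at `m = 2`.
    go 2 zero _ e c = subst (λ m → n * (2 * m + 1) < J * 4) (sym e) (arith n J c (trans 2J≡ (cong (λ m → m * (m + 1)) e)))
      where
      arith : ∀ n J → 4 * (2 * n) ≤ 4 * 4 + 4 → 2 * J ≡ 2 * (2 + 1) → n * (2 * 2 + 1) < J * 4
      arith n J c e = small (n≤2 n c)
        where
        n≤2 : ∀ n → 4 * (2 * n) ≤ 4 * 4 + 4 → n ≤ 2
        n≤2 n c = linarith (n ∷ [] ∣ᵉ []) (κ 4 ⊗ (κ 2 ⊗ ν 0) ≼ κ 4 ⊗ κ 4 ⊕ κ 4 ∷ []) (ν 0 ≼ κ 2) (c , tt)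
        small : n ≤ 2 → n * (2 * 2 + 1) < J * 4
        small h = linarith (n ∷ J ∷ [] ∣ᵉ [])
          (ν 0 ≼ κ 2 ∷ κ 2 ⊗ ν 1 ≐ κ 2 ⊗ (κ 2 ⊕ κ 1) ∷ []) (κ 1 ⊕ ν 0 ⊗ (κ 2 ⊗ κ 2 ⊕ κ 1) ≼ ν 1 ⊗ κ 4) (h , e , tt)
    go 2 (suc d) _ e c = subst (λ m → n * (2 * m + 1) < J * 4) (sym e) (arith n J d c (trans 2J≡ (cong (λ m → m * (m + 1)) e)))
      where
      arith : ∀ n J d → 4 * (2 * n) ≤ 4 * 4 + 4 → 2 * J ≡ (2 + suc d) * (2 + suc d + 1) → n * (2 * (2 + suc d) + 1) < J * 4
      arith n J d c e = small (ℕₚ.*-monoˡ-≤ (2 * (2 + suc d) + 1) (n≤2 n c))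
        where
        n≤2 : ∀ n → 4 * (2 * n) ≤ 4 * 4 + 4 → n ≤ 2
        n≤2 n c = linarith (n ∷ [] ∣ᵉ []) (κ 4 ⊗ (κ 2 ⊗ ν 0) ≼ κ 4 ⊗ κ 4 ⊕ κ 4 ∷ []) (ν 0 ≼ κ 2) (c , tt)
        small : n * (2 * (2 + suc d) + 1) ≤ 2 * (2 * (2 + suc d) + 1) → n * (2 * (2 + suc d) + 1) < J * 4
        small h = linarith (n ∷ d ∷ J ∷ [] ∣ᵉ [])
          (ν 0 ⊗ (κ 2 ⊗ (κ 2 ⊕ (κ 1 ⊕ ν 1)) ⊕ κ 1) ≼ κ 2 ⊗ (κ 2 ⊗ (κ 2 ⊕ (κ 1 ⊕ ν 1)) ⊕ κ 1) ∷ κ 2 ⊗ ν 2 ≐ (κ 2 ⊕ (κ 1 ⊕ ν 1)) ⊗ (κ 2 ⊕ (κ 1 ⊕ ν 1) ⊕ κ 1) ∷ [])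
          (κ 1 ⊕ ν 0 ⊗ (κ 2 ⊗ (κ 2 ⊕ (κ 1 ⊕ ν 1)) ⊕ κ 1) ≼ ν 2 ⊗ κ 4) (h , e , tt)
    go (suc (suc (suc g))) d _ e c = subst (λ m → n * (2 * m + 1) < J * (3 + g + (3 + g))) (sym e)
        (arith n J d g (ℕₚ.*-monoˡ-≤ (2 * (3 + g + d) + 1) c) (scale (3 + g) (trans 2J≡ (cong (λ m → m * (m + 1)) e))))
      where
      arith : ∀ n J d g → 4 * (2 * n) * (2 * (3 + g + d) + 1) ≤ ((3 + g + (3 + g)) * (3 + g + (3 + g)) + 4) * (2 * (3 + g + d) + 1) →
              2 * J * (3 + g) ≡ (3 + g + d) * (3 + g + d + 1) * (3 + g) →
              n * (2 * (3 + g + d) + 1) < J * (3 + g + (3 + g))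
      arith n J d g h e = linarith (n ∷ g ∷ d ∷ J ∷ [] ∣ᵉ [])
        (κ 4 ⊗ (κ 2 ⊗ ν 0) ⊗ (κ 2 ⊗ (κ 3 ⊕ ν 1 ⊕ ν 2) ⊕ κ 1) ≼ ((κ 3 ⊕ ν 1 ⊕ (κ 3 ⊕ ν 1)) ⊗ (κ 3 ⊕ ν 1 ⊕ (κ 3 ⊕ ν 1)) ⊕ κ 4) ⊗ (κ 2 ⊗ (κ 3 ⊕ ν 1 ⊕ ν 2) ⊕ κ 1) ∷ κ 2 ⊗ ν 3 ⊗ (κ 3 ⊕ ν 1) ≐ (κ 3 ⊕ ν 1 ⊕ ν 2) ⊗ (κ 3 ⊕ ν 1 ⊕ ν 2 ⊕ κ 1) ⊗ (κ 3 ⊕ ν 1) ∷ [])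
        (κ 1 ⊕ ν 0 ⊗ (κ 2 ⊗ (κ 3 ⊕ ν 1 ⊕ ν 2) ⊕ κ 1) ≼ ν 3 ⊗ (κ 3 ⊕ ν 1 ⊕ (κ 3 ⊕ ν 1))) (h , e , tt)

  classify-size : ∀ n U V → n ≤ k → 1 ≤ U → 1 ≤ V → 2 * n ≤ U * V + 1 → Loss n U V ⊎ (n ≡ J × Sides m U V)
  classify-size n U V n≤k 1≤U 1≤V h = go (ℕₚ.<-cmp (U + V) (2 * m + 1))
    where
    c² : 4 * (2 * n) ≤ (U + V) * (U + V) + 4
    c² = arith n (U * V) ((U + V) * (U + V)) h (4mn≤[m+n]² U V)
      where
      arith : ∀ n p s → 2 * n ≤ p + 1 → 4 * p ≤ s → 4 * (2 * n) ≤ s + 4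
      arith n p s h h′ = linarith (n ∷ s ∷ p ∷ [] ∣ᵉ [])
        (κ 2 ⊗ ν 0 ≼ ν 2 ⊕ κ 1 ∷ κ 4 ⊗ ν 2 ≼ ν 1 ∷ []) (κ 4 ⊗ (κ 2 ⊗ ν 0) ≼ ν 1 ⊕ κ 4) (h , h′ , tt)
    narrow : U + V < 2 * m + 1 → ∃[ t ] (U + V ≡ t + t ⊎ U + V ≡ t + suc t) → Loss n U V
    narrow lt (t , inj₁ e) = subst (λ c → n * (2 * m + 1) < J * c) (sym e)
      (narrow-even n t (l₁ U V t 1≤U 1≤V e) (l₂ (U + V) t m lt e) (subst (λ c → 4 * (2 * n) ≤ c * c + 4) e c²))
      where
      l₁ : ∀ U V t → 1 ≤ U → 1 ≤ V → U + V ≡ t + t → 1 ≤ t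
      l₁ U V t h h′ e = linarith (t ∷ U ∷ V ∷ [] ∣ᵉ [])
        (κ 1 ≼ ν 1 ∷ κ 1 ≼ ν 2 ∷ ν 1 ⊕ ν 2 ≐ ν 0 ⊕ ν 0 ∷ []) (κ 1 ≼ ν 0) (h , h′ , e , tt)
      l₂ : ∀ c t m → c < 2 * m + 1 → c ≡ t + t → t ≤ m
      l₂ c t m h e = linarith (t ∷ m ∷ c ∷ [] ∣ᵉ []) (κ 1 ⊕ ν 2 ≼ κ 2 ⊗ ν 1 ⊕ κ 1 ∷ ν 2 ≐ ν 0 ⊕ ν 0 ∷ []) (ν 0 ≼ ν 1) (h , e , tt)
    narrow lt (t , inj₂ e) = subst (λ c → n * (2 * m + 1) < J * c) (sym e)
      (narrow-odd n t (l₂ (U + V) t m lt e) (subst (λ c → 4 * (2 * n) ≤ c * c + 4) e c²))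
      where
      l₂ : ∀ c t m → c < 2 * m + 1 → c ≡ t + suc t → t < m
      l₂ c t m h e = linarith (t ∷ m ∷ c ∷ [] ∣ᵉ [])
        (κ 1 ⊕ ν 2 ≼ κ 2 ⊗ ν 1 ⊕ κ 1 ∷ ν 2 ≐ ν 0 ⊕ (κ 1 ⊕ ν 0) ∷ []) (κ 1 ⊕ ν 0 ≼ ν 1) (h , e , tt)
    go : Tri (U + V < 2 * m + 1) (U + V ≡ 2 * m + 1) (U + V ℕ.> 2 * m + 1) → Loss n U V ⊎ (n ≡ J × Sides m U V)
    go (tri< lt _ _) = inj₁ (narrow lt (even-or-odd (U + V)))
    go (tri≈ _ e _)  = exact n U V e h
    go (tri> _ _ gt) = inj₁ (too-wide n U V n≤k (subst (ℕ._≤ U + V) (sym (ℕₚ.+-suc (2 * m) 1)) gt))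


-- Strict inequality: lost tokens occur with positive density.

module Strict {k m J : ℕ} (ext : Extremal k m J) (I : Image) (comps : ComponentsAtMost four k I) (r : ℕ) where
  open Extremal ext

  -- `radius` is the distance given by `optimal⇒defect`, `M` the number of pixels in a ball of that
  -- radius, and `A` the number `2J + U + V` in the token bound for a full rectangle. The box of
  -- radius `R` contains all defective squares near white pixels of the original box.
  radius R M A : ℕ
  radius = 2 * m + 13
  R = r + radius
  M = (2 * radius + 1) * (2 * radius + 1)
  A = 2 * J + (2 * m + 1)

  L : List Pixel
  L = whites I r

  Comp : Components four L
  Comp = components L (whites-unique I r)
  open Components Comp
  open ComponentsProperties Comp

  r<R : suc r ≤ R
  r<R = l r m
    where
    l : ∀ r m → suc r ≤ r + (2 * m + 13)
    l r m = linarith (r ∷ m ∷ [] ∣ᵉ []) [] (κ 1 ⊕ ν 0 ≼ ν 0 ⊕ (κ 2 ⊗ ν 1 ⊕ κ 13)) tt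

  tokens : List Pixel → ℕ
  tokens C = ∑ (box R) (squares₄ C)

  Lossy : List Pixel → Set
  Lossy C = length C * A < J * tokens C

  lossy? : ∀ C → Dec (Lossy C)
  lossy? C = length C * A ℕ.<? J * tokens C

  lossyPixels wasteSquares : List Pixel
  lossyPixels = concat (filter lossy? parts)
  wasteSquares = filter (waste? L) (box R)

  tokens≥ : ∀ {C} (C∈ : C ∈ parts) → 2 * length C + (DiagRect.U (boundingRect (clusters C∈)) + DiagRect.V (boundingRect (clusters C∈))) ≤ tokens C
  tokens≥ C∈ = cluster-squares₄ (clusters C∈) (proj₁ ∘ ∈-whites I r ∘ inside C∈) r<R

  length≤k : ∀ {C} → C ∈ parts → length C ≤ k
  length≤k = bounded comps (proj₂ ∘ ∈-whites I r)

  dichotomy : ∀ {C} (C∈ : C ∈ parts) → Lossy C ⊎ (length C ≡ J × Sides m (DiagRect.U (boundingRect (clusters C∈))) (DiagRect.V (boundingRect (clusters C∈))))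
  dichotomy {C} C∈ = [ (λ loss → inj₁ (lossy (length C) J m _ (tokens C) loss (ℕₚ.*-monoʳ-≤ J (tokens≥ C∈)))) , inj₂ ]′
    (classify-size ext (length C) (DiagRect.U (boundingRect (clusters C∈))) (DiagRect.V (boundingRect (clusters C∈)))
      (length≤k C∈) (Extent.positive (uExtent (clusters C∈))) (Extent.positive (vExtent (clusters C∈))) (2*length≤ (clusters C∈)))
    where
    lossy : ∀ n J m c t → n * (2 * m + 1) < J * c → J * (2 * n + c) ≤ J * t → n * (2 * J + (2 * m + 1)) < J * t
    lossy n J m c t h h′ = linarith (n ∷ J ∷ m ∷ t ∷ c ∷ [] ∣ᵉ [])
      (κ 1 ⊕ ν 0 ⊗ (κ 2 ⊗ ν 2 ⊕ κ 1) ≼ ν 1 ⊗ ν 4 ∷ ν 1 ⊗ (κ 2 ⊗ ν 0 ⊕ ν 4) ≼ ν 1 ⊗ ν 3 ∷ [])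
      (κ 1 ⊕ ν 0 ⊗ (κ 2 ⊗ ν 1 ⊕ (κ 2 ⊗ ν 2 ⊕ κ 1)) ≼ ν 1 ⊗ ν 3) (h , h′ , tt)

  efficient : ∀ {C} → C ∈ parts → length C * A ≤ J * tokens C
  efficient {C} C∈ = [ ℕₚ.<⇒≤ , (λ (e , s) → bound (length C) J m _ (tokens C) (sides s) (ℕₚ.*-monoʳ-≤ J (tokens≥ C∈)) e) ]′ (dichotomy C∈)
    where
    sides : ∀ {U V} → Sides m U V → U + V ≡ 2 * m + 1
    sides {U} {V} (inj₁ (p , q)) = l U V m p q
      where
      l : ∀ U V m → U ≡ m → V ≡ suc m → U + V ≡ 2 * m + 1
      l U V m p q = linarith (U ∷ V ∷ m ∷ [] ∣ᵉ []) (ν 0 ≐ ν 2 ∷ ν 1 ≐ κ 1 ⊕ ν 2 ∷ []) (ν 0 ⊕ ν 1 ≐ κ 2 ⊗ ν 2 ⊕ κ 1) (p , q , tt)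
    sides {U} {V} (inj₂ (p , q)) = l U V m p q
      where
      l : ∀ U V m → U ≡ suc m → V ≡ m → U + V ≡ 2 * m + 1
      l U V m p q = linarith (U ∷ V ∷ m ∷ [] ∣ᵉ []) (ν 0 ≐ κ 1 ⊕ ν 2 ∷ ν 1 ≐ ν 2 ∷ []) (ν 0 ⊕ ν 1 ≐ κ 2 ⊗ ν 2 ⊕ κ 1) (p , q , tt)
    bound : ∀ n J m c t → c ≡ 2 * m + 1 → J * (2 * n + c) ≤ J * t → n ≡ J → n * (2 * J + (2 * m + 1)) ≤ J * t
    bound n .n m .(2 * m + 1) t refl h refl = linarith (n ∷ m ∷ t ∷ [] ∣ᵉ [])
      (ν 0 ⊗ (κ 2 ⊗ ν 0 ⊕ (κ 2 ⊗ ν 1 ⊕ κ 1)) ≼ ν 0 ⊗ ν 2 ∷ []) (ν 0 ⊗ (κ 2 ⊗ ν 0 ⊕ (κ 2 ⊗ ν 1 ⊕ κ 1)) ≼ ν 0 ⊗ ν 2)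
      (h , tt)

  -- Scaled by k, the loss of a lossy component is at least its number of pixels.
  weight : ∀ {C} → C ∈ parts → k * A * length C + 𝟙 (lossy? C) * length C ≤ k * J * tokens C
  weight {C} C∈ = go (lossy? C)
    where
    yes′ : ∀ n k A J t → n ≤ k → k * suc (n * A) ≤ k * (J * t) → k * A * n + 1 * n ≤ k * J * t
    yes′ n k A J t h h′ = linarith (k ∷ A ∷ n ∷ J ∷ t ∷ [] ∣ᵉ [])
      (ν 2 ≼ ν 0 ∷ ν 0 ⊗ (κ 1 ⊕ ν 2 ⊗ ν 1) ≼ ν 0 ⊗ (ν 3 ⊗ ν 4) ∷ []) (ν 0 ⊗ ν 1 ⊗ ν 2 ⊕ κ 1 ⊗ ν 2 ≼ ν 0 ⊗ ν 3 ⊗ ν 4)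
      (h , h′ , tt)
    no′ : ∀ n k A J t → k * (n * A) ≤ k * (J * t) → k * A * n + 0 * n ≤ k * J * t
    no′ n k A J t h = linarith (k ∷ A ∷ n ∷ J ∷ t ∷ [] ∣ᵉ [])
      (ν 0 ⊗ (ν 2 ⊗ ν 1) ≼ ν 0 ⊗ (ν 3 ⊗ ν 4) ∷ []) (ν 0 ⊗ ν 1 ⊗ ν 2 ⊕ κ 0 ⊗ ν 2 ≼ ν 0 ⊗ ν 3 ⊗ ν 4) (h , tt)
    go : (d : Dec (Lossy C)) → k * A * length C + 𝟙 d * length C ≤ k * J * tokens C
    go (yes lossy) = yes′ (length C) k A J (tokens C) (length≤k C∈) (ℕₚ.*-monoʳ-≤ k lossy)
    go (no _) = no′ (length C) k A J (tokens C) (ℕₚ.*-monoʳ-≤ k (efficient C∈))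

  ∑length ∑tokens : ℕ
  ∑length = ∑ parts length
  ∑tokens = ∑ parts tokens

  total-weight : k * A * ∑length + length lossyPixels ≤ k * J * ∑tokens
  total-weight = subst₂ ℕ._≤_
    (trans (∑-+ (λ C → k * A * length C) (λ C → 𝟙 (lossy? C) * length C) parts)
      (cong₂ ℕ._+_ (∑-* (k * A) length parts) (sym (length-concat-filter lossy? parts))))
    (∑-* (k * J) tokens parts) (∑-mono parts weight)

  token-count : ∑tokens + length wasteSquares ≤ 2 * ((2 * R + 1) * (2 * R + 1))
  token-count = subst₂ ℕ._≤_
    (trans (∑-+ (λ z → ∑ parts (λ C → squares₄ C z)) (λ z → 𝟙 (waste? L z)) (box R))
      (cong₂ ℕ._+_ (sym (∑-swap squares₄ parts (box R))) (sym (length-filter≡∑ (waste? L) (box R)))))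
    (trans (∑-const 2 (box R)) (cong (2 ℕ.*_) (length-box R)))
    (∑-mono (box R) λ {z} _ → SquareCount.squares₄+waste≤2 Comp z)

  Bad : Pixel → Set
  Bad z = z ∈ lossyPixels

  classify : ∀ {w} → w ∈ L → OptimalRect m (_∈ L) w ⊎ Bad w
  classify {w} w∈ = let C , C∈ , w∈C = covers w∈ in
    [ (λ lossy → inj₂ (∈-concat⁺′ w∈C (∈-filter⁺ lossy? C∈ lossy))) , (λ (e , s) → inj₁ (optimal C∈ w∈C e s)) ]′ (dichotomy C∈)
    where
    optimal : ∀ {C} (C∈ : C ∈ parts) → w ∈ C → length C ≡ J → Sides m (DiagRect.U (boundingRect (clusters C∈))) (DiagRect.V (boundingRect (clusters C∈))) →
              OptimalRect m (_∈ L) w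
    optimal {C} C∈ w∈C e s = record
      { rect = rect ; sides = s ; member = ∈-boundingRect (clusters C∈) w∈C
      ; inside = λ z∈ → inside C∈ (full z∈)
      ; outside = λ {z} {z′} z∈ z′∉ n z′∈L → z′∉ (∈-boundingRect (clusters C∈) (absorbs C∈ (full z∈) z′∈L n)) }
      where
      rect : DiagRect
      rect = boundingRect (clusters C∈)
      -- From `UV = 2J` the rectangle has at most `J` pixels, and `C` has `J`, so `C` fills it.
      small : length (pixels rect) ≤ length C
      small = l (length (pixels rect)) (length C) J m _ _ s e 2J≡ (length-pixels rect)
        where
        l : ∀ p n J m U V → Sides m U V → n ≡ J → 2 * J ≡ m * (m + 1) → 2 * p ≤ U * V + 1 → p ≤ n
        l p n .n m .m .(suc m) (inj₁ (refl , refl)) refl e h = linarith (p ∷ n ∷ m ∷ [] ∣ᵉ [])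
          (κ 2 ⊗ ν 1 ≐ ν 2 ⊗ (ν 2 ⊕ κ 1) ∷ κ 2 ⊗ ν 0 ≼ ν 2 ⊗ (κ 1 ⊕ ν 2) ⊕ κ 1 ∷ []) (ν 0 ≼ ν 1) (e , h , tt)
        l p n .n m .(suc m) .m (inj₂ (refl , refl)) refl e h = linarith (p ∷ n ∷ m ∷ [] ∣ᵉ [])
          (κ 2 ⊗ ν 1 ≐ ν 2 ⊗ (ν 2 ⊕ κ 1) ∷ κ 2 ⊗ ν 0 ≼ (κ 1 ⊕ ν 2) ⊗ ν 2 ⊕ κ 1 ∷ []) (ν 0 ≼ ν 1) (e , h , tt)
      full : ∀ {z} → z ∈ᴿ rect → z ∈ C
      full z∈ = ⊆-reverse (Cluster.unique (clusters C∈)) (∈-pixels rect ∘ ∈-boundingRect (clusters C∈)) small (∈-pixels rect z∈)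

  threeBlack⇒waste : ∀ {z} → ThreeBlack (_∈ L) z → Waste L z
  threeBlack⇒waste {z} t = go (z ∈? L) (e₁₂ z ∈? L) (e₁ z ∈? L) (e₂ z ∈? L) t
    where
    go : (a : Dec (z ∈ L)) (c : Dec (e₁₂ z ∈ L)) (b : Dec (e₁ z ∈ L)) (d : Dec (e₂ z ∈ L)) → ThreeBlack (_∈ L) z → count₄ a c b d ≤ 1
    go (yes p) _ _ _ (inj₁ (¬p , _)) = contradiction p ¬p
    go (no _) c (yes p) _ (inj₁ (_ , ¬p , _)) = contradiction p ¬p
    go (no _) c (no _) (yes p) (inj₁ (_ , _ , ¬p)) = contradiction p ¬p
    go (no _) c (no _) (no _) (inj₁ _) = subst (ℕ._≤ 1) (sym (ℕₚ.+-identityʳ (𝟙 c))) (𝟙≤1 c)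
    go (yes p) _ _ _ (inj₂ (inj₁ (¬p , _))) = contradiction p ¬p
    go (no _) (yes p) _ _ (inj₂ (inj₁ (_ , _ , ¬p))) = contradiction p ¬p
    go (no _) (no _) (yes p) _ (inj₂ (inj₁ (_ , ¬p , _))) = contradiction p ¬p
    go (no _) (no _) (no _) d (inj₂ (inj₁ _)) = 𝟙≤1 d
    go (yes p) _ _ _ (inj₂ (inj₂ (inj₁ (¬p , _)))) = contradiction p ¬p
    go (no _) (yes p) _ _ (inj₂ (inj₂ (inj₁ (_ , _ , ¬p)))) = contradiction p ¬p
    go (no _) (no _) b (yes p) (inj₂ (inj₂ (inj₁ (_ , ¬p , _)))) = contradiction p ¬p
    go (no _) (no _) b (no _) (inj₂ (inj₂ (inj₁ _))) = subst (ℕ._≤ 1) (sym (ℕₚ.+-identityʳ (𝟙 b))) (𝟙≤1 b)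
    go a (yes p) _ _ (inj₂ (inj₂ (inj₂ (_ , _ , ¬p)))) = contradiction p ¬p
    go a (no _) (yes p) _ (inj₂ (inj₂ (inj₂ (¬p , _)))) = contradiction p ¬p
    go a (no _) (no _) (yes p) (inj₂ (inj₂ (inj₂ (_ , ¬p , _)))) = contradiction p ¬p
    go a (no _) (no _) (no _) (inj₂ (inj₂ (inj₂ _))) = subst (ℕ._≤ 1) (sym (trans (ℕₚ.+-identityʳ (𝟙 a + 0)) (ℕₚ.+-identityʳ (𝟙 a)))) (𝟙≤1 a)

  near-defect : ∀ {z} → z ∈ L → ∃[ a ] (a ∈ lossyPixels ++ wasteSquares × InBox radius (proj₁ a ℤ.- proj₁ z , proj₂ a ℤ.- proj₂ z))
  near-defect {z} z∈ = [ (λ C → found (optimal⇒defect 2≤m (_∈? L) classify C)) , (λ bad → z , ∈-++⁺ˡ bad , at-z) ]′ (classify z∈)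
    where
    at-z : InBox radius (proj₁ z ℤ.- proj₁ z , proj₂ z ℤ.- proj₂ z)
    at-z = inBox (lo (proj₁ z) radius) (hi (proj₁ z) radius) (lo (proj₂ z) radius) (hi (proj₂ z) radius)
      where
      lo : ∀ t n → ℤ.- + n ℤ.≤ t ℤ.- t
      lo t n = linarith (n ∷ [] ∣ᵉ t ∷ []) [] (⊟ ι 0 ≼ᶻ ζ 0 ⊖ ζ 0) tt
      hi : ∀ t n → t ℤ.- t ℤ.≤ + n
      hi t n = linarith (n ∷ [] ∣ᵉ t ∷ []) [] (ζ 0 ⊖ ζ 0 ≼ᶻ ι 0) tt
    found : Defect (_∈ L) Bad radius z → ∃[ a ] (a ∈ lossyPixels ++ wasteSquares × InBox radius (proj₁ a ℤ.- proj₁ z , proj₂ a ℤ.- proj₂ z))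
    found (defect a close (inj₁ bad)) = a , ∈-++⁺ˡ bad , close
    found (defect a close (inj₂ t)) = a , ∈-++⁺ʳ lossyPixels (∈-filter⁺ (waste? L) (∈-box⁺ (inner close (proj₁ (∈-whites I r z∈)))) (threeBlack⇒waste t)) , close
      where
      lo : ∀ r n a t → ℤ.- + n ℤ.≤ a ℤ.- t → ℤ.- + r ℤ.≤ t → ℤ.- + (r + n) ℤ.≤ a
      lo r n a t h h′ = linarith (r ∷ n ∷ [] ∣ᵉ a ∷ t ∷ [])
        (⊟ ι 1 ≼ᶻ ζ 0 ⊖ ζ 1 ∷ ⊟ ι 0 ≼ᶻ ζ 1 ∷ []) (⊟ ⌞ ν 0 ⊕ ν 1 ⌟ ≼ᶻ ζ 0) (h , h′ , tt)
      hi : ∀ r n a t → a ℤ.- t ℤ.≤ + n → t ℤ.≤ + r → a ℤ.≤ + (r + n)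
      hi r n a t h h′ = linarith (r ∷ n ∷ [] ∣ᵉ a ∷ t ∷ [])
        (ζ 0 ⊖ ζ 1 ≼ᶻ ι 1 ∷ ζ 1 ≼ᶻ ι 0 ∷ []) (ζ 0 ≼ᶻ ⌞ ν 0 ⊕ ν 1 ⌟) (h , h′ , tt)
      inner : InBox radius (proj₁ a ℤ.- proj₁ z , proj₂ a ℤ.- proj₂ z) → InBox r z → InBox R a
      inner (inBox p q s t) (inBox p′ q′ s′ t′) = inBox (lo r radius (proj₁ a) (proj₁ z) p p′) (hi r radius (proj₁ a) (proj₁ z) q q′)
        (lo r radius (proj₂ a) (proj₂ z) s s′) (hi r radius (proj₂ a) (proj₂ z) t t′)

  ball : Pixel → List Pixel
  ball (a , b) = map (λ (s , t) → a ℤ.- s , b ℤ.- t) (box radius)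

  defects : List Pixel
  defects = lossyPixels ++ wasteSquares

  length-balls : length (concatMap ball defects) ≡ M * length defects
  length-balls = trans (length-concat (map ball defects)) (trans (∑-map ball length defects)
    (trans (∑-cong defects λ _ → trans (length-map _ (box radius)) (length-box radius)) (∑-const M defects)))

  -- By `near-defect`, the balls around the defects cover the white pixels.
  whites≤defects : length L ≤ M * length defects
  whites≤defects = subst (length L ℕ.≤_) length-balls (length-mono (whites-unique I r) covered)
    where
    back : ∀ a z → a ℤ.- (a ℤ.- z) ≡ z
    back = solve-∀
    covered : ∀ {z} → z ∈ L → z ∈ concatMap ball defects
    covered {z} z∈ = let a , a∈ , close = near-defect z∈ in
      ∈-concat⁺′ (subst (λ t → t ∈ ball a) (cong₂ _,_ (back (proj₁ a) (proj₁ z)) (back (proj₂ a) (proj₂ z)))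
        (∈-map⁺ (λ (s , t) → proj₁ a ℤ.- s , proj₂ a ℤ.- t) (∈-box⁺ close))) (∈-map⁺ ball a∈)

  -- Write `w` for the white pixels, `l` for those in lossy components, `g` for the wasted squares,
  -- `t` for the tokens and `B` for the size of the box. Then `kAw + l ≤ kJt`, `t + g ≤ 2B` and
  -- `w ≤ M(l + g)`. Multiply the first two by `M` and `MkJ`; since `kJ ≥ 1`, the losses cover
  -- `M(l + g)` and hence one further `w`.
  bound : length L * (M * (k * A) + 1) ≤ 2 * (M * (k * J)) * ((2 * R + 1) * (2 * R + 1))
  bound = arith (length L) M (k * A) (k * J) ∑length ∑tokens (length lossyPixels) (length wasteSquares) ((2 * R + 1) * (2 * R + 1))
    (ℕₚ.*-monoʳ-≤ (M * (k * A)) (length≤∑ (whites-unique I r)))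
    (subst (λ n → length L ≤ M * n) (length-++ lossyPixels) whites≤defects)
    (ℕₚ.*-monoʳ-≤ M total-weight)
    (ℕₚ.*-monoʳ-≤ (M * (k * J)) token-count)
    (ℕₚ.*-monoˡ-≤ (M * length wasteSquares) (ℕₚ.*-mono-≤ (ℕₚ.≤-trans 1≤J J≤k) 1≤J))
    where
    arith : ∀ w M a b s t l g B → M * a * w ≤ M * a * s → w ≤ M * (l + g) → M * (a * s + l) ≤ M * (b * t) →
            M * b * (t + g) ≤ M * b * (2 * B) → 1 * (M * g) ≤ b * (M * g) →
            w * (M * a + 1) ≤ 2 * (M * b) * B
    arith w M a b s t l g B h₁ h₂ h₃ h₄ h₅ = linarith (w ∷ M ∷ a ∷ b ∷ B ∷ s ∷ l ∷ g ∷ t ∷ [] ∣ᵉ [])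
      (ν 1 ⊗ ν 2 ⊗ ν 0 ≼ ν 1 ⊗ ν 2 ⊗ ν 5 ∷ ν 0 ≼ ν 1 ⊗ (ν 6 ⊕ ν 7) ∷ ν 1 ⊗ (ν 2 ⊗ ν 5 ⊕ ν 6) ≼ ν 1 ⊗ (ν 3 ⊗ ν 8) ∷ ν 1 ⊗ ν 3 ⊗ (ν 8 ⊕ ν 7) ≼ ν 1 ⊗ ν 3 ⊗ (κ 2 ⊗ ν 4) ∷ κ 1 ⊗ (ν 1 ⊗ ν 7) ≼ ν 3 ⊗ (ν 1 ⊗ ν 7) ∷ [])
      (ν 0 ⊗ (ν 1 ⊗ ν 2 ⊕ κ 1) ≼ κ 2 ⊗ (ν 1 ⊗ ν 3) ⊗ ν 4) (h₁ , h₂ , h₃ , h₄ , h₅ , tt)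

-- Without the `+ 1` in the denominator the bound would be `2J / A`. This is at most `term₄ J`,
-- because `⌈2√(2J - 1)⌉ ≤ 2m + 1`, and so at most `F₄ k`.
Extremal⇒PhiLt : ∀ {k m J} → Extremal k m J → PhiLt four k (F₄ k)
Extremal⇒PhiLt {k} {m} {J} ext = frac (2 * (M * (k * J))) (M * (k * A) + 1) , smaller , upper
  where
  open Extremal ext
  ρ M A : ℕ
  ρ = 2 * m + 13
  M = (2 * ρ + 1) * (2 * ρ + 1)
  A = 2 * J + (2 * m + 1)
  widen : ∀ r n → 2 * (r + n) + 1 ≡ 2 * r + 1 + 2 * n
  widen r n = linarith (r ∷ n ∷ [] ∣ᵉ []) [] (κ 2 ⊗ (ν 0 ⊕ ν 1) ⊕ κ 1 ≐ κ 2 ⊗ ν 0 ⊕ κ 1 ⊕ κ 2 ⊗ ν 1) tt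
  upper : PhiLe four k (frac (2 * (M * (k * J))) (M * (k * A) + 1))
  upper I comps = density-upper I (2 * (M * (k * J))) (M * (k * A) + 1) (2 * ρ) (ℕₚ.m≤n+m 1 (M * (k * A)))
    λ r → subst₂ ℕ._≤_ (cong (ℕ._* (M * (k * A) + 1)) (sym (countTrue-filter I (box r))))
      (cong (λ t → 2 * (M * (k * J)) * (t * t)) (widen r ρ)) (Strict.bound ext I comps r)
  diam≤ : diam J ≤ 2 * m + 1
  diam≤ = ceilSqrt-least _ (2 * m + 1) (ℕₚ.≤-trans (ℕₚ.*-monoʳ-≤ 4 (ℕₚ.m∸n≤m (2 * J) 1)) (square J m 2J≡))
    where
    square : ∀ J m → 2 * J ≡ m * (m + 1) → 4 * (2 * J) ≤ (2 * m + 1) * (2 * m + 1)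
    square J m e = linarith (J ∷ m ∷ [] ∣ᵉ [])
      (κ 2 ⊗ ν 0 ≐ ν 1 ⊗ (ν 1 ⊕ κ 1) ∷ []) (κ 4 ⊗ (κ 2 ⊗ ν 0) ≼ (κ 2 ⊗ ν 1 ⊕ κ 1) ⊗ (κ 2 ⊗ ν 1 ⊕ κ 1)) (e , tt)
  term≥ : frac (2 * J) A ℚ.≤ F₄ k
  term≥ = ℚₚ.≤-trans (frac-mono-≤ {2 * J} {A} {2 * J} (ℕₚ.≤-trans (ℕₚ.m≤n+m 1 (2 * m)) (ℕₚ.m≤n+m (2 * m + 1) (2 * J))) (denominator₄ J 1≤J)
    (ℕₚ.*-monoʳ-≤ (2 * J) (ℕₚ.+-monoʳ-≤ (2 * J) diam≤))) (maxUpTo-upper term₄ k 1≤J J≤k)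
  smaller : frac (2 * (M * (k * J))) (M * (k * A) + 1) ℚ.< F₄ k
  smaller = ℚₚ.<-≤-trans (frac-mono-< {2 * (M * (k * J))} {M * (k * A) + 1} {2 * J} {A} (ℕₚ.m≤n+m 1 (M * (k * A)))
    (ℕₚ.≤-trans (ℕₚ.m≤n+m 1 (2 * m)) (ℕₚ.m≤n+m (2 * m + 1) (2 * J))) (arith M k A J 1≤J)) term≥
    where
    arith : ∀ M k A J → 1 ≤ J → 2 * (M * (k * J)) * A < 2 * J * (M * (k * A) + 1)
    arith M k A J h = linarith (M ∷ k ∷ J ∷ A ∷ [] ∣ᵉ [])
      (κ 1 ≼ ν 2 ∷ []) (κ 1 ⊕ κ 2 ⊗ (ν 0 ⊗ (ν 1 ⊗ ν 2)) ⊗ ν 3 ≼ κ 2 ⊗ ν 2 ⊗ (ν 0 ⊗ (ν 1 ⊗ ν 3) ⊕ κ 1)) (h , tt)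

-- The intervals of `𝒰`, and the conclusion

-- `s₁ n` and `s₃ n` are the sizes `m(m + 1) / 2` for `m = 2n - 1` and `m = 2n`. At the upper ends
-- of the intervals `k<` amounts to `(n - 1)(2m + 1) < m(m + 1)` and `n(2m + 1) < m(m + 1)`. The
-- first family with `n = 1` would give only `k = 1`, which `2 ≤ k` excludes.
InU⇒Extremal : ∀ {k} → InU k → ∃[ m ] ∃[ J ] Extremal k m J
InU⇒Extremal {k} (2≤k , suc zero , _ , inj₁ (_ , hi)) = ⊥-elim (absurd k 2≤k hi)
  where
  absurd : ∀ k → 2 ≤ k → 2 * k ≤ 2 → ⊥
  absurd k h h′ = linarith (k ∷ [] ∣ᵉ []) (κ 2 ≼ ν 0 ∷ κ 2 ⊗ ν 0 ≼ κ 2 ∷ []) falsum (h , h′ , tt)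
InU⇒Extremal {k} (2≤k , suc (suc i) , _ , inj₁ (lo , hi)) = m , J , record
  { 2≤m = s≤s (s≤s z≤n) ; 2J≡ = double i ; J≤k = subst (ℕ._≤ k) s≡ lo ; k< = below i k (ℕₚ.*-monoˡ-≤ (2 * m + 1) hi′) }
  where
  m J : ℕ
  m = 3 + 2 * i
  J = (2 + i) * m
  inner : ∀ i → 2 * suc (suc i) ≡ suc (3 + 2 * i)
  inner i = linarith (i ∷ [] ∣ᵉ []) [] (κ 2 ⊗ (κ 1 ⊕ (κ 1 ⊕ ν 0)) ≐ κ 1 ⊕ (κ 3 ⊕ κ 2 ⊗ ν 0)) tt
  s≡ : s₁ (suc (suc i)) ≡ J
  s≡ = cong (λ t → suc (suc i) * (t ∸ 1)) (inner i)
  hi′ : 2 * k ≤ 2 * J + suc i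
  hi′ = subst (2 * k ℕ.≤_) (trans (ℕₚ.+-∸-assoc (2 * s₁ (suc (suc i))) {suc (suc i)} (s≤s z≤n)) (cong (λ t → 2 * t + suc i) s≡)) hi
  double : ∀ i → 2 * ((2 + i) * (3 + 2 * i)) ≡ (3 + 2 * i) * (3 + 2 * i + 1)
  double i = linarith (i ∷ [] ∣ᵉ []) [] (κ 2 ⊗ ((κ 2 ⊕ ν 0) ⊗ (κ 3 ⊕ κ 2 ⊗ ν 0)) ≐ (κ 3 ⊕ κ 2 ⊗ ν 0) ⊗ (κ 3 ⊕ κ 2 ⊗ ν 0 ⊕ κ 1)) tt
  below : ∀ i k → 2 * k * (2 * (3 + 2 * i) + 1) ≤ (2 * ((2 + i) * (3 + 2 * i)) + suc i) * (2 * (3 + 2 * i) + 1) →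
          2 * (k * (2 * (3 + 2 * i) + 1)) < 2 * ((3 + 2 * i) * ((3 + 2 * i + 1) * (3 + 2 * i + 1)))
  below i k h = linarith (k ∷ i ∷ [] ∣ᵉ [])
    (κ 2 ⊗ ν 0 ⊗ (κ 2 ⊗ (κ 3 ⊕ κ 2 ⊗ ν 1) ⊕ κ 1) ≼ (κ 2 ⊗ ((κ 2 ⊕ ν 1) ⊗ (κ 3 ⊕ κ 2 ⊗ ν 1)) ⊕ (κ 1 ⊕ ν 1)) ⊗ (κ 2 ⊗ (κ 3 ⊕ κ 2 ⊗ ν 1) ⊕ κ 1) ∷ [])
    (κ 1 ⊕ κ 2 ⊗ (ν 0 ⊗ (κ 2 ⊗ (κ 3 ⊕ κ 2 ⊗ ν 1) ⊕ κ 1)) ≼ κ 2 ⊗ ((κ 3 ⊕ κ 2 ⊗ ν 1) ⊗ ((κ 3 ⊕ κ 2 ⊗ ν 1 ⊕ κ 1) ⊗ (κ 3 ⊕ κ 2 ⊗ ν 1 ⊕ κ 1))))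
    (h , tt)
InU⇒Extremal {k} (2≤k , n , 1≤n , inj₂ (lo , hi)) = 2 * n , s₃ n , record
  { 2≤m = ℕₚ.*-monoʳ-≤ 2 1≤n ; 2J≡ = double n ; J≤k = lo ; k< = below n k 1≤n (ℕₚ.*-monoˡ-≤ (2 * (2 * n) + 1) hi) }
  where
  double : ∀ n → 2 * (n * (2 * n + 1)) ≡ 2 * n * (2 * n + 1)
  double n = linarith (n ∷ [] ∣ᵉ []) [] (κ 2 ⊗ (ν 0 ⊗ (κ 2 ⊗ ν 0 ⊕ κ 1)) ≐ κ 2 ⊗ ν 0 ⊗ (κ 2 ⊗ ν 0 ⊕ κ 1)) tt
  below : ∀ n k → 1 ≤ n → 2 * k * (2 * (2 * n) + 1) ≤ (2 * (n * (2 * n + 1)) + n) * (2 * (2 * n) + 1) →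
          2 * (k * (2 * (2 * n) + 1)) < 2 * (2 * n * ((2 * n + 1) * (2 * n + 1)))
  below n k 1≤n h = linarith (k ∷ n ∷ [] ∣ᵉ [])
    (κ 2 ⊗ ν 0 ⊗ (κ 2 ⊗ (κ 2 ⊗ ν 1) ⊕ κ 1) ≼ (κ 2 ⊗ (ν 1 ⊗ (κ 2 ⊗ ν 1 ⊕ κ 1)) ⊕ ν 1) ⊗ (κ 2 ⊗ (κ 2 ⊗ ν 1) ⊕ κ 1) ∷ κ 1 ≼ ν 1 ∷ [])
    (κ 1 ⊕ κ 2 ⊗ (ν 0 ⊗ (κ 2 ⊗ (κ 2 ⊗ ν 1) ⊕ κ 1)) ≼ κ 2 ⊗ (κ 2 ⊗ ν 1 ⊗ ((κ 2 ⊗ ν 1 ⊕ κ 1) ⊗ (κ 2 ⊗ ν 1 ⊕ κ 1))))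
    (h , 1≤n , tt)

theorem₄-U : ∀ k → InU k → PhiLt four k (F₄ k)
theorem₄-U k k∈U = let m , J , ext = InU⇒Extremal k∈U in Extremal⇒PhiLt ext

theorem1p1 : (k : ℕ) → 1 ≤ k →
    PhiEq eight k (F₈ k)
    × PhiLe four k (F₄ k)
    × (InS k → PhiEq four k (F₄ k))
    × (InU k → PhiLt four k (F₄ k))
theorem1p1 k 1≤k = theorem₈ k 1≤k , theorem₄-upper k 1≤k , theorem₄-S k , theorem₄-U k
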